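{- For all integers $k\ge1$ and $n\ge0$, $$e_6(11^{2k}n+\delta_{11,2k})\equiv0\pmod{11^{2k}}.$$
   Context: $q=e^{2\pi i\tau}$, $(q;q)_\infty=\prod_{n\ge1}(1-q^n)$, $E_6(\tau)=1-504\sum_{n\ge1}\sigma_5(n)q^n$ with $\sigma_5(n)=\sum_{d\mid n}d^5$. The numbers $e_6(n)$ are defined by $\sum_{n\ge0}e_6(n)q^n=E_6(\tau)/(q;q)_\infty$. For a prime $\ell\ge5$ and $k\ge1$, $\delta_{\ell,k}$ is the integer with $0<\delta_{\ell,k}<\ell^k$ and $24\delta_{\ell,k}\equiv1\pmod{\ell^k}$. -}

module Defs where

open import Data.Bool using (true; false; if_then_else_)
open import Data.Nat as ℕ using (ℕ; zero; suc)
open import Data.Integer as ℤ using (ℤ; +_; _+_; _*_; -_; _-_)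
open import Data.List using (List; []; _∷_; upTo; map; filter; foldr)
open import Data.Nat.ListAction using (sum)
open import Data.Nat.Divisibility using (_∣?_)

σ₅ : ℕ → ℕ
σ₅ n = sum (map (λ d → d ℕ.^ 5) (filter (_∣? n) (map suc (upTo n))))

E₆coeff : ℕ → ℤ
E₆coeff zero    = + 1
E₆coeff (suc n) = - (+ 504 * + σ₅ (suc n))

-- Truncated power series represented as functions ℕ → ℤ (coefficient of q^i).
-- Multiply a series by (1 - q^m).
mulOneMinus : ℕ → (ℕ → ℤ) → (ℕ → ℤ)
mulOneMinus m f i = f i - (if m ℕ.≤ᵇ i then f (i ℕ.∸ m) else + 0)

finProd : ℕ → ℕ → ℤ
finProd zero    zero    = + 1
finProd zero    (suc i) = + 0
finProd (suc N) = mulOneMinus (suc N) (finProd N)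

-- coefficients of (q;q)_∞ = ∏_{m≥1}(1 - q^m): the coefficient of q^i
-- stabilises once N ≥ i (factors with m > i do not affect it)
qPochCoeff : ℕ → ℤ
qPochCoeff i = finProd i i

sumTo : ℕ → (ℕ → ℤ) → ℤ
sumTo n f = foldr _+_ (+ 0) (map f (upTo n))

-- coefficients of 1/(q;q)_∞, the multiplicative inverse power series:
-- b 0 = 1 and Σ_{j=0}^{n} c j * b (n - j) = 0 for n ≥ 1 (c = qPochCoeff, c 0 = 1)
invQPochAux : ℕ → ℕ → ℤ
invQPochAux zero    _ = + 1   -- value unused beyond its index; fuel argument
invQPochAux (suc fuel) zero = + 1
invQPochAux (suc fuel) (suc n) =
  - sumTo (suc n) (λ j → qPochCoeff (suc j) * invQPochAux fuel (n ℕ.∸ j))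

invQPoch : ℕ → ℤ
invQPoch n = invQPochAux (suc n) n

e₆ : ℕ → ℤ
e₆ n = sumTo (suc n) (λ j → E₆coeff j * invQPoch (n ℕ.∸ j))

{-# OPTIONS --safe #-}
module Submission where

-- Write a(r) for the coefficient of q^r in E₆/φ, where φ = (q;q)_∞. The operator
--   (T a)(r) = a(121 r - 5) + 11⁴ χ(r) a(r) + 11⁹ a((r + 5)/121),   χ(r) ∈ {0, ±1},
-- maps quotients E₆ G / φ^(24 m + 1), G of level 1 and weight 12 m, to quotients of the same shape. To see this
-- without modular transformations, a form of level 11 and weight 2 κ is represented by its two expansions b and w b
-- (at ∞ and under the Fricke involution), as a combination over the level 1 forms of a basis closed under multiplication;
-- U and the trace 11 U b + 11^κ w b are computed on this basis, each identity being one between solutions of a linear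
-- system θ v = A v of which finitely many coefficients are compared.
-- The polynomials in Q³ and Q³ - R² are triangular, so such a quotient is divisible by 11^N as soon as its
-- coefficients at r ≤ 0 are. As a(r) = 0 for r < 0, induction shows that the coefficients of T^k a at r ≤ 0, hence
-- all of them, are divisible by 11^(4k). Solving the definition of T for its first term gives 11^(4k) ∣ a(s^k r) with
-- s r = 121 r - 5, and the residue class of the theorem is the set of values s^k r.

open import Defs
open import Algebra.Bundles using (CommutativeRing)
open import Data.Bool using (Bool; true; false; if_then_else_; T; _∧_)
open import Data.Empty using (⊥-elim)
open import Data.Fin using (Fin; zero; suc; #_; splitAt)
open import Data.Integer as ℤ using (ℤ; +_; -[1+_]; 0ℤ; 1ℤ; -1ℤ)
open import Data.Integer.Divisibility as ℤd using ()
open import Data.Integer.Divisibility.Signed as Div using (divides) renaming (_∣_ to _∣ᶻ_)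
import Data.Integer.Properties as ℤₚ
open import Data.Integer.Tactic.RingSolver using (solve-∀)
open import Data.List as List using (List; []; _∷_; _++_; take; upTo; map; filter; foldr)
open import Data.List.Membership.Propositional renaming (_∈_ to _∈ˡ_)
import Data.List.Properties as Listₚ
open import Data.List.Relation.Unary.Any using (here; there)
open import Data.Nat as ℕ using (ℕ; zero; suc; _≤_; _<_; z≤n; s≤s)
open import Data.Nat.DivMod using (_%_; _/_; m≡m%n+[m/n]*n; m%n<n; [m+kn]%n≡m%n)
open import Data.Nat.Divisibility using (_∣_; _∣?_; ∣⇒≤; ∣m+n∣m⇒∣n; ∣m∣n⇒∣m+n; ∣-refl)
open import Data.Nat.ListAction using (sum)
open import Data.Nat.ListAction.Properties using (sum-++)
import Data.Nat.Properties as ℕₚ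
open import Data.Nat.Tactic.RingSolver using () renaming (solve-∀ to solve-∀ℕ)
open import Data.Product using (_×_; _,_; proj₁; proj₂; Σ)
open import Data.Sum as Sum using (_⊎_; inj₁; inj₂)
open import Data.Vec as Vec using (Vec; []; _∷_; lookup)
import Data.Vec.Properties as Vecₚ
open import Level using (0ℓ)
open import Relation.Binary.PropositionalEquality
open import Relation.Nullary using (¬_; does; yes; no; Dec)
open import Relation.Nullary.Decidable using (dec-true; dec-false)

-- T is the Hecke operator T(11²) of half-integral weight 11/2 = 6 - 1/2, applied to E₆/η. On the
-- exponents 24 r - 1 of E₆/η the map s is multiplication by 121, and 11⁴, 11⁹ are ℓ^(λ-1), ℓ^(2λ-1)
-- for ℓ = 11, λ = 5. Since η stands in the denominator, T enlarges the pole: η^d with d = 24 m + 1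
-- becomes η^(121 d), so m becomes 121 m + 5, and only the principal part can be followed. The
-- obstacle is that integer series carry no action of the modular group. The substitute: at ∞ the
-- linear system of the basis has E₂, E₄, E₆ at q^11 as coefficients, so U and the twist by χ send
-- solutions to solutions; at the cusp 0 the same system has E₂, E₄, E₆ at q. Up to powers of 11
-- these are the coefficients that U leaves behind, so both summands of a trace solve one system.
-- The scalings 25 Q and 125 R clear the denominators of Q and R in the coordinates x, f, z, and 25³
-- = 125² keeps the constant term of the difference of cube and square equal to 0.

-- Formal power series over the integers and a decision procedure for polynomial identities between
-- them.

module PowerSeries where

  Series : Set
  Series = ℕ → ℤ

  infix  4 _≈ˢ_ _≈ˢ[_]_
  infixl 6 _+ˢ_ _-ˢ_
  infixl 7 _*ˢ_
  infix  8 -ˢ_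

  _≈ˢ_ : Series → Series → Set
  a ≈ˢ b = ∀ n → a n ≡ b n

  _≈ˢ[_]_ : Series → ℕ → Series → Set
  a ≈ˢ[ N ] b = ∀ n → n ≤ N → a n ≡ b n

  const : ℤ → Series
  const c zero    = c
  const c (suc n) = 0ℤ

  tail shift : Series → Series
  tail a n = a (suc n)
  shift a zero    = 0ℤ
  shift a (suc n) = a n

  _+ˢ_ _-ˢ_ _*ˢ_ : Series → Series → Series
  (a +ˢ b) n = a n ℤ.+ b n
  (a -ˢ b) n = a n ℤ.- b n
  (a *ˢ b) zero    = a 0 ℤ.* b 0
  (a *ˢ b) (suc n) = a 0 ℤ.* b (suc n) ℤ.+ (tail a *ˢ b) n

  -ˢ_ : Series → Series
  (-ˢ a) n = ℤ.- a n

  0ˢ 1ˢ : Series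
  0ˢ n = 0ℤ
  1ˢ = const 1ℤ

  *ˢ-cong-[] : ∀ N {a a′ b b′} → a ≈ˢ[ N ] a′ → b ≈ˢ[ N ] b′ → a *ˢ b ≈ˢ[ N ] a′ *ˢ b′
  *ˢ-cong-[] N a≈ b≈ zero    n≤N = cong₂ ℤ._*_ (a≈ 0 z≤n) (b≈ 0 z≤n)
  *ˢ-cong-[] (suc N) {a} {a′} {b} {b′} a≈ b≈ (suc n) (s≤s n≤N) =
    cong₂ ℤ._+_ (cong₂ ℤ._*_ (a≈ 0 z≤n) (b≈ (suc n) (s≤s n≤N)))
      (*ˢ-cong-[] N (λ k k≤N → a≈ (suc k) (s≤s k≤N)) (λ k k≤N → b≈ k (ℕₚ.m≤n⇒m≤1+n k≤N)) n n≤N)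

  *ˢ-cong : ∀ {a a′ b b′} → a ≈ˢ a′ → b ≈ˢ b′ → a *ˢ b ≈ˢ a′ *ˢ b′
  *ˢ-cong a≈ b≈ n = *ˢ-cong-[] n (λ k _ → a≈ k) (λ k _ → b≈ k) n ℕₚ.≤-refl

  +-congˡ : ∀ i {j k} → j ≡ k → i ℤ.+ j ≡ i ℤ.+ k
  +-congˡ i = cong (λ j → i ℤ.+ j)

  *ˢ-distribʳ : ∀ c a b → (a +ˢ b) *ˢ c ≈ˢ (a *ˢ c) +ˢ (b *ˢ c)
  *ˢ-distribʳ c a b zero    = ℤₚ.*-distribʳ-+ (c 0) (a 0) (b 0)
  *ˢ-distribʳ c a b (suc n) = trans
    (+-congˡ ((a 0 ℤ.+ b 0) ℤ.* c (suc n)) (*ˢ-distribʳ c (tail a) (tail b) n))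
    (eq (a 0) (b 0) (c (suc n)) _ _)
    where
    eq : ∀ x y z u v → (x ℤ.+ y) ℤ.* z ℤ.+ (u ℤ.+ v) ≡ (x ℤ.* z ℤ.+ u) ℤ.+ (y ℤ.* z ℤ.+ v)
    eq = solve-∀

  -- The defining recursion splits off the constant term of the first factor, this one that of the
  -- second. Commutativity is the comparison of the two.
  *ˢ-suc : ∀ a b n → (a *ˢ b) (suc n) ≡ (a *ˢ tail b) n ℤ.+ a (suc n) ℤ.* b 0
  *ˢ-suc a b zero    = refl
  *ˢ-suc a b (suc n) = trans (+-congˡ (a 0 ℤ.* b (suc (suc n))) (*ˢ-suc (tail a) b n))
    (sym (ℤₚ.+-assoc (a 0 ℤ.* b (suc (suc n))) _ _))

  *ˢ-comm : ∀ a b → a *ˢ b ≈ˢ b *ˢ a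
  *ˢ-comm a b zero    = ℤₚ.*-comm (a 0) (b 0)
  *ˢ-comm a b (suc n) = trans
    (cong₂ ℤ._+_ (ℤₚ.*-comm (a 0) (b (suc n))) (*ˢ-comm (tail a) b n))
    (trans (ℤₚ.+-comm (b (suc n) ℤ.* a 0) _) (sym (*ˢ-suc b a n)))

  *ˢ-distribˡ : ∀ c a b → c *ˢ (a +ˢ b) ≈ˢ (c *ˢ a) +ˢ (c *ˢ b)
  *ˢ-distribˡ c a b n = trans (*ˢ-comm c (a +ˢ b) n)
    (trans (*ˢ-distribʳ c a b n) (cong₂ ℤ._+_ (*ˢ-comm a c n) (*ˢ-comm b c n)))

  *ˢ-scaleˡ : ∀ k a b n → ((λ m → k ℤ.* a m) *ˢ b) n ≡ k ℤ.* (a *ˢ b) n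
  *ˢ-scaleˡ k a b zero    = ℤₚ.*-assoc k (a 0) (b 0)
  *ˢ-scaleˡ k a b (suc n) = trans
    (+-congˡ ((k ℤ.* a 0) ℤ.* b (suc n)) (*ˢ-scaleˡ k (tail a) b n)) (eq k (a 0) (b (suc n)) _)
    where
    eq : ∀ k x y z → (k ℤ.* x) ℤ.* y ℤ.+ k ℤ.* z ≡ k ℤ.* (x ℤ.* y ℤ.+ z)
    eq = solve-∀

  *ˢ-assoc : ∀ a b c → (a *ˢ b) *ˢ c ≈ˢ a *ˢ (b *ˢ c)
  *ˢ-assoc a b c zero    = ℤₚ.*-assoc (a 0) (b 0) (c 0)
  *ˢ-assoc a b c (suc n) = begin
    a 0 ℤ.* b 0 ℤ.* c (suc n) ℤ.+ (((λ m → a 0 ℤ.* b (suc m)) +ˢ (tail a *ˢ b)) *ˢ c) n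
      ≡⟨ +-congˡ (a 0 ℤ.* b 0 ℤ.* c (suc n))
           (trans (*ˢ-distribʳ c (λ m → a 0 ℤ.* b (suc m)) (tail a *ˢ b) n)
             (cong₂ ℤ._+_ (*ˢ-scaleˡ (a 0) (tail b) c n) (*ˢ-assoc (tail a) b c n))) ⟩
    a 0 ℤ.* b 0 ℤ.* c (suc n) ℤ.+ (a 0 ℤ.* (tail b *ˢ c) n ℤ.+ (tail a *ˢ (b *ˢ c)) n)
      ≡⟨ eq (a 0) (b 0) (c (suc n)) _ _ ⟩
    a 0 ℤ.* (b 0 ℤ.* c (suc n) ℤ.+ (tail b *ˢ c) n) ℤ.+ (tail a *ˢ (b *ˢ c)) n ∎
    where
    open ≡-Reasoning
    eq : ∀ x y z u v → x ℤ.* y ℤ.* z ℤ.+ (x ℤ.* u ℤ.+ v) ≡ x ℤ.* (y ℤ.* z ℤ.+ u) ℤ.+ v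
    eq = solve-∀

  0ˢ*ˢ : ∀ a → 0ˢ *ˢ a ≈ˢ 0ˢ
  0ˢ*ˢ a zero    = refl
  0ˢ*ˢ a (suc n) = trans (ℤₚ.+-identityˡ _) (0ˢ*ˢ a n)

  const*ˢ : ∀ k a n → (const k *ˢ a) n ≡ k ℤ.* a n
  const*ˢ k a zero    = refl
  const*ˢ k a (suc n) = trans (+-congˡ (k ℤ.* a (suc n)) (0ˢ*ˢ a n)) (ℤₚ.+-identityʳ _)

  1ˢ*ˢ : ∀ a → 1ˢ *ˢ a ≈ˢ a
  1ˢ*ˢ a n = trans (const*ˢ 1ℤ a n) (ℤₚ.*-identityˡ (a n))

  seriesRing : CommutativeRing 0ℓ 0ℓ
  seriesRing = record
    { Carrier = Series ; _≈_ = _≈ˢ_ ; _+_ = _+ˢ_ ; _*_ = _*ˢ_ ; -_ = -ˢ_ ; 0# = 0ˢ ; 1# = 1ˢ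
    ; isCommutativeRing = record
      { isRing = record
        { +-isAbelianGroup = record
          { isGroup = record
            { isMonoid = record
              { isSemigroup = record
                { isMagma = record
                  { isEquivalence = record
                    { refl = λ _ → refl ; sym = λ p n → sym (p n) ; trans = λ p q n → trans (p n) (q n) }
                  ; ∙-cong = λ p q n → cong₂ ℤ._+_ (p n) (q n) }
                ; assoc = λ a b c n → ℤₚ.+-assoc (a n) (b n) (c n) }
              ; identity = (λ a n → ℤₚ.+-identityˡ (a n)) , (λ a n → ℤₚ.+-identityʳ (a n)) }
            ; inverse = (λ a n → ℤₚ.+-inverseˡ (a n)) , (λ a n → ℤₚ.+-inverseʳ (a n))
            ; ⁻¹-cong = λ p n → cong ℤ.-_ (p n) }
          ; comm = λ a b n → ℤₚ.+-comm (a n) (b n) }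
        ; *-cong = *ˢ-cong
        ; *-assoc = *ˢ-assoc
        ; *-identity = 1ˢ*ˢ , λ a n → trans (*ˢ-comm a 1ˢ n) (1ˢ*ˢ a n)
        ; distrib = *ˢ-distribˡ , *ˢ-distribʳ }
      ; *-comm = *ˢ-comm } }

  module SR = CommutativeRing seriesRing
  open import Relation.Binary.Reasoning.Setoid SR.setoid
  open import Algebra.Properties.CommutativeSemiring.Exp SR.commutativeSemiring renaming (_^_ to _^ˢ_) using (^-congˡ; ^-congʳ; ^-homo-*; ^-assocʳ; ^-distrib-*) public

  const-+ : ∀ a b → const (a ℤ.+ b) ≈ˢ const a +ˢ const b
  const-+ a b zero    = refl
  const-+ a b (suc n) = refl

  const-* : ∀ a b → const (a ℤ.* b) ≈ˢ const a *ˢ const b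
  const-* a b zero    = refl
  const-* a b (suc n) = sym (trans (const*ˢ a (const b) (suc n)) (ℤₚ.*-zeroʳ a))

  const-neg : ∀ a → const (ℤ.- a) ≈ˢ -ˢ const a
  const-neg a zero    = refl
  const-neg a (suc n) = refl

  -- Dense Horner normal forms, used to decide polynomial identities between series

  Poly : ℕ → Set
  Poly zero    = ℤ
  Poly (suc n) = List (Poly n)

  constP : ∀ n → ℤ → Poly n
  constP zero    c = c
  constP (suc n) c = constP n c ∷ []

  varP : ∀ {n} → Fin n → Poly n
  varP {suc n} zero    = constP n 0ℤ ∷ constP n 1ℤ ∷ []
  varP {suc n} (suc i) = varP i ∷ []

  addP : ∀ n → Poly n → Poly n → Poly n
  addP zero    p q = p ℤ.+ q
  addP (suc n) [] q = q
  addP (suc n) (p ∷ ps) [] = p ∷ ps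
  addP (suc n) (p ∷ ps) (q ∷ qs) = addP n p q ∷ addP (suc n) ps qs

  negP : ∀ n → Poly n → Poly n
  negP zero    p = ℤ.- p
  negP (suc n) [] = []
  negP (suc n) (p ∷ ps) = negP n p ∷ negP (suc n) ps

  mulP   : ∀ n → Poly n → Poly n → Poly n
  scaleP : ∀ n → Poly n → Poly (suc n) → Poly (suc n)
  mulP zero    p q = p ℤ.* q
  mulP (suc n) [] q = []
  mulP (suc n) (p ∷ ps) q = addP (suc n) (scaleP n p q) (constP n 0ℤ ∷ mulP (suc n) ps q)
  scaleP n p [] = []
  scaleP n p (q ∷ qs) = mulP n p q ∷ scaleP n p qs

  isZeroℤ : ℤ → Bool
  isZeroℤ (+ zero) = true
  isZeroℤ _        = false

  isZeroP : ∀ n → Poly n → Bool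
  isZeroP zero    p = isZeroℤ p
  isZeroP (suc n) [] = true
  isZeroP (suc n) (p ∷ ps) = isZeroP n p ∧ isZeroP (suc n) ps

  evP : ∀ n → Poly n → Vec Series n → Series
  evP zero    c ρ = const c
  evP (suc n) [] ρ = 0ˢ
  evP (suc n) (p ∷ ps) (x ∷ ρ) = evP n p ρ +ˢ x *ˢ evP (suc n) ps (x ∷ ρ)

  open import Algebra.Properties.Ring SR.ring using (-‿distribʳ-*; -‿+-comm)

  private
    shuffle₁ : ∀ a b x c d → (a +ˢ x *ˢ c) +ˢ (b +ˢ x *ˢ d) ≈ˢ (a +ˢ b) +ˢ x *ˢ (c +ˢ d)
    shuffle₁ a b x c d n = trans (interchange (a n) ((x *ˢ c) n) (b n) _)
      (+-congˡ (a n ℤ.+ b n) (sym (*ˢ-distribˡ x c d n)))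
      where
      interchange : ∀ i j k l → (i ℤ.+ j) ℤ.+ (k ℤ.+ l) ≡ (i ℤ.+ k) ℤ.+ (j ℤ.+ l)
      interchange = solve-∀
    shuffle₂ : ∀ p x q q′ → p *ˢ q +ˢ x *ˢ (p *ˢ q′) ≈ˢ p *ˢ (q +ˢ x *ˢ q′)
    shuffle₂ p x q q′ = SR.trans (SR.+-congˡ {p *ˢ q} (SR.trans (SR.sym (SR.*-assoc x p q′))
      (SR.trans (SR.*-congʳ (SR.*-comm x p)) (SR.*-assoc p x q′)))) (SR.sym (SR.distribˡ p q (x *ˢ q′)))
    shuffle₃ : ∀ p x ps q → p *ˢ q +ˢ x *ˢ (ps *ˢ q) ≈ˢ (p +ˢ x *ˢ ps) *ˢ q
    shuffle₃ p x ps q = SR.trans (SR.+-congˡ {p *ˢ q} (SR.sym (SR.*-assoc x ps q))) (SR.sym (SR.distribʳ q p (x *ˢ ps)))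

  constP-sound : ∀ n c ρ → evP n (constP n c) ρ ≈ˢ const c
  constP-sound zero    c ρ = SR.refl
  constP-sound (suc n) c (x ∷ ρ) = begin
    evP n (constP n c) ρ +ˢ x *ˢ 0ˢ ≈⟨ SR.+-cong (constP-sound n c ρ) (SR.zeroʳ x) ⟩
    const c +ˢ 0ˢ                   ≈⟨ SR.+-identityʳ _ ⟩
    const c                         ∎

  constP0-sound : ∀ n ρ → evP n (constP n 0ℤ) ρ ≈ˢ 0ˢ
  constP0-sound n ρ = SR.trans (constP-sound n 0ℤ ρ) λ { zero → refl ; (suc _) → refl }

  varP-sound : ∀ {n} (i : Fin n) ρ → evP n (varP i) ρ ≈ˢ lookup ρ i
  varP-sound {suc n} zero (x ∷ ρ) = begin
    evP n (constP n 0ℤ) ρ +ˢ x *ˢ (evP n (constP n 1ℤ) ρ +ˢ x *ˢ 0ˢ)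
      ≈⟨ SR.+-cong (constP0-sound n ρ) (SR.*-congˡ {x} (SR.trans (SR.+-cong (constP-sound n 1ℤ ρ) (SR.zeroʳ x)) (SR.+-identityʳ _))) ⟩
    0ˢ +ˢ x *ˢ 1ˢ ≈⟨ SR.trans (SR.+-identityˡ _) (SR.*-identityʳ x) ⟩
    x ∎
  varP-sound {suc n} (suc i) (x ∷ ρ) = SR.trans (SR.+-cong (varP-sound i ρ) (SR.zeroʳ x)) (SR.+-identityʳ _)

  addP-sound : ∀ n p q ρ → evP n (addP n p q) ρ ≈ˢ evP n p ρ +ˢ evP n q ρ
  addP-sound zero    p q ρ = const-+ p q
  addP-sound (suc n) [] q ρ = SR.sym (SR.+-identityˡ _)
  addP-sound (suc n) (p ∷ ps) [] ρ = SR.sym (SR.+-identityʳ _)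
  addP-sound (suc n) (p ∷ ps) (q ∷ qs) (x ∷ ρ) = SR.trans
    (SR.+-cong (addP-sound n p q ρ) (SR.*-congˡ {x} (addP-sound (suc n) ps qs (x ∷ ρ))))
    (SR.sym (shuffle₁ (evP n p ρ) (evP n q ρ) x _ _))

  negP-sound : ∀ n p ρ → evP n (negP n p) ρ ≈ˢ -ˢ evP n p ρ
  negP-sound zero    p ρ = const-neg p
  negP-sound (suc n) [] ρ = λ _ → refl
  negP-sound (suc n) (p ∷ ps) (x ∷ ρ) = SR.trans
    (SR.+-cong (negP-sound n p ρ) (SR.trans (SR.*-congˡ {x} (negP-sound (suc n) ps (x ∷ ρ))) (SR.sym (-‿distribʳ-* x _))))
    (-‿+-comm (evP n p ρ) _)

  mulP-sound   : ∀ n p q ρ → evP n (mulP n p q) ρ ≈ˢ evP n p ρ *ˢ evP n q ρ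
  scaleP-sound : ∀ n p q x ρ → evP (suc n) (scaleP n p q) (x ∷ ρ) ≈ˢ evP n p ρ *ˢ evP (suc n) q (x ∷ ρ)
  mulP-sound zero    p q ρ = const-* p q
  mulP-sound (suc n) [] q ρ = SR.sym (SR.zeroˡ _)
  mulP-sound (suc n) (p ∷ ps) q (x ∷ ρ) = begin
    evP (suc n) (addP (suc n) (scaleP n p q) (constP n 0ℤ ∷ mulP (suc n) ps q)) (x ∷ ρ)
      ≈⟨ addP-sound (suc n) (scaleP n p q) _ (x ∷ ρ) ⟩
    evP (suc n) (scaleP n p q) (x ∷ ρ) +ˢ (evP n (constP n 0ℤ) ρ +ˢ x *ˢ evP (suc n) (mulP (suc n) ps q) (x ∷ ρ))
      ≈⟨ SR.+-cong (scaleP-sound n p q x ρ)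
           (SR.trans (SR.+-cong (constP0-sound n ρ) (SR.*-congˡ {x} (mulP-sound (suc n) ps q (x ∷ ρ)))) (SR.+-identityˡ _)) ⟩
    evP n p ρ *ˢ evP (suc n) q (x ∷ ρ) +ˢ x *ˢ (evP (suc n) ps (x ∷ ρ) *ˢ evP (suc n) q (x ∷ ρ))
      ≈⟨ shuffle₃ (evP n p ρ) x _ _ ⟩
    evP (suc n) (p ∷ ps) (x ∷ ρ) *ˢ evP (suc n) q (x ∷ ρ) ∎
  scaleP-sound n p [] x ρ = SR.sym (SR.zeroʳ _)
  scaleP-sound n p (q ∷ qs) x ρ = SR.trans
    (SR.+-cong (mulP-sound n p q ρ) (SR.*-congˡ {x} (scaleP-sound n p qs x ρ)))
    (shuffle₂ (evP n p ρ) x _ _)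

  ∧-true : ∀ {a b} → a ∧ b ≡ true → a ≡ true × b ≡ true
  ∧-true {true} {true} refl = refl , refl

  isZeroP-sound : ∀ n p ρ → isZeroP n p ≡ true → evP n p ρ ≈ˢ 0ˢ
  isZeroP-sound zero    (+ zero) ρ _ = λ { zero → refl ; (suc _) → refl }
  isZeroP-sound (suc n) [] ρ _ = SR.refl
  isZeroP-sound (suc n) (p ∷ ps) (x ∷ ρ) eq = let e₁ , e₂ = ∧-true eq in
    SR.trans (SR.+-cong (isZeroP-sound n p ρ e₁)
      (SR.trans (SR.*-congˡ {x} (isZeroP-sound (suc n) ps (x ∷ ρ) e₂)) (SR.zeroʳ x))) (SR.+-identityˡ _)

  infixl 6 _:+_ _:-_
  infixl 7 _:*_
  infixr 8 _:^_

  data Expr (n : ℕ) : Set where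
    con  : ℤ → Expr n
    var  : Fin n → Expr n
    _:+_ _:-_ _:*_ : Expr n → Expr n → Expr n
    _:^_ : Expr n → ℕ → Expr n

  ⟦_⟧ : ∀ {n} → Expr n → Vec Series n → Series
  ⟦ con c ⟧ ρ = const c
  ⟦ var i ⟧ ρ = lookup ρ i
  ⟦ e :+ e′ ⟧ ρ = ⟦ e ⟧ ρ +ˢ ⟦ e′ ⟧ ρ
  ⟦ e :- e′ ⟧ ρ = ⟦ e ⟧ ρ -ˢ ⟦ e′ ⟧ ρ
  ⟦ e :* e′ ⟧ ρ = ⟦ e ⟧ ρ *ˢ ⟦ e′ ⟧ ρ
  ⟦ e :^ k ⟧ ρ = ⟦ e ⟧ ρ ^ˢ k

  powP : ∀ n → Poly n → ℕ → Poly n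
  powP n p zero    = constP n 1ℤ
  powP n p (suc k) = mulP n p (powP n p k)

  powP-sound : ∀ n p k ρ → evP n (powP n p k) ρ ≈ˢ evP n p ρ ^ˢ k
  powP-sound n p zero    ρ = constP-sound n 1ℤ ρ
  powP-sound n p (suc k) ρ = SR.trans (mulP-sound n p _ ρ) (SR.*-congˡ {evP n p ρ} (powP-sound n p k ρ))

  nf : ∀ {n} → Expr n → Poly n
  nf {n} (con c)   = constP n c
  nf     (var i)   = varP i
  nf {n} (e :+ e′) = addP n (nf e) (nf e′)
  nf {n} (e :- e′) = addP n (nf e) (negP n (nf e′))
  nf {n} (e :* e′) = mulP n (nf e) (nf e′)
  nf {n} (e :^ k)  = powP n (nf e) k

  -ˢ-cong : ∀ {a a′ b b′} → a ≈ˢ a′ → b ≈ˢ b′ → a -ˢ b ≈ˢ a′ -ˢ b′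
  -ˢ-cong p q n = cong₂ ℤ._-_ (p n) (q n)

  nf-sound : ∀ {n} (e : Expr n) ρ → evP n (nf e) ρ ≈ˢ ⟦ e ⟧ ρ
  nf-sound {n} (con c) ρ = constP-sound n c ρ
  nf-sound (var i) ρ = varP-sound i ρ
  nf-sound {n} (e :+ e′) ρ = SR.trans (addP-sound n (nf e) (nf e′) ρ) (SR.+-cong (nf-sound e ρ) (nf-sound e′ ρ))
  nf-sound {n} (e :- e′) ρ = SR.trans (addP-sound n (nf e) (negP n (nf e′)) ρ)
    (SR.+-cong (nf-sound e ρ) (SR.trans (negP-sound n (nf e′) ρ) (SR.-‿cong (nf-sound e′ ρ))))
  nf-sound {n} (e :* e′) ρ = SR.trans (mulP-sound n (nf e) (nf e′) ρ) (SR.*-cong (nf-sound e ρ) (nf-sound e′ ρ))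
  nf-sound {n} (e :^ k) ρ = SR.trans (powP-sound n (nf e) k ρ) (^-congˡ k (nf-sound e ρ))

  -ˢ≈0⇒≈ : ∀ {a b} → a -ˢ b ≈ˢ 0ˢ → a ≈ˢ b
  -ˢ≈0⇒≈ {a} {b} p n = ℤₚ.i-j≡0⇒i≡j (a n) (b n) (p n)

  -- Normal forms are dense lists that may end in zeros, hence not unique. So the normal form of the
  -- difference is tested for vanishing, instead of two normal forms being compared.
  byPoly : ∀ {n} (ρ : Vec Series n) (e e′ : Expr n) → isZeroP n (nf (e :- e′)) ≡ true → ⟦ e ⟧ ρ ≈ˢ ⟦ e′ ⟧ ρ
  byPoly {n} ρ e e′ eq = -ˢ≈0⇒≈ (SR.trans (SR.sym (nf-sound (e :- e′) ρ)) (isZeroP-sound n (nf (e :- e′)) ρ eq))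

  swapˢ : ∀ a b c → a *ˢ (b *ˢ c) ≈ˢ b *ˢ (a *ˢ c)
  swapˢ a b c = byPoly (a ∷ b ∷ c ∷ []) (var zero :* (var (suc zero) :* var (suc (suc zero)))) (var (suc zero) :* (var zero :* var (suc (suc zero)))) refl

open PowerSeries

-- The derivation θ = q d/dq, cancellation, and finite sums of series.

module Derivation where

  open import Relation.Binary.Reasoning.Setoid SR.setoid

  θ : Series → Series
  θ a n = + n ℤ.* a n

  θ-cong : ∀ {a b} → a ≈ˢ b → θ a ≈ˢ θ b
  θ-cong p n = cong (+ n ℤ.*_) (p n)

  θ-+ : ∀ a b → θ (a +ˢ b) ≈ˢ θ a +ˢ θ b
  θ-+ a b n = ℤₚ.*-distribˡ-+ (+ n) (a n) (b n)

  θ-- : ∀ a b → θ (a -ˢ b) ≈ˢ θ a -ˢ θ b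
  θ-- a b n = eq (+ n) (a n) (b n)
    where
    eq : ∀ i j k → i ℤ.* (j ℤ.- k) ≡ i ℤ.* j ℤ.- i ℤ.* k
    eq = solve-∀

  θ-const : ∀ c → θ (const c) ≈ˢ 0ˢ
  θ-const c zero    = refl
  θ-const c (suc n) = ℤₚ.*-zeroʳ (+ suc n)

  +suc* : ∀ n i → + suc n ℤ.* i ≡ i ℤ.+ + n ℤ.* i
  +suc* n i = trans (cong (ℤ._* i) (ℤₚ.pos-+ 1 n)) (trans (ℤₚ.*-distribʳ-+ i 1ℤ (+ n)) (cong (ℤ._+ + n ℤ.* i) (ℤₚ.*-identityˡ i)))

  θ-* : ∀ a b → θ (a *ˢ b) ≈ˢ θ a *ˢ b +ˢ a *ˢ θ b
  θ-* a b zero    = sym (cong₂ ℤ._+_ (ℤₚ.*-zeroˡ (b 0)) (ℤₚ.*-zeroʳ (a 0)))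
  θ-* a b (suc n) = ≡.begin
    + suc n ℤ.* (a 0 ℤ.* b (suc n) ℤ.+ (tail a *ˢ b) n)
      ≡.≡⟨ ℤₚ.*-distribˡ-+ (+ suc n) (a 0 ℤ.* b (suc n)) _ ⟩
    + suc n ℤ.* (a 0 ℤ.* b (suc n)) ℤ.+ + suc n ℤ.* (tail a *ˢ b) n
      ≡.≡⟨ cong₂ ℤ._+_ (swap (+ suc n) (a 0) (b (suc n)))
           (trans (+suc* n _) (+-congˡ ((tail a *ˢ b) n) (θ-* (tail a) b n))) ⟩
    a 0 ℤ.* θ b (suc n) ℤ.+ ((tail a *ˢ b) n ℤ.+ ((θ (tail a) *ˢ b) n ℤ.+ (tail a *ˢ θ b) n))
      ≡.≡⟨ rearr (a 0 ℤ.* θ b (suc n)) ((tail a *ˢ b) n) _ _ (b (suc n)) ⟩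
    (0ℤ ℤ.* b (suc n) ℤ.+ ((tail a *ˢ b) n ℤ.+ (θ (tail a) *ˢ b) n)) ℤ.+ (a 0 ℤ.* θ b (suc n) ℤ.+ (tail a *ˢ θ b) n)
      ≡.≡⟨ cong (λ u → (0ℤ ℤ.* b (suc n) ℤ.+ u) ℤ.+ (a *ˢ θ b) (suc n))
           (trans (sym (*ˢ-distribʳ b (tail a) (θ (tail a)) n))
             (*ˢ-cong {b = b} (λ m → sym (+suc* m (tail a m))) (λ _ → refl) n)) ⟩
    (θ a *ˢ b) (suc n) ℤ.+ (a *ˢ θ b) (suc n) ≡.∎
    where
    module ≡ = ≡-Reasoning
    swap : ∀ i j k → i ℤ.* (j ℤ.* k) ≡ j ℤ.* (i ℤ.* k)
    swap = solve-∀
    rearr : ∀ i j k l m → i ℤ.+ (j ℤ.+ (k ℤ.+ l)) ≡ (0ℤ ℤ.* m ℤ.+ (j ℤ.+ k)) ℤ.+ (i ℤ.+ l)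
    rearr = solve-∀

  θ-const* : ∀ c a → θ (const c *ˢ a) ≈ˢ const c *ˢ θ a
  θ-const* c a = begin
    θ (const c *ˢ a)                       ≈⟨ θ-* (const c) a ⟩
    θ (const c) *ˢ a +ˢ const c *ˢ θ a     ≈⟨ SR.+-congʳ (SR.trans (SR.*-congʳ {a} (θ-const c)) (SR.zeroˡ a)) ⟩
    0ˢ +ˢ const c *ˢ θ a                   ≈⟨ SR.+-identityˡ _ ⟩
    const c *ˢ θ a ∎

  -- Congruence modulo q^(N+1) and cancellation

  ≈⇒≈[] : ∀ {a b} N → a ≈ˢ b → a ≈ˢ[ N ] b
  ≈⇒≈[] N p n _ = p n

  ≈[]-trans : ∀ {a b c} N → a ≈ˢ[ N ] b → b ≈ˢ[ N ] c → a ≈ˢ[ N ] c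
  ≈[]-trans N p q n n≤N = trans (p n n≤N) (q n n≤N)

  ≈[]-sym : ∀ {a b} N → a ≈ˢ[ N ] b → b ≈ˢ[ N ] a
  ≈[]-sym N p n n≤N = sym (p n n≤N)

  -- The coefficients of `b` vanish one after the other because ℤ has no zero divisors. A nonzero
  -- constant term is enough, so the same lemma also removes integer denominators.
  *ˢ-cancelˡ-0[] : ∀ N a {b} → a 0 ≢ 0ℤ → a *ˢ b ≈ˢ[ N ] 0ˢ → b ≈ˢ[ N ] 0ˢ
  *ˢ-cancelˡ-0[] N a {b} a₀≢0 ab≈0 n n≤N = vanish n n≤N n ℕₚ.≤-refl
    where
    cancel : ∀ {i} → a 0 ℤ.* i ≡ 0ℤ → i ≡ 0ℤ
    cancel {i} eq with ℤₚ.i*j≡0⇒i≡0∨j≡0 (a 0) eq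
    ... | inj₁ a₀≡0 = ⊥-elim (a₀≢0 a₀≡0)
    ... | inj₂ i≡0  = i≡0
    vanish : ∀ m → m ≤ N → ∀ k → k ≤ m → b k ≡ 0ℤ
    vanish zero    m≤N zero    z≤n = cancel (ab≈0 0 z≤n)
    vanish (suc m) m≤N k k≤m with ℕₚ.m≤n⇒m<n∨m≡n k≤m
    ... | inj₁ (s≤s k≤m′) = vanish m (ℕₚ.<⇒≤ m≤N) k k≤m′
    -- Split by `*ˢ-suc`, the coefficient m + 1 of the product is a₀ b(m+1) plus summands that each
    -- contain a lower coefficient of `b`.
    ... | inj₂ refl = cancel (trans (sym (trans (+-congʳ (lower m ℕₚ.≤-refl)) (ℤₚ.+-identityˡ _)))
        (trans (cong (λ u → (b *ˢ tail a) m ℤ.+ u) (ℤₚ.*-comm (a 0) (b (suc m))))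
          (trans (sym (*ˢ-suc b a m)) (trans (*ˢ-comm b a (suc m)) (ab≈0 (suc m) m≤N)))))
      where
      lower : b *ˢ tail a ≈ˢ[ m ] 0ˢ
      lower = ≈[]-trans m (*ˢ-cong-[] m {b = tail a} (vanish m (ℕₚ.<⇒≤ m≤N)) (λ _ _ → refl)) (≈⇒≈[] m (0ˢ*ˢ (tail a)))
      +-congʳ : ∀ {i j k} → i ≡ j → i ℤ.+ k ≡ j ℤ.+ k
      +-congʳ {k = k} = cong (ℤ._+ k)

  *ˢ-cancelˡ-0 : ∀ a {b} → a 0 ≢ 0ℤ → a *ˢ b ≈ˢ 0ˢ → b ≈ˢ 0ˢ
  *ˢ-cancelˡ-0 a a₀≢0 p n = *ˢ-cancelˡ-0[] n a a₀≢0 (≈⇒≈[] n p) n ℕₚ.≤-refl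

  ≈⇒-≈0 : ∀ {a b} → a ≈ˢ b → a -ˢ b ≈ˢ 0ˢ
  ≈⇒-≈0 {a} {b} p n = ℤₚ.i≡j⇒i-j≡0 (p n)

  *ˢ-cancelˡ : ∀ a {b c} → a 0 ≢ 0ℤ → a *ˢ b ≈ˢ a *ˢ c → b ≈ˢ c
  *ˢ-cancelˡ a {b} {c} a₀≢0 p = -ˢ≈0⇒≈ (*ˢ-cancelˡ-0 a a₀≢0 (SR.trans
    (byPoly (a ∷ b ∷ c ∷ []) (v₀ :* (v₁ :- v₂)) (v₀ :* v₁ :- v₀ :* v₂) refl) (≈⇒-≈0 p)))
    where v₀ = var (# 0) ; v₁ = var (# 1) ; v₂ = var (# 2)

  Σ₁ : ℕ → (ℕ → Series) → Series
  Σ₁ zero    f = 0ˢ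
  Σ₁ (suc N) f = Σ₁ N f +ˢ f (suc N)

  Σ₁-cong : ∀ N {f g} → (∀ i → 1 ≤ i → i ≤ N → f i ≈ˢ g i) → Σ₁ N f ≈ˢ Σ₁ N g
  Σ₁-cong zero    p = SR.refl
  Σ₁-cong (suc N) p = SR.+-cong (Σ₁-cong N (λ i l u → p i l (ℕₚ.m≤n⇒m≤1+n u))) (p (suc N) (s≤s z≤n) ℕₚ.≤-refl)

  Σ₁-cong[] : ∀ M N {f g} → (∀ i → 1 ≤ i → i ≤ N → f i ≈ˢ[ M ] g i) → Σ₁ N f ≈ˢ[ M ] Σ₁ N g
  Σ₁-cong[] M zero    p n _ = refl
  Σ₁-cong[] M (suc N) p n n≤M = cong₂ ℤ._+_ (Σ₁-cong[] M N (λ i l u → p i l (ℕₚ.m≤n⇒m≤1+n u)) n n≤M)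
    (p (suc N) (s≤s z≤n) ℕₚ.≤-refl n n≤M)

  Σ₁-+ : ∀ N f g → Σ₁ N (λ i → f i +ˢ g i) ≈ˢ Σ₁ N f +ˢ Σ₁ N g
  Σ₁-+ zero    f g n = refl
  Σ₁-+ (suc N) f g n = trans (cong (ℤ._+ (f (suc N) n ℤ.+ g (suc N) n)) (Σ₁-+ N f g n))
    (eq (Σ₁ N f n) (Σ₁ N g n) _ _)
    where
    eq : ∀ i j k l → (i ℤ.+ j) ℤ.+ (k ℤ.+ l) ≡ (i ℤ.+ k) ℤ.+ (j ℤ.+ l)
    eq = solve-∀

  Σ₁-0 : ∀ N → Σ₁ N (λ _ → 0ˢ) ≈ˢ 0ˢ
  Σ₁-0 zero    = SR.refl
  Σ₁-0 (suc N) = SR.trans (SR.+-identityʳ _) (Σ₁-0 N)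

  Σ₁-*ˡ : ∀ N a f → Σ₁ N (λ i → a *ˢ f i) ≈ˢ a *ˢ Σ₁ N f
  Σ₁-*ˡ zero    a f = SR.sym (SR.zeroʳ a)
  Σ₁-*ˡ (suc N) a f = SR.trans (SR.+-congʳ (Σ₁-*ˡ N a f)) (SR.sym (SR.distribˡ a (Σ₁ N f) (f (suc N))))

  Σ₁-swap : ∀ M N (f : ℕ → ℕ → Series) → Σ₁ M (λ i → Σ₁ N (f i)) ≈ˢ Σ₁ N (λ j → Σ₁ M (λ i → f i j))
  Σ₁-swap zero    N f = SR.sym (Σ₁-0 N)
  Σ₁-swap (suc M) N f = SR.trans (SR.+-congʳ (Σ₁-swap M N f)) (SR.sym (Σ₁-+ N _ (f (suc M))))

  Σ₁-tail : ∀ M k N {f} → (∀ i → N < i → f i ≈ˢ[ M ] 0ˢ) → Σ₁ (k ℕ.+ N) f ≈ˢ[ M ] Σ₁ N f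
  Σ₁-tail M zero    N p n _ = refl
  Σ₁-tail M (suc k) N {f} p n n≤M = trans
    (cong₂ ℤ._+_ (Σ₁-tail M k N {f} p n n≤M) (p (suc (k ℕ.+ N)) (s≤s (ℕₚ.m≤n+m N k)) n n≤M)) (ℤₚ.+-identityʳ _)

  -- Cut-off for a < c. It writes a sum over a triangle as one over a square, where the order of
  -- summation can be exchanged.
  above : ℕ → ℕ → Series → Series
  above a c s = if a ℕ.<ᵇ c then s else 0ˢ

  above-yes : ∀ {a c} s → a < c → above a c s ≡ s
  above-yes {a} {c} s a<c with a ℕ.<ᵇ c | ℕₚ.<⇒<ᵇ a<c
  ... | true | _ = refl

  above-no : ∀ {a c} s → c ≤ a → above a c s ≡ 0ˢ
  above-no {a} {c} s c≤a with a ℕ.<ᵇ c in eq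
  ... | false = refl
  ... | true  = ⊥-elim (ℕₚ.<⇒≱ (ℕₚ.<ᵇ⇒< a c (subst T (sym eq) _)) c≤a)

  ≡⇒≈ : ∀ {a b : Series} → a ≡ b → a ≈ˢ b
  ≡⇒≈ refl = SR.refl

  Σ₁-above : ∀ a N (h : ℕ → Series) → Σ₁ (N ℕ.+ a) (λ c → above a c (h c)) ≈ˢ Σ₁ N (λ b → h (b ℕ.+ a))
  Σ₁-above a zero    h = SR.trans (Σ₁-cong a (λ i _ i≤a → ≡⇒≈ (above-no (h i) i≤a))) (Σ₁-0 a)
  Σ₁-above a (suc N) h = SR.+-cong (Σ₁-above a N h) (≡⇒≈ (above-yes (h (suc N ℕ.+ a)) (s≤s (ℕₚ.m≤n+m a N))))

  Σ₁-aboveˡ : ∀ N c (h : ℕ → Series) → suc c ≤ N → Σ₁ N (λ a → above a (suc c) (h a)) ≈ˢ Σ₁ c h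
  Σ₁-aboveˡ N c h c<N = subst (λ M → Σ₁ M (λ a → above a (suc c) (h a)) ≈ˢ Σ₁ c h) (ℕₚ.m∸n+n≡m (ℕₚ.<⇒≤ c<N)) λ n → trans
    (Σ₁-tail n (N ℕ.∸ c) c (λ i c<i m _ → cong-app (above-no (h i) c<i) m) n ℕₚ.≤-refl)
    (Σ₁-cong c (λ i _ i≤c → ≡⇒≈ (above-yes (h i) (s≤s i≤c))) n)

  -- By symmetry, the new row and the new column of the square contribute the same values, which
  -- explains the two copies of the strict triangle.
  Σ₁-triangle : ∀ N (F : ℕ → ℕ → Series) → (∀ a c → F a c ≈ˢ F c a) →
    let D = Σ₁ N (λ a → Σ₁ N (λ c → above a c (F a c))) in
    Σ₁ N (λ a → Σ₁ N (F a)) ≈ˢ (D +ˢ D) +ˢ Σ₁ N (λ a → F a a)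
  Σ₁-triangle zero    F F-sym n = refl
  Σ₁-triangle (suc N) F F-sym = begin
    Σ₁ N (λ a → Σ₁ N (F a) +ˢ F a N′) +ˢ (Σ₁ N (F N′) +ˢ F N′ N′)
      ≈⟨ SR.+-cong (SR.trans (Σ₁-+ N (λ a → Σ₁ N (F a)) (λ a → F a N′)) (SR.+-congʳ (Σ₁-triangle N F F-sym)))
           (SR.+-congʳ (Σ₁-cong N (λ i _ _ → F-sym N′ i))) ⟩
    ((D +ˢ D) +ˢ E +ˢ R) +ˢ (R +ˢ F N′ N′)
      ≈⟨ byPoly (D ∷ E ∷ R ∷ F N′ N′ ∷ []) (v₀ :+ v₀ :+ v₁ :+ v₂ :+ (v₂ :+ v₃)) ((v₀ :+ v₂) :+ (v₀ :+ v₂) :+ (v₁ :+ v₃)) refl ⟩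
    ((D +ˢ R) +ˢ (D +ˢ R)) +ˢ (E +ˢ F N′ N′)
      ≈⟨ SR.+-congʳ {E +ˢ F N′ N′} (SR.+-cong D-step D-step) ⟨
    _ ∎
    where
    N′ = suc N
    D = Σ₁ N (λ a → Σ₁ N (λ c → above a c (F a c)))
    E = Σ₁ N (λ a → F a a)
    R = Σ₁ N (λ a → F a N′)
    v₀ = var (# 0) ; v₁ = var (# 1) ; v₂ = var (# 2) ; v₃ = var (# 3)
    D-step : Σ₁ N′ (λ a → Σ₁ N′ (λ c → above a c (F a c))) ≈ˢ D +ˢ R
    D-step = begin
      Σ₁ N (λ a → Σ₁ N (λ c → above a c (F a c)) +ˢ above a N′ (F a N′)) +ˢ Σ₁ N′ (λ c → above N′ c (F N′ c))
        ≈⟨ SR.+-cong (SR.trans (Σ₁-+ N _ _) (SR.+-congˡ {D} (Σ₁-cong N (λ i _ i≤N → ≡⇒≈ (above-yes (F i N′) (s≤s i≤N))))))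
             (SR.trans (Σ₁-cong N′ (λ i _ i≤N′ → ≡⇒≈ (above-no (F N′ i) i≤N′))) (Σ₁-0 N′)) ⟩
      (D +ˢ R) +ˢ 0ˢ ≈⟨ SR.+-identityʳ _ ⟩
      D +ˢ R ∎

open Derivation

-- The series q^d / (1 - q^d) and their products.

module GeometricSeries where

  open import Relation.Binary.Reasoning.Setoid SR.setoid

  X : Series
  X = shift 1ˢ

  X*ˢ : ∀ a → X *ˢ a ≈ˢ shift a
  X*ˢ a zero    = refl
  X*ˢ a (suc n) = trans (ℤₚ.+-identityˡ _) (1ˢ*ˢ a n)

  X^*-≥ : ∀ d a k → (X ^ˢ d *ˢ a) (d ℕ.+ k) ≡ a k
  X^*-≥ zero    a k = 1ˢ*ˢ a k
  X^*-≥ (suc d) a k = trans (*ˢ-assoc X (X ^ˢ d) a (suc (d ℕ.+ k)))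
    (trans (X*ˢ (X ^ˢ d *ˢ a) (suc (d ℕ.+ k))) (X^*-≥ d a k))

  X^*-< : ∀ d a n → n < d → (X ^ˢ d *ˢ a) n ≡ 0ℤ
  X^*-< (suc d) a n n<d = trans (*ˢ-assoc X (X ^ˢ d) a n) (trans (X*ˢ (X ^ˢ d *ˢ a) n) (lemma n n<d))
    where
    lemma : ∀ n → n < suc d → shift (X ^ˢ d *ˢ a) n ≡ 0ℤ
    lemma zero    _         = refl
    lemma (suc n) (s≤s n<d) = X^*-< d a n n<d

  -- This is q^d / (1 - q^d). The coefficient at 0 is set apart because d divides 0 although the
  -- series has no constant term.
  geo : ℕ → Series
  geo d zero    = 0ℤ
  geo d (suc n) = if does (d ∣? suc n) then 1ℤ else 0ℤ

  geo-yes : ∀ {d n} → 1 ≤ n → d ∣ n → geo d n ≡ 1ℤ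
  geo-yes {d} {suc n} _ d∣n rewrite dec-true (d ∣? suc n) d∣n = refl

  geo-no : ∀ {d n} → ¬ d ∣ n → geo d n ≡ 0ℤ
  geo-no {d} {zero}  _   = refl
  geo-no {d} {suc n} d∤n rewrite dec-false (d ∣? suc n) d∤n = refl

  geo-< : ∀ {d n} → n < d → geo d n ≡ 0ℤ
  geo-< {d} {zero}  _   = refl
  geo-< {d} {suc n} n<d = geo-no (λ d∣n → ℕₚ.<⇒≱ n<d (∣⇒≤ d∣n))

  geo-vanish : ∀ {d} N → N < d → geo d ≈ˢ[ N ] 0ˢ
  geo-vanish N N<d n n≤N = geo-< (ℕₚ.≤-<-trans n≤N N<d)

  geo-unfold : ∀ d → 1 ≤ d → geo d ≈ˢ X ^ˢ d *ˢ (1ˢ +ˢ geo d)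
  geo-unfold d 1≤d n with ℕₚ.<-≤-connex n d
  ... | inj₁ n<d = trans (geo-< n<d) (sym (X^*-< d (1ˢ +ˢ geo d) n n<d))
  ... | inj₂ d≤n = subst (λ m → geo d m ≡ (X ^ˢ d *ˢ (1ˢ +ˢ geo d)) m) (ℕₚ.m+[n∸m]≡n d≤n)
                     (trans (at (n ℕ.∸ d)) (sym (X^*-≥ d (1ˢ +ˢ geo d) (n ℕ.∸ d))))
    where
    at : ∀ k → geo d (d ℕ.+ k) ≡ (1ˢ +ˢ geo d) k
    at zero rewrite ℕₚ.+-identityʳ d = geo-yes 1≤d ∣-refl
    at (suc k) with d ∣? suc k
    ... | yes d∣k = geo-yes (ℕₚ.m≤n⇒m≤n+o (suc k) 1≤d) (∣m∣n⇒∣m+n ∣-refl d∣k)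
    ... | no  d∤k = geo-no (λ d∣ → d∤k (∣m+n∣m⇒∣n d∣ ∣-refl))

  geo-spec : ∀ d → 1 ≤ d → (1ˢ -ˢ X ^ˢ d) *ˢ geo d ≈ˢ X ^ˢ d
  geo-spec d 1≤d = begin
    (1ˢ -ˢ X ^ˢ d) *ˢ geo d
      ≈⟨ byPoly (X ^ˢ d ∷ geo d ∷ []) ((con 1ℤ :- x) :* g) (g :- x :* g) refl ⟩
    geo d -ˢ X ^ˢ d *ˢ geo d
      ≈⟨ -ˢ-cong (geo-unfold d 1≤d) SR.refl ⟩
    X ^ˢ d *ˢ (1ˢ +ˢ geo d) -ˢ X ^ˢ d *ˢ geo d
      ≈⟨ byPoly (X ^ˢ d ∷ geo d ∷ []) (x :* (con 1ℤ :+ g) :- x :* g) x refl ⟩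
    X ^ˢ d ∎
    where x = var (# 0) ; g = var (# 1)

  1-X^-unit : ∀ d → 1 ≤ d → (1ˢ -ˢ X ^ˢ d) 0 ≢ 0ℤ
  1-X^-unit (suc d) _ ()

  -- The partial fraction identity x/(1-x) · y/(1-y) = xy/(1-xy) · (1 + x/(1-x) + y/(1-y)).
  geo-product : ∀ a b → 1 ≤ a → 1 ≤ b → geo a *ˢ geo b ≈ˢ geo (a ℕ.+ b) *ˢ (1ˢ +ˢ geo a +ˢ geo b)
  geo-product a b 1≤a 1≤b =
    *ˢ-cancelˡ (1ˢ -ˢ X ^ˢ a) (1-X^-unit a 1≤a)
      (*ˢ-cancelˡ (1ˢ -ˢ X ^ˢ b) (1-X^-unit b 1≤b)
        (*ˢ-cancelˡ (1ˢ -ˢ X ^ˢ (a ℕ.+ b)) (1-X^-unit (a ℕ.+ b) (ℕₚ.m≤n⇒m≤n+o b 1≤a)) (begin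
    (1ˢ -ˢ Z) *ˢ ((1ˢ -ˢ Y) *ˢ ((1ˢ -ˢ W) *ˢ (A *ˢ B)))
      ≈⟨ byPoly (W ∷ Y ∷ Z ∷ A ∷ B ∷ [])
           ((𝟙 :- z) :* ((𝟙 :- y) :* ((𝟙 :- w) :* (α :* β)))) ((𝟙 :- z) :* (((𝟙 :- w) :* α) :* ((𝟙 :- y) :* β))) refl ⟩
    (1ˢ -ˢ Z) *ˢ (((1ˢ -ˢ W) *ˢ A) *ˢ ((1ˢ -ˢ Y) *ˢ B))
      ≈⟨ SR.*-cong {1ˢ -ˢ Z} (-ˢ-cong {1ˢ} SR.refl Z≈) (SR.*-cong hA hB) ⟩
    (1ˢ -ˢ W *ˢ Y) *ˢ (W *ˢ Y)
      ≈⟨ byPoly (W ∷ Y ∷ []) ((𝟙 :- w :* y) :* (w :* y))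
           ((w :* y) :* ((𝟙 :- w) :* (𝟙 :- y) :+ w :* (𝟙 :- y) :+ (𝟙 :- w) :* y)) refl ⟩
    (W *ˢ Y) *ˢ ((1ˢ -ˢ W) *ˢ (1ˢ -ˢ Y) +ˢ W *ˢ (1ˢ -ˢ Y) +ˢ (1ˢ -ˢ W) *ˢ Y)
      ≈⟨ SR.*-cong (SR.trans hC Z≈) (SR.+-cong (SR.+-congˡ {(1ˢ -ˢ W) *ˢ (1ˢ -ˢ Y)} (SR.*-congʳ hA)) (SR.*-congˡ {1ˢ -ˢ W} hB)) ⟨
    ((1ˢ -ˢ Z) *ˢ C) *ˢ ((1ˢ -ˢ W) *ˢ (1ˢ -ˢ Y) +ˢ ((1ˢ -ˢ W) *ˢ A) *ˢ (1ˢ -ˢ Y) +ˢ (1ˢ -ˢ W) *ˢ ((1ˢ -ˢ Y) *ˢ B))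
      ≈⟨ byPoly (W ∷ Y ∷ Z ∷ A ∷ B ∷ C ∷ [])
           (((𝟙 :- z) :* γ) :* ((𝟙 :- w) :* (𝟙 :- y) :+ ((𝟙 :- w) :* α) :* (𝟙 :- y) :+ (𝟙 :- w) :* ((𝟙 :- y) :* β)))
           ((𝟙 :- z) :* ((𝟙 :- y) :* ((𝟙 :- w) :* (γ :* (𝟙 :+ α :+ β))))) refl ⟩
    (1ˢ -ˢ Z) *ˢ ((1ˢ -ˢ Y) *ˢ ((1ˢ -ˢ W) *ˢ (C *ˢ (1ˢ +ˢ A +ˢ B)))) ∎)))
    where
    W = X ^ˢ a ; Y = X ^ˢ b ; Z = X ^ˢ (a ℕ.+ b) ; A = geo a ; B = geo b ; C = geo (a ℕ.+ b)
    Z≈ : Z ≈ˢ W *ˢ Y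
    Z≈ = ^-homo-* X a b
    hA = geo-spec a 1≤a
    hB = geo-spec b 1≤b
    hC = geo-spec (a ℕ.+ b) (ℕₚ.m≤n⇒m≤n+o b 1≤a)
    𝟙 : ∀ {n} → Expr n
    𝟙 = con 1ℤ
    w : ∀ {n} → Expr (suc n)
    w = var zero
    y : ∀ {n} → Expr (suc (suc n))
    y = var (suc zero)
    z : ∀ {n} → Expr (3 ℕ.+ n)
    z = var (suc (suc zero))
    α : ∀ {n} → Expr (4 ℕ.+ n)
    α = var (suc (suc (suc zero)))
    β : ∀ {n} → Expr (5 ℕ.+ n)
    β = var (suc (suc (suc (suc zero))))
    γ : Expr 6
    γ = var (# 5)

  θ-X^ : ∀ d → θ (X ^ˢ d) ≈ˢ const (+ d) *ˢ X ^ˢ d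
  θ-X^ d n with ℕₚ.<-≤-connex n d
  ... | inj₁ n<d = trans (cong (+ n ℤ.*_) zero-below)
        (trans (ℤₚ.*-zeroʳ (+ n)) (sym (trans (const*ˢ (+ d) (X ^ˢ d) n) (trans (cong (+ d ℤ.*_) zero-below) (ℤₚ.*-zeroʳ (+ d))))))
    where
    zero-below : (X ^ˢ d) n ≡ 0ℤ
    zero-below = trans (sym (SR.*-identityʳ (X ^ˢ d) n)) (X^*-< d 1ˢ n n<d)
  ... | inj₂ d≤n = trans (at (n ℕ.∸ d) (ℕₚ.m+[n∸m]≡n d≤n)) (sym (const*ˢ (+ d) (X ^ˢ d) n))
    where
    at : ∀ k → d ℕ.+ k ≡ n → + n ℤ.* (X ^ˢ d) n ≡ + d ℤ.* (X ^ˢ d) n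
    at zero    eq rewrite sym eq | ℕₚ.+-identityʳ d = refl
    at (suc k) eq = trans (cong (+ n ℤ.*_) z) (trans (ℤₚ.*-zeroʳ (+ n)) (sym (trans (cong (+ d ℤ.*_) z) (ℤₚ.*-zeroʳ (+ d)))))
      where
      z : (X ^ˢ d) n ≡ 0ℤ
      z = trans (cong (X ^ˢ d) (sym eq)) (trans (sym (SR.*-identityʳ (X ^ˢ d) (d ℕ.+ suc k))) (X^*-≥ d 1ˢ (suc k)))

  -- For x = q^d and g = x/(1 - x) one has θ g = d x/(1 - x)² = d (g + g²). The proof differentiates
  -- (1 - x) g = x and cancels 1 - x.
  geo-square : ∀ d → 1 ≤ d → const (+ d) *ˢ (geo d *ˢ geo d) ≈ˢ θ (geo d) -ˢ const (+ d) *ˢ geo d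
  geo-square d 1≤d = SR.sym (*ˢ-cancelˡ (1ˢ -ˢ x) (1-X^-unit d 1≤d) (begin
    (1ˢ -ˢ x) *ˢ (θ g -ˢ k *ˢ g)
      ≈⟨ byPoly (x ∷ g ∷ θ g ∷ k ∷ []) ((con 1ℤ :- e₀) :* (e₂ :- e₃ :* e₁))
           ((con 1ℤ :- e₀) :* e₂ :- e₃ :* ((con 1ℤ :- e₀) :* e₁)) refl ⟩
    (1ˢ -ˢ x) *ˢ θ g -ˢ k *ˢ ((1ˢ -ˢ x) *ˢ g)
      ≈⟨ -ˢ-cong dg (SR.*-congˡ {k} spec) ⟩
    k *ˢ x +ˢ k *ˢ x *ˢ g -ˢ k *ˢ x
      ≈⟨ byPoly (x ∷ g ∷ θ g ∷ k ∷ []) (e₃ :* e₀ :+ e₃ :* e₀ :* e₁ :- e₃ :* e₀) (e₃ :* (e₀ :* e₁)) refl ⟩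
    k *ˢ (x *ˢ g)
      ≈⟨ SR.*-congˡ {k} (SR.*-congʳ {g} spec) ⟨
    k *ˢ ((1ˢ -ˢ x) *ˢ g *ˢ g)
      ≈⟨ byPoly (x ∷ g ∷ θ g ∷ k ∷ []) (e₃ :* ((con 1ℤ :- e₀) :* e₁ :* e₁)) ((con 1ℤ :- e₀) :* (e₃ :* (e₁ :* e₁))) refl ⟩
    (1ˢ -ˢ x) *ˢ (k *ˢ (g *ˢ g)) ∎))
    where
    x = X ^ˢ d ; g = geo d ; k = const (+ d)
    e₀ e₁ e₂ e₃ : Expr 4
    e₀ = var (# 0) ; e₁ = var (# 1) ; e₂ = var (# 2) ; e₃ = var (# 3)
    spec = geo-spec d 1≤d
    dg : (1ˢ -ˢ x) *ˢ θ g ≈ˢ k *ˢ x +ˢ k *ˢ x *ˢ g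
    dg = begin
      (1ˢ -ˢ x) *ˢ θ g
        ≈⟨ byPoly (x ∷ g ∷ θ g ∷ k ∷ []) ((con 1ℤ :- e₀) :* e₂)
             (((con 0ℤ :- e₃ :* e₀) :* e₁ :+ (con 1ℤ :- e₀) :* e₂) :+ e₃ :* e₀ :* e₁) refl ⟩
      ((const 0ℤ -ˢ k *ˢ x) *ˢ g +ˢ (1ˢ -ˢ x) *ˢ θ g) +ˢ k *ˢ x *ˢ g
        ≈⟨ SR.+-congʳ (SR.+-congʳ (SR.*-congʳ {g} (SR.trans (θ-- 1ˢ x) (-ˢ-cong {θ 1ˢ} {const 0ℤ} (λ { zero → refl ; (suc n) → ℤₚ.*-zeroʳ (+ suc n) }) (θ-X^ d))))) ⟨
      (θ (1ˢ -ˢ x) *ˢ g +ˢ (1ˢ -ˢ x) *ˢ θ g) +ˢ k *ˢ x *ˢ g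
        ≈⟨ SR.+-congʳ (SR.trans (SR.sym (θ-* (1ˢ -ˢ x) g)) (SR.trans (θ-cong spec) (θ-X^ d))) ⟩
      k *ˢ x +ˢ k *ˢ x *ˢ g ∎

open GeometricSeries

-- Products of Lambert series by partial fractions.

module DivisorSums where

  open import Relation.Binary.Reasoning.Setoid SR.setoid

  infixr 9 _^ᶻ_
  _^ᶻ_ : ℤ → ℕ → ℤ
  x ^ᶻ k = x ℤ.^ k

  -- Truncation of ∑ d^k q^d/(1 - q^d) = ∑ σ_k(n) qⁿ, correct through q^N.
  lambert : ℕ → ℕ → Series
  lambert N k = Σ₁ N (λ d → const ((+ d) ^ᶻ k) *ˢ geo d)

  Σ₁-const : ℕ → (ℕ → ℤ) → Series
  Σ₁-const N f = Σ₁ N (λ d → const (f d))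

  -- Partial fractions replace g_a g_b by g_c (1 + g_a + g_b) with c = a + b, and φ(a, b) = ψ(a, c).
  -- The summand 1 gives ∑ g_c ∑_{a<c} ψ(a, c), which is the sum with τ. The summands g_a and g_b
  -- each give ψ(a, c) g_a g_c over the triangle a < c. These two triangles cancel against the sum
  -- of ψ over the square, of which only the diagonal remains.
  divisor-triangle : ∀ N (ψ φ : ℤ → ℤ → ℤ) (τ : ℤ → ℤ) →
    (∀ a c → ψ a c ≡ ψ c a) → (∀ a b → φ a b ≡ φ b a) → (∀ a b → ψ a (b ℤ.+ a) ≡ φ a b) →
    (∀ c → Σ₁-const c (λ a → ψ (+ a) (+ suc c)) ≈ˢ const (τ (+ suc c))) →
    Σ₁ N (λ a → Σ₁ N (λ b → const (φ (+ a) (+ b) ℤ.- ψ (+ a) (+ b)) *ˢ (geo a *ˢ geo b)))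
      ≈ˢ[ N ] Σ₁ N (λ c → const (τ (+ c)) *ˢ geo c) -ˢ Σ₁ N (λ a → const (ψ (+ a) (+ a)) *ˢ (geo a *ˢ geo a))
  divisor-triangle N ψ φ τ ψ-sym φ-sym ψφ ψτ n n≤N = ≡.begin
    S₂ (λ a b → const (φ (+ a) (+ b) ℤ.- ψ (+ a) (+ b)) *ˢ (geo a *ˢ geo b)) n
      ≡.≡⟨ S₂-cong (λ a b → SR.trans (SR.*-congʳ {geo a *ˢ geo b} (const-sub (φ (+ a) (+ b)) (ψ (+ a) (+ b))))
            (byPoly (const (φ (+ a) (+ b)) ∷ const (ψ (+ a) (+ b)) ∷ geo a *ˢ geo b ∷ []) ((v₀ :- v₁) :* v₂) (v₀ :* v₂ :+ con -1ℤ :* (v₁ :* v₂)) refl)) n ⟩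
    S₂ (λ a b → Φ a b *ˢ (geo a *ˢ geo b) +ˢ const -1ℤ *ˢ K a b) n
      ≡.≡⟨ S₂-+ (λ a b → Φ a b *ˢ (geo a *ˢ geo b)) (λ a b → const -1ℤ *ˢ K a b) n ⟩
    S₂ (λ a b → Φ a b *ˢ (geo a *ˢ geo b)) n ℤ.+ S₂ (λ a b → const -1ℤ *ˢ K a b) n
      ≡.≡⟨ cong₂ ℤ._+_ (trans φ-part (cong₂ ℤ._+_ (diag n n≤N) (cong₂ ℤ._+_ tri tri))) (trans (S₂-*ˡ (const -1ℤ) K n)
            (trans (const*ˢ -1ℤ (S₂ K) n) (cong (-1ℤ ℤ.*_) (Σ₁-triangle N K K-sym n)))) ⟩
    (Σ₁ N (λ c → const (τ (+ c)) *ˢ geo c) n ℤ.+ (D n ℤ.+ D n)) ℤ.+ -1ℤ ℤ.* ((D n ℤ.+ D n) ℤ.+ Σ₁ N (λ a → K a a) n)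
      ≡.≡⟨ final (Σ₁ N (λ c → const (τ (+ c)) *ˢ geo c) n) (D n) _ ⟩
    Σ₁ N (λ c → const (τ (+ c)) *ˢ geo c) n ℤ.- Σ₁ N (λ a → K a a) n ≡.∎
    where
    module ≡ = ≡-Reasoning
    v₀ v₁ v₂ : Expr 3
    v₀ = var (# 0) ; v₁ = var (# 1) ; v₂ = var (# 2)
    const-sub : ∀ i j → const (i ℤ.- j) ≈ˢ const i -ˢ const j
    const-sub i j zero    = refl
    const-sub i j (suc _) = refl
    S₂ : (ℕ → ℕ → Series) → Series
    S₂ F = Σ₁ N (λ a → Σ₁ N (F a))
    S₂-cong : ∀ {F G} → (∀ a b → F a b ≈ˢ G a b) → S₂ F ≈ˢ S₂ G
    S₂-cong p = Σ₁-cong N (λ a _ _ → Σ₁-cong N (λ b _ _ → p a b))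
    S₂-+ : ∀ F G → S₂ (λ a b → F a b +ˢ G a b) ≈ˢ S₂ F +ˢ S₂ G
    S₂-+ F G = SR.trans (Σ₁-cong N (λ a _ _ → Σ₁-+ N (F a) (G a))) (Σ₁-+ N _ _)
    S₂-*ˡ : ∀ s F → S₂ (λ a b → s *ˢ F a b) ≈ˢ s *ˢ S₂ F
    S₂-*ˡ s F = SR.trans (Σ₁-cong N (λ a _ _ → Σ₁-*ˡ N s (F a))) (Σ₁-*ˡ N s _)
    Φ Ψ K : ℕ → ℕ → Series
    Φ a b = const (φ (+ a) (+ b))
    Ψ a b = const (ψ (+ a) (+ b))
    K a c = Ψ a c *ˢ (geo a *ˢ geo c)
    K-sym : ∀ a c → K a c ≈ˢ K c a
    K-sym a c = SR.*-cong (≡⇒≈ (cong const (ψ-sym (+ a) (+ c)))) (SR.*-comm (geo a) (geo c))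
    D = S₂ (λ a c → above a c (K a c))
    ΨΦ : ∀ a b → Ψ a (b ℕ.+ a) ≡ Φ a b
    ΨΦ a b = cong const (trans (cong (ψ (+ a)) (ℤₚ.pos-+ b a)) (ψφ (+ a) (+ b)))
    above-*ˡ : ∀ a c s → above a c s ≈ˢ above a c 1ˢ *ˢ s
    above-*ˡ a c s with a ℕ.<ᵇ c
    ... | true  = SR.sym (SR.*-identityˡ s)
    ... | false = SR.sym (SR.zeroˡ s)
    -- Substituting c = a + b lets c run up to N + a; the terms with c > N vanish modulo q^(N+1).
    triangular : ∀ (H : ℕ → ℕ → Series) → (∀ a c → N < c → H a c ≈ˢ[ N ] 0ˢ) →
      S₂ (λ a b → H a (b ℕ.+ a)) ≈ˢ[ N ] S₂ (λ a c → above a c (H a c))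
    triangular H H-vanish = Σ₁-cong[] N N λ a _ _ → ≈[]-trans N
      (≈⇒≈[] N (SR.trans (SR.sym (Σ₁-above a N (H a))) (≡⇒≈ (cong (λ M → Σ₁ M (λ c → above a c (H a c))) (ℕₚ.+-comm N a)))))
      (Σ₁-tail N a N {λ c → above a c (H a c)} λ c N<c m m≤N → trans (above-*ˡ a c (H a c) m)
        (*ˢ-cong-[] N {above a c 1ˢ} {above a c 1ˢ} {H a c} {0ˢ} (λ _ _ → refl) (H-vanish a c N<c) m m≤N ∙ SR.zeroʳ (above a c 1ˢ) m))
      where
      _∙_ = trans
    geo-vanishʳ : ∀ s {c} → N < c → s *ˢ geo c ≈ˢ[ N ] 0ˢ
    geo-vanishʳ s {c} N<c m m≤N = trans (*ˢ-cong-[] N {s} {s} {geo c} {0ˢ} (λ _ _ → refl) (geo-vanish N N<c) m m≤N) (SR.zeroʳ s m)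
    φ-part : S₂ (λ a b → Φ a b *ˢ (geo a *ˢ geo b)) n
      ≡ S₂ (λ a b → Ψ a (b ℕ.+ a) *ˢ geo (b ℕ.+ a)) n ℤ.+ (S₂ (λ a b → K a (b ℕ.+ a)) n ℤ.+ S₂ (λ a b → K a (b ℕ.+ a)) n)
    φ-part = ≡.begin
      S₂ (λ a b → Φ a b *ˢ (geo a *ˢ geo b)) n
        ≡.≡⟨ Σ₁-cong N (λ a 1≤a _ → Σ₁-cong N (λ b 1≤b _ → expand a b 1≤a 1≤b)) n ⟩
      S₂ (λ a b → Ψ a (b ℕ.+ a) *ˢ geo (b ℕ.+ a) +ˢ (K a (b ℕ.+ a) +ˢ K b (a ℕ.+ b))) n
        ≡.≡⟨ trans (S₂-+ _ _ n) (cong (λ i → S₂ (λ a b → Ψ a (b ℕ.+ a) *ˢ geo (b ℕ.+ a)) n ℤ.+ i) (S₂-+ _ _ n)) ⟩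
      S₂ (λ a b → Ψ a (b ℕ.+ a) *ˢ geo (b ℕ.+ a)) n ℤ.+ (S₂ (λ a b → K a (b ℕ.+ a)) n ℤ.+ S₂ (λ a b → K b (a ℕ.+ b)) n)
        ≡.≡⟨ cong (λ i → S₂ (λ a b → Ψ a (b ℕ.+ a) *ˢ geo (b ℕ.+ a)) n ℤ.+ (S₂ (λ a b → K a (b ℕ.+ a)) n ℤ.+ i))
               (Σ₁-swap N N (λ a b → K b (a ℕ.+ b)) n) ⟩
      _ ≡.∎
      where
      expand : ∀ a b → 1 ≤ a → 1 ≤ b → Φ a b *ˢ (geo a *ˢ geo b)
        ≈ˢ Ψ a (b ℕ.+ a) *ˢ geo (b ℕ.+ a) +ˢ (K a (b ℕ.+ a) +ˢ K b (a ℕ.+ b))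
      expand a b 1≤a 1≤b rewrite ΨΦ a b | ΨΦ b a | sym (φ-sym (+ a) (+ b)) | ℕₚ.+-comm b a = SR.trans
        (SR.*-congˡ {Φ a b} (geo-product a b 1≤a 1≤b))
        (byPoly (Φ a b ∷ geo a ∷ geo b ∷ geo (a ℕ.+ b) ∷ []) (w₀ :* (w₃ :* (con 1ℤ :+ w₁ :+ w₂)))
          (w₀ :* w₃ :+ (w₀ :* (w₁ :* w₃) :+ w₀ :* (w₂ :* w₃))) refl)
        where
        w₀ w₁ w₂ w₃ : Expr 4
        w₀ = var (# 0) ; w₁ = var (# 1) ; w₂ = var (# 2) ; w₃ = var (# 3)
    tri : S₂ (λ a b → K a (b ℕ.+ a)) n ≡ D n
    tri = triangular K (λ a c N<c m m≤N → trans (sym (SR.*-assoc (Ψ a c) (geo a) (geo c) m)) (geo-vanishʳ (Ψ a c *ˢ geo a) N<c m m≤N)) n n≤N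
    diag : S₂ (λ a b → Ψ a (b ℕ.+ a) *ˢ geo (b ℕ.+ a)) ≈ˢ[ N ] Σ₁ N (λ c → const (τ (+ c)) *ˢ geo c)
    diag = ≈[]-trans N (triangular (λ a c → Ψ a c *ˢ geo c) (λ a c N<c → geo-vanishʳ (Ψ a c) N<c))
      (≈⇒≈[] N (SR.trans (Σ₁-swap N N _) (Σ₁-cong N column)))
      where
      column : ∀ c → 1 ≤ c → c ≤ N → Σ₁ N (λ a → above a c (Ψ a c *ˢ geo c)) ≈ˢ const (τ (+ c)) *ˢ geo c
      column (suc c) _ c≤N = begin
        Σ₁ N (λ a → above a (suc c) (Ψ a (suc c) *ˢ geo (suc c)))
          ≈⟨ Σ₁-aboveˡ N c (λ a → Ψ a (suc c) *ˢ geo (suc c)) c≤N ⟩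
        Σ₁ c (λ a → Ψ a (suc c) *ˢ geo (suc c))
          ≈⟨ Σ₁-cong c (λ a _ _ → SR.*-comm (Ψ a (suc c)) (geo (suc c))) ⟩
        Σ₁ c (λ a → geo (suc c) *ˢ Ψ a (suc c))
          ≈⟨ Σ₁-*ˡ c (geo (suc c)) (λ a → Ψ a (suc c)) ⟩
        geo (suc c) *ˢ Σ₁ c (λ a → Ψ a (suc c))
          ≈⟨ SR.trans (SR.*-congˡ {geo (suc c)} (ψτ c)) (SR.*-comm (geo (suc c)) _) ⟩
        const (τ (+ suc c)) *ˢ geo (suc c) ∎
    final : ∀ i j k → (i ℤ.+ (j ℤ.+ j)) ℤ.+ -1ℤ ℤ.* ((j ℤ.+ j) ℤ.+ k) ≡ i ℤ.- k
    final = solve-∀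

  0ˢ≈const : 0ˢ ≈ˢ const 0ℤ
  0ˢ≈const zero    = refl
  0ˢ≈const (suc _) = refl

  evPower : List (ℤ × ℕ) → ℤ → ℤ
  evPower [] x = 0ℤ
  evPower ((k , i) ∷ l) x = k ℤ.* x ^ᶻ i ℤ.+ evPower l x

  combination : List (ℤ × ℕ) → (ℕ → Series) → Series
  combination [] L = const 0ℤ
  combination ((k , i) ∷ l) L = const k *ˢ L i +ˢ combination l L

  lambert-combination : ∀ N l → Σ₁ N (λ c → const (evPower l (+ c)) *ˢ geo c) ≈ˢ combination l (lambert N)
  lambert-combination N [] = SR.trans (Σ₁-cong N (λ i _ _ → SR.trans (SR.*-congʳ {geo i} (λ { zero → refl ; (suc _) → refl })) (SR.zeroˡ (geo i)))) (SR.trans (Σ₁-0 N) 0ˢ≈const)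
  lambert-combination N ((k , i) ∷ l) = SR.trans
    (SR.trans (Σ₁-cong N (λ c _ _ → term c)) (Σ₁-+ N (λ c → const k *ˢ (const ((+ c) ^ᶻ i) *ˢ geo c)) (λ c → const (evPower l (+ c)) *ˢ geo c)))
    (SR.+-cong (Σ₁-*ˡ N (const k) _) (lambert-combination N l))
    where
    term : ∀ c → const (k ℤ.* (+ c) ^ᶻ i ℤ.+ evPower l (+ c)) *ˢ geo c
      ≈ˢ const k *ˢ (const ((+ c) ^ᶻ i) *ˢ geo c) +ˢ const (evPower l (+ c)) *ˢ geo c
    term c = SR.trans (SR.*-congʳ {geo c} (SR.trans (const-+ _ _) (SR.+-congʳ (const-* k _))))
      (byPoly (const k ∷ const ((+ c) ^ᶻ i) ∷ geo c ∷ const (evPower l (+ c)) ∷ [])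
        ((var (# 0) :* var (# 1) :+ var (# 3)) :* var (# 2)) (var (# 0) :* (var (# 1) :* var (# 2)) :+ var (# 3) :* var (# 2)) refl)

  evPower₂ : List (ℤ × ℕ × ℕ) → ℤ → ℤ → ℤ
  evPower₂ [] x y = 0ℤ
  evPower₂ ((k , i , j) ∷ l) x y = k ℤ.* (x ^ᶻ i ℤ.* y ^ᶻ j) ℤ.+ evPower₂ l x y

  combination₂ : List (ℤ × ℕ × ℕ) → (ℕ → Series) → Series
  combination₂ [] L = const 0ℤ
  combination₂ ((k , i , j) ∷ l) L = const k *ˢ (L i *ˢ L j) +ˢ combination₂ l L

  lambert-combination₂ : ∀ N l →
    Σ₁ N (λ a → Σ₁ N (λ b → const (evPower₂ l (+ a) (+ b)) *ˢ (geo a *ˢ geo b))) ≈ˢ combination₂ l (lambert N)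
  lambert-combination₂ N [] = SR.trans (Σ₁-cong N (λ a _ _ → SR.trans (Σ₁-cong N (λ b _ _ →
    SR.trans (SR.*-congʳ {geo a *ˢ geo b} (λ { zero → refl ; (suc _) → refl })) (SR.zeroˡ (geo a *ˢ geo b)))) (Σ₁-0 N))) (SR.trans (Σ₁-0 N) 0ˢ≈const)
  lambert-combination₂ N ((k , i , j) ∷ l) = SR.trans
    (SR.trans (Σ₁-cong N (λ a _ _ → SR.trans (Σ₁-cong N (λ b _ _ → term a b)) (Σ₁-+ N _ _))) (Σ₁-+ N _ _))
    (SR.+-cong product (lambert-combination₂ N l))
    where
    G : ℕ → ℕ → Series
    G e d = const ((+ d) ^ᶻ e) *ˢ geo d
    term : ∀ a b → const (k ℤ.* ((+ a) ^ᶻ i ℤ.* (+ b) ^ᶻ j) ℤ.+ evPower₂ l (+ a) (+ b)) *ˢ (geo a *ˢ geo b)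
      ≈ˢ (const k *ˢ G i a) *ˢ G j b +ˢ const (evPower₂ l (+ a) (+ b)) *ˢ (geo a *ˢ geo b)
    term a b = SR.trans (SR.*-congʳ {geo a *ˢ geo b} (SR.trans (const-+ _ _) (SR.+-congʳ (SR.trans (const-* k _) (SR.*-congˡ {const k} (const-* _ _))))))
      (byPoly (const k ∷ const ((+ a) ^ᶻ i) ∷ const ((+ b) ^ᶻ j) ∷ geo a ∷ geo b ∷ const (evPower₂ l (+ a) (+ b)) ∷ [])
        ((var (# 0) :* (var (# 1) :* var (# 2)) :+ var (# 5)) :* (var (# 3) :* var (# 4)))
        ((var (# 0) :* (var (# 1) :* var (# 3))) :* (var (# 2) :* var (# 4)) :+ var (# 5) :* (var (# 3) :* var (# 4))) refl)
    product : Σ₁ N (λ a → Σ₁ N (λ b → (const k *ˢ G i a) *ˢ G j b)) ≈ˢ const k *ˢ (lambert N i *ˢ lambert N j)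
    product = begin
      Σ₁ N (λ a → Σ₁ N (λ b → (const k *ˢ G i a) *ˢ G j b))
        ≈⟨ Σ₁-cong N (λ a _ _ → SR.trans (Σ₁-*ˡ N (const k *ˢ G i a) (G j)) (SR.*-comm (const k *ˢ G i a) (lambert N j))) ⟩
      Σ₁ N (λ a → lambert N j *ˢ (const k *ˢ G i a))
        ≈⟨ SR.trans (Σ₁-*ˡ N (lambert N j) _) (SR.*-congˡ {lambert N j} (Σ₁-*ˡ N (const k) (G i))) ⟩
      lambert N j *ˢ (const k *ˢ lambert N i)
        ≈⟨ byPoly (lambert N j ∷ const k ∷ lambert N i ∷ []) (var (# 0) :* (var (# 1) :* var (# 2))) (var (# 1) :* (var (# 2) :* var (# 0))) refl ⟩
      const k *ˢ (lambert N i *ˢ lambert N j) ∎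

  -- Multiplied by a^k, `geo-square` reads a^(k+1) g² = a^k θ g - a^(k+1) g; summation over a gives
  -- the claim.
  lambert-diagonal : ∀ N s k → Σ₁ N (λ a → const (s ℤ.* (+ a) ^ᶻ suc k) *ˢ (geo a *ˢ geo a))
    ≈ˢ const s *ˢ (θ (lambert N k) -ˢ lambert N (suc k))
  lambert-diagonal zero    s k = SR.sym (SR.trans (SR.*-congˡ {const s} (λ n → trans (ℤₚ.+-identityʳ _) (ℤₚ.*-zeroʳ (+ n)))) (SR.zeroʳ (const s)))
  lambert-diagonal (suc N) s k = begin
    Σ₁ N (λ a → const (s ℤ.* (+ a) ^ᶻ suc k) *ˢ (geo a *ˢ geo a)) +ˢ const (s ℤ.* (+ N′ ℤ.* (+ N′) ^ᶻ k)) *ˢ (g *ˢ g)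
      ≈⟨ SR.+-cong (lambert-diagonal N s k) (SR.trans (SR.*-congʳ {g *ˢ g} (SR.trans (const-* s _) (SR.*-congˡ {const s} (const-* (+ N′) _))))
           (byPoly (const s ∷ const (+ N′) ∷ const ((+ N′) ^ᶻ k) ∷ g ∷ []) ((v₀ :* (v₁ :* v₂)) :* (v₃ :* v₃)) ((v₀ :* v₂) :* (v₁ :* (v₃ :* v₃))) refl)) ⟩
    const s *ˢ (θ A -ˢ B) +ˢ (const s *ˢ p) *ˢ (const (+ N′) *ˢ (g *ˢ g))
      ≈⟨ SR.+-congˡ {const s *ˢ (θ A -ˢ B)} (SR.*-congˡ {const s *ˢ p} (geo-square N′ (s≤s z≤n))) ⟩
    const s *ˢ (θ A -ˢ B) +ˢ (const s *ˢ p) *ˢ (θ g -ˢ const (+ N′) *ˢ g)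
      ≈⟨ byPoly (const s ∷ const (+ N′) ∷ p ∷ g ∷ θ A ∷ B ∷ θ g ∷ []) (w₀ :* (w₄ :- w₅) :+ (w₀ :* w₂) :* (w₆ :- w₁ :* w₃))
           (w₀ :* ((w₄ :+ w₂ :* w₆) :- (w₅ :+ (w₁ :* w₂) :* w₃))) refl ⟩
    const s *ˢ ((θ A +ˢ p *ˢ θ g) -ˢ (B +ˢ (const (+ N′) *ˢ p) *ˢ g))
      ≈⟨ SR.*-congˡ {const s} (-ˢ-cong (SR.trans (θ-+ A (p *ˢ g)) (SR.+-congˡ {θ A} (θ-const* _ g)))
           (SR.+-congˡ {B} (SR.*-congʳ {g} (const-* (+ N′) _)))) ⟨
    const s *ˢ (θ (A +ˢ p *ˢ g) -ˢ (B +ˢ const ((+ N′) ^ᶻ suc k) *ˢ g)) ∎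
    where
    N′ = suc N
    g = geo N′
    p = const ((+ N′) ^ᶻ k)
    A = lambert N k
    B = lambert N (suc k)
    v₀ v₁ v₂ v₃ : Expr 4
    v₀ = var (# 0) ; v₁ = var (# 1) ; v₂ = var (# 2) ; v₃ = var (# 3)
    w₀ w₁ w₂ w₃ w₄ w₅ w₆ : Expr 7
    w₀ = var (# 0) ; w₁ = var (# 1) ; w₂ = var (# 2) ; w₃ = var (# 3) ; w₄ = var (# 4) ; w₅ = var (# 5) ; w₆ = var (# 6)

open DivisorSums

-- Convolution identities for divisor sums from polynomial data.

module DivisorIdentities where

  open import Relation.Binary.Reasoning.Setoid SR.setoid

  termsₑ : ∀ {n} → List (ℤ × ℕ) → Expr n → Expr n
  termsₑ [] x = con 0ℤ
  termsₑ ((k , i) ∷ l) x = con k :* x :^ i :+ termsₑ l x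

  terms₂ₑ : ∀ {n} → List (ℤ × ℕ × ℕ) → Expr n → Expr n → Expr n
  terms₂ₑ [] x y = con 0ℤ
  terms₂ₑ ((k , i , j) ∷ l) x y = con k :* (x :^ i :* y :^ j) :+ terms₂ₑ l x y

  ^-at-0 : ∀ a i → (a ^ˢ i) 0 ≡ a 0 ^ᶻ i
  ^-at-0 a zero    = refl
  ^-at-0 a (suc i) = cong (a 0 ℤ.*_) (^-at-0 a i)

  termsₑ-at-0 : ∀ {n} l (x : Expr n) ρ → ⟦ termsₑ l x ⟧ ρ 0 ≡ evPower l (⟦ x ⟧ ρ 0)
  termsₑ-at-0 [] x ρ = refl
  termsₑ-at-0 ((k , i) ∷ l) x ρ = cong₂ (λ u v → k ℤ.* u ℤ.+ v) (^-at-0 (⟦ x ⟧ ρ) i) (termsₑ-at-0 l x ρ)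

  terms₂ₑ-at-0 : ∀ {n} l (x y : Expr n) ρ → ⟦ terms₂ₑ l x y ⟧ ρ 0 ≡ evPower₂ l (⟦ x ⟧ ρ 0) (⟦ y ⟧ ρ 0)
  terms₂ₑ-at-0 [] x y ρ = refl
  terms₂ₑ-at-0 ((k , i , j) ∷ l) x y ρ =
    cong₂ (λ u v → k ℤ.* u ℤ.+ v) (cong₂ ℤ._*_ (^-at-0 (⟦ x ⟧ ρ) i) (^-at-0 (⟦ y ⟧ ρ) j)) (terms₂ₑ-at-0 l x y ρ)

  private
    𝕩 𝕪 𝕩+1 : Expr 2
    𝕩 = var (# 0)
    𝕪 = var (# 1)
    𝕩+1 = con 1ℤ :+ 𝕩

  -- ψ and φ are the symmetric polynomials of divisor-triangle, F x y = ∑_{a≤x} ψ a y and τ c = F (c-1) c.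
  record DivisorIdentity : Set where
    field
      ψ φ F φ-ψ : List (ℤ × ℕ × ℕ)
      τ : List (ℤ × ℕ)
      s : ℤ
      k : ℕ
      ψ-sym      : isZeroP 2 (nf (terms₂ₑ ψ 𝕩 𝕪 :- terms₂ₑ ψ 𝕪 𝕩)) ≡ true
      φ-sym      : isZeroP 2 (nf (terms₂ₑ φ 𝕩 𝕪 :- terms₂ₑ φ 𝕪 𝕩)) ≡ true
      ψ-shift    : isZeroP 2 (nf (terms₂ₑ ψ 𝕩 (𝕪 :+ 𝕩) :- terms₂ₑ φ 𝕩 𝕪)) ≡ true
      F-zero     : isZeroP 2 (nf (terms₂ₑ F (con 0ℤ) 𝕪 :- con 0ℤ)) ≡ true
      F-suc      : isZeroP 2 (nf (terms₂ₑ F 𝕩 𝕪 :+ terms₂ₑ ψ 𝕩+1 𝕪 :- terms₂ₑ F 𝕩+1 𝕪)) ≡ true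
      F-diagonal : isZeroP 2 (nf (terms₂ₑ F 𝕩 𝕩+1 :- termsₑ τ 𝕩+1)) ≡ true
      difference : isZeroP 2 (nf (terms₂ₑ φ 𝕩 𝕪 :- terms₂ₑ ψ 𝕩 𝕪 :- terms₂ₑ φ-ψ 𝕩 𝕪)) ≡ true
      ψ-diagonal : isZeroP 2 (nf (terms₂ₑ ψ 𝕩 𝕩 :- con s :* 𝕩 :^ suc k)) ≡ true

    -- `F` is a discrete antiderivative of `ψ` in its first argument: `F-zero` and `F-suc` sum `ψ`
    -- by induction, and `F-diagonal` evaluates the sum over a < c. On the diagonal `ψ` is a single
    -- power, as `lambert-diagonal` requires.
    lambert-identity : ∀ N → combination₂ φ-ψ (lambert N)
      ≈ˢ[ N ] combination τ (lambert N) -ˢ const s *ˢ (θ (lambert N k) -ˢ lambert N (suc k))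
    lambert-identity N = ≈[]-trans N (≈⇒≈[] N (SR.trans (SR.sym (lambert-combination₂ N φ-ψ))
        (Σ₁-cong N (λ a _ _ → Σ₁-cong N (λ b _ _ → SR.*-congʳ {geo a *ˢ geo b} (≡⇒≈ (cong const (sym (difference′ (+ a) (+ b))))))))))
      (≈[]-trans N (divisor-triangle N (evPower₂ ψ) (evPower₂ φ) (evPower τ)
          (λ x y → at x y (terms₂ₑ ψ 𝕩 𝕪) (terms₂ₑ ψ 𝕪 𝕩) ψ-sym (terms₂ₑ-at-0 ψ 𝕩 𝕪) (terms₂ₑ-at-0 ψ 𝕪 𝕩))
          (λ x y → at x y (terms₂ₑ φ 𝕩 𝕪) (terms₂ₑ φ 𝕪 𝕩) φ-sym (terms₂ₑ-at-0 φ 𝕩 𝕪) (terms₂ₑ-at-0 φ 𝕪 𝕩))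
          (λ x y → at x y (terms₂ₑ ψ 𝕩 (𝕪 :+ 𝕩)) (terms₂ₑ φ 𝕩 𝕪) ψ-shift (terms₂ₑ-at-0 ψ 𝕩 (𝕪 :+ 𝕩)) (terms₂ₑ-at-0 φ 𝕩 𝕪))
          (λ c → SR.trans (F-sum (+ suc c) c) (≡⇒≈ (cong const (trans (cong (evPower₂ F (+ c)) (ℤₚ.pos-+ 1 c)) (trans (at (+ c) 0ℤ (terms₂ₑ F 𝕩 𝕩+1) (termsₑ τ 𝕩+1) F-diagonal (terms₂ₑ-at-0 F 𝕩 𝕩+1) (termsₑ-at-0 τ 𝕩+1)) (cong (evPower τ) (sym (ℤₚ.pos-+ 1 c)))))))))
        (≈⇒≈[] N (-ˢ-cong (lambert-combination N τ) (SR.trans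
          (Σ₁-cong N (λ a _ _ → SR.*-congʳ {geo a *ˢ geo a} (≡⇒≈ (cong const (at (+ a) 0ℤ (terms₂ₑ ψ 𝕩 𝕩) (con s :* 𝕩 :^ suc k) ψ-diagonal
            (terms₂ₑ-at-0 ψ 𝕩 𝕩) (λ ρ → cong (s ℤ.*_) (^-at-0 (⟦ 𝕩 ⟧ ρ) (suc k))))))))
          (lambert-diagonal N s k)))))
      where
      -- An integer identity is the constant term of an identity between constant series, so the
      -- solver for series serves here too.
      at : ∀ x y {u v : Vec Series 2 → ℤ} (e e′ : Expr 2) → isZeroP 2 (nf (e :- e′)) ≡ true →
        (∀ ρ → ⟦ e ⟧ ρ 0 ≡ u ρ) → (∀ ρ → ⟦ e′ ⟧ ρ 0 ≡ v ρ) → u (const x ∷ const y ∷ []) ≡ v (const x ∷ const y ∷ [])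
      at x y e e′ z p q = trans (sym (p _)) (trans (byPoly (const x ∷ const y ∷ []) e e′ z 0) (q _))
      difference′ : ∀ x y → evPower₂ φ x y ℤ.- evPower₂ ψ x y ≡ evPower₂ φ-ψ x y
      difference′ x y = at x y (terms₂ₑ φ 𝕩 𝕪 :- terms₂ₑ ψ 𝕩 𝕪) (terms₂ₑ φ-ψ 𝕩 𝕪) difference
        (λ ρ → cong₂ ℤ._-_ (terms₂ₑ-at-0 φ 𝕩 𝕪 ρ) (terms₂ₑ-at-0 ψ 𝕩 𝕪 ρ)) (terms₂ₑ-at-0 φ-ψ 𝕩 𝕪)
      F-sum : ∀ y m → Σ₁-const m (λ a → evPower₂ ψ (+ a) y) ≈ˢ const (evPower₂ F (+ m) y)
      F-sum y zero    = SR.trans (λ { zero → refl ; (suc _) → refl }) (≡⇒≈ (cong const (sym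
        (at 0ℤ y (terms₂ₑ F (con 0ℤ) 𝕪) (con 0ℤ) F-zero (terms₂ₑ-at-0 F (con 0ℤ) 𝕪) (λ _ → refl)))))
      F-sum y (suc m) = SR.trans (SR.+-congʳ (F-sum y m)) (SR.trans (SR.sym (const-+ _ _)) (≡⇒≈ (cong const
        (trans (cong (λ z → evPower₂ F (+ m) y ℤ.+ evPower₂ ψ z y) (ℤₚ.pos-+ 1 m)) (trans
          (at (+ m) y (terms₂ₑ F 𝕩 𝕪 :+ terms₂ₑ ψ 𝕩+1 𝕪) (terms₂ₑ F 𝕩+1 𝕪) F-suc
            (λ ρ → cong₂ ℤ._+_ (terms₂ₑ-at-0 F 𝕩 𝕪 ρ) (terms₂ₑ-at-0 ψ 𝕩+1 𝕪 ρ)) (terms₂ₑ-at-0 F 𝕩+1 𝕪))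
          (cong (λ z → evPower₂ F z y) (sym (ℤₚ.pos-+ 1 m))))))))

  -- With L_k = ∑ σ_k(n) qⁿ this yields 12 L₁² = L₁ + 5 L₃ - 6 θ L₁; the two contributions of L₂
  -- cancel. The factor 6 makes the power sums in `F` integral.
  divisor-identity-11 : DivisorIdentity
  divisor-identity-11 = record
    { ψ = ((+ 6) , 2 , 0) ∷ ((-[1+ 5 ]) , 1 , 1) ∷ ((+ 6) , 0 , 2) ∷ []
    ; φ = ((+ 6) , 0 , 2) ∷ ((+ 6) , 1 , 1) ∷ ((+ 6) , 2 , 0) ∷ []
    ; F = ((+ 1) , 1 , 0) ∷ ((-[1+ 2 ]) , 1 , 1) ∷ ((+ 6) , 1 , 2) ∷ ((+ 3) , 2 , 0) ∷ ((-[1+ 2 ]) , 2 , 1) ∷ ((+ 2) , 3 , 0) ∷ []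
    ; τ = ((+ 1) , 1) ∷ ((-[1+ 5 ]) , 2) ∷ ((+ 5) , 3) ∷ []
    ; φ-ψ = ((+ 12) , 1 , 1) ∷ []
    ; s = (+ 6) ; k = 1
    ; ψ-sym = refl ; φ-sym = refl ; ψ-shift = refl ; F-zero = refl ; F-suc = refl ; F-diagonal = refl
    ; difference = refl ; ψ-diagonal = refl }

  -- Yields 240 L₁ L₃ = 21 L₅ + 10 L₃ - L₁ - 30 θ L₃, the source of the derivative of E₄.
  divisor-identity-13 : DivisorIdentity
  divisor-identity-13 = record
    { ψ = ((+ 30) , 4 , 0) ∷ ((-[1+ 59 ]) , 3 , 1) ∷ ((+ 90) , 2 , 2) ∷ ((-[1+ 59 ]) , 1 , 3) ∷ ((+ 30) , 0 , 4) ∷ []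
    ; φ = ((+ 30) , 0 , 4) ∷ ((+ 60) , 1 , 3) ∷ ((+ 90) , 2 , 2) ∷ ((+ 60) , 3 , 1) ∷ ((+ 30) , 4 , 0) ∷ []
    ; F = ((-[1+ 0 ]) , 1 , 0) ∷ ((+ 15) , 1 , 2) ∷ ((-[1+ 29 ]) , 1 , 3) ∷ ((+ 30) , 1 , 4) ∷ ((-[1+ 14 ]) , 2 , 1) ∷ ((+ 45) , 2 , 2) ∷ ((-[1+ 29 ]) , 2 , 3) ∷ ((+ 10) , 3 , 0) ∷ ((-[1+ 29 ]) , 3 , 1) ∷ ((+ 30) , 3 , 2) ∷ ((+ 15) , 4 , 0) ∷ ((-[1+ 14 ]) , 4 , 1) ∷ ((+ 6) , 5 , 0) ∷ []
    ; τ = ((-[1+ 0 ]) , 1) ∷ ((+ 10) , 3) ∷ ((-[1+ 29 ]) , 4) ∷ ((+ 21) , 5) ∷ []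
    ; φ-ψ = ((+ 120) , 3 , 1) ∷ ((+ 120) , 1 , 3) ∷ []
    ; s = (+ 30) ; k = 3
    ; ψ-sym = refl ; φ-sym = refl ; ψ-shift = refl ; F-zero = refl ; F-suc = refl ; F-diagonal = refl
    ; difference = refl ; ψ-diagonal = refl }

  -- Yields 120 L₃² = L₇ - L₃, that is E₄² = E₈. Here `ψ` vanishes on the diagonal, so that no
  -- derivative appears.
  divisor-identity-33 : DivisorIdentity
  divisor-identity-33 = record
    { ψ = ((+ 30) , 4 , 2) ∷ ((-[1+ 59 ]) , 3 , 3) ∷ ((+ 30) , 2 , 4) ∷ []
    ; φ = ((+ 30) , 2 , 4) ∷ ((+ 60) , 3 , 3) ∷ ((+ 30) , 4 , 2) ∷ []
    ; F = ((-[1+ 0 ]) , 1 , 2) ∷ ((+ 5) , 1 , 4) ∷ ((-[1+ 14 ]) , 2 , 3) ∷ ((+ 15) , 2 , 4) ∷ ((+ 10) , 3 , 2) ∷ ((-[1+ 29 ]) , 3 , 3) ∷ ((+ 10) , 3 , 4) ∷ ((+ 15) , 4 , 2) ∷ ((-[1+ 14 ]) , 4 , 3) ∷ ((+ 6) , 5 , 2) ∷ []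
    ; τ = ((-[1+ 0 ]) , 3) ∷ ((+ 1) , 7) ∷ []
    ; φ-ψ = ((+ 120) , 3 , 3) ∷ []
    ; s = (+ 0) ; k = 5
    ; ψ-sym = refl ; φ-sym = refl ; ψ-shift = refl ; F-zero = refl ; F-suc = refl ; F-diagonal = refl
    ; difference = refl ; ψ-diagonal = refl }

  -- Yields L₁ L₅ only in combination with L₃² and 249 L₇; the derivative of E₆ needs
  -- `divisor-identity-33` to eliminate L₇.
  divisor-identity-15 : DivisorIdentity
  divisor-identity-15 = record
    { ψ = ((+ 420) , 6 , 0) ∷ ((-[1+ 1259 ]) , 5 , 1) ∷ ((+ 2520) , 4 , 2) ∷ ((-[1+ 2939 ]) , 3 , 3) ∷ ((+ 2520) , 2 , 4) ∷ ((-[1+ 1259 ]) , 1 , 5) ∷ ((+ 420) , 0 , 6) ∷ []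
    ; φ = ((+ 420) , 0 , 6) ∷ ((+ 1260) , 1 , 5) ∷ ((+ 2520) , 2 , 4) ∷ ((+ 2940) , 3 , 3) ∷ ((+ 2520) , 4 , 2) ∷ ((+ 1260) , 5 , 1) ∷ ((+ 420) , 6 , 0) ∷ []
    ; F = ((+ 10) , 1 , 0) ∷ ((-[1+ 83 ]) , 1 , 2) ∷ ((+ 420) , 1 , 4) ∷ ((-[1+ 629 ]) , 1 , 5) ∷ ((+ 420) , 1 , 6) ∷ ((+ 105) , 2 , 1) ∷ ((-[1+ 734 ]) , 2 , 3) ∷ ((+ 1260) , 2 , 4) ∷ ((-[1+ 629 ]) , 2 , 5) ∷ ((-[1+ 69 ]) , 3 , 0) ∷ ((+ 840) , 3 , 2) ∷ ((-[1+ 1469 ]) , 3 , 3) ∷ ((+ 840) , 3 , 4) ∷ ((-[1+ 524 ]) , 4 , 1) ∷ ((+ 1260) , 4 , 2) ∷ ((-[1+ 734 ]) , 4 , 3) ∷ ((+ 210) , 5 , 0) ∷ ((-[1+ 629 ]) , 5 , 1) ∷ ((+ 504) , 5 , 2) ∷ ((+ 210) , 6 , 0) ∷ ((-[1+ 209 ]) , 6 , 1) ∷ ((+ 60) , 7 , 0) ∷ []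
    ; τ = ((+ 10) , 1) ∷ ((-[1+ 48 ]) , 3) ∷ ((+ 210) , 5) ∷ ((-[1+ 419 ]) , 6) ∷ ((+ 249) , 7) ∷ []
    ; φ-ψ = ((+ 2520) , 5 , 1) ∷ ((+ 2520) , 1 , 5) ∷ ((+ 5880) , 3 , 3) ∷ []
    ; s = (+ 420) ; k = 5
    ; ψ-sym = refl ; φ-sym = refl ; ψ-shift = refl ; F-zero = refl ; F-suc = refl ; F-diagonal = refl
    ; difference = refl ; ψ-diagonal = refl }

open DivisorIdentities

-- Eisenstein series, Ramanujan's equations, and the coefficients of the statement.

module EisensteinSeries where

  open import Relation.Binary.Reasoning.Setoid SR.setoid

  -- The coefficient of qⁿ is stable once the truncation reaches n, so this diagonal is the full
  -- series ∑ σ_k(n) qⁿ.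
  L : ℕ → Series
  L k n = lambert n k n

  Σ₁-lambert-tail : ∀ k N → lambert N k ≈ˢ[ N ] L k
  Σ₁-lambert-tail k N n n≤N = trans
    (cong (λ M → lambert M k n) (sym (ℕₚ.m∸n+n≡m n≤N)))
    (Σ₁-tail n (N ℕ.∸ n) n {λ d → const ((+ d) ^ᶻ k) *ˢ geo d} (λ d n<d m m≤n → trans
      (*ˢ-cong-[] n {const ((+ d) ^ᶻ k)} {const ((+ d) ^ᶻ k)} {geo d} {0ˢ} (λ _ _ → refl) (geo-vanish n n<d) m m≤n)
      (SR.zeroʳ (const ((+ d) ^ᶻ k)) m)) n ℕₚ.≤-refl)

  combination-cong : ∀ N l {f g : ℕ → Series} → (∀ i → f i ≈ˢ[ N ] g i) → combination l f ≈ˢ[ N ] combination l g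
  combination-cong N [] p n _ = refl
  combination-cong N ((k , i) ∷ l) p n n≤N =
    cong₂ ℤ._+_ (*ˢ-cong-[] N {const k} (λ _ _ → refl) (p i) n n≤N) (combination-cong N l p n n≤N)

  combination₂-cong : ∀ N l {f g : ℕ → Series} → (∀ i → f i ≈ˢ[ N ] g i) → combination₂ l f ≈ˢ[ N ] combination₂ l g
  combination₂-cong N [] p n _ = refl
  combination₂-cong N ((k , i , j) ∷ l) p n n≤N = cong₂ ℤ._+_
    (*ˢ-cong-[] N {const k} (λ _ _ → refl) (*ˢ-cong-[] N (p i) (p j)) n n≤N) (combination₂-cong N l p n n≤N)

  L-identity : (D : DivisorIdentity) → let open DivisorIdentity D in
    combination₂ φ-ψ L ≈ˢ combination τ L -ˢ const s *ˢ (θ (L k) -ˢ L (suc k))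
  L-identity D n = trans (sym (combination₂-cong n φ-ψ (λ i → Σ₁-lambert-tail i n) n ℕₚ.≤-refl))
    (trans (lambert-identity n n ℕₚ.≤-refl)
      (cong₂ ℤ._-_ (combination-cong n τ (λ i → Σ₁-lambert-tail i n) n ℕₚ.≤-refl)
        (*ˢ-cong-[] n {const s} (λ _ _ → refl) (λ m m≤n → cong₂ ℤ._-_ (cong (+ m ℤ.*_) (Σ₁-lambert-tail k n m m≤n)) (Σ₁-lambert-tail (suc k) n m m≤n)) n ℕₚ.≤-refl)))
    where open DivisorIdentity D

  -- Eisenstein series and Ramanujan's differential equations

  E₂ E₄ E₆ : Series
  E₂ = 1ˢ -ˢ const (+ 24) *ˢ L 1
  E₄ = 1ˢ +ˢ const (+ 240) *ˢ L 3
  E₆ = 1ˢ -ˢ const (+ 504) *ˢ L 5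

  θ-1- : ∀ c a → θ (1ˢ -ˢ const c *ˢ a) ≈ˢ const 0ℤ -ˢ const c *ˢ θ a
  θ-1- c a = SR.trans (θ-- 1ˢ (const c *ˢ a)) (-ˢ-cong {θ 1ˢ} {const 0ℤ} (SR.trans (θ-const 1ℤ) 0ˢ≈const) (θ-const* c a))

  θ-1+ : ∀ c a → θ (1ˢ +ˢ const c *ˢ a) ≈ˢ const c *ˢ θ a
  θ-1+ c a = SR.trans (θ-+ 1ˢ (const c *ˢ a)) (SR.trans (SR.+-cong (θ-const 1ℤ) (θ-const* c a)) (SR.+-identityˡ _))

  absorb : ∀ {a b} s c → a ≈ˢ b → s +ˢ c *ˢ (a -ˢ b) ≈ˢ s
  absorb s c a≈b = SR.trans (SR.+-congˡ {s} (SR.trans (SR.*-congˡ {c} (≈⇒-≈0 a≈b)) (SR.zeroʳ c))) (SR.+-identityʳ s)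

  private
    L₁ = L 1 ; L₂ = L 2 ; L₃ = L 3 ; L₄ = L 4 ; L₅ = L 5 ; L₆ = L 6 ; L₇ = L 7
    ρ : Vec Series 10
    ρ = L₁ ∷ L₂ ∷ L₃ ∷ L₄ ∷ L₅ ∷ L₆ ∷ L₇ ∷ θ L₁ ∷ θ L₃ ∷ θ L₅ ∷ []
    l₁ l₂ l₃ l₄ l₅ l₆ l₇ t₁ t₃ t₅ p q r : Expr 10
    l₁ = var (# 0) ; l₂ = var (# 1) ; l₃ = var (# 2) ; l₄ = var (# 3) ; l₅ = var (# 4) ; l₆ = var (# 5) ; l₇ = var (# 6)
    t₁ = var (# 7) ; t₃ = var (# 8) ; t₅ = var (# 9)
    p = con 1ℤ :- con (+ 24) :* l₁
    q = con 1ℤ :+ con (+ 240) :* l₃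
    r = con 1ℤ :- con (+ 504) :* l₅
    k : ∀ {n} → ℕ → Expr n
    k n = con (+ n)
    lhs rhs : DivisorIdentity → (ℕ → Expr 10) → Expr 10 → Expr 10
    lhs D f _ = go (DivisorIdentity.φ-ψ D)
      where
      go : List (ℤ × ℕ × ℕ) → Expr 10
      go [] = con 0ℤ
      go ((c , i , j) ∷ l) = con c :* (f i :* f j) :+ go l
    rhs D f t = go (DivisorIdentity.τ D) :- con (DivisorIdentity.s D) :* (t :- f (suc (DivisorIdentity.k D)))
      where
      go : List (ℤ × ℕ) → Expr 10
      go [] = con 0ℤ
      go ((c , i) ∷ l) = con c :* f i :+ go l
    ℓ : ℕ → Expr 10
    ℓ 1 = l₁
    ℓ 2 = l₂
    ℓ 3 = l₃
    ℓ 4 = l₄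
    ℓ 5 = l₅
    ℓ 6 = l₆
    ℓ _ = l₇

  θE₂ : const (+ 12) *ˢ θ E₂ ≈ˢ E₂ *ˢ E₂ -ˢ E₄
  θE₂ = SR.trans (SR.*-congˡ {const (+ 12)} (θ-1- (+ 24) L₁)) (SR.trans
    (byPoly ρ (k 12 :* (con 0ℤ :- k 24 :* t₁)) (p :* p :- q :+ (con -[1+ 47 ]) :* (lhs D ℓ t₁ :- rhs D ℓ t₁)) refl)
    (absorb (E₂ *ˢ E₂ -ˢ E₄) (const -[1+ 47 ]) (L-identity D)))
    where
    D = divisor-identity-11

  θE₄ : const (+ 3) *ˢ θ E₄ ≈ˢ E₂ *ˢ E₄ -ˢ E₆
  θE₄ = SR.trans (SR.*-congˡ {const (+ 3)} (θ-1+ (+ 240) L₃)) (SR.trans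
    (byPoly ρ (k 3 :* (k 240 :* t₃)) (p :* q :- r :+ k 24 :* (lhs D ℓ t₃ :- rhs D ℓ t₃)) refl)
    (absorb (E₂ *ˢ E₄ -ˢ E₆) (const (+ 24)) (L-identity D)))
    where D = divisor-identity-13

  θE₆ : const (+ 2) *ˢ θ E₆ ≈ˢ E₂ *ˢ E₆ -ˢ E₄ *ˢ E₄
  θE₆ = *ˢ-cancelˡ (const (+ 5)) (λ ()) (SR.trans (SR.*-congˡ {const (+ 5)} (SR.*-congˡ {const (+ 2)} (θ-1- (+ 504) L₅)))
    (SR.trans (byPoly ρ (k 5 :* (k 2 :* (con 0ℤ :- k 504 :* t₅)))
        -- The multiplier 2988 = 12 · 249 of the identity for L₃² cancels the L₇ brought in by -12
        -- times the identity for L₁ L₅.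
        ((k 5 :* (p :* r :- q :* q) :+ (con -[1+ 11 ]) :* (lhs D ℓ t₅ :- rhs D ℓ t₅)) :+ (con (+ 2988)) :* (lhs D′ ℓ t₅ :- rhs D′ ℓ t₅)) refl)
      (SR.trans (absorb _ (const (+ 2988)) (L-identity D′))
        (absorb (const (+ 5) *ˢ (E₂ *ˢ E₆ -ˢ E₄ *ˢ E₄)) (const -[1+ 11 ]) (L-identity D)))))
    where
    D = divisor-identity-15
    D′ = divisor-identity-33
  -- The partition generating function

  tail-sum : ∀ n (f : ℕ → ℤ) → sumTo (suc n) f ≡ f 0 ℤ.+ sumTo n (λ j → f (suc j))
  tail-sum n f = cong (λ l → f 0 ℤ.+ foldr ℤ._+_ 0ℤ l)
    (trans (Listₚ.map-applyUpTo suc f n) (sym (Listₚ.map-upTo (λ j → f (suc j)) n)))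

  sumTo-convolution : ∀ a b n → sumTo (suc n) (λ j → a j ℤ.* b (n ℕ.∸ j)) ≡ (a *ˢ b) n
  sumTo-convolution a b zero    = ℤₚ.+-identityʳ _
  sumTo-convolution a b (suc n) = trans (tail-sum (suc n) (λ j → a j ℤ.* b (suc n ℕ.∸ j)))
    (+-congˡ (a 0 ℤ.* b (suc n)) (sumTo-convolution (tail a) b n))

  sumTo-cong : ∀ n {f g : ℕ → ℤ} → (∀ j → f j ≡ g j) → sumTo n f ≡ sumTo n g
  sumTo-cong n p = cong (foldr ℤ._+_ 0ℤ) (Listₚ.map-cong p (upTo n))

  invQPochAux-fuel : ∀ f g n → n < f → n < g → invQPochAux f n ≡ invQPochAux g n
  invQPochAux-fuel (suc f) (suc g) zero    _ _ = refl
  invQPochAux-fuel (suc f) (suc g) (suc n) (s≤s n<f) (s≤s n<g) = cong ℤ.-_ (sumTo-cong (suc n) λ j →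
    cong (qPochCoeff (suc j) ℤ.*_) (invQPochAux-fuel f g (n ℕ.∸ j)
      (ℕₚ.≤-<-trans (ℕₚ.m∸n≤m n j) n<f) (ℕₚ.≤-<-trans (ℕₚ.m∸n≤m n j) n<g)))

  φ ψ : Series
  φ = qPochCoeff
  ψ = invQPoch

  -- The recursion defining `ψ` says that the higher coefficients of the product vanish; only the
  -- fuel arguments have to be equalised.
  φψ≈1 : φ *ˢ ψ ≈ˢ 1ˢ
  φψ≈1 zero    = refl
  φψ≈1 (suc n) = trans (cong₂ ℤ._+_ (ℤₚ.*-identityˡ (ψ (suc n))) (trans (sym (sumTo-convolution (tail φ) ψ n))
      (sumTo-cong (suc n) λ j → cong (φ (suc j) ℤ.*_) (invQPochAux-fuel (suc (n ℕ.∸ j)) (suc n) (n ℕ.∸ j) ℕₚ.≤-refl (s≤s (ℕₚ.m∸n≤m n j))))))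
    (ℤₚ.+-inverseˡ (sumTo (suc n) (λ j → φ (suc j) ℤ.* invQPochAux (suc n) (n ℕ.∸ j))))

  if-≤ᵇ : ∀ {m n} {x y : ℤ} → m ≤ n → (if m ℕ.≤ᵇ n then x else y) ≡ x
  if-≤ᵇ {m} {n} m≤n with m ℕ.≤ᵇ n | ℕₚ.≤⇒≤ᵇ m≤n
  ... | true | _ = refl

  if-≰ᵇ : ∀ {m n} {x y : ℤ} → n < m → (if m ℕ.≤ᵇ n then x else y) ≡ y
  if-≰ᵇ {m} {n} n<m with m ℕ.≤ᵇ n in eq
  ... | false = refl
  ... | true  = ⊥-elim (ℕₚ.<⇒≱ n<m (ℕₚ.≤ᵇ⇒≤ m n (subst T (sym eq) _)))

  mulOneMinus≈ : ∀ m f → mulOneMinus m f ≈ˢ (1ˢ -ˢ X ^ˢ m) *ˢ f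
  mulOneMinus≈ m f i = trans (cong (λ j → f i ℤ.- j) shifted)
    (byPoly (f ∷ X ^ˢ m ∷ []) (var (# 0) :- var (# 1) :* var (# 0)) ((con 1ℤ :- var (# 1)) :* var (# 0)) refl i)
    where
    shifted : (if m ℕ.≤ᵇ i then f (i ℕ.∸ m) else 0ℤ) ≡ (X ^ˢ m *ˢ f) i
    shifted with ℕₚ.<-≤-connex i m
    ... | inj₁ i<m = trans (if-≰ᵇ i<m) (sym (X^*-< m f i i<m))
    ... | inj₂ m≤i = trans (if-≤ᵇ m≤i) (trans (sym (X^*-≥ m f (i ℕ.∸ m))) (cong (X ^ˢ m *ˢ f) (ℕₚ.m+[n∸m]≡n m≤i)))

  finProd-stable : ∀ k i → finProd (k ℕ.+ i) i ≡ qPochCoeff i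
  finProd-stable zero    i = refl
  finProd-stable (suc k) i = trans (cong (λ j → finProd (k ℕ.+ i) i ℤ.- j) (if-≰ᵇ {suc (k ℕ.+ i)} {i} (s≤s (ℕₚ.m≤n+m i k))))
    (trans (ℤₚ.+-identityʳ _) (finProd-stable k i))

  finProd≈φ : ∀ N → finProd N ≈ˢ[ N ] φ
  finProd≈φ N n n≤N = trans (cong (λ M → finProd M n) (sym (ℕₚ.m∸n+n≡m n≤N))) (finProd-stable (N ℕ.∸ n) n)

  -- Logarithmic derivative of the product: the factor 1 - q^m contributes -m q^m/(1 - q^m).
  θ-finProd : ∀ N → θ (finProd N) ≈ˢ -ˢ (finProd N *ˢ lambert N 1)
  θ-finProd zero = λ { zero → refl ; (suc n) → trans (ℤₚ.*-zeroʳ (+ suc n)) (sym (cong ℤ.-_ (SR.zeroʳ (finProd 0) (suc n)))) }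
  θ-finProd (suc N) = begin
    θ (finProd N′)
      ≈⟨ SR.trans (θ-cong (mulOneMinus≈ N′ F)) (θ-* (1ˢ -ˢ x) F) ⟩
    θ (1ˢ -ˢ x) *ˢ F +ˢ (1ˢ -ˢ x) *ˢ θ F
      ≈⟨ SR.+-cong (SR.*-congʳ {F} (SR.trans (θ-- 1ˢ x) (-ˢ-cong {θ 1ˢ} {const 0ℤ} (SR.trans (θ-const 1ℤ) 0ˢ≈const) (θ-X^ N′))))
           (SR.*-congˡ {1ˢ -ˢ x} (SR.trans (θ-finProd N) (λ n → sym (ℤₚ.+-identityˡ _)))) ⟩
    (const 0ℤ -ˢ const (+ N′) *ˢ x) *ˢ F +ˢ (1ˢ -ˢ x) *ˢ (0ˢ -ˢ F *ˢ Λ)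
      ≈⟨ SR.+-cong {(const 0ℤ -ˢ const (+ N′) *ˢ x) *ˢ F} (SR.*-congʳ {F} (-ˢ-cong {const 0ℤ} SR.refl (SR.*-congˡ {const (+ N′)} (SR.sym (geo-spec N′ (s≤s z≤n))))))
           (SR.*-congˡ {1ˢ -ˢ x} (-ˢ-cong {0ˢ} {const 0ℤ} 0ˢ≈const SR.refl)) ⟩
    (const 0ℤ -ˢ const (+ N′) *ˢ ((1ˢ -ˢ x) *ˢ geo N′)) *ˢ F +ˢ (1ˢ -ˢ x) *ˢ (const 0ℤ -ˢ F *ˢ Λ)
      ≈⟨ byPoly (x ∷ F ∷ Λ ∷ geo N′ ∷ const (+ N′) ∷ [])
           ((con 0ℤ :- v₄ :* ((con 1ℤ :- v₀) :* v₃)) :* v₁ :+ (con 1ℤ :- v₀) :* (con 0ℤ :- v₁ :* v₂))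
           (con 0ℤ :- ((con 1ℤ :- v₀) :* v₁) :* (v₂ :+ (v₄ :* con 1ℤ) :* v₃)) refl ⟩
    const 0ℤ -ˢ ((1ˢ -ˢ x) *ˢ F) *ˢ (Λ +ˢ (const (+ N′) *ˢ const 1ℤ) *ˢ geo N′)
      ≈⟨ -ˢ-cong (SR.sym 0ˢ≈const) (SR.*-cong (SR.sym (mulOneMinus≈ N′ F)) (SR.+-congˡ {Λ} (SR.*-congʳ {geo N′} (SR.sym (const-* (+ N′) 1ℤ))))) ⟩
    0ˢ -ˢ finProd N′ *ˢ lambert N′ 1
      ≈⟨ (λ n → ℤₚ.+-identityˡ _) ⟩
    -ˢ (finProd N′ *ˢ lambert N′ 1) ∎
    where
    N′ = suc N
    x = X ^ˢ N′
    F = finProd N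
    Λ = lambert N 1
    v₀ v₁ v₂ v₃ v₄ : Expr 5
    v₀ = var (# 0) ; v₁ = var (# 1) ; v₂ = var (# 2) ; v₃ = var (# 3) ; v₄ = var (# 4)

  θφ : θ φ ≈ˢ -ˢ (φ *ˢ L 1)
  θφ n = trans (cong (+ n ℤ.*_) (sym (finProd≈φ n n ℕₚ.≤-refl))) (trans (θ-finProd n n)
    (cong ℤ.-_ (*ˢ-cong-[] n (finProd≈φ n) (Σ₁-lambert-tail 1 n) n ℕₚ.≤-refl)))

  -- Equivalent to 24 θ η = E₂ η for η = q^(1/24) φ.
  24θφ : const (+ 24) *ˢ θ φ ≈ˢ φ *ˢ (E₂ -ˢ 1ˢ)
  24θφ = SR.trans (SR.*-congˡ {const (+ 24)} (SR.trans θφ (SR.trans (λ n → sym (ℤₚ.+-identityˡ _)) (-ˢ-cong {0ˢ} {const 0ℤ} 0ˢ≈const SR.refl))))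
    (byPoly (φ ∷ L 1 ∷ []) (con (+ 24) :* (con 0ℤ :- var (# 0) :* var (# 1)))
      (var (# 0) :* (con 1ℤ :- con (+ 24) :* var (# 1) :- con 1ℤ)) refl)

  -- Comparison with the coefficients of the statement

  divisor-sum : ∀ n N → + sum (map (ℕ._^ 5) (filter (_∣? suc n) (map suc (upTo N)))) ≡ lambert N 5 (suc n)
  divisor-sum n zero    = refl
  divisor-sum n (suc N) = ≡.begin
    + sum (map (ℕ._^ 5) (filter (_∣? suc n) (map suc (upTo (suc N)))))
      ≡.≡⟨ cong (λ l → + sum (map (ℕ._^ 5) l)) split ⟩
    + sum (map (ℕ._^ 5) (A ++ B))
      ≡.≡⟨ cong +_ (trans (cong sum (Listₚ.map-++ (ℕ._^ 5) A B)) (sum-++ (map (ℕ._^ 5) A) (map (ℕ._^ 5) B))) ⟩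
    + (sum (map (ℕ._^ 5) A) ℕ.+ sum (map (ℕ._^ 5) B))
      ≡.≡⟨ ℤₚ.pos-+ (sum (map (ℕ._^ 5) A)) _ ⟩
    + sum (map (ℕ._^ 5) A) ℤ.+ + sum (map (ℕ._^ 5) B)
      ≡.≡⟨ cong₂ ℤ._+_ (divisor-sum n N) (last (suc N ∣? suc n)) ⟩
    lambert (suc N) 5 (suc n) ≡.∎
    where
    module ≡ = ≡-Reasoning
    A = filter (_∣? suc n) (map suc (upTo N))
    B = filter (_∣? suc n) (suc N ∷ [])
    split : filter (_∣? suc n) (map suc (upTo (suc N))) ≡ A ++ B
    split = trans (cong (filter (_∣? suc n)) (trans (cong (map suc) (sym (Listₚ.upTo-∷ʳ N))) (Listₚ.map-++ suc (upTo N) (N ∷ []))))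
      (Listₚ.filter-++ (_∣? suc n) (map suc (upTo N)) (suc N ∷ []))
    pow5 : ∀ d → + (d ℕ.^ 5) ≡ (+ d) ^ᶻ 5
    pow5 d = go 5
      where
      go : ∀ k → + (d ℕ.^ k) ≡ (+ d) ^ᶻ k
      go zero    = refl
      go (suc k) = trans (ℤₚ.pos-* d (d ℕ.^ k)) (cong (+ d ℤ.*_) (go k))
    last : Dec (suc N ∣ suc n) → + sum (map (ℕ._^ 5) B) ≡ (const ((+ suc N) ^ᶻ 5) *ˢ geo (suc N)) (suc n)
    last (yes d∣n) = trans (cong (λ l → + sum (map (ℕ._^ 5) l)) (Listₚ.filter-accept (_∣? suc n) d∣n))
      (trans (cong +_ (ℕₚ.+-identityʳ (suc N ℕ.^ 5))) (trans (pow5 (suc N)) (sym (trans (const*ˢ ((+ suc N) ^ᶻ 5) (geo (suc N)) (suc n))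
          (trans (cong ((+ suc N) ^ᶻ 5 ℤ.*_) (geo-yes (s≤s z≤n) d∣n)) (ℤₚ.*-identityʳ _))))))
    last (no  d∤n) = trans (cong (λ l → + sum (map (ℕ._^ 5) l)) (Listₚ.filter-reject (_∣? suc n) {xs = []} d∤n))
      (sym (trans (const*ˢ ((+ suc N) ^ᶻ 5) (geo (suc N)) (suc n)) (trans (cong ((+ suc N) ^ᶻ 5 ℤ.*_) (geo-no d∤n)) (ℤₚ.*-zeroʳ ((+ suc N) ^ᶻ 5)))))

  E₆coeff≈E₆ : E₆coeff ≈ˢ E₆
  E₆coeff≈E₆ zero    = refl
  E₆coeff≈E₆ (suc n) = trans (cong (λ i → ℤ.- (+ 504 ℤ.* i)) (divisor-sum n (suc n)))
    (trans (sym (ℤₚ.+-identityˡ _)) (cong (λ i → 0ℤ ℤ.- i) (sym (const*ˢ (+ 504) (L 5) (suc n)))))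

  e₆≈E₆ψ : e₆ ≈ˢ E₆ *ˢ ψ
  e₆≈E₆ψ n = trans (sumTo-convolution E₆coeff ψ n) (*ˢ-cong {b = ψ} E₆coeff≈E₆ (λ _ → refl) n)

open EisensteinSeries

-- The operators U, V and the twist by the quadratic character modulo 11.

module HeckeOperators where

  open import Relation.Binary.Reasoning.Setoid SR.setoid

  -- V a is a(q^11). Inserting ten zeros between consecutive coefficients makes V a = a₀ + q^11 V
  -- (tail a) a structural recursion without any division.
  U V χ⊗ : Series → Series
  U a n = a (n ℕ.* 11)

  V-gap : ℕ → Series → Series
  V a zero    = a 0
  V a (suc n) = V-gap 10 (tail a) n
  V-gap zero    a n       = V a n
  V-gap (suc k) a zero    = 0ℤ
  V-gap (suc k) a (suc n) = V-gap k a n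

  -- The quadratic residues modulo 11 are 1, 3, 4, 5 and 9.
  χ : ℕ → ℤ
  χ 0  = 0ℤ
  χ 1  = 1ℤ
  χ 2  = -1ℤ
  χ 3  = 1ℤ
  χ 4  = 1ℤ
  χ 5  = 1ℤ
  χ 6  = -1ℤ
  χ 7  = -1ℤ
  χ 8  = -1ℤ
  χ 9  = 1ℤ
  χ 10 = -1ℤ
  χ (suc (suc (suc (suc (suc (suc (suc (suc (suc (suc (suc n))))))))))) = χ n

  χ⊗ a n = χ n ℤ.* a n

  steps-of-11 : ∀ {ℓ} (P : ℕ → Set ℓ) → (∀ n → n ≤ 10 → P n) → (∀ n → P n → P (11 ℕ.+ n)) → ∀ n → P n
  steps-of-11 P lo hi 0  = lo 0 z≤n
  steps-of-11 P lo hi 1  = lo 1 (s≤s z≤n)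
  steps-of-11 P lo hi 2  = lo 2 (s≤s (s≤s z≤n))
  steps-of-11 P lo hi 3  = lo 3 (s≤s (s≤s (s≤s z≤n)))
  steps-of-11 P lo hi 4  = lo 4 (ℕₚ.m≤m+n 4 6)
  steps-of-11 P lo hi 5  = lo 5 (ℕₚ.m≤m+n 5 5)
  steps-of-11 P lo hi 6  = lo 6 (ℕₚ.m≤m+n 6 4)
  steps-of-11 P lo hi 7  = lo 7 (ℕₚ.m≤m+n 7 3)
  steps-of-11 P lo hi 8  = lo 8 (ℕₚ.m≤m+n 8 2)
  steps-of-11 P lo hi 9  = lo 9 (ℕₚ.m≤m+n 9 1)
  steps-of-11 P lo hi 10 = lo 10 ℕₚ.≤-refl
  steps-of-11 P lo hi (suc (suc (suc (suc (suc (suc (suc (suc (suc (suc (suc n))))))))))) = hi n (steps-of-11 P lo hi n)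

  V≈[10]const : ∀ a → V a ≈ˢ[ 10 ] const (a 0)
  V≈[10]const a 0 _ = refl
  V≈[10]const a 1 _ = refl
  V≈[10]const a 2 _ = refl
  V≈[10]const a 3 _ = refl
  V≈[10]const a 4 _ = refl
  V≈[10]const a 5 _ = refl
  V≈[10]const a 6 _ = refl
  V≈[10]const a 7 _ = refl
  V≈[10]const a 8 _ = refl
  V≈[10]const a 9 _ = refl
  V≈[10]const a 10 _ = refl
  V≈[10]const a (suc (suc (suc (suc (suc (suc (suc (suc (suc (suc (suc n))))))))))) (s≤s (s≤s (s≤s (s≤s (s≤s (s≤s (s≤s (s≤s (s≤s (s≤s ()))))))))))

  0*ˢ-suc : ∀ {a} b n → a 0 ≡ 0ℤ → (a *ˢ b) (suc n) ≡ (tail a *ˢ b) n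
  0*ˢ-suc {a} b n eq = trans (cong (λ i → i ℤ.* b (suc n) ℤ.+ (tail a *ˢ b) n) eq) (ℤₚ.+-identityˡ _)

  -- Immediate from V a = a₀ + q^11 V (tail a). The linearity of U, V and the twist over series in
  -- q^11 is proved by induction along this step.
  V*-step : ∀ a b n → (V a *ˢ b) (11 ℕ.+ n) ≡ a 0 ℤ.* b (11 ℕ.+ n) ℤ.+ (V (tail a) *ˢ b) n
  V*-step a b n = +-congˡ (a 0 ℤ.* b (11 ℕ.+ n)) (gap 10)
    where
    gap : ∀ k → (V-gap k (tail a) *ˢ b) (k ℕ.+ n) ≡ (V (tail a) *ˢ b) n
    gap zero    = refl
    gap (suc k) = trans (0*ˢ-suc {V-gap (suc k) (tail a)} b (k ℕ.+ n) refl) (gap k)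

  V*-low : ∀ a b → V a *ˢ b ≈ˢ[ 10 ] const (a 0) *ˢ b
  V*-low a b = *ˢ-cong-[] 10 {b = b} (V≈[10]const a) (λ _ _ → refl)

  V-cong : ∀ {a b} → a ≈ˢ b → V a ≈ˢ V b
  V-cong {a} {b} p n = steps-of-11 (λ n → ∀ a b → a ≈ˢ b → V a n ≡ V b n)
    (λ n n≤10 a b p → trans (V≈[10]const a n n≤10) (trans (cong (λ i → const i n) (p 0)) (sym (V≈[10]const b n n≤10))))
    (λ n ih a b p → ih (tail a) (tail b) (λ m → p (suc m))) n a b p

  V-+ : ∀ a b → V (a +ˢ b) ≈ˢ V a +ˢ V b
  V-+ a b n = steps-of-11 (λ n → ∀ a b → V (a +ˢ b) n ≡ V a n ℤ.+ V b n)
    (λ n n≤10 a b → trans (V≈[10]const (a +ˢ b) n n≤10) (trans (const-+ (a 0) (b 0) n)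
      (sym (cong₂ ℤ._+_ (V≈[10]const a n n≤10) (V≈[10]const b n n≤10)))))
    (λ n ih a b → ih (tail a) (tail b)) n a b

  V-const : ∀ c → V (const c) ≈ˢ const c
  V-const c n = steps-of-11 (λ n → ∀ a → tail a ≈ˢ 0ˢ → V a n ≡ const (a 0) n)
    (λ n n≤10 a _ → V≈[10]const a n n≤10)
    (λ n ih a p → trans (ih (tail a) (λ m → p (suc m))) (trans (cong (λ i → const i n) (p 0)) (sym (0ˢ≈const n))))
    n (const c) (λ _ → refl)

  V-* : ∀ a b → V (a *ˢ b) ≈ˢ V a *ˢ V b
  V-* a b n = steps-of-11 (λ n → ∀ a b → V (a *ˢ b) n ≡ (V a *ˢ V b) n)
    (λ n n≤10 a b → trans (V≈[10]const (a *ˢ b) n n≤10) (trans (const-* (a 0) (b 0) n)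
      (sym (*ˢ-cong-[] 10 (V≈[10]const a) (V≈[10]const b) n n≤10))))
    (λ n ih a b → trans (V-+ (λ m → a 0 ℤ.* b (suc m)) (tail a *ˢ b) n)
      (trans (cong₂ ℤ._+_ (trans (V-cong (λ m → sym (const*ˢ (a 0) (tail b) m)) n)
          (trans (ih (const (a 0)) (tail b)) (trans (*ˢ-cong {b = V (tail b)} (V-const (a 0)) (λ _ → refl) n) (const*ˢ (a 0) (V (tail b)) n))))
        (ih (tail a) b))
        (sym (V*-step a (V b) n)))) n a b

  V-const* : ∀ c a → V (const c *ˢ a) ≈ˢ const c *ˢ V a
  V-const* c a = SR.trans (V-* (const c) a) (SR.*-congʳ {V a} (V-const c))

  V-- : ∀ a b → V (a -ˢ b) ≈ˢ V a -ˢ V b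
  V-- a b = begin
    V (a -ˢ b)                      ≈⟨ V-cong (byPoly (a ∷ b ∷ []) (x :- y) (x :+ con -1ℤ :* y) refl) ⟩
    V (a +ˢ const -1ℤ *ˢ b)         ≈⟨ V-+ a _ ⟩
    V a +ˢ V (const -1ℤ *ˢ b)       ≈⟨ SR.+-congˡ {V a} (V-const* -1ℤ b) ⟩
    V a +ˢ const -1ℤ *ˢ V b         ≈⟨ byPoly (V a ∷ V b ∷ []) (x :+ con -1ℤ :* y) (x :- y) refl ⟩
    V a -ˢ V b ∎
    where x = var (# 0) ; y = var (# 1)

  V-^ : ∀ a k → V (a ^ˢ k) ≈ˢ V a ^ˢ k
  V-^ a zero    = V-const 1ℤ
  V-^ a (suc k) = SR.trans (V-* a (a ^ˢ k)) (SR.*-congˡ {V a} (V-^ a k))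

  θ-V : ∀ a → θ (V a) ≈ˢ const (+ 11) *ˢ V (θ a)
  θ-V a n = trans (steps-of-11 (λ n → ∀ a → + n ℤ.* V a n ≡ + 11 ℤ.* V (θ a) n)
    (λ { zero _ a → refl
       ; (suc n) n≤10 a → trans (cong (+ suc n ℤ.*_) (V≈[10]const a (suc n) n≤10)) (trans (ℤₚ.*-zeroʳ (+ suc n))
           (sym (trans (cong (+ 11 ℤ.*_) (V≈[10]const (θ a) (suc n) n≤10)) (ℤₚ.*-zeroʳ (+ 11))))) })
    (λ n ih a → ≡.begin
      + (11 ℕ.+ n) ℤ.* V (tail a) n
        ≡.≡⟨ trans (cong (ℤ._* V (tail a) n) (ℤₚ.pos-+ 11 n)) (ℤₚ.*-distribʳ-+ (V (tail a) n) (+ 11) (+ n)) ⟩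
      + 11 ℤ.* V (tail a) n ℤ.+ + n ℤ.* V (tail a) n
        ≡.≡⟨ +-congˡ (+ 11 ℤ.* V (tail a) n) (ih (tail a)) ⟩
      + 11 ℤ.* V (tail a) n ℤ.+ + 11 ℤ.* V (θ (tail a)) n
        ≡.≡⟨ sym (ℤₚ.*-distribˡ-+ (+ 11) (V (tail a) n) (V (θ (tail a)) n)) ⟩
      + 11 ℤ.* (V (tail a) n ℤ.+ V (θ (tail a)) n)
        ≡.≡⟨ cong (+ 11 ℤ.*_) (trans (sym (V-+ (tail a) (θ (tail a)) n)) (V-cong (λ m → sym (+suc* m (a (suc m)))) n)) ⟩
      + 11 ℤ.* V (tail (θ a)) n ≡.∎) n a) (sym (const*ˢ (+ 11) (V (θ a)) n))
    where
    module ≡ = ≡-Reasoning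

  U-cong : ∀ {a b} → a ≈ˢ b → U a ≈ˢ U b
  U-cong p n = p (n ℕ.* 11)

  -- U is linear over series in q^11, which it turns into series in q. This is what carries a linear
  -- system with coefficients V a through U.
  U-V* : ∀ a b → U (V a *ˢ b) ≈ˢ a *ˢ U b
  U-V* a b zero    = refl
  U-V* a b (suc n) = trans (V*-step a b (n ℕ.* 11)) (+-congˡ (a 0 ℤ.* U b (suc n)) (U-V* (tail a) b n))

  U-const* : ∀ c a → U (const c *ˢ a) ≈ˢ const c *ˢ U a
  U-const* c a = SR.trans (U-cong (SR.*-congʳ {a} (SR.sym (V-const c)))) (U-V* (const c) a)

  U-θ : ∀ a → U (θ a) ≈ˢ const (+ 11) *ˢ θ (U a)
  U-θ a n = trans (cong (ℤ._* a (n ℕ.* 11)) (trans (ℤₚ.pos-* n 11) (ℤₚ.*-comm (+ n) (+ 11))))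
    (trans (ℤₚ.*-assoc (+ 11) (+ n) (a (n ℕ.* 11))) (sym (const*ˢ (+ 11) (θ (U a)) n)))

  χ⊗-cong : ∀ {a b} → a ≈ˢ b → χ⊗ a ≈ˢ χ⊗ b
  χ⊗-cong p n = cong (χ n ℤ.*_) (p n)

  χ⊗-+ : ∀ a b → χ⊗ (a +ˢ b) ≈ˢ χ⊗ a +ˢ χ⊗ b
  χ⊗-+ a b n = ℤₚ.*-distribˡ-+ (χ n) (a n) (b n)

  χ⊗-θ : ∀ a → χ⊗ (θ a) ≈ˢ θ (χ⊗ a)
  χ⊗-θ a n = eq (χ n) (+ n) (a n)
    where
    eq : ∀ i j k → i ℤ.* (j ℤ.* k) ≡ j ℤ.* (i ℤ.* k)
    eq = solve-∀

  χ⊗-const* : ∀ c a → χ⊗ (const c *ˢ a) ≈ˢ const c *ˢ χ⊗ a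
  χ⊗-const* c a n = trans (cong (χ n ℤ.*_) (const*ˢ c a n)) (trans (eq (χ n) c (a n)) (sym (const*ˢ c (χ⊗ a) n)))
    where
    eq : ∀ i j k → i ℤ.* (j ℤ.* k) ≡ j ℤ.* (i ℤ.* k)
    eq = solve-∀

  -- V a is supported on multiples of 11 and χ has period 11, so the twist is linear over series in
  -- q^11 as well.
  χ⊗-V* : ∀ a b → χ⊗ (V a *ˢ b) ≈ˢ V a *ˢ χ⊗ b
  χ⊗-V* a b n = steps-of-11 (λ n → ∀ a → χ n ℤ.* (V a *ˢ b) n ≡ (V a *ˢ χ⊗ b) n)
    (λ n n≤10 a → trans (cong (χ n ℤ.*_) (trans (V*-low a b n n≤10) (const*ˢ (a 0) b n)))
      (trans (swap (χ n) (a 0) (b n)) (sym (trans (V*-low a (χ⊗ b) n n≤10) (const*ˢ (a 0) (χ⊗ b) n)))))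
    (λ n ih a → trans (cong (χ n ℤ.*_) (V*-step a b n))
      (trans (ℤₚ.*-distribˡ-+ (χ n) (a 0 ℤ.* b (11 ℕ.+ n)) _)
        (trans (cong₂ ℤ._+_ (swap (χ n) (a 0) (b (11 ℕ.+ n))) (ih (tail a))) (sym (V*-step a (χ⊗ b) n))))) n a
    where
    swap : ∀ i j k → i ℤ.* (j ℤ.* k) ≡ j ℤ.* (i ℤ.* k)
    swap = solve-∀

open HeckeOperators

-- Truncated evaluation of series, and uniqueness for linear differential systems.

module LinearSystems where

  open import Relation.Binary.Reasoning.Setoid SR.setoid

  series : List ℤ → Series
  series l = evP 1 l (X ∷ [])

  X*ˢ-cong-[] : ∀ N {a b} → a ≈ˢ[ N ] b → X *ˢ a ≈ˢ[ suc N ] X *ˢ b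
  X*ˢ-cong-[] N {a} {b} p zero    _ = refl
  X*ˢ-cong-[] N {a} {b} p (suc n) (s≤s n≤N) = trans (X*ˢ a (suc n)) (trans (p n n≤N) (sym (X*ˢ b (suc n))))

  take-series : ∀ N l → series (take (suc N) l) ≈ˢ[ N ] series l
  take-series N       []      n _ = refl
  take-series zero    (c ∷ l) zero z≤n = refl
  take-series (suc N) (c ∷ l) n n≤N = lemma n n≤N
    where
    lemma : const c +ˢ X *ˢ series (take (suc N) l) ≈ˢ[ suc N ] const c +ˢ X *ˢ series l
    lemma n n≤N = +-congˡ (const c n) (X*ˢ-cong-[] N (take-series N l) n n≤N)

  coefficients : ℕ → Series → List ℤ
  coefficients zero    a = a 0 ∷ []
  coefficients (suc N) a = a 0 ∷ coefficients N (tail a)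

  coefficients-series : ∀ N a → a ≈ˢ[ N ] series (coefficients N a)
  coefficients-series zero    a zero z≤n = sym (ℤₚ.+-identityʳ (a 0))
  coefficients-series (suc N) a zero    _ = sym (ℤₚ.+-identityʳ (a 0))
  coefficients-series (suc N) a (suc n) (s≤s n≤N) = trans (coefficients-series N (tail a) n n≤N)
    (sym (trans (ℤₚ.+-identityˡ _) (X*ˢ (series (coefficients N (tail a))) (suc n))))

  module Truncated (N : ℕ) where

    mulL : List ℤ → List ℤ → List ℤ
    mulL a b = take (suc N) (mulP 1 a b)

    powL : List ℤ → ℕ → List ℤ
    powL a zero    = 1ℤ ∷ []
    powL a (suc k) = mulL a (powL a k)

    evL : ∀ {n} → Expr n → Vec (List ℤ) n → List ℤ
    evL (con c)   ρ = c ∷ []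
    evL (var i)   ρ = lookup ρ i
    evL (e :+ e′) ρ = addP 1 (evL e ρ) (evL e′ ρ)
    evL (e :- e′) ρ = addP 1 (evL e ρ) (negP 1 (evL e′ ρ))
    evL (e :* e′) ρ = mulL (evL e ρ) (evL e′ ρ)
    evL (e :^ k)  ρ = powL (evL e ρ) k

    infixr 5 _∷_
    data _≈*_ : ∀ {n} → Vec Series n → Vec (List ℤ) n → Set where
      []  : [] ≈* []
      _∷_ : ∀ {n s l} {ss : Vec Series n} {ls} → s ≈ˢ[ N ] series l → ss ≈* ls → (s ∷ ss) ≈* (l ∷ ls)

    coefficients-≈* : ∀ {n} (ss : Vec Series n) → ss ≈* Vec.map (coefficients N) ss
    coefficients-≈* []       = []
    coefficients-≈* (a ∷ ss) = coefficients-series N a ∷ coefficients-≈* ss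

    lookup-≈ : ∀ {n} {ss : Vec Series n} {ls} → ss ≈* ls → ∀ i → lookup ss i ≈ˢ[ N ] series (lookup ls i)
    lookup-≈ (p ∷ ps) zero    = p
    lookup-≈ (p ∷ ps) (suc i) = lookup-≈ ps i

    const≈series : ∀ c → const c ≈ˢ[ N ] series (c ∷ [])
    const≈series c n _ = sym (constP-sound 1 c (X ∷ []) n)

    mulL-sound : ∀ {a b : Series} {la lb} → a ≈ˢ[ N ] series la → b ≈ˢ[ N ] series lb → a *ˢ b ≈ˢ[ N ] series (mulL la lb)
    mulL-sound {la = la} {lb} p q n n≤N = trans (*ˢ-cong-[] N p q n n≤N)
      (trans (sym (mulP-sound 1 la lb (X ∷ []) n)) (sym (take-series N (mulP 1 la lb) n n≤N)))

    powL-sound : ∀ {a : Series} {la} k → a ≈ˢ[ N ] series la → a ^ˢ k ≈ˢ[ N ] series (powL la k)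
    powL-sound zero    p = const≈series 1ℤ
    powL-sound {a} {la} (suc k) p = mulL-sound {a} {a ^ˢ k} {la} p (powL-sound k p)

    evL-sound : ∀ {n} (e : Expr n) {ss ls} → ss ≈* ls → ⟦ e ⟧ ss ≈ˢ[ N ] series (evL e ls)
    evL-sound (con c) p = const≈series c
    evL-sound (var i) p = lookup-≈ p i
    evL-sound (e :+ e′) {ss} {ls} p n n≤N = trans (cong₂ ℤ._+_ (evL-sound e p n n≤N) (evL-sound e′ p n n≤N))
      (sym (addP-sound 1 (evL e ls) (evL e′ ls) (X ∷ []) n))
    evL-sound (e :- e′) {ss} {ls} p n n≤N = trans (cong₂ ℤ._-_ (evL-sound e p n n≤N) (evL-sound e′ p n n≤N))
      (sym (trans (addP-sound 1 (evL e ls) (negP 1 (evL e′ ls)) (X ∷ []) n)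
        (cong (λ i → series (evL e ls) n ℤ.+ i) (negP-sound 1 (evL e′ ls) (X ∷ []) n))))
    evL-sound (e :* e′) {ss} {ls} p = mulL-sound {la = evL e ls} (evL-sound e p) (evL-sound e′ p)
    evL-sound (e :^ k) {ss} {ls} p = powL-sound {la = evL e ls} k (evL-sound e p)

    vanishes : List ℤ → Bool
    vanishes l = isZeroP 1 (take (suc N) l)

    vanishes-sound : ∀ l → vanishes l ≡ true → series l ≈ˢ[ N ] 0ˢ
    vanishes-sound l eq n n≤N = trans (sym (take-series N l n n≤N)) (isZeroP-sound 1 (take (suc N) l) (X ∷ []) eq n)

    byTruncation : ∀ {n} {ss : Vec Series n} {ls} → ss ≈* ls → (e e′ : Expr n) → vanishes (evL (e :- e′) ls) ≡ true →
      ⟦ e ⟧ ss ≈ˢ[ N ] ⟦ e′ ⟧ ss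
    byTruncation {ss = ss} {ls} p e e′ eq n n≤N = ℤₚ.i-j≡0⇒i≡j (⟦ e ⟧ ss n) (⟦ e′ ⟧ ss n)
      (trans (evL-sound (e :- e′) p n n≤N) (vanishes-sound (evL (e :- e′) ls) eq n n≤N))

    -- Keeping the list of coefficients next to its proof lets the results of U, V, twists and
    -- products be reused as data, in place of evaluating nested coefficient functions.
    record Approx (a : Series) : Set where
      constructor approx
      field
        list  : List ℤ
        sound : a ≈ˢ[ N ] series list

    infixr 5 _∷ᴬ_
    data Approxes : ∀ {n} → Vec Series n → Set where
      []ᴬ  : Approxes []
      _∷ᴬ_ : ∀ {n a} {ss : Vec Series n} → Approx a → Approxes ss → Approxes (a ∷ ss)

    lists : ∀ {n} {ss : Vec Series n} → Approxes ss → Vec (List ℤ) n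
    lists []ᴬ      = []
    lists (a ∷ᴬ p) = Approx.list a ∷ lists p

    lists-≈* : ∀ {n} {ss : Vec Series n} (p : Approxes ss) → ss ≈* lists p
    lists-≈* []ᴬ      = []
    lists-≈* (a ∷ᴬ p) = Approx.sound a ∷ lists-≈* p

    approximate : ∀ {n} {ss : Vec Series n} (e : Expr n) → Approxes ss → Approx (⟦ e ⟧ ss)
    approximate e p = approx (evL e (lists p)) (evL-sound e (lists-≈* p))

    approx-* : ∀ {a b} → Approx a → Approx b → Approx (a *ˢ b)
    approx-* (approx la p) (approx lb q) = approx (mulL la lb) (mulL-sound {la = la} p q)

    approx-resp : ∀ {a b} → a ≈ˢ b → Approx b → Approx a
    approx-resp p (approx l q) = approx l (≈[]-trans N (≈⇒≈[] N p) q)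

    approx-vanishes : ∀ {a} (A : Approx a) → vanishes (Approx.list A) ≡ true → a ≈ˢ[ N ] 0ˢ
    approx-vanishes (approx l p) eq = ≈[]-trans N p (vanishes-sound l eq)

  -- Linear differential systems  c θ v = A v

  dot : ∀ {d} → Vec ℤ d → (Fin d → ℤ) → ℤ
  dot []      w = 0ℤ
  dot (a ∷ r) w = a ℤ.* w zero ℤ.+ dot r (λ i → w (suc i))

  dotˢ : ∀ {d} → Vec Series d → (Fin d → Series) → Series
  dotˢ []      v = const 0ℤ
  dotˢ (a ∷ r) v = a *ˢ v zero +ˢ dotˢ r (λ i → v (suc i))

  rowTimes : ∀ {d e} → Vec ℤ e → Vec (Vec ℤ d) e → Vec ℤ d
  rowTimes []      []      = Vec.replicate _ 0ℤ
  rowTimes (x ∷ r) (m ∷ M) = Vec.zipWith (λ i j → x ℤ.* i ℤ.+ j) m (rowTimes r M)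

  minusScaled : ∀ {d} → ℤ → Vec ℤ d → Vec ℤ d → Vec ℤ d
  minusScaled ρ r s = Vec.zipWith (λ i j → i ℤ.- ρ ℤ.* j) s r

  dot-replicate : ∀ {d} (w : Fin d → ℤ) → dot (Vec.replicate d 0ℤ) w ≡ 0ℤ
  dot-replicate {zero}  w = refl
  dot-replicate {suc d} w = trans (ℤₚ.+-identityˡ _) (dot-replicate (λ i → w (suc i)))

  dot-zipWith : ∀ {d} x y (r s : Vec ℤ d) w →
    dot (Vec.zipWith (λ i j → x ℤ.* i ℤ.+ y ℤ.* j) r s) w ≡ x ℤ.* dot r w ℤ.+ y ℤ.* dot s w
  dot-zipWith x y [] [] w = sym (cong₂ ℤ._+_ (ℤₚ.*-zeroʳ x) (ℤₚ.*-zeroʳ y))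
  dot-zipWith x y (a ∷ r) (b ∷ s) w = trans (+-congˡ ((x ℤ.* a ℤ.+ y ℤ.* b) ℤ.* w zero) (dot-zipWith x y r s (λ i → w (suc i))))
    (eq x y a b (w zero) _ _)
    where
    eq : ∀ x y a b u p q → (x ℤ.* a ℤ.+ y ℤ.* b) ℤ.* u ℤ.+ (x ℤ.* p ℤ.+ y ℤ.* q) ≡ x ℤ.* (a ℤ.* u ℤ.+ p) ℤ.+ y ℤ.* (b ℤ.* u ℤ.+ q)
    eq = solve-∀

  zipWith-ext : ∀ {d} {f g : ℤ → ℤ → ℤ} → (∀ i j → f i j ≡ g i j) → (r s : Vec ℤ d) → Vec.zipWith f r s ≡ Vec.zipWith g r s
  zipWith-ext p [] [] = refl
  zipWith-ext p (a ∷ r) (b ∷ s) = cong₂ _∷_ (p a b) (zipWith-ext p r s)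

  dot-rowTimes : ∀ {d e} (r : Vec ℤ e) (M : Vec (Vec ℤ d) e) w → dot (rowTimes r M) w ≡ dot r (λ i → dot (lookup M i) w)
  dot-rowTimes [] [] w = dot-replicate w
  dot-rowTimes (x ∷ r) (m ∷ M) w = trans
    (cong (λ v → dot v w) (zipWith-ext (λ i j → cong (λ k → x ℤ.* i ℤ.+ k) (sym (ℤₚ.*-identityˡ j))) m (rowTimes r M)))
    (trans (dot-zipWith x 1ℤ m (rowTimes r M) w) (cong (λ i → x ℤ.* dot m w ℤ.+ i) (trans (ℤₚ.*-identityˡ _) (dot-rowTimes r M w))))

  dot-minusScaled : ∀ {d} ρ (r s : Vec ℤ d) w → dot (minusScaled ρ r s) w ≡ dot s w ℤ.- ρ ℤ.* dot r w
  dot-minusScaled ρ r s w = trans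
    (cong (λ v → dot v w) (zipWith-ext (λ i j → eq i ρ j) s r))
    (trans (dot-zipWith 1ℤ (ℤ.- ρ) s r w) (sym (eq (dot s w) ρ (dot r w))))
    where
    eq : ∀ i ρ j → i ℤ.- ρ ℤ.* j ≡ 1ℤ ℤ.* i ℤ.+ (ℤ.- ρ) ℤ.* j
    eq = solve-∀

  dot-scale : ∀ {d} (r : Vec ℤ d) k w w′ → (∀ i → w′ i ≡ k ℤ.* w i) → dot r w′ ≡ k ℤ.* dot r w
  dot-scale [] k w w′ p = sym (ℤₚ.*-zeroʳ k)
  dot-scale (a ∷ r) k w w′ p = trans (cong₂ (λ i j → a ℤ.* i ℤ.+ j) (p zero) (dot-scale r k (λ i → w (suc i)) _ (λ i → p (suc i))))
    (eq a k (w zero) _)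
    where
    eq : ∀ a k u v → a ℤ.* (k ℤ.* u) ℤ.+ k ℤ.* v ≡ k ℤ.* (a ℤ.* u ℤ.+ v)
    eq = solve-∀

  -- The row r ∏ (M - ρ). No product of matrices is formed, only products of a row with M.
  reduceRow : ∀ {d} → Vec (Vec ℤ d) d → List ℤ → Vec ℤ d → Vec ℤ d
  reduceRow M []       r = r
  reduceRow M (ρ ∷ ρs) r = reduceRow M ρs (minusScaled ρ r (rowTimes r M))

  unitRow : ∀ {d} → Fin d → Vec ℤ d
  unitRow {suc d} zero    = 1ℤ ∷ Vec.replicate d 0ℤ
  unitRow {suc d} (suc i) = 0ℤ ∷ unitRow i

  dot-unitRow : ∀ {d} (i : Fin d) w → dot (unitRow i) w ≡ w i
  dot-unitRow zero    w = trans (cong₂ ℤ._+_ (ℤₚ.*-identityˡ (w zero)) (dot-replicate (λ i → w (suc i)))) (ℤₚ.+-identityʳ _)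
  dot-unitRow (suc i) w = trans (ℤₚ.+-identityˡ _) (dot-unitRow i (λ j → w (suc j)))

  isZeroVec : ∀ {d} → Vec ℤ d → Bool
  isZeroVec []      = true
  isZeroVec (a ∷ r) = isZeroℤ a ∧ isZeroVec r

  dot-isZeroVec : ∀ {d} (r : Vec ℤ d) w → isZeroVec r ≡ true → dot r w ≡ 0ℤ
  dot-isZeroVec [] w _ = refl
  dot-isZeroVec ((+ zero) ∷ r) w eq = trans (ℤₚ.+-identityˡ _) (dot-isZeroVec r _ eq)

  annihilates : ∀ {d} → Vec (Vec ℤ d) d → List ℤ → Bool
  annihilates {d} M ρs = Vec.foldr _ (λ i b → isZeroVec (reduceRow M ρs (unitRow i)) ∧ b) true (Vec.allFin d)

  foldr-∧ : ∀ {A : Set} {n} (f : A → Bool) (v : Vec A n) → Vec.foldr _ (λ a b → f a ∧ b) true v ≡ true → ∀ i → f (lookup v i) ≡ true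
  foldr-∧ f (a ∷ v) eq zero    = proj₁ (∧-true eq)
  foldr-∧ f (a ∷ v) eq (suc i) = foldr-∧ f v (proj₂ (∧-true {f a} eq)) i

  annihilates-row : ∀ {d} (M : Vec (Vec ℤ d) d) ρs → annihilates M ρs ≡ true → ∀ i → isZeroVec (reduceRow M ρs (unitRow i)) ≡ true
  annihilates-row {d} M ρs eq i = trans (cong (λ j → isZeroVec (reduceRow M ρs (unitRow j))) (sym (Vecₚ.lookup-allFin i)))
    (foldr-∧ (λ j → isZeroVec (reduceRow M ρs (unitRow j))) (Vec.allFin d) eq i)

  -- If ∏ (M - ρ) = 0 then every eigenvalue of M is one of the ρ.
  reduceRow-eigen : ∀ {d} (M : Vec (Vec ℤ d) d) ρs r (w : Fin d → ℤ) λ′ → (∀ i → dot (lookup M i) w ≡ λ′ ℤ.* w i) →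
    (∀ ρ → ρ ∈ˡ ρs → λ′ ≢ ρ) → dot (reduceRow M ρs r) w ≡ 0ℤ → dot r w ≡ 0ℤ
  reduceRow-eigen M []       r w λ′ eig ≢ eq = eq
  reduceRow-eigen M (ρ ∷ ρs) r w λ′ eig ≢ eq
    with ℤₚ.i*j≡0⇒i≡0∨j≡0 (λ′ ℤ.- ρ) (trans (sym factor) (reduceRow-eigen M ρs _ w λ′ eig (λ σ σ∈ → ≢ σ (there σ∈)) eq))
    where
    fac : ∀ i j k → i ℤ.* k ℤ.- j ℤ.* k ≡ (i ℤ.- j) ℤ.* k
    fac = solve-∀
    factor : dot (minusScaled ρ r (rowTimes r M)) w ≡ (λ′ ℤ.- ρ) ℤ.* dot r w
    factor = trans (dot-minusScaled ρ r (rowTimes r M) w)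
      (trans (cong (λ i → i ℤ.- ρ ℤ.* dot r w) (trans (dot-rowTimes r M w) (dot-scale r λ′ w _ eig))) (fac λ′ ρ (dot r w)))
  ... | inj₁ λ′-ρ≡0 = ⊥-elim (≢ ρ (here refl) (ℤₚ.i-j≡0⇒i≡j λ′ ρ λ′-ρ≡0))
  ... | inj₂ r·w≡0  = r·w≡0

  *ˢ-leading : ∀ a v n → (∀ m → m < n → v m ≡ 0ℤ) → (a *ˢ v) n ≡ a 0 ℤ.* v n
  *ˢ-leading a v zero    _ = refl
  *ˢ-leading a v (suc n) p = trans (+-congˡ (a 0 ℤ.* v (suc n))
    (trans (*ˢ-cong-[] n {tail a} {tail a} {v} {0ˢ} (λ _ _ → refl) (λ m m≤n → p m (s≤s m≤n)) n ℕₚ.≤-refl) (SR.zeroʳ (tail a) n)))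
    (ℤₚ.+-identityʳ _)

  constantTerms : ∀ {d e} → Vec (Vec Series d) e → Vec (Vec ℤ d) e
  constantTerms = Vec.map (Vec.map (λ a → a 0))

  -- If v vanishes below n, the coefficient of qⁿ in A v sees only the constant terms of A, which
  -- form the residue matrix.
  dotˢ-leading : ∀ {d} (r : Vec Series d) (v : Fin d → Series) n → (∀ i m → m < n → v i m ≡ 0ℤ) →
    dotˢ r v n ≡ dot (Vec.map (λ a → a 0) r) (λ i → v i n)
  dotˢ-leading [] v n p = sym (0ˢ≈const n)
  dotˢ-leading (a ∷ r) v n p = cong₂ ℤ._+_ (*ˢ-leading a (v zero) n (p zero)) (dotˢ-leading r (λ i → v (suc i)) n (λ i → p (suc i)))

  -- A system whose solutions vanish to order N and whose residue matrix has no eigenvalue c n with n > N has only the zero solution.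
  system-unique : ∀ {d} N c (A : Vec (Vec Series d) d) (v : Fin d → Series) ρs →
    (∀ i → const c *ˢ θ (v i) ≈ˢ dotˢ (lookup A i) v) →
    (∀ i → v i ≈ˢ[ N ] 0ˢ) →
    annihilates (constantTerms A) ρs ≡ true → (∀ n → N < n → ∀ ρ → ρ ∈ˡ ρs → c ℤ.* + n ≢ ρ) →
    ∀ i → v i ≈ˢ 0ˢ
  system-unique {d} N c A v ρs ode start ann ≢ i n = vanish n i n ℕₚ.≤-refl
    where
    vanish : ∀ n i m → m ≤ n → v i m ≡ 0ℤ
    step : ∀ n → (∀ i m → m < n → v i m ≡ 0ℤ) → ∀ i → v i n ≡ 0ℤ
    step n below i with ℕₚ.<-≤-connex N n
    ... | inj₂ n≤N = start i n n≤N
    -- The n-th coefficients of v satisfy the eigenvector equation of the residue matrix for c n. As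
    -- c n is none of the ρ, these coefficients are 0.
    ... | inj₁ N<n = trans (sym (dot-unitRow i (λ j → v j n))) (reduceRow-eigen (constantTerms A) ρs (unitRow i) (λ j → v j n) (c ℤ.* + n)
        (λ j → trans (cong (λ r → dot r (λ k → v k n)) (Vecₚ.lookup-map j (Vec.map (λ a → a 0)) A))
          (trans (sym (dotˢ-leading (lookup A j) v n below)) (trans (sym (ode j n)) (trans (const*ˢ c (θ (v j)) n) (sym (ℤₚ.*-assoc c (+ n) (v j n)))))))
        (≢ n N<n) (dot-isZeroVec (reduceRow (constantTerms A) ρs (unitRow i)) _ (annihilates-row (constantTerms A) ρs ann i)))
    vanish zero    i zero z≤n = step 0 (λ _ _ ()) i
    vanish (suc n) i m m≤n with ℕₚ.m≤n⇒m<n∨m≡n m≤n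
    ... | inj₁ (s≤s m≤n′) = vanish n i m m≤n′
    ... | inj₂ refl = step (suc n) (λ { j k (s≤s k≤n) → vanish n j k k≤n }) i

open LinearSystems

-- Forms of level 11 and their derivatives.

module Level11Forms where

  open import Relation.Binary.Reasoning.Setoid SR.setoid

  infix 6 _·_≈_by_
  record Hyp {n} (ρ : Vec Series n) : Set where
    constructor _·_≈_by_
    field
      coef left right : Expr n
      holds : ⟦ left ⟧ ρ ≈ˢ ⟦ right ⟧ ρ

  weightedDefects : ∀ {n} {ρ : Vec Series n} → List (Hyp ρ) → Expr n
  weightedDefects [] = con 0ℤ
  weightedDefects ((c · a ≈ b by _) ∷ hs) = weightedDefects hs :+ c :* (a :- b)

  weightedDefects≈0 : ∀ {n} {ρ : Vec Series n} (hs : List (Hyp ρ)) → ⟦ weightedDefects hs ⟧ ρ ≈ˢ 0ˢ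
  weightedDefects≈0 [] = SR.sym 0ˢ≈const
  weightedDefects≈0 {ρ = ρ} ((c · a ≈ b by p) ∷ hs) =
    SR.trans (absorb (⟦ weightedDefects hs ⟧ ρ) (⟦ c ⟧ ρ) p) (weightedDefects≈0 hs)

  -- Certificate by linear combination: as polynomials, m (e - e′) is the sum of the defects of the
  -- hypotheses times their `coef`. The integer m allows rational cofactors.
  byHyps : ∀ {n} {ρ : Vec Series n} m (hs : List (Hyp ρ)) (e e′ : Expr n) → m ≢ 0ℤ →
    isZeroP n (nf (con m :* (e :- e′) :- weightedDefects hs)) ≡ true → ⟦ e ⟧ ρ ≈ˢ ⟦ e′ ⟧ ρ
  byHyps {ρ = ρ} m hs e e′ m≢0 eq = -ˢ≈0⇒≈ (*ˢ-cancelˡ-0 (const m) m≢0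
    (SR.trans (byPoly ρ (con m :* (e :- e′)) (weightedDefects hs) eq) (weightedDefects≈0 hs)))

  -- `d` prescribes c θ on the variables. Every clause is linear in the derivatives, so the result
  -- is c θ of the whole expression, and a single factor c clears all denominators.
  derivation : ∀ {n} → (Fin n → Expr n) → Expr n → Expr n
  derivation d (con c)   = con 0ℤ
  derivation d (var i)   = d i
  derivation d (e :+ e′) = derivation d e :+ derivation d e′
  derivation d (e :- e′) = derivation d e :- derivation d e′
  derivation d (e :* e′) = derivation d e :* e′ :+ e :* derivation d e′
  derivation d (e :^ zero)  = con 0ℤ
  derivation d (e :^ suc k) = derivation d e :* e :^ k :+ e :* derivation d (e :^ k)

  derivation-sound : ∀ {n} c (d : Fin n → Expr n) ρ → (∀ i → const c *ˢ θ (lookup ρ i) ≈ˢ ⟦ d i ⟧ ρ) →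
    ∀ e → const c *ˢ θ (⟦ e ⟧ ρ) ≈ˢ ⟦ derivation d e ⟧ ρ
  derivation-sound c d ρ p (con k) = SR.trans (SR.*-congˡ {const c} (θ-const k)) (SR.trans (SR.zeroʳ (const c)) 0ˢ≈const)
  derivation-sound c d ρ p (var i) = p i
  derivation-sound c d ρ p (e :+ e′) = SR.trans (SR.*-congˡ {const c} (θ-+ (⟦ e ⟧ ρ) (⟦ e′ ⟧ ρ)))
    (SR.trans (SR.distribˡ (const c) _ _) (SR.+-cong (derivation-sound c d ρ p e) (derivation-sound c d ρ p e′)))
  derivation-sound c d ρ p (e :- e′) = SR.trans (SR.*-congˡ {const c} (θ-- (⟦ e ⟧ ρ) (⟦ e′ ⟧ ρ)))
    (SR.trans (byPoly (const c ∷ θ (⟦ e ⟧ ρ) ∷ θ (⟦ e′ ⟧ ρ) ∷ []) (var (# 0) :* (var (# 1) :- var (# 2))) (var (# 0) :* var (# 1) :- var (# 0) :* var (# 2)) refl)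
      (-ˢ-cong (derivation-sound c d ρ p e) (derivation-sound c d ρ p e′)))
  derivation-sound c d ρ p (e :* e′) = SR.trans (SR.*-congˡ {const c} (θ-* (⟦ e ⟧ ρ) (⟦ e′ ⟧ ρ)))
    (SR.trans (byPoly (const c ∷ ⟦ e ⟧ ρ ∷ ⟦ e′ ⟧ ρ ∷ θ (⟦ e ⟧ ρ) ∷ θ (⟦ e′ ⟧ ρ) ∷ [])
        (var (# 0) :* (var (# 3) :* var (# 2) :+ var (# 1) :* var (# 4)))
        ((var (# 0) :* var (# 3)) :* var (# 2) :+ var (# 1) :* (var (# 0) :* var (# 4))) refl)
      (SR.+-cong (SR.*-congʳ {⟦ e′ ⟧ ρ} (derivation-sound c d ρ p e)) (SR.*-congˡ {⟦ e ⟧ ρ} (derivation-sound c d ρ p e′))))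
  derivation-sound c d ρ p (e :^ zero) = derivation-sound c d ρ p (con 1ℤ)
  derivation-sound c d ρ p (e :^ suc k) = SR.trans (SR.*-congˡ {const c} (θ-* (⟦ e ⟧ ρ) (⟦ e ⟧ ρ ^ˢ k)))
    (SR.trans (byPoly (const c ∷ ⟦ e ⟧ ρ ∷ ⟦ e ⟧ ρ ^ˢ k ∷ θ (⟦ e ⟧ ρ) ∷ θ (⟦ e ⟧ ρ ^ˢ k) ∷ [])
        (var (# 0) :* (var (# 3) :* var (# 2) :+ var (# 1) :* var (# 4)))
        ((var (# 0) :* var (# 3)) :* var (# 2) :+ var (# 1) :* (var (# 0) :* var (# 4))) refl)
      (SR.+-cong (SR.*-congʳ {⟦ e ⟧ ρ ^ˢ k} (derivation-sound c d ρ p e)) (SR.*-congˡ {⟦ e ⟧ ρ} (derivation-sound c d ρ p (e :^ k)))))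

  -- Modular forms of level 11:  P = 6 s - G,  11 P(q^11) = 6 s + G,  f = η(τ)²η(11τ)²,  24 z = 5 (Q - 121 Q(q^11)).

  Q̂ R̂ s G f x z : Series
  Q̂ = const (+ 121) *ˢ V E₄
  R̂ = const (+ 1331) *ˢ V E₆
  s = 1ˢ -ˢ const (+ 2) *ˢ L 1 -ˢ const (+ 22) *ˢ V (L 1)
  G = const (+ 5) +ˢ const (+ 12) *ˢ L 1 -ˢ const (+ 132) *ˢ V (L 1)
  f = X *ˢ (φ *ˢ φ *ˢ (V φ *ˢ V φ))
  -- With this shift the quartic in x and f that equals z² has no f⁴ term.
  x = G +ˢ const (+ 8) *ˢ f
  z = const (+ 50) *ˢ L 3 -ˢ const (+ 6050) *ˢ V (L 3) -ˢ const (+ 25)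

  private
    k : ∀ {n} → ℕ → Expr n
    k n = con (+ n)
    L₁ = L 1 ; L₃ = L 3 ; V₁ = V (L 1) ; V₃ = V (L 3)

  VE₂≈ : V E₂ ≈ˢ 1ˢ -ˢ const (+ 24) *ˢ V (L 1)
  VE₂≈ = SR.trans (V-- 1ˢ (const (+ 24) *ˢ L 1)) (-ˢ-cong (V-const 1ℤ) (V-const* (+ 24) (L 1)))

  VE₄≈ : V E₄ ≈ˢ 1ˢ +ˢ const (+ 240) *ˢ V (L 3)
  VE₄≈ = SR.trans (V-+ 1ˢ (const (+ 240) *ˢ L 3)) (SR.+-cong (V-const 1ℤ) (V-const* (+ 240) (L 3)))

  P≈ : E₂ ≈ˢ const (+ 6) *ˢ s -ˢ G
  P≈ = byPoly (L₁ ∷ V₁ ∷ []) (k 1 :- k 24 :* l) (k 6 :* (k 1 :- k 2 :* l :- k 22 :* v) :- (k 5 :+ k 12 :* l :- k 132 :* v)) refl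
    where l = var (# 0) ; v = var (# 1)

  P′≈ : const (+ 11) *ˢ V E₂ ≈ˢ const (+ 6) *ˢ s +ˢ G
  P′≈ = SR.trans (SR.*-congˡ {const (+ 11)} VE₂≈)
    (byPoly (L₁ ∷ V₁ ∷ []) (k 11 :* (k 1 :- k 24 :* v)) (k 6 :* (k 1 :- k 2 :* l :- k 22 :* v) :+ (k 5 :+ k 12 :* l :- k 132 :* v)) refl)
    where l = var (# 0) ; v = var (# 1)

  z-Q : const (+ 24) *ˢ z ≈ˢ const (+ 5) *ˢ (E₄ -ˢ Q̂)
  z-Q = SR.trans
    (byPoly (L₃ ∷ V₃ ∷ []) (k 24 :* (k 50 :* l :- k 6050 :* v :- k 25)) (k 5 :* (k 1 :+ k 240 :* l :- k 121 :* (k 1 :+ k 240 :* v))) refl)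
    (SR.*-congˡ {const (+ 5)} (-ˢ-cong {E₄} SR.refl (SR.*-congˡ {const (+ 121)} (SR.sym VE₄≈))))
    where l = var (# 0) ; v = var (# 1)

  θVE₂ : const (+ 12) *ˢ θ (V E₂) ≈ˢ const (+ 11) *ˢ (V E₂ *ˢ V E₂ -ˢ V E₄)
  θVE₂ = begin
    const (+ 12) *ˢ θ (V E₂)                           ≈⟨ SR.*-congˡ {const (+ 12)} (θ-V E₂) ⟩
    const (+ 12) *ˢ (const (+ 11) *ˢ V (θ E₂))         ≈⟨ byPoly (V (θ E₂) ∷ []) (k 12 :* (k 11 :* var zero)) (k 11 :* (k 12 :* var zero)) refl ⟩
    const (+ 11) *ˢ (const (+ 12) *ˢ V (θ E₂))         ≈⟨ SR.*-congˡ {const (+ 11)} (SR.trans (SR.sym (V-const* (+ 12) (θ E₂))) (V-cong θE₂)) ⟩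
    const (+ 11) *ˢ V (E₂ *ˢ E₂ -ˢ E₄)                 ≈⟨ SR.*-congˡ {const (+ 11)} (SR.trans (V-- (E₂ *ˢ E₂) E₄) (-ˢ-cong (V-* E₂ E₂) SR.refl)) ⟩
    const (+ 11) *ˢ (V E₂ *ˢ V E₂ -ˢ V E₄) ∎

  θVE₄ : const (+ 3) *ˢ θ (V E₄) ≈ˢ const (+ 11) *ˢ (V E₂ *ˢ V E₄ -ˢ V E₆)
  θVE₄ = begin
    const (+ 3) *ˢ θ (V E₄)                           ≈⟨ SR.*-congˡ {const (+ 3)} (θ-V E₄) ⟩
    const (+ 3) *ˢ (const (+ 11) *ˢ V (θ E₄))         ≈⟨ byPoly (V (θ E₄) ∷ []) (k 3 :* (k 11 :* var zero)) (k 11 :* (k 3 :* var zero)) refl ⟩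
    const (+ 11) *ˢ (const (+ 3) *ˢ V (θ E₄))         ≈⟨ SR.*-congˡ {const (+ 11)} (SR.trans (SR.sym (V-const* (+ 3) (θ E₄))) (V-cong θE₄)) ⟩
    const (+ 11) *ˢ V (E₂ *ˢ E₄ -ˢ E₆)                 ≈⟨ SR.*-congˡ {const (+ 11)} (SR.trans (V-- (E₂ *ˢ E₄) E₆) (-ˢ-cong (V-* E₂ E₄) SR.refl)) ⟩
    const (+ 11) *ˢ (V E₂ *ˢ V E₄ -ˢ V E₆) ∎

  θVE₆ : const (+ 2) *ˢ θ (V E₆) ≈ˢ const (+ 11) *ˢ (V E₂ *ˢ V E₆ -ˢ V E₄ *ˢ V E₄)
  θVE₆ = begin
    const (+ 2) *ˢ θ (V E₆)                           ≈⟨ SR.*-congˡ {const (+ 2)} (θ-V E₆) ⟩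
    const (+ 2) *ˢ (const (+ 11) *ˢ V (θ E₆))         ≈⟨ byPoly (V (θ E₆) ∷ []) (k 2 :* (k 11 :* var zero)) (k 11 :* (k 2 :* var zero)) refl ⟩
    const (+ 11) *ˢ (const (+ 2) *ˢ V (θ E₆))         ≈⟨ SR.*-congˡ {const (+ 11)} (SR.trans (SR.sym (V-const* (+ 2) (θ E₆))) (V-cong θE₆)) ⟩
    const (+ 11) *ˢ V (E₂ *ˢ E₆ -ˢ E₄ *ˢ E₄)           ≈⟨ SR.*-congˡ {const (+ 11)} (SR.trans (V-- (E₂ *ˢ E₆) (E₄ *ˢ E₄)) (-ˢ-cong (V-* E₂ E₆) (V-* E₄ E₄))) ⟩
    const (+ 11) *ˢ (V E₂ *ˢ V E₆ -ˢ V E₄ *ˢ V E₄) ∎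

  24θVφ : const (+ 24) *ˢ θ (V φ) ≈ˢ V φ *ˢ (const (+ 11) *ˢ V E₂ -ˢ const (+ 11))
  24θVφ = begin
    const (+ 24) *ˢ θ (V φ)                           ≈⟨ SR.*-congˡ {const (+ 24)} (θ-V φ) ⟩
    const (+ 24) *ˢ (const (+ 11) *ˢ V (θ φ))         ≈⟨ byPoly (V (θ φ) ∷ []) (k 24 :* (k 11 :* var zero)) (k 11 :* (k 24 :* var zero)) refl ⟩
    const (+ 11) *ˢ (const (+ 24) *ˢ V (θ φ))         ≈⟨ SR.*-congˡ {const (+ 11)} (SR.trans (SR.sym (V-const* (+ 24) (θ φ))) (V-cong 24θφ)) ⟩
    const (+ 11) *ˢ V (φ *ˢ (E₂ -ˢ 1ˢ))               ≈⟨ SR.*-congˡ {const (+ 11)} (SR.trans (V-* φ (E₂ -ˢ 1ˢ)) (SR.*-congˡ {V φ} (SR.trans (V-- E₂ 1ˢ) (-ˢ-cong {V E₂} SR.refl (V-const 1ℤ))))) ⟩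
    const (+ 11) *ˢ (V φ *ˢ (V E₂ -ˢ 1ˢ))
      ≈⟨ byPoly (V φ ∷ V E₂ ∷ []) (k 11 :* (var (# 0) :* (var (# 1) :- k 1))) (var (# 0) :* (k 11 :* var (# 1) :- k 11)) refl ⟩
    V φ *ˢ (const (+ 11) *ˢ V E₂ -ˢ const (+ 11)) ∎

  -- Differentiation rules for the level 11 forms, each multiplied by the scalar that clears denominators.

  2θG : const (+ 2) *ˢ θ G ≈ˢ const (+ 11) *ˢ θ (V E₂) -ˢ θ E₂
  2θG = begin
    const (+ 2) *ˢ θ G                      ≈⟨ θ-const* (+ 2) G ⟨
    θ (const (+ 2) *ˢ G)                    ≈⟨ θ-cong (SR.trans (byPoly (s ∷ G ∷ []) (k 2 :* var (# 1)) ((k 6 :* var (# 0) :+ var (# 1)) :- (k 6 :* var (# 0) :- var (# 1))) refl)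
                                                 (-ˢ-cong (SR.sym P′≈) (SR.sym P≈))) ⟩
    θ (const (+ 11) *ˢ V E₂ -ˢ E₂)          ≈⟨ SR.trans (θ-- (const (+ 11) *ˢ V E₂) E₂) (-ˢ-cong (θ-const* (+ 11) (V E₂)) SR.refl) ⟩
    const (+ 11) *ˢ θ (V E₂) -ˢ θ E₂ ∎

  module Rules where
    ρ : Vec Series 15
    ρ = s ∷ G ∷ z ∷ E₂ ∷ V E₂ ∷ E₄ ∷ V E₄ ∷ E₆ ∷ V E₆ ∷ θ E₂ ∷ θ (V E₂) ∷ θ E₄ ∷ θ (V E₄) ∷ θ E₆ ∷ θ (V E₆) ∷ []
    S 𝐆 𝐙 P P′ Q Q′ R R′ dP dP′ dQ dQ′ dR dR′ : Expr 15
    S = var (# 0) ; 𝐆 = var (# 1) ; 𝐙 = var (# 2) ; P = var (# 3) ; P′ = var (# 4) ; Q = var (# 5) ; Q′ = var (# 6)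
    R = var (# 7) ; R′ = var (# 8) ; dP = var (# 9) ; dP′ = var (# 10) ; dQ = var (# 11) ; dQ′ = var (# 12) ; dR = var (# 13) ; dR′ = var (# 14)

    hP : Expr 15 → Hyp ρ
    hP c = c · P ≈ k 6 :* S :- 𝐆 by P≈
    hP′ : Expr 15 → Hyp ρ
    hP′ c = c · k 11 :* P′ ≈ k 6 :* S :+ 𝐆 by P′≈
    hz : Expr 15 → Hyp ρ
    hz c = c · k 24 :* 𝐙 ≈ k 5 :* (Q :- k 121 :* Q′) by z-Q
    hdP : Expr 15 → Hyp ρ
    hdP c = c · k 12 :* dP ≈ P :* P :- Q by θE₂
    hdP′ : Expr 15 → Hyp ρ
    hdP′ c = c · k 12 :* dP′ ≈ k 11 :* (P′ :* P′ :- Q′) by θVE₂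
    hdQ : Expr 15 → Hyp ρ
    hdQ c = c · k 3 :* dQ ≈ P :* Q :- R by θE₄
    hdQ′ : Expr 15 → Hyp ρ
    hdQ′ c = c · k 3 :* dQ′ ≈ k 11 :* (P′ :* Q′ :- R′) by θVE₄
    hdR : Expr 15 → Hyp ρ
    hdR c = c · k 2 :* dR ≈ P :* R :- Q :* Q by θE₆
    hdR′ : Expr 15 → Hyp ρ
    hdR′ c = c · k 2 :* dR′ ≈ k 11 :* (P′ :* R′ :- Q′ :* Q′) by θVE₆

    neg : ∀ {n} → ℕ → Expr n
    neg n = con (ℤ.- (+ n))
    Qp Rp Rm : Expr 15
    Qp = Q :+ k 121 :* Q′
    Rp = R :+ k 1331 :* R′
    Rm = R :- k 1331 :* R′

    -- The right-hand side is 10 θ G.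
    θG-rule : const (+ 5) *ˢ (const (+ 11) *ˢ θ (V E₂) -ˢ θ E₂) ≈ˢ const (+ 10) *ˢ (s *ˢ G) +ˢ const (+ 2) *ˢ z
    θG-rule = byHyps (+ 24) (hdP′ (k 110) ∷ hdP (neg 10) ∷ hP′ (k 10 :* (k 11 :* P′ :+ k 6 :* S :+ 𝐆)) ∷ hP (neg 10 :* (P :+ k 6 :* S :- 𝐆)) ∷ hz (neg 2) ∷ [])
      (k 5 :* (k 11 :* dP′ :- dP)) (k 10 :* (S :* 𝐆) :+ k 2 :* 𝐙) (λ ()) refl

    θQp-rule : ⟦ k 15 :* (dQ :+ k 121 :* dQ′) ⟧ ρ ≈ˢ ⟦ k 30 :* S :* Qp :- k 24 :* 𝐆 :* 𝐙 :- k 5 :* Rp ⟧ ρ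
    θQp-rule = byHyps (+ 1) (hdQ (k 5) ∷ hdQ′ (k 605) ∷ hP (k 5 :* Q) ∷ hP′ (k 605 :* Q′) ∷ hz 𝐆 ∷ [])
      (k 15 :* (dQ :+ k 121 :* dQ′)) (k 30 :* S :* Qp :- k 24 :* 𝐆 :* 𝐙 :- k 5 :* Rp) (λ ()) refl

    θRm-rule : ⟦ k 10 :* (dR :- k 1331 :* dR′) ⟧ ρ ≈ˢ ⟦ k 30 :* S :* Rm :- k 5 :* 𝐆 :* Rp :- k 24 :* 𝐙 :* Qp ⟧ ρ
    θRm-rule = byHyps (+ 1) (hdR (k 5) ∷ hdR′ (neg 6655) ∷ hP (k 5 :* R) ∷ hP′ (neg 6655 :* R′) ∷ hz Qp ∷ [])
      (k 10 :* (dR :- k 1331 :* dR′)) (k 30 :* S :* Rm :- k 5 :* 𝐆 :* Rp :- k 24 :* 𝐙 :* Qp) (λ ()) refl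

    θRp-rule : ⟦ k 100 :* (dR :+ k 1331 :* dR′) ⟧ ρ ≈ˢ ⟦ k 300 :* S :* Rp :- k 50 :* 𝐆 :* Rm :- k 25 :* (Qp :* Qp) :- k 576 :* (𝐙 :* 𝐙) ⟧ ρ
    θRp-rule = byHyps (+ 1) (hdR (k 50) ∷ hdR′ (k 66550) ∷ hP (k 50 :* R) ∷ hP′ (k 66550 :* R′) ∷ hz (k 24 :* 𝐙 :+ k 5 :* (Q :- k 121 :* Q′)) ∷ [])
      (k 100 :* (dR :+ k 1331 :* dR′)) (k 300 :* S :* Rp :- k 50 :* 𝐆 :* Rm :- k 25 :* (Qp :* Qp) :- k 576 :* (𝐙 :* 𝐙)) (λ ()) refl

    -- The left-hand side is 72 θ z.
    θz-rule : ⟦ k 15 :* (dQ :- k 121 :* dQ′) ⟧ ρ ≈ˢ ⟦ k 144 :* S :* 𝐙 :- k 5 :* 𝐆 :* Qp :- k 5 :* Rm ⟧ ρ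
    θz-rule = byHyps (+ 1) (hdQ (k 5) ∷ hdQ′ (neg 605) ∷ hP (k 5 :* Q) ∷ hP′ (neg 605 :* Q′) ∷ hz (neg 6 :* S) ∷ [])
      (k 15 :* (dQ :- k 121 :* dQ′)) (k 144 :* S :* 𝐙 :- k 5 :* 𝐆 :* Qp :- k 5 :* Rm) (λ ()) refl

  -- Sum and difference of a level 1 form and its image under the Fricke involution; up to a scalar,
  -- z is the missing Q₋. Together with s and G these forms are closed under θ.
  Q₊ R₊ R₋ : Series
  Q₊ = E₄ +ˢ Q̂
  R₊ = E₆ +ˢ R̂
  R₋ = E₆ -ˢ R̂

  -- With P′ = 11 P(q^11), Ramanujan's equation at q and at q^11 gives 24 θ G = P′² - P² + Q - 121
  -- Q(q^11), where P′² - P² = 24 s G and the rest is a multiple of z.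
  θG≈ : const (+ 5) *ˢ θ G ≈ˢ const (+ 5) *ˢ (s *ˢ G) +ˢ z
  θG≈ = *ˢ-cancelˡ (const (+ 2)) (λ ()) (begin
    const (+ 2) *ˢ (const (+ 5) *ˢ θ G)   ≈⟨ byPoly (θ G ∷ []) (k 2 :* (k 5 :* var zero)) (k 5 :* (k 2 :* var zero)) refl ⟩
    const (+ 5) *ˢ (const (+ 2) *ˢ θ G)   ≈⟨ SR.*-congˡ {const (+ 5)} 2θG ⟩
    _                                     ≈⟨ Rules.θG-rule ⟩
    const (+ 10) *ˢ (s *ˢ G) +ˢ const (+ 2) *ˢ z
      ≈⟨ byPoly (s *ˢ G ∷ z ∷ []) (k 10 :* var (# 0) :+ k 2 :* var (# 1)) (k 2 :* (k 5 :* var (# 0) :+ var (# 1))) refl ⟩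
    const (+ 2) *ˢ (const (+ 5) *ˢ (s *ˢ G) +ˢ z) ∎)

  θQ₊ : const (+ 15) *ˢ θ Q₊ ≈ˢ const (+ 30) *ˢ s *ˢ Q₊ -ˢ const (+ 24) *ˢ G *ˢ z -ˢ const (+ 5) *ˢ R₊
  θQ₊ = SR.trans (SR.*-congˡ {const (+ 15)} (SR.trans (θ-+ E₄ Q̂) (SR.+-congˡ {θ E₄} (θ-const* (+ 121) (V E₄))))) Rules.θQp-rule

  θR₋ : const (+ 10) *ˢ θ R₋ ≈ˢ const (+ 30) *ˢ s *ˢ R₋ -ˢ const (+ 5) *ˢ G *ˢ R₊ -ˢ const (+ 24) *ˢ z *ˢ Q₊
  θR₋ = SR.trans (SR.*-congˡ {const (+ 10)} (SR.trans (θ-- E₆ R̂) (-ˢ-cong {θ E₆} SR.refl (θ-const* (+ 1331) (V E₆))))) Rules.θRm-rule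

  θR₊ : const (+ 100) *ˢ θ R₊ ≈ˢ const (+ 300) *ˢ s *ˢ R₊ -ˢ const (+ 50) *ˢ G *ˢ R₋ -ˢ const (+ 25) *ˢ (Q₊ *ˢ Q₊) -ˢ const (+ 576) *ˢ (z *ˢ z)
  θR₊ = SR.trans (SR.*-congˡ {const (+ 100)} (SR.trans (θ-+ E₆ R̂) (SR.+-congˡ {θ E₆} (θ-const* (+ 1331) (V E₆))))) Rules.θRp-rule

  θz≈ : const (+ 72) *ˢ θ z ≈ˢ const (+ 144) *ˢ s *ˢ z -ˢ const (+ 5) *ˢ G *ˢ Q₊ -ˢ const (+ 5) *ˢ R₋
  θz≈ = begin
    const (+ 72) *ˢ θ z                    ≈⟨ byPoly (θ z ∷ []) (k 72 :* var zero) (k 3 :* (k 24 :* var zero)) refl ⟩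
    const (+ 3) *ˢ (const (+ 24) *ˢ θ z)   ≈⟨ SR.*-congˡ {const (+ 3)} (SR.trans (SR.sym (θ-const* (+ 24) z)) (SR.trans (θ-cong z-Q)
                                                (SR.trans (θ-const* (+ 5) (E₄ -ˢ Q̂)) (SR.*-congˡ {const (+ 5)} (SR.trans (θ-- E₄ Q̂) (-ˢ-cong {θ E₄} SR.refl (θ-const* (+ 121) (V E₄)))))))) ⟩
    const (+ 3) *ˢ (const (+ 5) *ˢ (θ E₄ -ˢ const (+ 121) *ˢ θ (V E₄)))
      ≈⟨ byPoly (θ E₄ ∷ θ (V E₄) ∷ []) (k 3 :* (k 5 :* (var (# 0) :- k 121 :* var (# 1)))) (k 15 :* (var (# 0) :- k 121 :* var (# 1))) refl ⟩
    _                                      ≈⟨ Rules.θz-rule ⟩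
    _ ∎

  θX≈ : θ X ≈ˢ X
  θX≈ zero          = refl
  θX≈ (suc zero)    = refl
  θX≈ (suc (suc n)) = ℤₚ.*-zeroʳ (+ suc (suc n))

  -- The logarithmic derivative of η(τ)² η(11τ)² is 2 (E₂ + 11 E₂(q^11))/24, which is s.
  θf≈ : θ f ≈ˢ f *ˢ s
  θf≈ = byHyps {ρ = θ X ∷ θ φ ∷ θ (V φ) ∷ X ∷ φ ∷ V φ ∷ E₂ ∷ V E₂ ∷ s ∷ G ∷ θ f ∷ []} (+ 24)
    ( (k 24 · a₁₀ ≈ a₀ :* (a₄ :* a₄ :* (a₅ :* a₅)) :+ a₃ :* ((a₁ :* a₄ :+ a₄ :* a₁) :* (a₅ :* a₅) :+ a₄ :* a₄ :* (a₂ :* a₅ :+ a₅ :* a₂)) by product-rule)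
    ∷ (k 24 :* (a₄ :* a₄ :* (a₅ :* a₅)) · a₀ ≈ a₃ by θX≈)
    ∷ (k 2 :* a₃ :* (a₄ :* (a₅ :* a₅)) · k 24 :* a₁ ≈ a₄ :* (a₆ :- k 1) by 24θφ)
    ∷ (k 2 :* a₃ :* (a₄ :* a₄ :* a₅) · k 24 :* a₂ ≈ a₅ :* (k 11 :* a₇ :- k 11) by 24θVφ)
    ∷ (k 2 :* F · a₆ ≈ k 6 :* a₈ :- a₉ by P≈)
    ∷ (k 2 :* F · k 11 :* a₇ ≈ k 6 :* a₈ :+ a₉ by P′≈)
    ∷ [] ) a₁₀ (F :* a₈) (λ ()) refl
    where
    a₀ a₁ a₂ a₃ a₄ a₅ a₆ a₇ a₈ a₉ a₁₀ F : Expr 11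
    a₀ = var (# 0) ; a₁ = var (# 1) ; a₂ = var (# 2) ; a₃ = var (# 3) ; a₄ = var (# 4) ; a₅ = var (# 5)
    a₆ = var (# 6) ; a₇ = var (# 7) ; a₈ = var (# 8) ; a₉ = var (# 9) ; a₁₀ = var (# 10)
    F = a₃ :* (a₄ :* a₄ :* (a₅ :* a₅))
    product-rule : θ f ≈ˢ θ X *ˢ (φ *ˢ φ *ˢ (V φ *ˢ V φ)) +ˢ X *ˢ ((θ φ *ˢ φ +ˢ φ *ˢ θ φ) *ˢ (V φ *ˢ V φ) +ˢ φ *ˢ φ *ˢ (θ (V φ) *ˢ V φ +ˢ V φ *ˢ θ (V φ)))
    product-rule = SR.trans (θ-* X (φ *ˢ φ *ˢ (V φ *ˢ V φ))) (SR.+-congˡ {θ X *ˢ (φ *ˢ φ *ˢ (V φ *ˢ V φ))} (SR.*-congˡ {X}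
      (SR.trans (θ-* (φ *ˢ φ) (V φ *ˢ V φ)) (SR.+-cong (SR.*-congʳ {V φ *ˢ V φ} (θ-* φ φ)) (SR.*-congˡ {φ *ˢ φ} (θ-* (V φ) (V φ)))))))

  θx≈ : const (+ 5) *ˢ θ x ≈ˢ const (+ 5) *ˢ (s *ˢ x) +ˢ z
  θx≈ = begin
    const (+ 5) *ˢ θ x
      ≈⟨ SR.*-congˡ {const (+ 5)} (SR.trans (θ-+ G (const (+ 8) *ˢ f)) (SR.+-congˡ {θ G} (θ-const* (+ 8) f))) ⟩
    const (+ 5) *ˢ (θ G +ˢ const (+ 8) *ˢ θ f)
      ≈⟨ byHyps {ρ = θ G ∷ θ f ∷ s ∷ G ∷ f ∷ z ∷ []} (+ 1)
           ( (k 1 · k 5 :* var (# 0) ≈ k 5 :* (var (# 2) :* var (# 3)) :+ var (# 5) by θG≈) ∷ (k 40 · var (# 1) ≈ var (# 4) :* var (# 2) by θf≈) ∷ [] )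
           (k 5 :* (var (# 0) :+ k 8 :* var (# 1))) (k 5 :* (var (# 2) :* (var (# 3) :+ k 8 :* var (# 4))) :+ var (# 5)) (λ ()) refl ⟩
    const (+ 5) *ˢ (s *ˢ x) +ˢ z ∎

open Level11Forms

-- Algebraic relations between the forms of level 11.

module Level11Relations where

  open import Relation.Binary.Reasoning.Setoid SR.setoid

  private
    k : ∀ {n} → ℕ → Expr n
    k n = con (+ n)

  θs≈ : const (+ 144) *ˢ θ s ≈ˢ const (+ 72) *ˢ (s *ˢ s) +ˢ const (+ 2) *ˢ (G *ˢ G) -ˢ Q₊
  θs≈ = byHyps {ρ = θ s ∷ θ E₂ ∷ θ (V E₂) ∷ s ∷ G ∷ E₂ ∷ V E₂ ∷ E₄ ∷ V E₄ ∷ []} (+ 1)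
    ( (k 12 · k 12 :* a₀ ≈ a₁ :+ k 11 :* a₂ by 12θs)
    ∷ (k 1 · k 12 :* a₁ ≈ a₅ :* a₅ :- a₇ by θE₂)
    ∷ (k 11 · k 12 :* a₂ ≈ k 11 :* (a₆ :* a₆ :- a₈) by θVE₂)
    ∷ ((a₅ :+ k 6 :* a₃ :- a₄) · a₅ ≈ k 6 :* a₃ :- a₄ by P≈)
    ∷ ((k 11 :* a₆ :+ k 6 :* a₃ :+ a₄) · k 11 :* a₆ ≈ k 6 :* a₃ :+ a₄ by P′≈)
    ∷ [] ) (k 144 :* a₀) (k 72 :* (a₃ :* a₃) :+ k 2 :* (a₄ :* a₄) :- (a₇ :+ k 121 :* a₈)) (λ ()) refl
    where
    a₀ a₁ a₂ a₃ a₄ a₅ a₆ a₇ a₈ : Expr 9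
    a₀ = var (# 0) ; a₁ = var (# 1) ; a₂ = var (# 2) ; a₃ = var (# 3) ; a₄ = var (# 4) ; a₅ = var (# 5)
    a₆ = var (# 6) ; a₇ = var (# 7) ; a₈ = var (# 8)
    12θs : const (+ 12) *ˢ θ s ≈ˢ θ E₂ +ˢ const (+ 11) *ˢ θ (V E₂)
    12θs = SR.trans (SR.sym (θ-const* (+ 12) s)) (SR.trans
      (θ-cong (SR.trans (byPoly (s ∷ G ∷ []) (k 12 :* var (# 0)) ((k 6 :* var (# 0) :- var (# 1)) :+ (k 6 :* var (# 0) :+ var (# 1))) refl)
        (SR.+-cong (SR.sym P≈) (SR.sym P′≈))))
      (SR.trans (θ-+ E₂ (const (+ 11) *ˢ V E₂)) (SR.+-congˡ {θ E₂} (θ-const* (+ 11) (V E₂)))))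

  module Level11 where
    ρ : Vec Series 7
    ρ = G ∷ f ∷ z ∷ Q₊ ∷ R₊ ∷ R₋ ∷ s ∷ []
    𝐆 𝐟 𝐳 Qp Rp Rm 𝐬 𝐱 : Expr 7
    𝐆 = var (# 0) ; 𝐟 = var (# 1) ; 𝐳 = var (# 2) ; Qp = var (# 3) ; Rp = var (# 4) ; Rm = var (# 5) ; 𝐬 = var (# 6)
    𝐱 = 𝐆 :+ k 8 :* 𝐟

    rule : Fin 7 → Expr 7
    rule zero                                     = k 720 :* (k 5 :* (𝐬 :* 𝐆) :+ 𝐳)
    rule (suc zero)                               = k 3600 :* (𝐟 :* 𝐬)
    rule (suc (suc zero))                         = k 50 :* (k 144 :* 𝐬 :* 𝐳 :- k 5 :* 𝐆 :* Qp :- k 5 :* Rm)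
    rule (suc (suc (suc zero)))                   = k 240 :* (k 30 :* 𝐬 :* Qp :- k 24 :* 𝐆 :* 𝐳 :- k 5 :* Rp)
    rule (suc (suc (suc (suc zero))))             = k 36 :* (k 300 :* 𝐬 :* Rp :- k 50 :* 𝐆 :* Rm :- k 25 :* (Qp :* Qp) :- k 576 :* (𝐳 :* 𝐳))
    rule (suc (suc (suc (suc (suc zero)))))       = k 360 :* (k 30 :* 𝐬 :* Rm :- k 5 :* 𝐆 :* Rp :- k 24 :* 𝐳 :* Qp)
    rule (suc (suc (suc (suc (suc (suc zero)))))) = k 25 :* (k 72 :* (𝐬 :* 𝐬) :+ k 2 :* (𝐆 :* 𝐆) :- Qp)

    scaled : ∀ {a b} m n → const (+ n) *ˢ a ≈ˢ b → const (+ (m ℕ.* n)) *ˢ a ≈ˢ const (+ m) *ˢ b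
    scaled {a} m n p = SR.trans (SR.*-congʳ {a} (SR.trans (≡⇒≈ (cong const (ℤₚ.pos-* m n))) (const-* (+ m) (+ n))))
      (SR.trans (SR.*-assoc (const (+ m)) (const (+ n)) a) (SR.*-congˡ {const (+ m)} p))

    -- 3600 is the least common multiple of the scalars 5, 72, 15, 100, 10 and 144 in the individual
    -- rules.
    rules : ∀ i → const (+ 3600) *ˢ θ (lookup ρ i) ≈ˢ ⟦ rule i ⟧ ρ
    rules zero                                     = scaled 720 5 θG≈
    rules (suc zero)                               = SR.*-congˡ {const (+ 3600)} θf≈
    rules (suc (suc zero))                         = scaled 50 72 θz≈
    rules (suc (suc (suc zero)))                   = scaled 240 15 θQ₊
    rules (suc (suc (suc (suc zero))))             = scaled 36 100 θR₊
    rules (suc (suc (suc (suc (suc zero)))))       = scaled 360 10 θR₋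
    rules (suc (suc (suc (suc (suc (suc zero)))))) = scaled 25 144 θs≈

    𝐚 𝐛 𝐥 𝐩 : Expr 7
    𝐚 = k 61 :* (𝐱 :* 𝐱) :- k 1840 :* 𝐱 :* 𝐟 :+ k 8800 :* (𝐟 :* 𝐟)
    𝐛 = k 38640 :* 𝐱 :* 𝐱 :* 𝐟 :- k 665 :* 𝐱 :* 𝐱 :* 𝐱 :- k 369600 :* 𝐱 :* 𝐟 :* 𝐟 :+ k 847000 :* 𝐟 :* 𝐟 :* 𝐟
    𝐥 = k 7920 :* 𝐟 :- k 666 :* 𝐱
    𝐩 = 𝐱 :^ 4 :- k 100 :* 𝐱 :^ 3 :* 𝐟 :+ k 1400 :* 𝐱 :^ 2 :* 𝐟 :^ 2 :- k 5500 :* 𝐱 :* 𝐟 :^ 3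

    -- Q₊, R₋, R₊ and z² as polynomials in x, f and z. The last relation is a model of the genus one
    -- curve X₀(11).
    defect : Fin 4 → Expr 7
    defect zero                   = k 25 :* Qp :- k 2 :* 𝐚
    defect (suc zero)             = k 125 :* Rm :- k 2 :* 𝐛
    defect (suc (suc zero))       = k 125 :* Rp :- k 2 :* 𝐳 :* 𝐥
    defect (suc (suc (suc zero))) = 𝐳 :* 𝐳 :- 𝐩

    n : ∀ {m} → ℕ → Expr m
    n i = con (ℤ.- (+ i))

    -- Cofactors: the derivative of each relation lies in the ideal generated by the four relations,
    -- so the defects solve a homogeneous linear system.
    matrix : Vec (Vec (Expr 7) 4) 4
    matrix = (k 7200 :* 𝐬 ∷ k 0 ∷ n 240 ∷ k 0 ∷ [])
      ∷ (n 43200 :* 𝐳 ∷ k 10800 :* 𝐬 ∷ n 1800 :* 𝐆 ∷ k 0 ∷ [])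
      ∷ (n 180 :* (k 25 :* Qp :+ k 2 :* 𝐚) :+ k 20 :* 𝐥 :* 𝐆 ∷ n 1800 :* 𝐆 :+ k 4 :* 𝐥 ∷ k 10800 :* 𝐬 ∷ n 1632960 ∷ [])
      ∷ (n 20 :* 𝐳 :* 𝐆 ∷ n 4 :* 𝐳 ∷ k 0 ∷ k 14400 :* 𝐬 ∷ [])
      ∷ []

    A : Vec (Vec Series 4) 4
    A = Vec.map (Vec.map (λ e → ⟦ e ⟧ ρ)) matrix

    rowExpr : ∀ {m} → Vec (Expr 7) m → (Fin m → Expr 7) → Expr 7
    rowExpr []      g = con 0ℤ
    rowExpr (a ∷ r) g = a :* g zero :+ rowExpr r (λ i → g (suc i))

    ode : ∀ i → const (+ 3600) *ˢ θ (⟦ defect i ⟧ ρ) ≈ˢ dotˢ (lookup A i) (λ j → ⟦ defect j ⟧ ρ)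
    ode i = SR.trans (derivation-sound (+ 3600) rule ρ rules (defect i)) (by-row i)
      where
      by-row : ∀ i → ⟦ derivation rule (defect i) ⟧ ρ ≈ˢ dotˢ (lookup A i) (λ j → ⟦ defect j ⟧ ρ)
      by-row zero                   = byPoly ρ (derivation rule (defect (# 0))) (rowExpr (lookup matrix (# 0)) defect) refl
      by-row (suc zero)             = byPoly ρ (derivation rule (defect (# 1))) (rowExpr (lookup matrix (# 1)) defect) refl
      by-row (suc (suc zero))       = byPoly ρ (derivation rule (defect (# 2))) (rowExpr (lookup matrix (# 2)) defect) refl
      by-row (suc (suc (suc zero))) = byPoly ρ (derivation rule (defect (# 3))) (rowExpr (lookup matrix (# 3)) defect) refl

    module T = Truncated 11

    basis : Vec Series 9
    basis = G ∷ X ∷ φ ∷ V φ ∷ z ∷ E₄ ∷ V E₄ ∷ E₆ ∷ V E₆ ∷ []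

    -- The entry for s is a dummy 0, since s does not occur in the defects.
    inBasis : Vec (Expr 9) 7
    inBasis = var (# 0) ∷ (var (# 1) :* (var (# 2) :* var (# 2) :* (var (# 3) :* var (# 3)))) ∷ var (# 4) ∷ (var (# 5) :+ k 121 :* var (# 6))
      ∷ (var (# 7) :+ k 1331 :* var (# 8)) ∷ (var (# 7) :- k 1331 :* var (# 8)) ∷ k 0 ∷ []

    substitute : ∀ {m m′} → Vec (Expr m′) m → Expr m → Expr m′
    substitute σ (con c)   = con c
    substitute σ (var i)   = lookup σ i
    substitute σ (e :+ e′) = substitute σ e :+ substitute σ e′
    substitute σ (e :- e′) = substitute σ e :- substitute σ e′
    substitute σ (e :* e′) = substitute σ e :* substitute σ e′
    substitute σ (e :^ j)  = substitute σ e :^ j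

    initial : ∀ i → ⟦ defect i ⟧ ρ ≈ˢ[ 11 ] 0ˢ
    initial i = ≈[]-trans 11 (by-row i) (≈⇒≈[] 11 (SR.sym 0ˢ≈const))
      where
      by-row : ∀ i → ⟦ defect i ⟧ ρ ≈ˢ[ 11 ] const 0ℤ
      by-row zero                   = T.byTruncation (T.coefficients-≈* basis) (substitute inBasis (defect (# 0))) (con 0ℤ) refl
      by-row (suc zero)             = T.byTruncation (T.coefficients-≈* basis) (substitute inBasis (defect (# 1))) (con 0ℤ) refl
      by-row (suc (suc zero))       = T.byTruncation (T.coefficients-≈* basis) (substitute inBasis (defect (# 2))) (con 0ℤ) refl
      by-row (suc (suc (suc zero))) = T.byTruncation (T.coefficients-≈* basis) (substitute inBasis (defect (# 3))) (con 0ℤ) refl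

    -- The eigenvalues of the residue matrix lie among 3600 · 0, 3600 · 1 and 3600 · 11. A nonzero
    -- solution could only start at q⁰, q¹ or q^11, which is why the coefficients through q^11 are
    -- compared.
    defects≈0 : ∀ i → ⟦ defect i ⟧ ρ ≈ˢ 0ˢ
    defects≈0 = system-unique 11 (+ 3600) A (λ i → ⟦ defect i ⟧ ρ) (0ℤ ∷ 0ℤ ∷ + 3600 ∷ + 39600 ∷ []) ode initial refl
      λ { (suc n) n>11 _ (here refl) () ; (suc n) n>11 _ (there (here refl)) () ; (suc n) n>11 _ (there (there (here refl))) eq → no-eigenvalue 1 (suc n) (s≤s (s≤s z≤n)) n>11 eq
        ; (suc n) n>11 _ (there (there (there (here refl)))) eq → no-eigenvalue 11 (suc n) ℕₚ.≤-refl n>11 eq }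
      where
      no-eigenvalue : ∀ r n → r < 12 → 11 < n → + 3600 ℤ.* + n ≢ + (3600 ℕ.* r)
      no-eigenvalue r n r<12 11<n eq = ℕₚ.<⇒≢ (ℕₚ.<-≤-trans r<12 11<n) (sym (ℕₚ.*-cancelˡ-≡ n r 3600 (ℤₚ.+-injective (trans (ℤₚ.pos-* 3600 n) eq))))

open Level11Relations

-- Normal forms in the ring of level 11 forms, and its two expansions.

module NormalForms where

  open import Relation.Binary.Reasoning.Setoid SR.setoid

  -- Normal forms in ℤ[x, f, s, z] modulo the quadratic relation for z

  ring-𝐱 ring-𝐟 ring-𝐬 ring-𝐳 ring-𝐆 ring-𝐚 ring-𝐛 ring-𝐥 ring-𝐩 : Expr 4
  ring-𝐱 = var zero
  ring-𝐟 = var (suc zero)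
  ring-𝐬 = var (suc (suc zero))
  ring-𝐳 = var (suc (suc (suc zero)))

  private
    k n : ∀ {m} → ℕ → Expr m
    k i = con (+ i)
    n i = con (ℤ.- (+ i))
    𝐱 = ring-𝐱 ; 𝐟 = ring-𝐟 ; 𝐬 = ring-𝐬 ; 𝐳 = ring-𝐳

  ring-𝐆 = 𝐱 :- k 8 :* 𝐟
  ring-𝐚 = k 61 :* (𝐱 :* 𝐱) :- k 1840 :* 𝐱 :* 𝐟 :+ k 8800 :* (𝐟 :* 𝐟)
  ring-𝐛 = k 38640 :* 𝐱 :* 𝐱 :* 𝐟 :- k 665 :* 𝐱 :* 𝐱 :* 𝐱 :- k 369600 :* 𝐱 :* 𝐟 :* 𝐟 :+ k 847000 :* 𝐟 :* 𝐟 :* 𝐟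
  ring-𝐥 = k 7920 :* 𝐟 :- k 666 :* 𝐱
  ring-𝐩 = 𝐱 :^ 4 :- k 100 :* 𝐱 :^ 3 :* 𝐟 :+ k 1400 :* 𝐱 :^ 2 :* 𝐟 :^ 2 :- k 5500 :* 𝐱 :* 𝐟 :^ 3

  private
    𝐆 = ring-𝐆 ; 𝐚 = ring-𝐚 ; 𝐛 = ring-𝐛 ; 𝐥 = ring-𝐥 ; 𝐩 = ring-𝐩

  -- Horner normal forms in which a power of the variable is split off; they stay small for homogeneous polynomials.

  SPoly : ℕ → Set
  SPoly zero    = ℤ
  SPoly (suc m) = ℕ × List (SPoly m)

  constS : ∀ m → ℤ → SPoly m
  constS zero    c = c
  constS (suc m) c = 0 , constS m c ∷ []

  zeroS : ∀ m → SPoly m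
  zeroS zero    = 0ℤ
  zeroS (suc m) = 0 , []

  varS : ∀ {m} → Fin m → SPoly m
  varS {suc m} zero    = 1 , constS m 1ℤ ∷ []
  varS {suc m} (suc i) = 0 , varS i ∷ []

  pad : ∀ m → ℕ → List (SPoly m) → List (SPoly m)
  pad m zero    ps = ps
  pad m (suc k) ps = zeroS m ∷ pad m k ps

  addS : ∀ m → SPoly m → SPoly m → SPoly m
  addH : ∀ m → List (SPoly m) → List (SPoly m) → List (SPoly m)
  addAt : ∀ m → ℕ → List (SPoly m) → ℕ → List (SPoly m) → Bool → ℕ × List (SPoly m)
  addS zero    p q = p ℤ.+ q
  addS (suc m) (k , ps)     (l , [])     = k , ps
  addS (suc m) (k , [])     (l , q ∷ qs) = l , q ∷ qs
  addS (suc m) (k , p ∷ ps) (l , q ∷ qs) = addAt m k (p ∷ ps) l (q ∷ qs) (k ℕ.≤ᵇ l)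
  addAt m k ps l qs true  = k , addH m ps (pad m (l ℕ.∸ k) qs)
  addAt m k ps l qs false = l , addH m (pad m (k ℕ.∸ l) ps) qs
  addH m [] qs = qs
  addH m (p ∷ ps) [] = p ∷ ps
  addH m (p ∷ ps) (q ∷ qs) = addS m p q ∷ addH m ps qs

  negS : ∀ m → SPoly m → SPoly m
  negH : ∀ m → List (SPoly m) → List (SPoly m)
  negS zero    p = ℤ.- p
  negS (suc m) (k , ps) = k , negH m ps
  negH m [] = []
  negH m (p ∷ ps) = negS m p ∷ negH m ps

  mulS : ∀ m → SPoly m → SPoly m → SPoly m
  scaleH : ∀ m → SPoly m → List (SPoly m) → List (SPoly m)
  mulH : ∀ m → List (SPoly m) → List (SPoly m) → List (SPoly m)
  mulS zero    p q = p ℤ.* q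
  mulS (suc m) (k , ps) (l , qs) = k ℕ.+ l , mulH m ps qs
  mulH m [] qs = []
  mulH m (p ∷ ps) qs = addH m (scaleH m p qs) (zeroS m ∷ mulH m ps qs)
  scaleH m p [] = []
  scaleH m p (q ∷ qs) = mulS m p q ∷ scaleH m p qs

  isZeroS : ∀ m → SPoly m → Bool
  isZeroH : ∀ m → List (SPoly m) → Bool
  isZeroS zero    p = isZeroℤ p
  isZeroS (suc m) (k , ps) = isZeroH m ps
  isZeroH m [] = true
  isZeroH m (p ∷ ps) = isZeroS m p ∧ isZeroH m ps

  evS : ∀ m → SPoly m → Vec Series m → Series
  evH : ∀ m → List (SPoly m) → Series → Vec Series m → Series
  evS zero    c ρ = const c
  evS (suc m) (k , ps) (x ∷ ρ) = x ^ˢ k *ˢ evH m ps x ρ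
  evH m [] x ρ = 0ˢ
  evH m (p ∷ ps) x ρ = evS m p ρ +ˢ x *ˢ evH m ps x ρ

  constS-sound : ∀ m c ρ → evS m (constS m c) ρ ≈ˢ const c
  constS-sound zero    c ρ = SR.refl
  constS-sound (suc m) c (x ∷ ρ) = SR.trans (SR.*-identityˡ _)
    (SR.trans (SR.+-cong (constS-sound m c ρ) (SR.zeroʳ x)) (SR.+-identityʳ (const c)))

  zeroS-sound : ∀ m ρ → evS m (zeroS m) ρ ≈ˢ 0ˢ
  zeroS-sound zero    ρ = SR.sym 0ˢ≈const
  zeroS-sound (suc m) (x ∷ ρ) = SR.zeroʳ 1ˢ

  varS-sound : ∀ {m} (i : Fin m) ρ → evS m (varS i) ρ ≈ˢ lookup ρ i
  varS-sound {suc m} zero (x ∷ ρ) = SR.trans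
    (SR.*-cong (SR.*-identityʳ x) (SR.trans (SR.+-cong (constS-sound m 1ℤ ρ) (SR.zeroʳ x)) (SR.+-identityʳ 1ˢ))) (SR.*-identityʳ x)
  varS-sound {suc m} (suc i) (x ∷ ρ) = SR.trans (SR.*-identityˡ _)
    (SR.trans (SR.+-cong (varS-sound i ρ) (SR.zeroʳ x)) (SR.+-identityʳ _))

  pad-sound : ∀ m k ps x ρ → evH m (pad m k ps) x ρ ≈ˢ x ^ˢ k *ˢ evH m ps x ρ
  pad-sound m zero    ps x ρ = SR.sym (SR.*-identityˡ _)
  pad-sound m (suc k) ps x ρ = SR.trans (SR.+-cong (zeroS-sound m ρ) (SR.*-congˡ {x} (pad-sound m k ps x ρ)))
    (SR.trans (SR.+-identityˡ _) (SR.sym (SR.*-assoc x (x ^ˢ k) (evH m ps x ρ))))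

  ^-+-∸ : ∀ x {k l} → k ≤ l → x ^ˢ l ≈ˢ x ^ˢ k *ˢ x ^ˢ (l ℕ.∸ k)
  ^-+-∸ x {k} {l} k≤l = SR.trans (^-congʳ x (sym (ℕₚ.m+[n∸m]≡n k≤l))) (^-homo-* x k (l ℕ.∸ k))

  addS-sound : ∀ m p q ρ → evS m (addS m p q) ρ ≈ˢ evS m p ρ +ˢ evS m q ρ
  addH-sound : ∀ m ps qs x ρ → evH m (addH m ps qs) x ρ ≈ˢ evH m ps x ρ +ˢ evH m qs x ρ
  addAt-sound : ∀ m k ps l qs x ρ b → (k ℕ.≤ᵇ l) ≡ b →
    evS (suc m) (addAt m k ps l qs b) (x ∷ ρ) ≈ˢ x ^ˢ k *ˢ evH m ps x ρ +ˢ x ^ˢ l *ˢ evH m qs x ρ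
  addS-sound zero    p q ρ = const-+ p q
  addS-sound (suc m) (k , ps)     (l , [])     (x ∷ ρ) = SR.sym (SR.trans (SR.+-congˡ {x ^ˢ k *ˢ evH m ps x ρ} (SR.zeroʳ (x ^ˢ l))) (SR.+-identityʳ _))
  addS-sound (suc m) (k , [])     (l , q ∷ qs) (x ∷ ρ) = SR.sym (SR.trans (SR.+-congʳ (SR.zeroʳ (x ^ˢ k))) (SR.+-identityˡ _))
  addS-sound (suc m) (k , p ∷ ps) (l , q ∷ qs) (x ∷ ρ) = addAt-sound m k (p ∷ ps) l (q ∷ qs) x ρ (k ℕ.≤ᵇ l) refl
  addAt-sound m k ps l qs x ρ true  eq = SR.trans
    (SR.*-congˡ {x ^ˢ k} (SR.trans (addH-sound m ps (pad m (l ℕ.∸ k) qs) x ρ) (SR.+-congˡ {evH m ps x ρ} (pad-sound m (l ℕ.∸ k) qs x ρ))))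
    (SR.trans (byPoly (x ^ˢ k ∷ evH m ps x ρ ∷ x ^ˢ (l ℕ.∸ k) ∷ evH m qs x ρ ∷ [])
        (var (# 0) :* (var (# 1) :+ var (# 2) :* var (# 3))) (var (# 0) :* var (# 1) :+ (var (# 0) :* var (# 2)) :* var (# 3)) refl)
      (SR.+-congˡ {x ^ˢ k *ˢ evH m ps x ρ} (SR.*-congʳ {evH m qs x ρ} (SR.sym (^-+-∸ x {k} {l} (ℕₚ.≤ᵇ⇒≤ k l (subst T (sym eq) _)))))))
  addAt-sound m k ps l qs x ρ false eq = SR.trans
    (SR.*-congˡ {x ^ˢ l} (SR.trans (addH-sound m (pad m (k ℕ.∸ l) ps) qs x ρ) (SR.+-congʳ {evH m qs x ρ} (pad-sound m (k ℕ.∸ l) ps x ρ))))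
    (SR.trans (byPoly (x ^ˢ l ∷ evH m ps x ρ ∷ x ^ˢ (k ℕ.∸ l) ∷ evH m qs x ρ ∷ [])
        (var (# 0) :* (var (# 2) :* var (# 1) :+ var (# 3))) ((var (# 0) :* var (# 2)) :* var (# 1) :+ var (# 0) :* var (# 3)) refl)
      (SR.+-congʳ (SR.*-congʳ {evH m ps x ρ} (SR.sym (^-+-∸ x {l} {k} (ℕₚ.<⇒≤ (ℕₚ.≰⇒> λ k≤l → subst T eq (ℕₚ.≤⇒≤ᵇ {k} {l} k≤l))))))))
  addH-sound m [] qs x ρ = SR.sym (SR.+-identityˡ _)
  addH-sound m (p ∷ ps) [] x ρ = SR.sym (SR.+-identityʳ _)
  addH-sound m (p ∷ ps) (q ∷ qs) x ρ = SR.trans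
    (SR.+-cong (addS-sound m p q ρ) (SR.*-congˡ {x} (addH-sound m ps qs x ρ)))
    (byPoly (evS m p ρ ∷ evH m ps x ρ ∷ evS m q ρ ∷ evH m qs x ρ ∷ x ∷ [])
      ((var (# 0) :+ var (# 2)) :+ var (# 4) :* (var (# 1) :+ var (# 3))) ((var (# 0) :+ var (# 4) :* var (# 1)) :+ (var (# 2) :+ var (# 4) :* var (# 3))) refl)

  negS-sound : ∀ m p ρ → evS m (negS m p) ρ ≈ˢ const -1ℤ *ˢ evS m p ρ
  negH-sound : ∀ m ps x ρ → evH m (negH m ps) x ρ ≈ˢ const -1ℤ *ˢ evH m ps x ρ
  negS-sound zero    p ρ = SR.trans (≡⇒≈ (cong const (sym (ℤₚ.-1*i≡-i p)))) (const-* -1ℤ p)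
  negS-sound (suc m) (k , ps) (x ∷ ρ) = SR.trans (SR.*-congˡ {x ^ˢ k} (negH-sound m ps x ρ))
    (byPoly (x ^ˢ k ∷ evH m ps x ρ ∷ []) (var (# 0) :* (con -1ℤ :* var (# 1))) (con -1ℤ :* (var (# 0) :* var (# 1))) refl)
  negH-sound m [] x ρ = SR.sym (SR.zeroʳ (const -1ℤ))
  negH-sound m (p ∷ ps) x ρ = SR.trans (SR.+-cong (negS-sound m p ρ) (SR.*-congˡ {x} (negH-sound m ps x ρ)))
    (byPoly (evS m p ρ ∷ evH m ps x ρ ∷ x ∷ []) (con -1ℤ :* var (# 0) :+ var (# 2) :* (con -1ℤ :* var (# 1))) (con -1ℤ :* (var (# 0) :+ var (# 2) :* var (# 1))) refl)

  mulS-sound : ∀ m p q ρ → evS m (mulS m p q) ρ ≈ˢ evS m p ρ *ˢ evS m q ρ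
  mulH-sound : ∀ m ps qs x ρ → evH m (mulH m ps qs) x ρ ≈ˢ evH m ps x ρ *ˢ evH m qs x ρ
  scaleH-sound : ∀ m p qs x ρ → evH m (scaleH m p qs) x ρ ≈ˢ evS m p ρ *ˢ evH m qs x ρ
  mulS-sound zero    p q ρ = const-* p q
  mulS-sound (suc m) (k , ps) (l , qs) (x ∷ ρ) = SR.trans
    (SR.*-cong (^-homo-* x k l) (mulH-sound m ps qs x ρ))
    (byPoly (x ^ˢ k ∷ x ^ˢ l ∷ evH m ps x ρ ∷ evH m qs x ρ ∷ []) ((var (# 0) :* var (# 1)) :* (var (# 2) :* var (# 3))) ((var (# 0) :* var (# 2)) :* (var (# 1) :* var (# 3))) refl)
  mulH-sound m [] qs x ρ = SR.sym (SR.zeroˡ _)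
  mulH-sound m (p ∷ ps) qs x ρ = SR.trans (addH-sound m (scaleH m p qs) (zeroS m ∷ mulH m ps qs) x ρ)
    (SR.trans (SR.+-cong (scaleH-sound m p qs x ρ) (SR.trans (SR.+-cong (zeroS-sound m ρ) (SR.*-congˡ {x} (mulH-sound m ps qs x ρ))) (SR.+-identityˡ _)))
      (byPoly (evS m p ρ ∷ evH m ps x ρ ∷ evH m qs x ρ ∷ x ∷ []) (var (# 0) :* var (# 2) :+ var (# 3) :* (var (# 1) :* var (# 2))) ((var (# 0) :+ var (# 3) :* var (# 1)) :* var (# 2)) refl))
  scaleH-sound m p [] x ρ = SR.sym (SR.zeroʳ _)
  scaleH-sound m p (q ∷ qs) x ρ = SR.trans (SR.+-cong (mulS-sound m p q ρ) (SR.*-congˡ {x} (scaleH-sound m p qs x ρ)))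
    (byPoly (evS m p ρ ∷ evS m q ρ ∷ evH m qs x ρ ∷ x ∷ []) (var (# 0) :* var (# 1) :+ var (# 3) :* (var (# 0) :* var (# 2))) (var (# 0) :* (var (# 1) :+ var (# 3) :* var (# 2))) refl)

  isZeroS-sound : ∀ m p ρ → isZeroS m p ≡ true → evS m p ρ ≈ˢ 0ˢ
  isZeroH-sound : ∀ m ps x ρ → isZeroH m ps ≡ true → evH m ps x ρ ≈ˢ 0ˢ
  isZeroS-sound zero    p ρ eq = isZeroP-sound 0 p ρ eq
  isZeroS-sound (suc m) (k , ps) (x ∷ ρ) eq = SR.trans (SR.*-congˡ {x ^ˢ k} (isZeroH-sound m ps x ρ eq)) (SR.zeroʳ (x ^ˢ k))
  isZeroH-sound m [] x ρ _ = SR.refl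
  isZeroH-sound m (p ∷ ps) x ρ eq = let e₁ , e₂ = ∧-true eq in
    SR.trans (SR.+-cong (isZeroS-sound m p ρ e₁) (SR.trans (SR.*-congˡ {x} (isZeroH-sound m ps x ρ e₂)) (SR.zeroʳ x))) (SR.+-identityˡ _)

  nfS : ∀ {m} → Expr m → SPoly m
  nfS {m} (con c)   = constS m c
  nfS     (var i)   = varS i
  nfS {m} (e :+ e′) = addS m (nfS e) (nfS e′)
  nfS {m} (e :- e′) = addS m (nfS e) (negS m (nfS e′))
  nfS {m} (e :* e′) = mulS m (nfS e) (nfS e′)
  nfS {m} (e :^ zero)  = constS m 1ℤ
  nfS {m} (e :^ suc i) = mulS m (nfS e) (nfS (e :^ i))

  nfS-sound : ∀ {m} (e : Expr m) ρ → evS m (nfS e) ρ ≈ˢ ⟦ e ⟧ ρ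
  nfS-sound {m} (con c)   ρ = constS-sound m c ρ
  nfS-sound     (var i)   ρ = varS-sound i ρ
  nfS-sound {m} (e :+ e′) ρ = SR.trans (addS-sound m (nfS e) (nfS e′) ρ) (SR.+-cong (nfS-sound e ρ) (nfS-sound e′ ρ))
  nfS-sound {m} (e :- e′) ρ = SR.trans (addS-sound m (nfS e) (negS m (nfS e′)) ρ) (SR.trans
    (SR.+-cong (nfS-sound e ρ) (SR.trans (negS-sound m (nfS e′) ρ) (SR.*-congˡ {const -1ℤ} (nfS-sound e′ ρ))))
    (byPoly (⟦ e ⟧ ρ ∷ ⟦ e′ ⟧ ρ ∷ []) (var (# 0) :+ con -1ℤ :* var (# 1)) (var (# 0) :- var (# 1)) refl))
  nfS-sound {m} (e :* e′) ρ = SR.trans (mulS-sound m (nfS e) (nfS e′) ρ) (SR.*-cong (nfS-sound e ρ) (nfS-sound e′ ρ))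
  nfS-sound {m} (e :^ zero)  ρ = constS-sound m 1ℤ ρ
  nfS-sound {m} (e :^ suc i) ρ = SR.trans (mulS-sound m (nfS e) (nfS (e :^ i)) ρ) (SR.*-cong (nfS-sound e ρ) (nfS-sound (e :^ i) ρ))

  -- The ring of polynomials in d variables with a square root of root adjoined as the last variable

  module QuadraticForms (d : ℕ) (root : SPoly d) where

    QPoly : Set
    QPoly = SPoly d × SPoly d

    addQ mulQ : QPoly → QPoly → QPoly
    addQ (a , b) (c , e) = addS d a c , addS d b e
    mulQ (a , b) (c , e) = addS d (mulS d a c) (mulS d root (mulS d b e)) , addS d (mulS d a e) (mulS d b c)

    negQ : QPoly → QPoly
    negQ (a , b) = negS d a , negS d b

    constQ : ℤ → QPoly
    constQ c = constS d c , zeroS d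

    powQ : QPoly → ℕ → QPoly
    powQ a zero    = constQ 1ℤ
    powQ a (suc i) = mulQ a (powQ a i)

    varQ : Fin d ⊎ Fin 1 → QPoly
    varQ (inj₁ i) = varS i , zeroS d
    varQ (inj₂ _) = zeroS d , constS d 1ℤ

    nfQ : Expr (d ℕ.+ 1) → QPoly
    nfQ (con c)   = constQ c
    nfQ (var i)   = varQ (splitAt d i)
    nfQ (e :+ e′) = addQ (nfQ e) (nfQ e′)
    nfQ (e :- e′) = addQ (nfQ e) (negQ (nfQ e′))
    nfQ (e :* e′) = mulQ (nfQ e) (nfQ e′)
    nfQ (e :^ i)  = powQ (nfQ e) i

    isZeroQ : QPoly → Bool
    isZeroQ (a , b) = isZeroS d a ∧ isZeroS d b

    module Quadratic (base : Vec Series d) (z : Series) (relation : z *ˢ z ≈ˢ evS d root base) where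

      ev : SPoly d → Series
      ev a = evS d a base

      evQ : QPoly → Series
      evQ (a , b) = ev a +ˢ z *ˢ ev b

      addQ-sound : ∀ a b → evQ (addQ a b) ≈ˢ evQ a +ˢ evQ b
      addQ-sound (a , b) (c , e) = SR.trans (SR.+-cong (addS-sound d a c base) (SR.*-congˡ {z} (addS-sound d b e base)))
        (byPoly (ev a ∷ ev b ∷ ev c ∷ ev e ∷ z ∷ [])
          ((var (# 0) :+ var (# 2)) :+ var (# 4) :* (var (# 1) :+ var (# 3))) ((var (# 0) :+ var (# 4) :* var (# 1)) :+ (var (# 2) :+ var (# 4) :* var (# 3))) refl)

      subQ-sound : ∀ a b → evQ (addQ a (negQ b)) ≈ˢ evQ a -ˢ evQ b
      subQ-sound a (c , e) = SR.trans (addQ-sound a (negQ (c , e))) (SR.trans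
        (SR.+-congˡ {evQ a} (SR.+-cong (negS-sound d c base) (SR.*-congˡ {z} (negS-sound d e base))))
        (byPoly (evQ a ∷ ev c ∷ ev e ∷ z ∷ []) (var (# 0) :+ (con -1ℤ :* var (# 1) :+ var (# 3) :* (con -1ℤ :* var (# 2))))
          (var (# 0) :- (var (# 1) :+ var (# 3) :* var (# 2))) refl))

      mulQ-sound : ∀ a b → evQ (mulQ a b) ≈ˢ evQ a *ˢ evQ b
      mulQ-sound (a , b) (c , e) = begin
        ev (addS d (mulS d a c) (mulS d root (mulS d b e))) +ˢ z *ˢ ev (addS d (mulS d a e) (mulS d b c))
          ≈⟨ SR.+-cong (SR.trans (addS-sound d (mulS d a c) (mulS d root (mulS d b e)) base) (SR.+-cong (mulS-sound d a c base)
                 (SR.trans (mulS-sound d root (mulS d b e) base) (SR.*-cong (SR.sym relation) (mulS-sound d b e base)))))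
               (SR.*-congˡ {z} (SR.trans (addS-sound d (mulS d a e) (mulS d b c) base) (SR.+-cong (mulS-sound d a e base) (mulS-sound d b c base)))) ⟩
        (ev a *ˢ ev c +ˢ (z *ˢ z) *ˢ (ev b *ˢ ev e)) +ˢ z *ˢ (ev a *ˢ ev e +ˢ ev b *ˢ ev c)
          ≈⟨ byPoly (ev a ∷ ev b ∷ ev c ∷ ev e ∷ z ∷ []) ((w₀ :* w₂ :+ (w₄ :* w₄) :* (w₁ :* w₃)) :+ w₄ :* (w₀ :* w₃ :+ w₁ :* w₂))
               ((w₀ :+ w₄ :* w₁) :* (w₂ :+ w₄ :* w₃)) refl ⟩
        (ev a +ˢ z *ˢ ev b) *ˢ (ev c +ˢ z *ˢ ev e) ∎
        where
        w₀ w₁ w₂ w₃ w₄ : Expr 5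
        w₀ = var (# 0) ; w₁ = var (# 1) ; w₂ = var (# 2) ; w₃ = var (# 3) ; w₄ = var (# 4)

      z*0 : z *ˢ ev (zeroS d) ≈ˢ 0ˢ
      z*0 = SR.trans (SR.*-congˡ {z} (zeroS-sound d base)) (SR.zeroʳ z)

      constQ-sound : ∀ c → evQ (constQ c) ≈ˢ const c
      constQ-sound c = SR.trans (SR.+-cong (constS-sound d c base) z*0) (SR.+-identityʳ (const c))

      powQ-sound : ∀ a i → evQ (powQ a i) ≈ˢ evQ a ^ˢ i
      powQ-sound a zero    = constQ-sound 1ℤ
      powQ-sound a (suc i) = SR.trans (mulQ-sound a (powQ a i)) (SR.*-congˡ {evQ a} (powQ-sound a i))

      varQ-sound : ∀ i → evQ (varQ i) ≈ˢ Sum.[ lookup base , lookup (z ∷ []) ]′ i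
      varQ-sound (inj₁ i)    = SR.trans (SR.+-cong (varS-sound i base) z*0) (SR.+-identityʳ (lookup base i))
      varQ-sound (inj₂ zero) = SR.trans (SR.+-cong (zeroS-sound d base) (SR.*-congˡ {z} (constS-sound d 1ℤ base)))
        (SR.trans (SR.+-identityˡ (z *ˢ 1ˢ)) (SR.*-identityʳ z))

      nfQ-sound : ∀ e → evQ (nfQ e) ≈ˢ ⟦ e ⟧ (base Vec.++ z ∷ [])
      nfQ-sound (con c) = constQ-sound c
      nfQ-sound (var i) = SR.trans (varQ-sound (splitAt d i)) (≡⇒≈ (sym (Vecₚ.lookup-splitAt d base (z ∷ []) i)))
      nfQ-sound (e :+ e′) = SR.trans (addQ-sound (nfQ e) (nfQ e′)) (SR.+-cong (nfQ-sound e) (nfQ-sound e′))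
      nfQ-sound (e :- e′) = SR.trans (subQ-sound (nfQ e) (nfQ e′)) (-ˢ-cong (nfQ-sound e) (nfQ-sound e′))
      nfQ-sound (e :* e′) = SR.trans (mulQ-sound (nfQ e) (nfQ e′)) (SR.*-cong (nfQ-sound e) (nfQ-sound e′))
      nfQ-sound (e :^ i)  = SR.trans (powQ-sound (nfQ e) i) (^-congˡ i (nfQ-sound e))

      byRelation : ∀ e e′ → isZeroQ (nfQ (e :- e′)) ≡ true → ⟦ e ⟧ (base Vec.++ z ∷ []) ≈ˢ ⟦ e′ ⟧ (base Vec.++ z ∷ [])
      byRelation e e′ eq = let e₁ , e₂ = ∧-true eq in
        -ˢ≈0⇒≈ (SR.trans (SR.sym (nfQ-sound (e :- e′))) (SR.trans
          (SR.+-cong (isZeroS-sound d _ base e₁) (SR.trans (SR.*-congˡ {z} (isZeroS-sound d _ base e₂)) (SR.zeroʳ z))) (SR.+-identityʳ 0ˢ)))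

  rootExpr : Expr 3
  rootExpr = X₀ :^ 4 :- k 100 :* X₀ :^ 3 :* X₁ :+ k 1400 :* X₀ :^ 2 :* X₁ :^ 2 :- k 5500 :* X₀ :* X₁ :^ 3
    where
    X₀ X₁ : Expr 3
    X₀ = var (# 0) ; X₁ = var (# 1)

  open QuadraticForms 3 (nfS rootExpr) public

  -- `𝐪`, `𝐫` are 25 E₄, 125 E₆ in the coordinates, and `𝐪′`, `𝐫′` are 25 · 121 E₄(q^11), 125 · 1331
  -- E₆(q^11). `𝐜` is half of the derivative of `𝐩` with respect to x.
  𝐪 𝐫 𝐪′ 𝐫′ 𝐜 : Expr 4
  𝐪 = 𝐚 :+ k 60 :* 𝐳
  𝐪′ = 𝐚 :- k 60 :* 𝐳
  𝐫 = 𝐳 :* 𝐥 :+ 𝐛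
  𝐫′ = 𝐳 :* 𝐥 :- 𝐛
  𝐜 = k 2 :* 𝐱 :^ 3 :- k 150 :* 𝐱 :^ 2 :* 𝐟 :+ k 1400 :* 𝐱 :* 𝐟 :^ 2 :- k 2750 :* 𝐟 :^ 3

  -- The rule for z is what differentiating z² = 𝐩 predicts: 𝐩 is homogeneous of degree 4 in x and
  -- f, so 2 z θ z = 4 s 𝐩 + (2/5) z 𝐜, that is 5 θ z = 10 s z + 𝐜.
  levelRule : Fin 4 → Expr 4
  levelRule zero                   = k 720 :* (k 5 :* (𝐬 :* 𝐱) :+ 𝐳)
  levelRule (suc zero)             = k 3600 :* (𝐟 :* 𝐬)
  levelRule (suc (suc zero))       = k 25 :* (k 72 :* (𝐬 :* 𝐬) :+ k 2 :* (𝐆 :* 𝐆)) :- k 2 :* 𝐚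
  levelRule (suc (suc (suc zero))) = k 720 :* (k 10 :* (𝐬 :* 𝐳) :+ 𝐜)

  -- The ring of level 11 forms, expanded at one of the two cusps; 12 s = P + 11 P(q^11).
  -- δ stands for an eta quotient with 2 θ δ = (5 s + G) δ.
  record Cusp : Set where
    field
      xᶜ fᶜ zᶜ δ : Series
    ρ : Vec Series 4
    ρ = xᶜ ∷ fᶜ ∷ s ∷ zᶜ ∷ []
    field
      relation : zᶜ *ˢ zᶜ ≈ˢ ⟦ 𝐩 ⟧ ρ
      rules    : ∀ i → const (+ 3600) *ˢ θ (lookup ρ i) ≈ˢ ⟦ levelRule i ⟧ ρ
      δ-rule   : const (+ 2) *ˢ θ δ ≈ˢ ⟦ k 5 :* 𝐬 :+ 𝐆 ⟧ ρ *ˢ δ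
    open Quadratic (xᶜ ∷ fᶜ ∷ s ∷ []) zᶜ (SR.trans relation (SR.sym (nfS-sound rootExpr (xᶜ ∷ fᶜ ∷ s ∷ [])))) public

    θ⟦⟧ : ∀ e → const (+ 3600) *ˢ θ (⟦ e ⟧ ρ) ≈ˢ ⟦ derivation levelRule e ⟧ ρ
    θ⟦⟧ = derivation-sound (+ 3600) levelRule ρ rules

  -- Logarithmic derivative of d = a^i / b, with the quotient expressed by d b = a^i and b cancelled
  -- at the end.
  η-quotient-rule : ∀ {a b c d u v} i → const (+ 24) *ˢ θ a ≈ˢ a *ˢ u → const (+ 24) *ˢ θ b ≈ˢ b *ˢ v →
    c ≈ˢ a ^ˢ i → d *ˢ b ≈ˢ c → b 0 ≢ 0ℤ → const (+ 24) *ˢ θ d ≈ˢ d *ˢ (const (+ i) *ˢ u -ˢ v)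
  η-quotient-rule {a} {b} {c} {d} {u} {v} i θa θb c≈ db≈ b₀ = *ˢ-cancelˡ b b₀ (byHyps {ρ = b ∷ d ∷ θ b ∷ θ d ∷ u ∷ v ∷ θ c ∷ c ∷ const (+ i) ∷ []} (+ 1)
    ( (k 24 · var (# 3) :* var (# 0) :+ var (# 1) :* var (# 2) ≈ var (# 6) by SR.trans (SR.sym (θ-* d b)) (θ-cong db≈))
    ∷ (k 1 · k 24 :* var (# 6) ≈ var (# 7) :* (var (# 8) :* var (# 4)) by SR.trans (SR.*-congˡ {const (+ 24)} (θ-cong c≈)) (SR.trans (power i) (SR.*-congʳ (SR.sym c≈))))
    ∷ (n 1 :* var (# 1) · k 24 :* var (# 2) ≈ var (# 0) :* var (# 5) by θb)
    ∷ (n 1 :* (var (# 8) :* var (# 4)) · var (# 1) :* var (# 0) ≈ var (# 7) by db≈)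
    ∷ []) (var (# 0) :* (k 24 :* var (# 3))) (var (# 0) :* (var (# 1) :* (var (# 8) :* var (# 4) :- var (# 5)))) (λ ()) refl)
    where
    power : ∀ m → const (+ 24) *ˢ θ (a ^ˢ m) ≈ˢ a ^ˢ m *ˢ (const (+ m) *ˢ u)
    power zero = SR.trans (SR.*-congˡ {const (+ 24)} (θ-const 1ℤ)) (SR.trans (SR.zeroʳ _) (SR.sym
      (SR.trans (SR.*-congˡ {1ˢ} (SR.trans (SR.*-congʳ {u} (SR.sym 0ˢ≈const)) (SR.zeroˡ u))) (SR.zeroʳ 1ˢ))))
    power (suc m) = byHyps {ρ = a ∷ a ^ˢ m ∷ θ a ∷ θ (a ^ˢ m) ∷ u ∷ const (+ m) ∷ θ (a ^ˢ suc m) ∷ const (+ suc m) ∷ []} (+ 1)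
      ( (k 24 · var (# 6) ≈ var (# 2) :* var (# 1) :+ var (# 0) :* var (# 3) by θ-* a (a ^ˢ m))
      ∷ (var (# 1) · k 24 :* var (# 2) ≈ var (# 0) :* var (# 4) by θa)
      ∷ (var (# 0) · k 24 :* var (# 3) ≈ var (# 1) :* (var (# 5) :* var (# 4)) by power m)
      ∷ (n 1 :* (var (# 0) :* var (# 1) :* var (# 4)) · var (# 7) ≈ k 1 :+ var (# 5) by SR.trans (≡⇒≈ (cong const (ℤₚ.pos-+ 1 m))) (const-+ 1ℤ (+ m)))
      ∷ []) (k 24 :* var (# 6)) (var (# 0) :* var (# 1) :* (var (# 7) :* var (# 4))) (λ ()) refl

  -- η(11τ)^11/η(τ) and η(τ)^11/η(11τ), which have weight 5 and are interchanged by the Fricke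
  -- involution up to a scalar. The exponent 5 is (121 - 1)/24.
  δ∞ δ₀ : Series
  δ∞ = X ^ˢ 5 *ˢ (V φ ^ˢ 11 *ˢ ψ)
  δ₀ = φ ^ˢ 11 *ˢ V ψ

  VφVψ≈1 : V φ *ˢ V ψ ≈ˢ 1ˢ
  VφVψ≈1 = SR.trans (SR.sym (V-* φ ψ)) (SR.trans (V-cong φψ≈1) (V-const 1ℤ))

  δ∞φ : δ∞ *ˢ φ ≈ˢ X ^ˢ 5 *ˢ V φ ^ˢ 11
  δ∞φ = byHyps {ρ = X ^ˢ 5 ∷ V φ ^ˢ 11 ∷ ψ ∷ φ ∷ []} (+ 1) ((var (# 0) :* var (# 1) · var (# 3) :* var (# 2) ≈ k 1 by φψ≈1) ∷ [])
    (var (# 0) :* (var (# 1) :* var (# 2)) :* var (# 3)) (var (# 0) :* var (# 1)) (λ ()) refl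

  δ₀Vφ : δ₀ *ˢ V φ ≈ˢ φ ^ˢ 11
  δ₀Vφ = byHyps {ρ = φ ^ˢ 11 ∷ V ψ ∷ V φ ∷ []} (+ 1) ((var (# 0) · var (# 2) :* var (# 1) ≈ k 1 by VφVψ≈1) ∷ [])
    (var (# 0) :* var (# 1) :* var (# 2)) (var (# 0)) (λ ()) refl

  θδ₀ : const (+ 24) *ˢ θ δ₀ ≈ˢ δ₀ *ˢ (const (+ 11) *ˢ (E₂ -ˢ 1ˢ) -ˢ (const (+ 11) *ˢ V E₂ -ˢ const (+ 11)))
  θδ₀ = η-quotient-rule {c = φ ^ˢ 11} 11 24θφ 24θVφ SR.refl δ₀Vφ (λ ())

  θδ∞ : const (+ 24) *ˢ θ δ∞ ≈ˢ δ∞ *ˢ (const (+ 120) +ˢ (const (+ 11) *ˢ (const (+ 11) *ˢ V E₂ -ˢ const (+ 11)) -ˢ (E₂ -ˢ 1ˢ)))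
  θδ∞ = byHyps {ρ = X ^ˢ 5 ∷ E ∷ θ (X ^ˢ 5) ∷ θ E ∷ θ δ∞ ∷ E₂ ∷ V E₂ ∷ []} (+ 1)
    ( (k 24 · var (# 4) ≈ var (# 2) :* var (# 1) :+ var (# 0) :* var (# 3) by θ-* (X ^ˢ 5) E)
    ∷ (k 24 :* var (# 1) · var (# 2) ≈ k 5 :* var (# 0) by θ-X^ 5)
    ∷ (var (# 0) · k 24 :* var (# 3) ≈ var (# 1) :* (k 11 :* (k 11 :* var (# 6) :- k 11) :- (var (# 5) :- k 1)) by θE)
    ∷ []) (k 24 :* var (# 4)) (var (# 0) :* var (# 1) :* (k 120 :+ (k 11 :* (k 11 :* var (# 6) :- k 11) :- (var (# 5) :- k 1)))) (λ ()) refl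
    where
    E = V φ ^ˢ 11 *ˢ ψ
    Eφ : E *ˢ φ ≈ˢ V φ ^ˢ 11
    Eφ = byHyps {ρ = V φ ^ˢ 11 ∷ ψ ∷ φ ∷ []} (+ 1) ((var (# 0) · var (# 2) :* var (# 1) ≈ k 1 by φψ≈1) ∷ [])
      (var (# 0) :* var (# 1) :* var (# 2)) (var (# 0)) (λ ()) refl
    θE : const (+ 24) *ˢ θ E ≈ˢ E *ˢ (const (+ 11) *ˢ (const (+ 11) *ˢ V E₂ -ˢ const (+ 11)) -ˢ (E₂ -ˢ 1ˢ))
    θE = η-quotient-rule {c = V φ ^ˢ 11} 11 24θVφ 24θφ SR.refl Eφ (λ ())

  25Q₊ : const (+ 25) *ˢ Q₊ ≈ˢ const (+ 2) *ˢ ⟦ 𝐚 ⟧ (x ∷ f ∷ s ∷ z ∷ [])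
  25Q₊ = -ˢ≈0⇒≈ (Level11.defects≈0 (# 0))

  125R₋ : const (+ 125) *ˢ R₋ ≈ˢ const (+ 2) *ˢ ⟦ 𝐛 ⟧ (x ∷ f ∷ s ∷ z ∷ [])
  125R₋ = -ˢ≈0⇒≈ (Level11.defects≈0 (# 1))

  125R₊ : const (+ 125) *ˢ R₊ ≈ˢ const (+ 2) *ˢ z *ˢ ⟦ 𝐥 ⟧ (x ∷ f ∷ s ∷ z ∷ [])
  125R₊ = -ˢ≈0⇒≈ (Level11.defects≈0 (# 2))

  lift+ : ∀ {m} → Expr 4 → Expr (4 ℕ.+ m)
  lift+ (con c)   = con c
  lift+ (var zero) = var zero
  lift+ (var (suc zero)) = var (suc zero)
  lift+ (var (suc (suc zero))) = var (suc (suc zero))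
  lift+ (var (suc (suc (suc zero)))) = var (suc (suc (suc zero)))
  lift+ (e :+ e′) = lift+ e :+ lift+ e′
  lift+ (e :- e′) = lift+ e :- lift+ e′
  lift+ (e :* e′) = lift+ e :* lift+ e′
  lift+ (e :^ i)  = lift+ e :^ i

  cusp∞ : Cusp
  cusp∞ = record
    { xᶜ = x ; fᶜ = f ; zᶜ = z ; δ = δ∞
    ; relation = -ˢ≈0⇒≈ (Level11.defects≈0 (# 3))
    ; rules = λ
      { zero                   → Level11.scaled 720 5 θx≈
      ; (suc zero)             → SR.*-congˡ {const (+ 3600)} θf≈
      ; (suc (suc zero))       → byHyps {ρ = σ} (+ 1)
          ( (k 25 · k 144 :* var (# 6) ≈ k 72 :* (S :* S) :+ k 2 :* (var (# 5) :* var (# 5)) :- var (# 4) by θs≈)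
          ∷ (n 1 · k 25 :* var (# 4) ≈ k 2 :* lift+ 𝐚 by 25Q₊)
          ∷ (k 50 :* (var (# 5) :+ lift+ 𝐆) · var (# 5) ≈ lift+ 𝐆 by G≈)
          ∷ []) (k 3600 :* var (# 6)) (lift+ (levelRule (# 2))) (λ ()) refl
      ; (suc (suc (suc zero))) → byHyps {ρ = σ} (+ 1)
          ( (k 50 · k 72 :* var (# 7) ≈ k 144 :* S :* var (# 3) :- k 5 :* var (# 5) :* var (# 4) :- k 5 :* var (# 8) by θz≈)
          ∷ (n 250 :* var (# 4) · var (# 5) ≈ lift+ 𝐆 by G≈)
          ∷ (n 10 :* lift+ 𝐆 · k 25 :* var (# 4) ≈ k 2 :* lift+ 𝐚 by 25Q₊)
          ∷ (n 2 · k 125 :* var (# 8) ≈ k 2 :* lift+ 𝐛 by 125R₋)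
          ∷ []) (k 3600 :* var (# 7)) (lift+ (levelRule (# 3))) (λ ()) refl }
    ; δ-rule = byHyps {ρ = x ∷ f ∷ s ∷ z ∷ δ∞ ∷ θ δ∞ ∷ E₂ ∷ V E₂ ∷ G ∷ []} (+ 12)
        ( (k 1 · k 24 :* var (# 5) ≈ var (# 4) :* (k 120 :+ (k 11 :* (k 11 :* var (# 7) :- k 11) :- (var (# 6) :- k 1))) by θδ∞)
        ∷ (n 1 :* var (# 4) · var (# 6) ≈ k 6 :* S :- var (# 8) by P≈)
        ∷ (k 11 :* var (# 4) · k 11 :* var (# 7) ≈ k 6 :* S :+ var (# 8) by P′≈)
        ∷ (k 12 :* var (# 4) · var (# 8) ≈ lift+ 𝐆 by G≈)
        ∷ []) (k 2 :* var (# 5)) ((k 5 :* S :+ lift+ 𝐆) :* var (# 4)) (λ ()) refl }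
    where
    σ : Vec Series 9
    σ = x ∷ f ∷ s ∷ z ∷ Q₊ ∷ G ∷ θ s ∷ θ z ∷ R₋ ∷ []
    S : Expr 9
    S = var (# 2)
    G≈ : G ≈ˢ x -ˢ const (+ 8) *ˢ f
    G≈ = byPoly (G ∷ f ∷ []) (var (# 0)) (var (# 0) :+ k 8 :* var (# 1) :- k 8 :* var (# 1)) refl

  -ˢ1* : Series → Series
  -ˢ1* a = const -1ℤ *ˢ a

  θ-negated : ∀ c {a b} → const c *ˢ θ a ≈ˢ b → const c *ˢ θ (-ˢ1* a) ≈ˢ -ˢ1* b
  θ-negated c {a} p = SR.trans (SR.*-congˡ {const c} (θ-const* -1ℤ a)) (SR.trans
    (byPoly (const c ∷ θ a ∷ []) (var (# 0) :* (con -1ℤ :* var (# 1))) (con -1ℤ :* (var (# 0) :* var (# 1))) refl) (SR.*-congˡ {const -1ℤ} p))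

  -- The expansion at the cusp 0, i.e. after the Fricke involution, suitably normalised.
  cusp₀ : Cusp
  cusp₀ = record
    { xᶜ = -ˢ1* x ; fᶜ = -ˢ1* f ; zᶜ = -ˢ1* z ; δ = δ₀
    ; relation = byHyps {ρ = ρ∞} (+ 1) ((k 1 · 𝐳 :* 𝐳 ≈ 𝐩 by Cusp.relation cusp∞) ∷ [])
        (N 𝐳 :* N 𝐳) (N 𝐱 :^ 4 :- k 100 :* N 𝐱 :^ 3 :* N 𝐟 :+ k 1400 :* N 𝐱 :^ 2 :* N 𝐟 :^ 2 :- k 5500 :* N 𝐱 :* N 𝐟 :^ 3) (λ ()) refl
    ; rules = λ
      { zero                   → SR.trans (θ-negated (+ 3600) {x} (Cusp.rules cusp∞ (# 0))) (byPoly ρ∞ (N (levelRule (# 0))) (negated (levelRule (# 0))) refl)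
      ; (suc zero)             → SR.trans (θ-negated (+ 3600) {f} (Cusp.rules cusp∞ (# 1))) (byPoly ρ∞ (N (levelRule (# 1))) (negated (levelRule (# 1))) refl)
      ; (suc (suc zero))       → SR.trans (Cusp.rules cusp∞ (# 2)) (byPoly ρ∞ (levelRule (# 2)) (negated (levelRule (# 2))) refl)
      ; (suc (suc (suc zero))) → SR.trans (θ-negated (+ 3600) {z} (Cusp.rules cusp∞ (# 3))) (byPoly ρ∞ (N (levelRule (# 3))) (negated (levelRule (# 3))) refl) }
    ; δ-rule = byHyps {ρ = x ∷ f ∷ s ∷ z ∷ δ₀ ∷ θ δ₀ ∷ E₂ ∷ V E₂ ∷ G ∷ []} (+ 12)
        ( (k 1 · k 24 :* var (# 5) ≈ var (# 4) :* (k 11 :* (var (# 6) :- k 1) :- (k 11 :* var (# 7) :- k 11)) by θδ₀)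
        ∷ (k 11 :* var (# 4) · var (# 6) ≈ k 6 :* var (# 2) :- var (# 8) by P≈)
        ∷ (n 1 :* var (# 4) · k 11 :* var (# 7) ≈ k 6 :* var (# 2) :+ var (# 8) by P′≈)
        ∷ (n 12 :* var (# 4) · var (# 8) ≈ lift+ 𝐆 by byPoly (G ∷ f ∷ []) (var (# 0)) (var (# 0) :+ k 8 :* var (# 1) :- k 8 :* var (# 1)) refl)
        ∷ []) (k 2 :* var (# 5)) ((k 5 :* var (# 2) :+ (con -1ℤ :* var (# 0) :- k 8 :* (con -1ℤ :* var (# 1)))) :* var (# 4)) (λ ()) refl }
    where
    ρ∞ : Vec Series 4
    ρ∞ = Cusp.ρ cusp∞
    N : Expr 4 → Expr 4
    N e = con -1ℤ :* e
    negated : Expr 4 → Expr 4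
    negated (con c) = con c
    negated (var zero) = N (var zero)
    negated (var (suc zero)) = N (var (suc zero))
    negated (var (suc (suc zero))) = var (suc (suc zero))
    negated (var (suc (suc (suc zero)))) = N (var (suc (suc (suc zero))))
    negated (e :+ e′) = negated e :+ negated e′
    negated (e :- e′) = negated e :- negated e′
    negated (e :* e′) = negated e :* negated e′
    negated (e :^ i) = negated e :^ i

open NormalForms

-- A basis over level 1, its connection, and its images under the operators.

module Tables where

  open import Relation.Binary.Reasoning.Setoid SR.setoid

  -- The module of level 11 forms over the ring of level 1 forms in q^11: basis xᵃ fᵇ with a < 3 and b < 4

  private
    k n : ∀ {m} → ℕ → Expr m
    k i = con (+ i)
    n i = con (ℤ.- (+ i))
    𝐱 = ring-𝐱 ; 𝐟 = ring-𝐟 ; 𝐬 = ring-𝐬 ; 𝐳 = ring-𝐳 ; 𝐆 = ring-𝐆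

  basisExponents : Vec (ℕ × ℕ) 12
  basisExponents = (0 , 0) ∷ (1 , 0) ∷ (2 , 0) ∷ (0 , 1) ∷ (1 , 1) ∷ (2 , 1) ∷ (0 , 2) ∷ (1 , 2) ∷ (2 , 2) ∷ (0 , 3) ∷ (1 , 3) ∷ (2 , 3) ∷ []

  basis : Fin 12 → Expr 4
  basis i = 𝐱 :^ proj₁ (lookup basisExponents i) :* 𝐟 :^ proj₂ (lookup basisExponents i)

  weight : Fin 12 → ℕ
  weight i = proj₁ (lookup basisExponents i) ℕ.+ proj₂ (lookup basisExponents i)

  Row : Set
  Row = Vec (List (ℤ × ℕ × ℕ)) 12

  scale : ℤ
  scale = + 14494590000

  -- connection and connectionδ describe the derivatives of the bⱼ and of the δ bⱼ in terms of the bⱼ, scaled to be integral.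
  -- They were found by linear algebra on q-expansions.
  -- An entry (c , i , j) stands for c (25 Q(q^11)·121)ⁱ (125 R(q^11)·1331)ʲ.
  connection connectionδ : Vec Row 12
  connection
    = ([] ∷ [] ∷ [] ∷ [] ∷ [] ∷ [] ∷ [] ∷ [] ∷ [] ∷ [] ∷ [] ∷ [] ∷ [])
    ∷ (((-[1+ 1449458999 ] , 1 , 0) ∷ []) ∷ [] ∷ ((+ 15944049000 , 0 , 0) ∷ []) ∷ [] ∷ ((-[1+ 2087220959999 ] , 0 , 0) ∷ []) ∷ [] ∷ ((+ 12755239200000 , 0 , 0) ∷ []) ∷ [] ∷ [] ∷ [] ∷ [] ∷ [] ∷ [])
    ∷ (((-[1+ 2635379999 ] , 0 , 1) ∷ []) ∷ ((+ 26353800000 , 1 , 0) ∷ []) ∷ [] ∷ ((-[1+ 347870159999 ] , 1 , 0) ∷ []) ∷ [] ∷ ((-[1+ 30960444239999 ] , 0 , 0) ∷ []) ∷ [] ∷ ((+ 102041913600000 , 0 , 0) ∷ []) ∷ [] ∷ ((+ 829090548000000 , 0 , 0) ∷ []) ∷ [] ∷ [] ∷ [])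
    ∷ ([] ∷ [] ∷ [] ∷ [] ∷ ((-[1+ 72472949999 ] , 0 , 0) ∷ []) ∷ [] ∷ ((+ 579783600000 , 0 , 0) ∷ []) ∷ [] ∷ [] ∷ [] ∷ [] ∷ [] ∷ [])
    ∷ ([] ∷ [] ∷ [] ∷ ((-[1+ 1449458999 ] , 1 , 0) ∷ []) ∷ [] ∷ ((-[1+ 56528900999 ] , 0 , 0) ∷ []) ∷ [] ∷ ((-[1+ 1507437359999 ] , 0 , 0) ∷ []) ∷ [] ∷ ((+ 12755239200000 , 0 , 0) ∷ []) ∷ [] ∷ [] ∷ [])
    ∷ (((+ 1101100 , 2 , 0) ∷ []) ∷ ((-[1+ 11010999 ] , 0 , 1) ∷ []) ∷ ((-[1+ 12112099 ] , 1 , 0) ∷ []) ∷ ((+ 271040000 , 0 , 1) ∷ []) ∷ ((-[1+ 3308865999 ] , 1 , 0) ∷ []) ∷ [] ∷ ((+ 16397920000 , 1 , 0) ∷ []) ∷ [] ∷ ((-[1+ 1159567199999 ] , 0 , 0) ∷ []) ∷ [] ∷ ((+ 7247295000000 , 0 , 0) ∷ []) ∷ [] ∷ [])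
    ∷ ([] ∷ [] ∷ [] ∷ [] ∷ [] ∷ [] ∷ [] ∷ ((-[1+ 144945899999 ] , 0 , 0) ∷ []) ∷ [] ∷ ((+ 1159567200000 , 0 , 0) ∷ []) ∷ [] ∷ [] ∷ [])
    ∷ (((-[1+ 13309 ] , 2 , 0) ∷ []) ∷ ((+ 133100 , 0 , 1) ∷ []) ∷ ((+ 146410 , 1 , 0) ∷ []) ∷ ((+ 37268000 , 0 , 1) ∷ []) ∷ ((-[1+ 445086399 ] , 1 , 0) ∷ []) ∷ [] ∷ ((+ 3704173000 , 1 , 0) ∷ []) ∷ [] ∷ ((+ 253655325000 , 0 , 0) ∷ []) ∷ [] ∷ ((-[1+ 1884296699999 ] , 0 , 0) ∷ []) ∷ [] ∷ [])
    ∷ (((-[1+ 1924 ] , 1 , 1) ∷ []) ∷ ((+ 19250 , 2 , 0) ∷ []) ∷ ((+ 21175 , 0 , 1) ∷ []) ∷ ((+ 1161600 , 2 , 0) ∷ []) ∷ ((-[1+ 8227999 ] , 0 , 1) ∷ []) ∷ ((-[1+ 105947599 ] , 1 , 0) ∷ []) ∷ ((+ 348480000 , 0 , 1) ∷ []) ∷ ((-[1+ 2550195999 ] , 1 , 0) ∷ []) ∷ [] ∷ ((+ 21688645000 , 1 , 0) ∷ []) ∷ [] ∷ ((-[1+ 36236474999 ] , 0 , 0) ∷ []) ∷ [])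
    ∷ (((-[1+ 1814 ] , 2 , 0) ∷ []) ∷ ((+ 18150 , 0 , 1) ∷ []) ∷ ((+ 19965 , 1 , 0) ∷ []) ∷ ((+ 5082000 , 0 , 1) ∷ []) ∷ ((-[1+ 60693599 ] , 1 , 0) ∷ []) ∷ [] ∷ ((+ 702768000 , 1 , 0) ∷ []) ∷ [] ∷ ((+ 52180524000 , 0 , 0) ∷ []) ∷ [] ∷ ((-[1+ 347870159999 ] , 0 , 0) ∷ []) ∷ [] ∷ [])
    ∷ (((-[1+ 98 ] , 1 , 1) ∷ []) ∷ ((+ 990 , 2 , 0) ∷ []) ∷ ((+ 1089 , 0 , 1) ∷ []) ∷ ((-[1+ 111319 ] , 2 , 0) ∷ []) ∷ ((+ 1287440 , 0 , 1) ∷ []) ∷ ((-[1+ 3567079 ] , 1 , 0) ∷ []) ∷ ((+ 16359200 , 0 , 1) ∷ []) ∷ ((-[1+ 368420799 ] , 1 , 0) ∷ []) ∷ [] ∷ ((+ 2470336000 , 1 , 0) ∷ []) ∷ [] ∷ ((-[1+ 14494589999 ] , 0 , 0) ∷ []) ∷ [])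
    ∷ (((-[1+ 20 ] , 3 , 0) ∷ []) ∷ ((+ 210 , 1 , 1) ∷ []) ∷ ((+ 231 , 2 , 0) ∷ []) ∷ ((+ 54400 , 1 , 1) ∷ []) ∷ ((-[1+ 658239 ] , 2 , 0) ∷ []) ∷ ((+ 48400 , 0 , 1) ∷ []) ∷ ((+ 8808800 , 2 , 0) ∷ []) ∷ ((+ 968000 , 0 , 1) ∷ []) ∷ ((+ 383328000 , 1 , 0) ∷ []) ∷ ((+ 309760000 , 0 , 1) ∷ []) ∷ ((-[1+ 2874959999 ] , 1 , 0) ∷ []) ∷ [] ∷ [])
    ∷ []
  connectionδ
    = ([] ∷ ((+ 72472950000 , 0 , 0) ∷ []) ∷ [] ∷ ((-[1+ 579783599999 ] , 0 , 0) ∷ []) ∷ [] ∷ [] ∷ [] ∷ [] ∷ [] ∷ [] ∷ [] ∷ [] ∷ [])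
    ∷ (((-[1+ 2898917999 ] , 1 , 0) ∷ []) ∷ [] ∷ ((+ 104361048000 , 0 , 0) ∷ []) ∷ [] ∷ ((-[1+ 4754225519999 ] , 0 , 0) ∷ []) ∷ [] ∷ ((+ 25510478400000 , 0 , 0) ∷ []) ∷ [] ∷ [] ∷ [] ∷ [] ∷ [] ∷ [])
    ∷ (((-[1+ 11260259999 ] , 0 , 1) ∷ []) ∷ ((+ 119191050000 , 1 , 0) ∷ []) ∷ [] ∷ ((-[1+ 1486354319999 ] , 1 , 0) ∷ []) ∷ [] ∷ ((-[1+ 123377950079999 ] , 0 , 0) ∷ []) ∷ [] ∷ ((+ 378018907200000 , 0 , 0) ∷ []) ∷ [] ∷ ((+ 3542477796000000 , 0 , 0) ∷ []) ∷ [] ∷ [] ∷ [])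
    ∷ ([] ∷ [] ∷ [] ∷ [] ∷ ((-[1+ 72472949999 ] , 0 , 0) ∷ []) ∷ [] ∷ ((+ 579783600000 , 0 , 0) ∷ []) ∷ [] ∷ [] ∷ [] ∷ [] ∷ [] ∷ [])
    ∷ ([] ∷ [] ∷ [] ∷ ((-[1+ 2898917999 ] , 1 , 0) ∷ []) ∷ [] ∷ ((-[1+ 40584851999 ] , 0 , 0) ∷ []) ∷ [] ∷ ((-[1+ 3594658319999 ] , 0 , 0) ∷ []) ∷ [] ∷ ((+ 25510478400000 , 0 , 0) ∷ []) ∷ [] ∷ [] ∷ [])
    ∷ (((+ 235950 , 2 , 0) ∷ []) ∷ ((-[1+ 2359499 ] , 0 , 1) ∷ []) ∷ ((-[1+ 2595449 ] , 1 , 0) ∷ []) ∷ ((+ 58080000 , 0 , 1) ∷ []) ∷ ((-[1+ 5885681999 ] , 1 , 0) ∷ []) ∷ [] ∷ ((+ 3513840000 , 1 , 0) ∷ []) ∷ [] ∷ ((-[1+ 7247294999999 ] , 0 , 0) ∷ []) ∷ [] ∷ ((+ 47107417500000 , 0 , 0) ∷ []) ∷ [] ∷ [])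
    ∷ ([] ∷ [] ∷ [] ∷ [] ∷ [] ∷ [] ∷ [] ∷ ((-[1+ 217418849999 ] , 0 , 0) ∷ []) ∷ [] ∷ ((+ 1739350800000 , 0 , 0) ∷ []) ∷ [] ∷ [] ∷ [])
    ∷ (((-[1+ 26619 ] , 2 , 0) ∷ []) ∷ ((+ 266200 , 0 , 1) ∷ []) ∷ ((+ 292820 , 1 , 0) ∷ []) ∷ ((+ 74536000 , 0 , 1) ∷ []) ∷ ((-[1+ 890172799 ] , 1 , 0) ∷ []) ∷ [] ∷ ((+ 7408346000 , 1 , 0) ∷ []) ∷ [] ∷ ((+ 579783600000 , 0 , 0) ∷ []) ∷ [] ∷ ((-[1+ 4348376999999 ] , 0 , 0) ∷ []) ∷ [] ∷ [])
    ∷ (((-[1+ 1374 ] , 1 , 1) ∷ []) ∷ ((+ 13750 , 2 , 0) ∷ []) ∷ ((+ 15125 , 0 , 1) ∷ []) ∷ ((+ 2807200 , 2 , 0) ∷ []) ∷ ((-[1+ 25651999 ] , 0 , 1) ∷ []) ∷ ((-[1+ 97429199 ] , 1 , 0) ∷ []) ∷ ((+ 735680000 , 0 , 1) ∷ []) ∷ ((-[1+ 6284981999 ] , 1 , 0) ∷ []) ∷ [] ∷ ((+ 44941215000 , 1 , 0) ∷ []) ∷ [] ∷ ((-[1+ 108709424999 ] , 0 , 0) ∷ []) ∷ [])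
    ∷ (((-[1+ 3024 ] , 2 , 0) ∷ []) ∷ ((+ 30250 , 0 , 1) ∷ []) ∷ ((+ 33275 , 1 , 0) ∷ []) ∷ ((+ 8470000 , 0 , 1) ∷ []) ∷ ((-[1+ 101155999 ] , 1 , 0) ∷ []) ∷ [] ∷ ((+ 1171280000 , 1 , 0) ∷ []) ∷ [] ∷ ((+ 86967540000 , 0 , 0) ∷ []) ∷ [] ∷ ((-[1+ 579783599999 ] , 0 , 0) ∷ []) ∷ [] ∷ [])
    ∷ (((-[1+ 241 ] , 1 , 1) ∷ []) ∷ ((+ 2420 , 2 , 0) ∷ []) ∷ ((+ 2662 , 0 , 1) ∷ []) ∷ ((-[1+ 266199 ] , 2 , 0) ∷ []) ∷ ((+ 3087920 , 0 , 1) ∷ []) ∷ ((-[1+ 8784599 ] , 1 , 0) ∷ []) ∷ ((+ 23425600 , 0 , 1) ∷ []) ∷ ((-[1+ 702767999 ] , 1 , 0) ∷ []) ∷ [] ∷ ((+ 4392300000 , 1 , 0) ∷ []) ∷ [] ∷ ((-[1+ 43483769999 ] , 0 , 0) ∷ []) ∷ [])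
    ∷ (((+ 20 , 0 , 2) ∷ (-[1+ 66 ] , 3 , 0) ∷ []) ∷ ((+ 470 , 1 , 1) ∷ []) ∷ ((+ 517 , 2 , 0) ∷ []) ∷ ((+ 117200 , 1 , 1) ∷ []) ∷ ((-[1+ 1413279 ] , 2 , 0) ∷ []) ∷ [] ∷ ((+ 19069600 , 2 , 0) ∷ []) ∷ ((-[1+ 8711999 ] , 0 , 1) ∷ []) ∷ ((+ 958320000 , 1 , 0) ∷ []) ∷ ((+ 675180000 , 0 , 1) ∷ []) ∷ ((-[1+ 7187399999 ] , 1 , 0) ∷ []) ∷ [] ∷ [])
    ∷ []

  terms₂ : List (ℤ × ℕ × ℕ) → Series → Series → Series
  terms₂ [] q r = const 0ℤ
  terms₂ ((c , i , j) ∷ l) q r = const c *ˢ (q ^ˢ i *ˢ r ^ˢ j) +ˢ terms₂ l q r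

  terms₂-⟦⟧ : ∀ {m} l (e e′ : Expr m) ρ → terms₂ l (⟦ e ⟧ ρ) (⟦ e′ ⟧ ρ) ≡ ⟦ terms₂ₑ l e e′ ⟧ ρ
  terms₂-⟦⟧ [] e e′ ρ = refl
  terms₂-⟦⟧ ((c , i , j) ∷ l) e e′ ρ = cong (const c *ˢ (⟦ e ⟧ ρ ^ˢ i *ˢ ⟦ e′ ⟧ ρ ^ˢ j) +ˢ_) (terms₂-⟦⟧ l e e′ ρ)

  rowˢ : ∀ {m} → Vec (List (ℤ × ℕ × ℕ)) m → Series → Series → Vec Series m
  rowˢ r q q′ = Vec.map (λ l → terms₂ l q q′) r

  rowₑ : ∀ {m d} → Vec (List (ℤ × ℕ × ℕ)) d → Expr m → Expr m → (Fin d → Expr m) → Expr m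
  rowₑ []      q q′ g = con 0ℤ
  rowₑ (l ∷ r) q q′ g = terms₂ₑ l q q′ :* g zero :+ rowₑ r q q′ (λ i → g (suc i))

  rowₑ-⟦⟧ : ∀ {m d} (r : Vec (List (ℤ × ℕ × ℕ)) d) (q q′ : Expr m) g ρ →
    ⟦ rowₑ r q q′ g ⟧ ρ ≡ dotˢ (rowˢ r (⟦ q ⟧ ρ) (⟦ q′ ⟧ ρ)) (λ i → ⟦ g i ⟧ ρ)
  rowₑ-⟦⟧ []      q q′ g ρ = refl
  rowₑ-⟦⟧ (l ∷ r) q q′ g ρ = cong₂ (λ a b → a *ˢ ⟦ g zero ⟧ ρ +ˢ b) (sym (terms₂-⟦⟧ l q q′ ρ)) (rowₑ-⟦⟧ r q q′ (λ i → g (suc i)) ρ)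

  every : ∀ {d} → (Fin d → Bool) → Bool
  every {zero}  f = true
  every {suc d} f = f zero ∧ every (λ i → f (suc i))

  every-sound : ∀ {d} (f : Fin d → Bool) → every f ≡ true → ∀ i → f i ≡ true
  every-sound f eq zero    = proj₁ (∧-true eq)
  every-sound f eq (suc i) = every-sound (λ i → f (suc i)) (proj₂ (∧-true {f zero} eq)) i

  con-scale : ∀ {m} → ℕ → Expr m
  con-scale i = con (+ i ℤ.* scale)

  -- The first summand is the weight term of the Serre derivative formed with 11 E₂(q^11) = 6 s + G,
  -- and `𝐪′`, `𝐫′` are multiples of E₄(q^11), E₆(q^11). So at ∞ all coefficients of the system are
  -- series in q^11. A derivative formed with E₂(q) would not pass through U. For δ b the weight is
  -- 2 κ + 5.
  basisRight basisδRight : Fin 12 → Expr 4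
  basisRight i = con-scale (5 ℕ.* weight i) :* ((k 6 :* 𝐬 :+ 𝐆) :* basis i) :+ rowₑ (lookup connection i) 𝐪′ 𝐫′ basis
  basisδRight i = con-scale (5 ℕ.* (2 ℕ.* weight i ℕ.+ 5)) :* ((k 6 :* 𝐬 :+ 𝐆) :* basis i) :+ rowₑ (lookup connectionδ i) 𝐪′ 𝐫′ basis

  opaque
    -- As `levelRule` computes 3600 θ, division by 120 turns this into 30 scale θ b = `basisRight`.
    -- Opacity keeps the large normal forms from being recomputed where the check is used.
    basis-check : ∀ i → isZeroQ (nfQ (con scale :* derivation levelRule (basis i) :- k 120 :* basisRight i)) ≡ true
    basis-check = every-sound (λ i → isZeroQ (nfQ (con scale :* derivation levelRule (basis i) :- k 120 :* basisRight i))) refl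

    basisδ-check : ∀ i → isZeroQ (nfQ (con scale :* derivation levelRule (basis i) :+ con-scale 1800 :* ((k 5 :* 𝐬 :+ 𝐆) :* basis i) :- k 60 :* basisδRight i)) ≡ true
    basisδ-check = every-sound (λ i → isZeroQ (nfQ (con scale :* derivation levelRule (basis i) :+ con-scale 1800 :* ((k 5 :* 𝐬 :+ 𝐆) :* basis i) :- k 60 :* basisδRight i))) refl

  monomialsₑ : List (ℤ × ℕ × ℕ × ℕ) → Expr 4
  monomialsₑ [] = con 0ℤ
  monomialsₑ ((c , a , b , e) ∷ l) = con c :* (𝐱 :^ a :* (𝐟 :^ b :* 𝐳 :^ e)) :+ monomialsₑ l

  -- δ U(δ bᵢ) multiplied by Hscale, and (11 U bᵢ + 11^κ w bᵢ)
  Hscale : ℤ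
  Hscale = + 756250

  Hterms : Vec (List (ℤ × ℕ × ℕ × ℕ)) 12
  Hterms
    = ((-[1+ 13749 ] , 0 , 3 , 1) ∷ (-[1+ 756249 ] , 0 , 5 , 0) ∷ (+ 2750 , 1 , 2 , 1) ∷ (+ 687500 , 1 , 4 , 0) ∷ (-[1+ 104 ] , 2 , 1 , 1) ∷ (-[1+ 123749 ] , 2 , 3 , 0) ∷ (+ 1 , 3 , 0 , 1) ∷ (+ 7450 , 3 , 2 , 0) ∷ (-[1+ 154 ] , 4 , 1 , 0) ∷ (+ 1 , 5 , 0 , 0) ∷ [])
    ∷ ((+ 16940000 , 0 , 4 , 1) ∷ (+ 937750000 , 0 , 6 , 0) ∷ (-[1+ 6140749 ] , 1 , 3 , 1) ∷ (-[1+ 1038331249 ] , 1 , 5 , 0) ∷ (+ 550550 , 2 , 2 , 1) ∷ (+ 277392500 , 2 , 4 , 0) ∷ (-[1+ 15124 ] , 3 , 1 , 1) ∷ (-[1+ 29009749 ] , 3 , 3 , 0) ∷ (+ 121 , 4 , 0 , 1) ∷ (+ 1240250 , 4 , 2 , 0) ∷ (-[1+ 21174 ] , 5 , 1 , 0) ∷ (+ 121 , 6 , 0 , 0) ∷ [])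
    ∷ ((-[1+ 20630499999 ] , 0 , 5 , 1) ∷ (-[1+ 931699999999 ] , 0 , 7 , 0) ∷ (+ 10980750000 , 1 , 4 , 1) ∷ (+ 1474082500000 , 1 , 6 , 0) ∷ (-[1+ 1723977749 ] , 2 , 3 , 1) ∷ (-[1+ 540477506249 ] , 2 , 5 , 0) ∷ (+ 98826750 , 3 , 2 , 1) ∷ (+ 82685047500 , 3 , 4 , 0) ∷ (-[1+ 2122944 ] , 4 , 1 , 1) ∷ (-[1+ 5940585749 ] , 4 , 3 , 0) ∷ (+ 14641 , 5 , 0 , 1) ∷ (+ 196921450 , 5 , 2 , 0) ∷ (-[1+ 2854994 ] , 6 , 1 , 0) ∷ (+ 14641 , 7 , 0 , 0) ∷ [])
    ∷ ((+ 756250 , 0 , 6 , 0) ∷ [])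
    ∷ ((-[1+ 8318749 ] , 1 , 6 , 0) ∷ [])
    ∷ ((+ 12100000 , 0 , 6 , 1) ∷ (+ 6655000000 , 0 , 8 , 0) ∷ (+ 605000000 , 1 , 7 , 0) ∷ (+ 79406250 , 2 , 6 , 0) ∷ [])
    ∷ ((-[1+ 8318749 ] , 0 , 7 , 0) ∷ [])
    ∷ ((-[1+ 1209999 ] , 0 , 6 , 1) ∷ (-[1+ 665499999 ] , 0 , 8 , 0) ∷ (+ 31006250 , 1 , 7 , 0) ∷ (+ 1210000 , 2 , 6 , 0) ∷ [])
    ∷ ((+ 66550000 , 0 , 7 , 1) ∷ (-[1+ 1209999 ] , 1 , 6 , 1) ∷ (+ 2662000000 , 1 , 8 , 0) ∷ (-[1+ 1133618749 ] , 2 , 7 , 0) ∷ (+ 1210000 , 3 , 6 , 0) ∷ [])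
    ∷ ((-[1+ 151249 ] , 0 , 6 , 1) ∷ (+ 8318750 , 0 , 8 , 0) ∷ (-[1+ 7562499 ] , 1 , 7 , 0) ∷ (+ 151250 , 2 , 6 , 0) ∷ [])
    ∷ ((+ 26620000 , 0 , 7 , 1) ∷ (-[1+ 3660249999 ] , 0 , 9 , 0) ∷ (-[1+ 272249 ] , 1 , 6 , 1) ∷ (+ 174693750 , 1 , 8 , 0) ∷ (-[1+ 40232499 ] , 2 , 7 , 0) ∷ (+ 272250 , 3 , 6 , 0) ∷ [])
    ∷ ((+ 1464100000 , 0 , 8 , 1) ∷ (+ 119790000 , 1 , 7 , 1) ∷ (-[1+ 183012499999 ] , 1 , 9 , 0) ∷ (+ 332750 , 2 , 6 , 1) ∷ (+ 15780668750 , 2 , 8 , 0) ∷ (-[1+ 103152499 ] , 3 , 7 , 0) ∷ (-[1+ 332749 ] , 4 , 6 , 0) ∷ [])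
    ∷ []

  -- The values of `τ` are forced by dimension: multiples of f are cusp forms, and there is no level
  -- 1 cusp form of weight at most 10; there is no form of weight 2; in weight 4 only multiples of
  -- E₄ remain. The trace of 1 is the index 12 of Γ₀(11).
  H τ : Fin 12 → Expr 4
  H i = monomialsₑ (lookup Hterms i)
  τ zero             = con (+ 12)
  τ (suc (suc zero)) = con (+ 132) :* 𝐪
  τ _                = con 0ℤ

  -- The connection after U: V (11 E₂) becomes 11 E₂ with E₂ = 6 s - G, and `𝐪′`, `𝐫′` become 121
  -- `𝐪`, 1331 `𝐫`. In `HRight` the term with 330 comes from differentiating the outer factor δ.
  HRight τRight : Fin 12 → Expr 4
  HRight i = (con-scale (55 ℕ.* (2 ℕ.* weight i ℕ.+ 5)) :* (k 6 :* 𝐬 :- 𝐆) :+ con-scale 330 :* (k 5 :* 𝐬 :+ 𝐆)) :* H i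
    :+ rowₑ (lookup connectionδ i) (k 121 :* 𝐪) (k 1331 :* 𝐫) H
  τRight i = (con-scale (55 ℕ.* weight i) :* (k 6 :* 𝐬 :- 𝐆)) :* τ i :+ rowₑ (lookup connection i) (k 121 :* 𝐪) (k 1331 :* 𝐫) τ

  opaque
    τ-check : ∀ i → isZeroQ (nfQ (con-scale 11 :* derivation levelRule (τ i) :- k 120 :* τRight i)) ≡ true
    τ-check = every-sound (λ i → isZeroQ (nfQ (con-scale 11 :* derivation levelRule (τ i) :- k 120 :* τRight i))) refl

    H-check : ∀ i → isZeroQ (nfQ (con-scale 11 :* derivation levelRule (H i) :- k 60 :* HRight i)) ≡ true
    H-check = every-sound (λ i → isZeroQ (nfQ (con-scale 11 :* derivation levelRule (H i) :- k 60 :* HRight i))) refl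

open Tables

-- Linear systems with homogeneous level 1 coefficients.

module DifferentialSystems where

  open import Relation.Binary.Reasoning.Setoid SR.setoid

  private
    k n : ∀ {m} → ℕ → Expr m
    k i = con (+ i)
    n i = con (ℤ.- (+ i))

  dotˢ-+ : ∀ {d} (r : Vec Series d) v w → dotˢ r (λ i → v i +ˢ w i) ≈ˢ dotˢ r v +ˢ dotˢ r w
  dotˢ-+ [] v w = byPoly [] (k 0) (k 0 :+ k 0) refl
  dotˢ-+ (a ∷ r) v w = SR.trans (SR.+-congˡ {a *ˢ (v zero +ˢ w zero)} (dotˢ-+ r (λ i → v (suc i)) (λ i → w (suc i))))
    (byPoly (a ∷ v zero ∷ w zero ∷ dotˢ r (λ i → v (suc i)) ∷ dotˢ r (λ i → w (suc i)) ∷ [])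
      (var (# 0) :* (var (# 1) :+ var (# 2)) :+ (var (# 3) :+ var (# 4))) ((var (# 0) :* var (# 1) :+ var (# 3)) :+ (var (# 0) :* var (# 2) :+ var (# 4))) refl)

  dotˢ-* : ∀ {d} c (r : Vec Series d) v → dotˢ r (λ i → c *ˢ v i) ≈ˢ c *ˢ dotˢ r v
  dotˢ-* c [] v = byPoly (c ∷ []) (k 0) (var (# 0) :* k 0) refl
  dotˢ-* c (a ∷ r) v = SR.trans (SR.+-congˡ {a *ˢ (c *ˢ v zero)} (dotˢ-* c r (λ i → v (suc i))))
    (byPoly (a ∷ c ∷ v zero ∷ dotˢ r (λ i → v (suc i)) ∷ [])
      (var (# 0) :* (var (# 1) :* var (# 2)) :+ var (# 1) :* var (# 3)) (var (# 1) :* (var (# 0) :* var (# 2) :+ var (# 3))) refl)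

  Entry : Set
  Entry = List (ℤ × ℕ × ℕ)

  -- Common core of the statements for U, χ⊗ and V: each operator is additive and passes through a
  -- coefficient, changing it from `F` to `F′`.
  dotˢ-op : ∀ {d} (O : Series → Series) → (∀ a b → O (a +ˢ b) ≈ˢ O a +ˢ O b) → O (const 0ℤ) ≈ˢ const 0ℤ →
    (F F′ : Entry → Series) → (∀ l b → O (F l *ˢ b) ≈ˢ F′ l *ˢ O b) →
    (r : Vec Entry d) (v : Fin d → Series) → O (dotˢ (Vec.map F r) v) ≈ˢ dotˢ (Vec.map F′ r) (λ i → O (v i))
  dotˢ-op O O-+ O-0 F F′ O-* [] v = O-0
  dotˢ-op O O-+ O-0 F F′ O-* (l ∷ r) v = SR.trans (O-+ (F l *ˢ v zero) _)
    (SR.+-cong (O-* l (v zero)) (dotˢ-op O O-+ O-0 F F′ O-* r (λ i → v (suc i))))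

  terms₂-cong : ∀ l {q q′ r r′} → q ≈ˢ q′ → r ≈ˢ r′ → terms₂ l q r ≈ˢ terms₂ l q′ r′
  terms₂-cong [] p p′ = SR.refl
  terms₂-cong ((c , i , j) ∷ l) p p′ = SR.+-cong (SR.*-congˡ {const c} (SR.*-cong (^-congˡ i p) (^-congˡ j p′))) (terms₂-cong l p p′)

  rowˢ-cong : ∀ {d} (r : Vec Entry d) {q q′ s s′} v → q ≈ˢ q′ → s ≈ˢ s′ → dotˢ (rowˢ r q s) v ≈ˢ dotˢ (rowˢ r q′ s′) v
  rowˢ-cong [] v p p′ = SR.refl
  rowˢ-cong (l ∷ r) v p p′ = SR.+-cong (SR.*-congʳ {v zero} (terms₂-cong l p p′)) (rowˢ-cong r (λ i → v (suc i)) p p′)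

  V-terms₂ : ∀ l q r → V (terms₂ l q r) ≈ˢ terms₂ l (V q) (V r)
  V-terms₂ [] q r = V-const 0ℤ
  V-terms₂ ((c , i , j) ∷ l) q r = SR.trans (V-+ (const c *ˢ (q ^ˢ i *ˢ r ^ˢ j)) (terms₂ l q r))
    (SR.+-cong (SR.trans (V-const* c (q ^ˢ i *ˢ r ^ˢ j)) (SR.*-congˡ {const c} (SR.trans (V-* (q ^ˢ i) (r ^ˢ j)) (SR.*-cong (V-^ q i) (V-^ r j))))) (V-terms₂ l q r))

  U-+ : ∀ a b → U (a +ˢ b) ≈ˢ U a +ˢ U b
  U-+ a b n = refl

  U-row : ∀ {d} (r : Vec Entry d) q s v → U (dotˢ (rowˢ r (V q) (V s)) v) ≈ˢ dotˢ (rowˢ r q s) (λ i → U (v i))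
  U-row r q s v = dotˢ-op U U-+ (λ { zero → refl ; (suc _) → refl }) (λ l → terms₂ l (V q) (V s)) (λ l → terms₂ l q s)
    (λ l b → SR.trans (U-cong (SR.*-congʳ {b} (SR.sym (V-terms₂ l q s)))) (U-V* (terms₂ l q s) b)) r v

  χ⊗-row : ∀ {d} (r : Vec Entry d) q s v → χ⊗ (dotˢ (rowˢ r (V q) (V s)) v) ≈ˢ dotˢ (rowˢ r (V q) (V s)) (λ i → χ⊗ (v i))
  χ⊗-row r q s v = dotˢ-op χ⊗ χ⊗-+ (λ { zero → refl ; (suc m) → ℤₚ.*-zeroʳ (χ (suc m)) }) (λ l → terms₂ l (V q) (V s)) (λ l → terms₂ l (V q) (V s))
    (λ l b → SR.trans (χ⊗-cong (SR.*-congʳ {b} (SR.sym (V-terms₂ l q s)))) (SR.trans (χ⊗-V* (terms₂ l q s) b) (SR.*-congʳ {χ⊗ b} (V-terms₂ l q s)))) r v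

  V-row : ∀ {d} (r : Vec Entry d) q s v → V (dotˢ (rowˢ r q s) v) ≈ˢ dotˢ (rowˢ r (V q) (V s)) (λ i → V (v i))
  V-row r q s v = dotˢ-op V V-+ (V-const 0ℤ) (λ l → terms₂ l q s) (λ l → terms₂ l (V q) (V s))
    (λ l b → SR.trans (V-* (terms₂ l q s) b) (SR.*-congʳ {V b} (V-terms₂ l q s))) r v

  -- Weights: the entries of a row of weight w are homogeneous when q and r have weights 2 and 3.

  E : Series
  E = const (+ 11)

  -- The target is `suc w` because θ raises κ by one, as multiplication by x or f does in the later
  -- tables.
  homogeneousEntry : ℕ → ℕ → Entry → Bool
  homogeneousEntry w w′ [] = true
  homogeneousEntry w w′ ((c , i , j) ∷ l) = (2 ℕ.* i ℕ.+ (3 ℕ.* j ℕ.+ w′) ℕ.≡ᵇ suc w) ∧ homogeneousEntry w w′ l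

  homogeneousRow : ∀ {d} → ℕ → (Fin d → ℕ) → Vec Entry d → Bool
  homogeneousRow w w′ [] = true
  homogeneousRow w w′ (l ∷ r) = homogeneousEntry w (w′ zero) l ∧ homogeneousRow w (λ i → w′ (suc i)) r

  power-scaled : ∀ m q i → (const (+ (11 ℕ.^ m)) *ˢ q) ^ˢ i ≈ˢ E ^ˢ (m ℕ.* i) *ˢ q ^ˢ i
  power-scaled m q i = SR.trans (^-distrib-* (const (+ (11 ℕ.^ m))) q i)
    (SR.*-congʳ {q ^ˢ i} (SR.trans (^-congˡ i (E^ m)) (^-assocʳ E m i)))
    where
    E^ : ∀ m → const (+ (11 ℕ.^ m)) ≈ˢ E ^ˢ m
    E^ zero    = SR.refl
    E^ (suc m) = SR.trans (≡⇒≈ (cong const (ℤₚ.pos-* 11 (11 ℕ.^ m)))) (SR.trans (const-* (+ 11) (+ (11 ℕ.^ m))) (SR.*-congˡ {E} (E^ m)))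

  -- A term q^i r^j g absorbs 11^(2 i), 11^(3 j) and 11^w′; by homogeneity these exponents add up to
  -- w + 1.
  scaledEntry : ∀ w w′ l q r g → homogeneousEntry w w′ l ≡ true →
    E ^ˢ suc w *ˢ (terms₂ l q r *ˢ g) ≈ˢ terms₂ l (const (+ 121) *ˢ q) (const (+ 1331) *ˢ r) *ˢ (E ^ˢ w′ *ˢ g)
  scaledEntry w w′ [] q r g _ = byPoly (E ^ˢ suc w ∷ E ^ˢ w′ ∷ g ∷ []) (var (# 0) :* (k 0 :* var (# 2))) (k 0 :* (var (# 1) :* var (# 2))) refl
  scaledEntry w w′ ((c , i , j) ∷ l) q r g eq = begin
    E ^ˢ suc w *ˢ ((const c *ˢ (q ^ˢ i *ˢ r ^ˢ j) +ˢ terms₂ l q r) *ˢ g)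
      ≈⟨ byPoly (E ^ˢ suc w ∷ const c ∷ q ^ˢ i ∷ r ^ˢ j ∷ terms₂ l q r ∷ g ∷ [])
           (var (# 0) :* ((var (# 1) :* (var (# 2) :* var (# 3)) :+ var (# 4)) :* var (# 5)))
           (var (# 1) :* (var (# 0) :* (var (# 2) :* var (# 3))) :* var (# 5) :+ var (# 0) :* (var (# 4) :* var (# 5))) refl ⟩
    const c *ˢ (E ^ˢ suc w *ˢ (q ^ˢ i *ˢ r ^ˢ j)) *ˢ g +ˢ E ^ˢ suc w *ˢ (terms₂ l q r *ˢ g)
      ≈⟨ SR.+-cong (SR.*-congʳ {g} (SR.*-congˡ {const c} (SR.*-congʳ {q ^ˢ i *ˢ r ^ˢ j} exponents))) (scaledEntry w w′ l q r g (proj₂ (∧-true {2 ℕ.* i ℕ.+ (3 ℕ.* j ℕ.+ w′) ℕ.≡ᵇ suc w} eq))) ⟩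
    const c *ˢ ((E ^ˢ (2 ℕ.* i) *ˢ (E ^ˢ (3 ℕ.* j) *ˢ E ^ˢ w′)) *ˢ (q ^ˢ i *ˢ r ^ˢ j)) *ˢ g +ˢ M *ˢ (E ^ˢ w′ *ˢ g)
      ≈⟨ SR.+-congʳ (byPoly (const c ∷ E ^ˢ (2 ℕ.* i) ∷ E ^ˢ (3 ℕ.* j) ∷ E ^ˢ w′ ∷ q ^ˢ i ∷ r ^ˢ j ∷ g ∷ [])
           (var (# 0) :* ((var (# 1) :* (var (# 2) :* var (# 3))) :* (var (# 4) :* var (# 5))) :* var (# 6))
           ((var (# 0) :* ((var (# 1) :* var (# 4)) :* (var (# 2) :* var (# 5)))) :* (var (# 3) :* var (# 6))) refl) ⟩
    (const c *ˢ ((E ^ˢ (2 ℕ.* i) *ˢ q ^ˢ i) *ˢ (E ^ˢ (3 ℕ.* j) *ˢ r ^ˢ j))) *ˢ (E ^ˢ w′ *ˢ g) +ˢ M *ˢ (E ^ˢ w′ *ˢ g)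
      ≈⟨ SR.+-congʳ (SR.*-congʳ {E ^ˢ w′ *ˢ g} (SR.*-congˡ {const c} (SR.*-cong (power-scaled 2 q i) (power-scaled 3 r j)))) ⟨
    (const c *ˢ ((const (+ 121) *ˢ q) ^ˢ i *ˢ (const (+ 1331) *ˢ r) ^ˢ j)) *ˢ (E ^ˢ w′ *ˢ g) +ˢ M *ˢ (E ^ˢ w′ *ˢ g)
      ≈⟨ SR.distribʳ (E ^ˢ w′ *ˢ g) _ M ⟨
    _ ∎
    where
    M = terms₂ l (const (+ 121) *ˢ q) (const (+ 1331) *ˢ r)
    exponents : E ^ˢ suc w ≈ˢ E ^ˢ (2 ℕ.* i) *ˢ (E ^ˢ (3 ℕ.* j) *ˢ E ^ˢ w′)
    exponents = SR.trans (^-congʳ E (sym (ℕₚ.≡ᵇ⇒≡ (2 ℕ.* i ℕ.+ (3 ℕ.* j ℕ.+ w′)) (suc w) (subst T (sym (proj₁ (∧-true {2 ℕ.* i ℕ.+ (3 ℕ.* j ℕ.+ w′) ℕ.≡ᵇ suc w} eq))) _))))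
      (SR.trans (^-homo-* E (2 ℕ.* i) (3 ℕ.* j ℕ.+ w′)) (SR.*-congˡ {E ^ˢ (2 ℕ.* i)} (^-homo-* E (3 ℕ.* j) w′)))

  scaledRow : ∀ {d} w (w′ : Fin d → ℕ) (ls : Vec Entry d) q r g → homogeneousRow w w′ ls ≡ true →
    E ^ˢ suc w *ˢ dotˢ (rowˢ ls q r) g ≈ˢ dotˢ (rowˢ ls (const (+ 121) *ˢ q) (const (+ 1331) *ˢ r)) (λ i → E ^ˢ w′ i *ˢ g i)
  scaledRow w w′ [] q r g _ = byPoly (E ^ˢ suc w ∷ []) (var (# 0) :* k 0) (k 0) refl
  scaledRow w w′ (l ∷ ls) q r g eq = SR.trans (SR.distribˡ (E ^ˢ suc w) (terms₂ l q r *ˢ g zero) _)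
    (SR.+-cong (scaledEntry w (w′ zero) l q r (g zero) (proj₁ (∧-true eq)))
      (scaledRow w (λ i → w′ (suc i)) ls q r (λ i → g (suc i)) (proj₂ (∧-true {homogeneousEntry w (w′ zero) l} eq))))

  opaque
    connection-homogeneous : ∀ i → homogeneousRow (weight i) weight (lookup connection i) ≡ true
    connection-homogeneous = every-sound (λ i → homogeneousRow (weight i) weight (lookup connection i)) refl

    connectionδ-homogeneous : ∀ i → homogeneousRow (weight i) weight (lookup connectionδ i) ≡ true
    connectionδ-homogeneous = every-sound (λ i → homogeneousRow (weight i) weight (lookup connectionδ i)) refl

  -- Solutions of  c · scale · θ v = diag v + table v

  Sol : ∀ {d} → ℕ → Vec (Vec Entry d) d → (Fin d → Series) → Series → Series → (Fin d → Series) → Set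
  Sol c table diag q r v = ∀ i → const (+ c) *ˢ (const scale *ˢ θ (v i)) ≈ˢ diag i *ˢ v i +ˢ dotˢ (rowˢ (lookup table i) q r) v

  module _ {d c : ℕ} {table : Vec (Vec Entry d) d} {diag : Fin d → Series} {q r : Series} where

    Sol-+ : ∀ {v w} → Sol c table diag q r v → Sol c table diag q r w → Sol c table diag q r (λ i → v i +ˢ w i)
    Sol-+ {v} {w} p p′ i = begin
      const (+ c) *ˢ (const scale *ˢ θ (v i +ˢ w i))
        ≈⟨ SR.*-congˡ {const (+ c)} (SR.*-congˡ {const scale} (θ-+ (v i) (w i))) ⟩
      const (+ c) *ˢ (const scale *ˢ (θ (v i) +ˢ θ (w i)))
        ≈⟨ byPoly (const (+ c) ∷ const scale ∷ θ (v i) ∷ θ (w i) ∷ []) (var (# 0) :* (var (# 1) :* (var (# 2) :+ var (# 3))))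
             (var (# 0) :* (var (# 1) :* var (# 2)) :+ var (# 0) :* (var (# 1) :* var (# 3))) refl ⟩
      const (+ c) *ˢ (const scale *ˢ θ (v i)) +ˢ const (+ c) *ˢ (const scale *ˢ θ (w i))
        ≈⟨ SR.+-cong (p i) (p′ i) ⟩
      (diag i *ˢ v i +ˢ dotˢ R v) +ˢ (diag i *ˢ w i +ˢ dotˢ R w)
        ≈⟨ byPoly (diag i ∷ v i ∷ w i ∷ dotˢ R v ∷ dotˢ R w ∷ []) ((var (# 0) :* var (# 1) :+ var (# 3)) :+ (var (# 0) :* var (# 2) :+ var (# 4)))
             (var (# 0) :* (var (# 1) :+ var (# 2)) :+ (var (# 3) :+ var (# 4))) refl ⟩
      diag i *ˢ (v i +ˢ w i) +ˢ (dotˢ R v +ˢ dotˢ R w)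
        ≈⟨ SR.+-congˡ {diag i *ˢ (v i +ˢ w i)} (dotˢ-+ R v w) ⟨
      _ ∎
      where R = rowˢ (lookup table i) q r

    Sol-* : ∀ a {v} → Sol c table diag q r v → Sol c table diag q r (λ i → const a *ˢ v i)
    Sol-* a {v} p i = begin
      const (+ c) *ˢ (const scale *ˢ θ (const a *ˢ v i))
        ≈⟨ SR.*-congˡ {const (+ c)} (SR.*-congˡ {const scale} (θ-const* a (v i))) ⟩
      const (+ c) *ˢ (const scale *ˢ (const a *ˢ θ (v i)))
        ≈⟨ byPoly (const (+ c) ∷ const scale ∷ const a ∷ θ (v i) ∷ []) (var (# 0) :* (var (# 1) :* (var (# 2) :* var (# 3))))
             (var (# 2) :* (var (# 0) :* (var (# 1) :* var (# 3)))) refl ⟩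
      const a *ˢ (const (+ c) *ˢ (const scale *ˢ θ (v i)))
        ≈⟨ SR.*-congˡ {const a} (p i) ⟩
      const a *ˢ (diag i *ˢ v i +ˢ dotˢ R v)
        ≈⟨ byPoly (const a ∷ diag i ∷ v i ∷ dotˢ R v ∷ []) (var (# 0) :* (var (# 1) :* var (# 2) :+ var (# 3)))
             (var (# 1) :* (var (# 0) :* var (# 2)) :+ var (# 0) :* var (# 3)) refl ⟩
      diag i *ˢ (const a *ˢ v i) +ˢ const a *ˢ dotˢ R v
        ≈⟨ SR.+-congˡ {diag i *ˢ (const a *ˢ v i)} (dotˢ-* (const a) R v) ⟨
      _ ∎
      where R = rowˢ (lookup table i) q r

  Sol-coefficients : ∀ {d c table} {diag diag′ : Fin d → Series} {q q′ r r′ v} → (∀ i → diag i ≈ˢ diag′ i) → q ≈ˢ q′ → r ≈ˢ r′ →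
    Sol c table diag q r v → Sol c table diag′ q′ r′ v
  Sol-coefficients {table = table} {v = v} pd pq pr p i =
    SR.trans (p i) (SR.+-cong (SR.*-congʳ {v i} (pd i)) (rowˢ-cong (lookup table i) v pq pr))

  addAtDiagonal : ∀ {d} → Fin d → Series → Vec Series d → Vec Series d
  addAtDiagonal zero    a (b ∷ r) = (a +ˢ b) ∷ r
  addAtDiagonal (suc i) a (b ∷ r) = b ∷ addAtDiagonal i a r

  dotˢ-addAtDiagonal : ∀ {d} (i : Fin d) a r v → dotˢ (addAtDiagonal i a r) v ≈ˢ a *ˢ v i +ˢ dotˢ r v
  dotˢ-addAtDiagonal zero    a (b ∷ r) v = byPoly (a ∷ b ∷ v zero ∷ dotˢ r (λ i → v (suc i)) ∷ [])
    ((var (# 0) :+ var (# 1)) :* var (# 2) :+ var (# 3)) (var (# 0) :* var (# 2) :+ (var (# 1) :* var (# 2) :+ var (# 3))) refl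
  dotˢ-addAtDiagonal (suc i) a (b ∷ r) v = SR.trans (SR.+-congˡ {b *ˢ v zero} (dotˢ-addAtDiagonal i a r (λ j → v (suc j))))
    (byPoly (b *ˢ v zero ∷ a *ˢ v (suc i) ∷ dotˢ r (λ j → v (suc j)) ∷ []) (var (# 0) :+ (var (# 1) :+ var (# 2))) (var (# 1) :+ (var (# 0) :+ var (# 2))) refl)

  systemMatrix : ∀ {d} → Vec (Vec Entry d) d → (Fin d → Series) → Series → Series → Vec (Vec Series d) d
  systemMatrix table diag q r = Vec.tabulate (λ i → addAtDiagonal i (diag i) (rowˢ (lookup table i) q r))

  -- The residue matrix enters as a separate `M`, so that series are evaluated once, against a
  -- literal matrix, and the product of the M - ρ is computed with integers only.
  Sol-unique : ∀ {d} N c {table : Vec (Vec Entry d) d} {diag q r v} ρs → Sol c table diag q r v → (∀ i → v i ≈ˢ[ N ] 0ˢ) →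
    ∀ {M} → constantTerms (systemMatrix table diag q r) ≡ M → annihilates M ρs ≡ true →
    (∀ n → N < n → ∀ ρ → ρ ∈ˡ ρs → (+ c ℤ.* scale) ℤ.* + n ≢ ρ) → ∀ i → v i ≈ˢ 0ˢ
  Sol-unique N c {table} {diag} {q} {r} {v} ρs p initial refl ann ≢ = system-unique N (+ c ℤ.* scale) (systemMatrix table diag q r) v ρs
    (λ i → SR.trans (SR.*-congʳ {θ (v i)} (const-* (+ c) scale)) (SR.trans (SR.*-assoc (const (+ c)) (const scale) (θ (v i)))
      (SR.trans (p i) (SR.trans (SR.sym (dotˢ-addAtDiagonal i (diag i) (rowˢ (lookup table i) q r) v))
        (≡⇒≈ (cong (λ R → dotˢ R v) (sym (Vecₚ.lookup∘tabulate _ i))))))))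
    initial ann ≢

open DifferentialSystems

-- The differential systems of the basis at the two cusps.

module Basis where

  open import Relation.Binary.Reasoning.Setoid SR.setoid

  private
    k n : ∀ {m} → ℕ → Expr m
    k i = con (+ i)
    n i = con (ℤ.- (+ i))
    𝐱 = ring-𝐱 ; 𝐟 = ring-𝐟 ; 𝐬 = ring-𝐬 ; 𝐳 = ring-𝐳 ; 𝐆 = ring-𝐆 ; 𝐚 = ring-𝐚 ; 𝐛 = ring-𝐛 ; 𝐥 = ring-𝐥
    module ∞ = Cusp cusp∞
    module 𝟘 = Cusp cusp₀

  S : Series
  S = const scale

  -- The forms 25 Q, 125 R of level 1 and 25·121 Q(q^11), 125·1331 R(q^11)

  q∞ r∞ q₀ r₀ : Series
  q∞ = const (+ 25) *ˢ E₄
  r∞ = const (+ 125) *ˢ E₆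
  q₀ = const (+ 25) *ˢ Q̂
  r₀ = const (+ 125) *ˢ R̂

  private
    ρ⁺ : Vec Series 8
    ρ⁺ = x ∷ f ∷ s ∷ z ∷ E₄ ∷ Q̂ ∷ E₆ ∷ R̂ ∷ []
    hQ₊ hz hR₋ hR₊ : Expr 8 → Hyp ρ⁺
    hQ₊ c = c · k 25 :* (var (# 4) :+ var (# 5)) ≈ k 2 :* lift+ 𝐚 by 25Q₊
    hz c = c · k 24 :* var (# 3) ≈ k 5 :* (var (# 4) :- var (# 5)) by z-Q
    hR₋ c = c · k 125 :* (var (# 6) :- var (# 7)) ≈ k 2 :* lift+ 𝐛 by 125R₋
    hR₊ c = c · k 125 :* (var (# 6) :+ var (# 7)) ≈ k 2 :* var (# 3) :* lift+ 𝐥 by 125R₊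

  q∞≈ : q∞ ≈ˢ ⟦ 𝐪 ⟧ ∞.ρ
  q∞≈ = byHyps {ρ = ρ⁺} (+ 2) (hQ₊ (k 1) ∷ hz (n 5) ∷ []) (k 25 :* var (# 4)) (lift+ 𝐪) (λ ()) refl

  q₀≈ : q₀ ≈ˢ ⟦ 𝐪′ ⟧ ∞.ρ
  q₀≈ = byHyps {ρ = ρ⁺} (+ 2) (hQ₊ (k 1) ∷ hz (k 5) ∷ []) (k 25 :* var (# 5)) (lift+ 𝐪′) (λ ()) refl

  r∞≈ : r∞ ≈ˢ ⟦ 𝐫 ⟧ ∞.ρ
  r∞≈ = byHyps {ρ = ρ⁺} (+ 2) (hR₊ (k 1) ∷ hR₋ (k 1) ∷ []) (k 125 :* var (# 6)) (lift+ 𝐫) (λ ()) refl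

  r₀≈ : r₀ ≈ˢ ⟦ 𝐫′ ⟧ ∞.ρ
  r₀≈ = byHyps {ρ = ρ⁺} (+ 2) (hR₊ (k 1) ∷ hR₋ (n 1) ∷ []) (k 125 :* var (# 7)) (lift+ 𝐫′) (λ ()) refl

  private
    N : Expr 4 → Expr 4
    N e = con -1ℤ :* e
    negated : Expr 4 → Expr 4
    negated (con c) = con c
    negated (var zero) = N (var zero)
    negated (var (suc zero)) = N (var (suc zero))
    negated (var (suc (suc zero))) = var (suc (suc zero))
    negated (var (suc (suc (suc zero)))) = N (var (suc (suc (suc zero))))
    negated (e :+ e′) = negated e :+ negated e′
    negated (e :- e′) = negated e :- negated e′
    negated (e :* e′) = negated e :* negated e′
    negated (e :^ i) = negated e :^ i

  q₀≈₀ : q₀ ≈ˢ ⟦ 𝐪 ⟧ 𝟘.ρ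
  q₀≈₀ = SR.trans q₀≈ (byPoly ∞.ρ 𝐪′ (negated 𝐪) refl)

  q∞≈₀ : q∞ ≈ˢ ⟦ 𝐪′ ⟧ 𝟘.ρ
  q∞≈₀ = SR.trans q∞≈ (byPoly ∞.ρ 𝐪 (negated 𝐪′) refl)

  r₀≈₀ : r₀ ≈ˢ ⟦ 𝐫 ⟧ 𝟘.ρ
  r₀≈₀ = SR.trans r₀≈ (byPoly ∞.ρ 𝐫′ (negated 𝐫) refl)

  r∞≈₀ : r∞ ≈ˢ ⟦ 𝐫′ ⟧ 𝟘.ρ
  r∞≈₀ = SR.trans r∞≈ (byPoly ∞.ρ 𝐫 (negated 𝐫′) refl)

  q₀≈V : q₀ ≈ˢ V (const (+ 121) *ˢ q∞)
  q₀≈V = SR.sym (SR.trans (V-const* (+ 121) q∞) (SR.trans (SR.*-congˡ {const (+ 121)} (V-const* (+ 25) E₄))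
    (byPoly (V E₄ ∷ []) (k 121 :* (k 25 :* var zero)) (k 25 :* (k 121 :* var zero)) refl)))

  r₀≈V : r₀ ≈ˢ V (const (+ 1331) *ˢ r∞)
  r₀≈V = SR.sym (SR.trans (V-const* (+ 1331) r∞) (SR.trans (SR.*-congˡ {const (+ 1331)} (V-const* (+ 125) E₆))
    (byPoly (V E₆ ∷ []) (k 1331 :* (k 125 :* var zero)) (k 125 :* (k 1331 :* var zero)) refl)))

  6s+G 6s-G : Series
  6s+G = const (+ 6) *ˢ s +ˢ G
  6s-G = const (+ 6) *ˢ s -ˢ G

  -- The differential systems satisfied by the basis and its multiples by δ

  b∞ b₀ : Fin 12 → Series
  b∞ i = ⟦ basis i ⟧ ∞.ρ
  b₀ i = ⟦ basis i ⟧ 𝟘.ρ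

  diagonal : ℕ → Series → Fin 12 → Series
  diagonal c a i = const (+ (c ℕ.* weight i) ℤ.* scale) *ˢ a

  diagonalδ : ℕ → Series → Fin 12 → Series
  diagonalδ c a i = const (+ (c ℕ.* (2 ℕ.* weight i ℕ.+ 5)) ℤ.* scale) *ˢ a

  module _ (c : Cusp) where
    open Cusp c

    basis-rule : Sol 30 connection (diagonal 5 (⟦ k 6 :* 𝐬 :+ 𝐆 ⟧ ρ)) (⟦ 𝐪′ ⟧ ρ) (⟦ 𝐫′ ⟧ ρ) (λ i → ⟦ basis i ⟧ ρ)
    basis-rule i = SR.trans
      (byHyps {ρ = θ b ∷ ⟦ d ⟧ ρ ∷ ⟦ basisRight i ⟧ ρ ∷ []} (+ 120)
        ( (con scale · k 3600 :* var (# 0) ≈ var (# 1) by θ⟦⟧ (basis i))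
        ∷ (k 1 · con scale :* var (# 1) ≈ k 120 :* var (# 2) by byRelation (con scale :* d) (k 120 :* basisRight i) (basis-check i))
        ∷ []) (k 30 :* (con scale :* var (# 0))) (var (# 2)) (λ ()) refl)
      (SR.+-cong (SR.sym (SR.*-assoc (const (+ (5 ℕ.* weight i) ℤ.* scale)) (⟦ k 6 :* 𝐬 :+ 𝐆 ⟧ ρ) b)) (≡⇒≈ (rowₑ-⟦⟧ (lookup connection i) 𝐪′ 𝐫′ basis ρ)))
      where
      b = ⟦ basis i ⟧ ρ
      d = derivation levelRule (basis i)

    basisδ-rule : Sol 60 connectionδ (diagonalδ 5 (⟦ k 6 :* 𝐬 :+ 𝐆 ⟧ ρ)) (⟦ 𝐪′ ⟧ ρ) (⟦ 𝐫′ ⟧ ρ) (λ i → δ *ˢ ⟦ basis i ⟧ ρ)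
    basisδ-rule i = SR.trans
      (byHyps {ρ = θ b ∷ ⟦ d ⟧ ρ ∷ ⟦ basisδRight i ⟧ ρ ∷ b ∷ δ ∷ θ δ ∷ θ (δ *ˢ b) ∷ ⟦ k 5 :* 𝐬 :+ 𝐆 ⟧ ρ ∷ []} (+ 60)
        ( (k 3600 :* con scale · var (# 6) ≈ var (# 5) :* var (# 3) :+ var (# 4) :* var (# 0) by θ-* δ b)
        ∷ (con scale :* var (# 4) · k 3600 :* var (# 0) ≈ var (# 1) by θ⟦⟧ (basis i))
        ∷ (k 1800 :* con scale :* var (# 3) · k 2 :* var (# 5) ≈ var (# 7) :* var (# 4) by δ-rule)
        ∷ (var (# 4) · con scale :* var (# 1) :+ con (+ 1800 ℤ.* scale) :* (var (# 7) :* var (# 3)) ≈ k 60 :* var (# 2)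
            by byRelation (con scale :* d :+ con-scale 1800 :* ((k 5 :* 𝐬 :+ 𝐆) :* basis i)) (k 60 :* basisδRight i) (basisδ-check i))
        ∷ []) (k 60 :* (con scale :* var (# 6))) (var (# 4) :* var (# 2)) (λ ()) refl)
      (SR.trans (SR.*-congˡ {δ} (SR.+-congˡ {⟦ con-scale (5 ℕ.* (2 ℕ.* weight i ℕ.+ 5)) :* ((k 6 :* 𝐬 :+ 𝐆) :* basis i) ⟧ ρ} (≡⇒≈ (rowₑ-⟦⟧ (lookup connectionδ i) 𝐪′ 𝐫′ basis ρ))))
        (SR.trans (byPoly (δ ∷ const (+ (5 ℕ.* (2 ℕ.* weight i ℕ.+ 5)) ℤ.* scale) ∷ ⟦ k 6 :* 𝐬 :+ 𝐆 ⟧ ρ ∷ b ∷ R ∷ [])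
            (var (# 0) :* (var (# 1) :* (var (# 2) :* var (# 3)) :+ var (# 4))) ((var (# 1) :* var (# 2)) :* (var (# 0) :* var (# 3)) :+ var (# 0) :* var (# 4)) refl)
          (SR.+-congˡ {diagonalδ 5 (⟦ k 6 :* 𝐬 :+ 𝐆 ⟧ ρ) i *ˢ (δ *ˢ b)} (SR.sym (dotˢ-* δ (rowˢ (lookup connectionδ i) (⟦ 𝐪′ ⟧ ρ) (⟦ 𝐫′ ⟧ ρ)) (λ j → ⟦ basis j ⟧ ρ))))))
      where
      b = ⟦ basis i ⟧ ρ
      d = derivation levelRule (basis i)
      R = dotˢ (rowˢ (lookup connectionδ i) (⟦ 𝐪′ ⟧ ρ) (⟦ 𝐫′ ⟧ ρ)) (λ j → ⟦ basis j ⟧ ρ)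

  𝐆∞ : ⟦ k 6 :* 𝐬 :+ 𝐆 ⟧ ∞.ρ ≈ˢ 6s+G
  𝐆∞ = byPoly (s ∷ G ∷ f ∷ []) (k 6 :* var (# 0) :+ ((var (# 1) :+ k 8 :* var (# 2)) :- k 8 :* var (# 2))) (k 6 :* var (# 0) :+ var (# 1)) refl

  𝐆₀ : ⟦ k 6 :* 𝐬 :+ 𝐆 ⟧ 𝟘.ρ ≈ˢ 6s-G
  𝐆₀ = byPoly (s ∷ G ∷ f ∷ []) (k 6 :* var (# 0) :+ (con -1ℤ :* (var (# 1) :+ k 8 :* var (# 2)) :- k 8 :* (con -1ℤ :* var (# 2)))) (k 6 :* var (# 0) :- var (# 1)) refl

  diagonal-cong : ∀ c {a b} → a ≈ˢ b → ∀ i → diagonal c a i ≈ˢ diagonal c b i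
  diagonal-cong c p i = SR.*-congˡ {const (+ (c ℕ.* weight i) ℤ.* scale)} p

  diagonalδ-cong : ∀ c {a b} → a ≈ˢ b → ∀ i → diagonalδ c a i ≈ˢ diagonalδ c b i
  diagonalδ-cong c p i = SR.*-congˡ {const (+ (c ℕ.* (2 ℕ.* weight i ℕ.+ 5)) ℤ.* scale)} p

  11VE₂≈ : V (const (+ 11) *ˢ E₂) ≈ˢ 6s+G
  11VE₂≈ = SR.trans (V-const* (+ 11) E₂) P′≈

  -- All coefficients have the form V a, which is the hypothesis of `U-Sol` and `χ⊗-Sol`.
  basis∞-rule : Sol 30 connection (diagonal 5 (V (const (+ 11) *ˢ E₂))) (V (const (+ 121) *ˢ q∞)) (V (const (+ 1331) *ˢ r∞)) b∞
  basis∞-rule = Sol-coefficients {table = connection} {v = b∞} (diagonal-cong 5 (SR.trans 𝐆∞ (SR.sym 11VE₂≈))) (SR.trans (SR.sym q₀≈) q₀≈V) (SR.trans (SR.sym r₀≈) r₀≈V) (basis-rule cusp∞)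

  -- Since x, f and z change sign at this cusp, the same table now has level 1 coefficients in q.
  -- After scaling by 11^κ they agree with those that U produces at ∞.
  basis₀-rule : Sol 30 connection (diagonal 5 E₂) q∞ r∞ b₀
  basis₀-rule = Sol-coefficients {table = connection} {v = b₀} (diagonal-cong 5 (SR.trans 𝐆₀ (SR.sym P≈))) (SR.sym q∞≈₀) (SR.sym r∞≈₀) (basis-rule cusp₀)

  δ∞b δ₀b : Fin 12 → Series
  δ∞b i = δ∞ *ˢ b∞ i
  δ₀b i = δ₀ *ˢ b₀ i

  basisδ∞-rule : Sol 60 connectionδ (diagonalδ 5 (V (const (+ 11) *ˢ E₂))) (V (const (+ 121) *ˢ q∞)) (V (const (+ 1331) *ˢ r∞)) δ∞b
  basisδ∞-rule = Sol-coefficients {table = connectionδ} {v = δ∞b} (diagonalδ-cong 5 (SR.trans 𝐆∞ (SR.sym 11VE₂≈))) (SR.trans (SR.sym q₀≈) q₀≈V) (SR.trans (SR.sym r₀≈) r₀≈V) (basisδ-rule cusp∞)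

  basisδ₀-rule : Sol 60 connectionδ (diagonalδ 5 E₂) q∞ r∞ δ₀b
  basisδ₀-rule = Sol-coefficients {table = connectionδ} {v = δ₀b} (diagonalδ-cong 5 (SR.trans 𝐆₀ (SR.sym P≈))) (SR.sym q∞≈₀) (SR.sym r∞≈₀) (basisδ-rule cusp₀)

  11*c : ∀ c → const (+ (11 ℕ.* c)) ≈ˢ E *ˢ const (+ c)
  11*c c = SR.trans (≡⇒≈ (cong const (ℤₚ.pos-* 11 c))) (const-* (+ 11) (+ c))

  θ-E^ : ∀ j b → θ (E ^ˢ j *ˢ b) ≈ˢ E ^ˢ j *ˢ θ b
  θ-E^ zero    b = SR.trans (θ-cong (SR.*-identityˡ b)) (SR.sym (SR.*-identityˡ (θ b)))
  θ-E^ (suc j) b = SR.trans (θ-cong (SR.*-assoc E (E ^ˢ j) b)) (SR.trans (θ-const* (+ 11) (E ^ˢ j *ˢ b))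
    (SR.trans (SR.*-congˡ {E} (θ-E^ j b)) (SR.sym (SR.*-assoc E (E ^ˢ j) (θ b)))))

  -- Transport of such systems along U, χ⊗ and V

  scalars : ∀ m c (w : ℕ) a b → const (+ m) *ˢ (const (+ (c ℕ.* w) ℤ.* scale) *ˢ a *ˢ b) ≈ˢ const (+ ((m ℕ.* c) ℕ.* w) ℤ.* scale) *ˢ (a *ˢ b)
  scalars m c w a b = SR.trans
    (byPoly (const (+ m) ∷ const (+ (c ℕ.* w) ℤ.* scale) ∷ a ∷ b ∷ []) (var (# 0) :* (var (# 1) :* var (# 2) :* var (# 3))) ((var (# 0) :* var (# 1)) :* (var (# 2) :* var (# 3))) refl)
    (SR.*-congʳ {a *ˢ b} (SR.trans (SR.sym (const-* (+ m) (+ (c ℕ.* w) ℤ.* scale))) (≡⇒≈ (cong const (trans (sym (ℤₚ.*-assoc (+ m) (+ (c ℕ.* w)) scale))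
      (cong (ℤ._* scale) (trans (sym (ℤₚ.pos-* m (c ℕ.* w))) (cong +_ (sym (ℕₚ.*-assoc m c w))))))))))

  module _ {d : ℕ} (table : Vec (Vec Entry d) d) (w : Fin d → ℕ) (c m : ℕ) where

    private
      diag : ℕ → Series → Fin d → Series
      diag e a i = const (+ (e ℕ.* w i) ℤ.* scale) *ˢ a

    -- U θ = 11 θ U accounts for the factor 11, and U strips V from the coefficients.
    U-Sol : ∀ {a q r v} → Sol c table (diag m (V a)) (V q) (V r) v → Sol (11 ℕ.* c) table (diag m a) q r (λ i → U (v i))
    U-Sol {a} {q} {r} {v} p i = begin
      const (+ (11 ℕ.* c)) *ˢ (S *ˢ θ (U (v i)))
        ≈⟨ SR.*-congʳ {S *ˢ θ (U (v i))} (11*c c) ⟩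
      (const (+ 11) *ˢ const (+ c)) *ˢ (S *ˢ θ (U (v i)))
        ≈⟨ byPoly (const (+ c) ∷ S ∷ θ (U (v i)) ∷ []) ((k 11 :* var (# 0)) :* (var (# 1) :* var (# 2))) (var (# 0) :* (var (# 1) :* (k 11 :* var (# 2)))) refl ⟩
      const (+ c) *ˢ (S *ˢ (const (+ 11) *ˢ θ (U (v i))))
        ≈⟨ SR.trans (U-const* (+ c) (S *ˢ θ (v i))) (SR.*-congˡ {const (+ c)} (SR.trans (U-const* scale (θ (v i))) (SR.*-congˡ {S} (U-θ (v i))))) ⟨
      U (const (+ c) *ˢ (S *ˢ θ (v i)))
        ≈⟨ U-cong (p i) ⟩
      U (diag m (V a) i *ˢ v i) +ˢ U (dotˢ (rowˢ (lookup table i) (V q) (V r)) v)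
        ≈⟨ SR.+-cong (SR.trans (U-cong (SR.*-assoc (const e) (V a) (v i))) (SR.trans (U-const* e (V a *ˢ v i)) (SR.trans (SR.*-congˡ {const e} (U-V* a (v i))) (SR.sym (SR.*-assoc (const e) a (U (v i)))))))
             (U-row (lookup table i) q r v) ⟩
      diag m a i *ˢ U (v i) +ˢ dotˢ (rowˢ (lookup table i) q r) (λ j → U (v j)) ∎
      where e = + (m ℕ.* w i) ℤ.* scale

    χ⊗-Sol : ∀ {a q r v} → Sol c table (diag m (V a)) (V q) (V r) v → Sol c table (diag m (V a)) (V q) (V r) (λ i → χ⊗ (v i))
    χ⊗-Sol {a} {q} {r} {v} p i = begin
      const (+ c) *ˢ (S *ˢ θ (χ⊗ (v i)))
        ≈⟨ SR.trans (χ⊗-const* (+ c) (S *ˢ θ (v i))) (SR.*-congˡ {const (+ c)} (SR.trans (χ⊗-const* scale (θ (v i))) (SR.*-congˡ {S} (χ⊗-θ (v i))))) ⟨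
      χ⊗ (const (+ c) *ˢ (S *ˢ θ (v i)))
        ≈⟨ SR.trans (χ⊗-cong (p i)) (χ⊗-+ (diag m (V a) i *ˢ v i) _) ⟩
      χ⊗ (diag m (V a) i *ˢ v i) +ˢ χ⊗ (dotˢ (rowˢ (lookup table i) (V q) (V r)) v)
        ≈⟨ SR.+-cong (SR.trans (χ⊗-cong (SR.*-assoc (const e) (V a) (v i))) (SR.trans (χ⊗-const* e (V a *ˢ v i)) (SR.trans (SR.*-congˡ {const e} (χ⊗-V* a (v i))) (SR.sym (SR.*-assoc (const e) (V a) (χ⊗ (v i)))))))
             (χ⊗-row (lookup table i) q r v) ⟩
      diag m (V a) i *ˢ χ⊗ (v i) +ˢ dotˢ (rowˢ (lookup table i) (V q) (V r)) (λ j → χ⊗ (v j)) ∎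
      where e = + (m ℕ.* w i) ℤ.* scale

  module _ {d : ℕ} (table : Vec (Vec Entry d) d) (κ : Fin d → ℕ) (homogeneous : ∀ i → homogeneousRow (κ i) κ (lookup table i) ≡ true) (w : Fin d → ℕ) (c m : ℕ) where

    private
      diag : ℕ → Series → Fin d → Series
      diag e a i = const (+ (e ℕ.* w i) ℤ.* scale) *ˢ a

    -- Multiplying by 11^κ replaces q, r by 121 q, 1331 r.
    scaled-Sol : ∀ {a q r v} → Sol c table (diag m a) q r v →
      Sol (11 ℕ.* c) table (diag (11 ℕ.* m) a) (const (+ 121) *ˢ q) (const (+ 1331) *ˢ r) (λ i → E ^ˢ κ i *ˢ v i)
    scaled-Sol {a} {q} {r} {v} p i = begin
      const (+ (11 ℕ.* c)) *ˢ (S *ˢ θ (E ^ˢ κ i *ˢ v i))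
        ≈⟨ SR.*-cong (11*c c) (SR.*-congˡ {S} (θ-E^ (κ i) (v i))) ⟩
      (const (+ 11) *ˢ const (+ c)) *ˢ (S *ˢ (E ^ˢ κ i *ˢ θ (v i)))
        ≈⟨ byPoly (const (+ c) ∷ S ∷ E ^ˢ κ i ∷ θ (v i) ∷ []) ((k 11 :* var (# 0)) :* (var (# 1) :* (var (# 2) :* var (# 3))))
             ((k 11 :* var (# 2)) :* (var (# 0) :* (var (# 1) :* var (# 3)))) refl ⟩
      E ^ˢ suc (κ i) *ˢ (const (+ c) *ˢ (S *ˢ θ (v i)))
        ≈⟨ SR.*-congˡ {E ^ˢ suc (κ i)} (p i) ⟩
      E ^ˢ suc (κ i) *ˢ (const e *ˢ a *ˢ v i +ˢ dotˢ (rowˢ (lookup table i) q r) v)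
        ≈⟨ SR.distribˡ (E ^ˢ suc (κ i)) (const e *ˢ a *ˢ v i) _ ⟩
      E ^ˢ suc (κ i) *ˢ (const e *ˢ a *ˢ v i) +ˢ E ^ˢ suc (κ i) *ˢ dotˢ (rowˢ (lookup table i) q r) v
        ≈⟨ SR.+-cong (SR.trans (byPoly (E ^ˢ κ i ∷ const e ∷ a ∷ v i ∷ []) ((k 11 :* var (# 0)) :* (var (# 1) :* var (# 2) :* var (# 3))) (k 11 :* (var (# 1) :* var (# 2) :* (var (# 0) :* var (# 3)))) refl)
               (SR.trans (scalars 11 m (w i) a (E ^ˢ κ i *ˢ v i)) (SR.sym (SR.*-assoc (const (+ ((11 ℕ.* m) ℕ.* w i) ℤ.* scale)) a (E ^ˢ κ i *ˢ v i)))))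
             (scaledRow (κ i) κ (lookup table i) q r v (homogeneous i)) ⟩
      _ ∎
      where
      e = + (m ℕ.* w i) ℤ.* scale

    -- θ V = 11 V θ; together with 11^κ this makes 11^(κ+1), which homogeneity distributes over the
    -- entries of the row.
    V-Sol : ∀ {a q r v} → Sol c table (diag m a) q r v →
      Sol c table (diag (11 ℕ.* m) (V a)) (const (+ 121) *ˢ V q) (const (+ 1331) *ˢ V r) (λ i → E ^ˢ κ i *ˢ V (v i))
    V-Sol {a} {q} {r} {v} p i = begin
      const (+ c) *ˢ (S *ˢ θ (E ^ˢ κ i *ˢ V (v i)))
        ≈⟨ SR.*-congˡ {const (+ c)} (SR.*-congˡ {S} (SR.trans (θ-E^ (κ i) (V (v i))) (SR.*-congˡ {E ^ˢ κ i} (θ-V (v i))))) ⟩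
      const (+ c) *ˢ (S *ˢ (E ^ˢ κ i *ˢ (E *ˢ V (θ (v i)))))
        ≈⟨ byPoly (const (+ c) ∷ S ∷ E ^ˢ κ i ∷ V (θ (v i)) ∷ []) (var (# 0) :* (var (# 1) :* (var (# 2) :* (k 11 :* var (# 3)))))
             ((k 11 :* var (# 2)) :* (var (# 0) :* (var (# 1) :* var (# 3)))) refl ⟩
      E ^ˢ suc (κ i) *ˢ (const (+ c) *ˢ (S *ˢ V (θ (v i))))
        ≈⟨ SR.*-congˡ {E ^ˢ suc (κ i)} (SR.trans (V-const* (+ c) (S *ˢ θ (v i))) (SR.*-congˡ {const (+ c)} (V-const* scale (θ (v i))))) ⟨
      E ^ˢ suc (κ i) *ˢ V (const (+ c) *ˢ (S *ˢ θ (v i)))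
        ≈⟨ SR.*-congˡ {E ^ˢ suc (κ i)} (SR.trans (V-cong (p i)) (V-+ (const e *ˢ a *ˢ v i) _)) ⟩
      E ^ˢ suc (κ i) *ˢ (V (const e *ˢ a *ˢ v i) +ˢ V (dotˢ (rowˢ (lookup table i) q r) v))
        ≈⟨ SR.*-congˡ {E ^ˢ suc (κ i)} (SR.+-cong (SR.trans (V-* (const e *ˢ a) (v i)) (SR.*-congʳ {V (v i)} (V-const* e a))) (V-row (lookup table i) q r v)) ⟩
      E ^ˢ suc (κ i) *ˢ (const e *ˢ V a *ˢ V (v i) +ˢ dotˢ (rowˢ (lookup table i) (V q) (V r)) (λ j → V (v j)))
        ≈⟨ SR.distribˡ (E ^ˢ suc (κ i)) (const e *ˢ V a *ˢ V (v i)) _ ⟩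
      E ^ˢ suc (κ i) *ˢ (const e *ˢ V a *ˢ V (v i)) +ˢ E ^ˢ suc (κ i) *ˢ dotˢ (rowˢ (lookup table i) (V q) (V r)) (λ j → V (v j))
        ≈⟨ SR.+-cong (SR.trans (byPoly (E ^ˢ κ i ∷ const e ∷ V a ∷ V (v i) ∷ []) ((k 11 :* var (# 0)) :* (var (# 1) :* var (# 2) :* var (# 3))) (k 11 :* (var (# 1) :* var (# 2) :* (var (# 0) :* var (# 3)))) refl)
               (SR.trans (scalars 11 m (w i) (V a) (E ^ˢ κ i *ˢ V (v i))) (SR.sym (SR.*-assoc (const (+ ((11 ℕ.* m) ℕ.* w i) ℤ.* scale)) (V a) (E ^ˢ κ i *ˢ V (v i))))))
             (scaledRow (κ i) κ (lookup table i) (V q) (V r) (λ j → V (v j)) (homogeneous i)) ⟩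
      _ ∎
      where e = + (m ℕ.* w i) ℤ.* scale

open Basis

-- The trace from level 11 to level 1, and approximations of the basic series.

module Trace where

  open import Relation.Binary.Reasoning.Setoid SR.setoid

  private
    k n : ∀ {m} → ℕ → Expr m
    k i = con (+ i)
    n i = con (ℤ.- (+ i))
    𝐱 = ring-𝐱 ; 𝐟 = ring-𝐟 ; 𝐬 = ring-𝐬 ; 𝐳 = ring-𝐳 ; 𝐆 = ring-𝐆 ; 𝐚 = ring-𝐚 ; 𝐛 = ring-𝐛 ; 𝐥 = ring-𝐥
    module ∞ = Cusp cusp∞
    module 𝟘 = Cusp cusp₀

  eigenvalues : ℤ → List ℕ → List ℤ
  eigenvalues K = List.map (λ r → K ℤ.* + r)

  allBelow : ℕ → List ℕ → Bool
  allBelow b []       = true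
  allBelow b (r ∷ rs) = (r ℕ.<ᵇ b) ∧ allBelow b rs

  -- Since c = 11 K, order n corresponds to the exponent 11 n in units of K, and n > N gives 11 n ≥
  -- 11 (N + 1), beyond all listed exponents.
  not-eigenvalue : ∀ K c N rs → K ≢ 0ℤ → c ≡ K ℤ.* + 11 → allBelow (11 ℕ.* suc N) rs ≡ true →
    ∀ n → N < n → ∀ ρ → ρ ∈ˡ eigenvalues K rs → c ℤ.* + n ≢ ρ
  not-eigenvalue K c N (r ∷ rs) K≢0 c≡ eq n N<n ρ (here refl) cn≡ =
    ℕₚ.<⇒≢ (ℕₚ.<-≤-trans (ℕₚ.<ᵇ⇒< r (11 ℕ.* suc N) (subst T (sym (proj₁ (∧-true {r ℕ.<ᵇ 11 ℕ.* suc N} eq))) _)) (ℕₚ.*-monoʳ-≤ 11 N<n))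
      (sym (ℤₚ.+-injective (cancel (trans (sym shape) cn≡))))
    where
    shape : c ℤ.* + n ≡ K ℤ.* + (11 ℕ.* n)
    shape = trans (cong (ℤ._* + n) c≡) (trans (ℤₚ.*-assoc K (+ 11) (+ n)) (cong (K ℤ.*_) (sym (ℤₚ.pos-* 11 n))))
    distrib : ∀ i j l → i ℤ.* (j ℤ.- l) ≡ i ℤ.* j ℤ.- i ℤ.* l
    distrib = solve-∀
    cancel : ∀ {i j} → K ℤ.* i ≡ K ℤ.* j → i ≡ j
    cancel {i} {j} p with ℤₚ.i*j≡0⇒i≡0∨j≡0 K (trans (distrib K i j) (ℤₚ.i≡j⇒i-j≡0 p))
    ... | inj₁ K≡0 = ⊥-elim (K≢0 K≡0)
    ... | inj₂ i-j≡0 = ℤₚ.i-j≡0⇒i≡j i j i-j≡0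
  not-eigenvalue K c N (r ∷ rs) K≢0 c≡ eq n N<n ρ (there ρ∈) =
    not-eigenvalue K c N rs K≢0 c≡ (proj₂ (∧-true {r ℕ.<ᵇ 11 ℕ.* suc N} eq)) n N<n ρ ρ∈

  isZeroℤ-sound : ∀ i → isZeroℤ i ≡ true → i ≡ 0ℤ
  isZeroℤ-sound (+ zero) _ = refl

  τˢ : Fin 12 → Series
  τˢ i = ⟦ τ i ⟧ ∞.ρ

  diagonal-11 : ∀ (w : Fin 12 → ℕ) c a i → const (+ (c ℕ.* w i) ℤ.* scale) *ˢ (E *ˢ a) ≈ˢ const (+ ((11 ℕ.* c) ℕ.* w i) ℤ.* scale) *ˢ a
  diagonal-11 w c a i = SR.trans (byPoly (const (+ (c ℕ.* w i) ℤ.* scale) ∷ a ∷ []) (var (# 0) :* (k 11 :* var (# 1))) (k 11 :* (var (# 0) :* var (# 1) :* k 1)) refl)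
    (SR.trans (scalars 11 c (w i) a 1ˢ) (SR.*-congˡ {const (+ ((11 ℕ.* c) ℕ.* w i) ℤ.* scale)} (SR.*-identityʳ a)))

  𝐆∞-E₂ : ⟦ k 6 :* 𝐬 :- 𝐆 ⟧ ∞.ρ ≈ˢ E₂
  𝐆∞-E₂ = SR.trans (byPoly (s ∷ G ∷ f ∷ []) (k 6 :* var (# 0) :- ((var (# 1) :+ k 8 :* var (# 2)) :- k 8 :* var (# 2))) (k 6 :* var (# 0) :- var (# 1)) refl) (SR.sym P≈)

  τ-rule : Sol 330 connection (diagonal 55 E₂) (const (+ 121) *ˢ q∞) (const (+ 1331) *ˢ r∞) τˢ
  τ-rule = Sol-coefficients {table = connection} {v = τˢ} (diagonal-cong 55 𝐆∞-E₂) (SR.*-congˡ {const (+ 121)} (SR.sym q∞≈)) (SR.*-congˡ {const (+ 1331)} (SR.sym r∞≈))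
    (λ i → SR.trans
      (byHyps {ρ = θ (τˢ i) ∷ ⟦ derivation levelRule (τ i) ⟧ ∞.ρ ∷ ⟦ τRight i ⟧ ∞.ρ ∷ []} (+ 120)
        ( (k 11 :* con scale · k 3600 :* var (# 0) ≈ var (# 1) by ∞.θ⟦⟧ (τ i))
        ∷ (k 1 · con (+ 11 ℤ.* scale) :* var (# 1) ≈ k 120 :* var (# 2) by ∞.byRelation (con-scale 11 :* derivation levelRule (τ i)) (k 120 :* τRight i) (τ-check i))
        ∷ []) (k 330 :* (con scale :* var (# 0))) (var (# 2)) (λ ()) refl)
      (SR.+-congˡ {diagonal 55 (⟦ k 6 :* 𝐬 :- 𝐆 ⟧ ∞.ρ) i *ˢ τˢ i} (≡⇒≈ (rowₑ-⟦⟧ (lookup connection i) (k 121 :* 𝐪) (k 1331 :* 𝐫) τ ∞.ρ))))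

  -- In weight 2 κ, the trace of w b to level 1 is w b + 11^(1-κ) U b; 11^κ times this is 11 U b +
  -- 11^κ w b. The two summands solve one system, by `U-Sol` and by `scaled-Sol`.
  trace-defect : Fin 12 → Series
  trace-defect i = (const (+ 11) *ˢ U (b∞ i) +ˢ E ^ˢ weight i *ˢ b₀ i) +ˢ const -1ℤ *ˢ τˢ i

  trace-rule : Sol 330 connection (diagonal 55 E₂) (const (+ 121) *ˢ q∞) (const (+ 1331) *ˢ r∞) trace-defect
  trace-rule = Sol-+ {table = connection} {v = λ i → const (+ 11) *ˢ U (b∞ i) +ˢ E ^ˢ weight i *ˢ b₀ i} {w = λ i → const -1ℤ *ˢ τˢ i}
    (Sol-+ {table = connection} {v = λ i → const (+ 11) *ˢ U (b∞ i)} {w = λ i → E ^ˢ weight i *ˢ b₀ i}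
      (Sol-* {table = connection} (+ 11) {v = λ i → U (b∞ i)} (Sol-coefficients {table = connection} {v = λ i → U (b∞ i)} (diagonal-11 weight 5 E₂) SR.refl SR.refl
        (U-Sol connection weight 30 5 {v = b∞} basis∞-rule)))
      (scaled-Sol connection weight connection-homogeneous weight 30 5 {v = b₀} basis₀-rule))
    (Sol-* {table = connection} -1ℤ {v = τˢ} τ-rule)

  opaque
    -- Constant terms suffice: the exponents of the residue matrix are at most 10, while order 1
    -- already corresponds to 11.
    trace-initial : ∀ i → trace-defect i 0 ≡ 0ℤ
    trace-initial i = isZeroℤ-sound _ (every-sound (λ i → isZeroℤ (trace-defect i 0)) refl i)

  traceExponents : List ℕ
  traceExponents = 0 ∷ 1 ∷ 2 ∷ 3 ∷ 4 ∷ 5 ∷ 6 ∷ 7 ∷ 8 ∷ 9 ∷ 10 ∷ []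

  traceMatrix : Vec (Vec ℤ 12) 12
  traceMatrix
    = (+ 0 ∷ + 0 ∷ + 0 ∷ + 0 ∷ + 0 ∷ + 0 ∷ + 0 ∷ + 0 ∷ + 0 ∷ + 0 ∷ + 0 ∷ + 0 ∷ [])
    ∷ (-[1+ 4384613474999 ] ∷ + 797202450000 ∷ + 15944049000 ∷ + 0 ∷ -[1+ 2087220959999 ] ∷ + 0 ∷ + 12755239200000 ∷ + 0 ∷ + 0 ∷ + 0 ∷ + 0 ∷ + 0 ∷ [])
    ∷ (-[1+ 438461347499999 ] ∷ + 79720245000000 ∷ + 1594404900000 ∷ -[1+ 1052307233999999 ] ∷ + 0 ∷ -[1+ 30960444239999 ] ∷ + 0 ∷ + 102041913600000 ∷ + 0 ∷ + 829090548000000 ∷ + 0 ∷ + 0 ∷ [])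
    ∷ (+ 0 ∷ + 0 ∷ + 0 ∷ + 797202450000 ∷ -[1+ 72472949999 ] ∷ + 0 ∷ + 579783600000 ∷ + 0 ∷ + 0 ∷ + 0 ∷ + 0 ∷ + 0 ∷ [])
    ∷ (+ 0 ∷ + 0 ∷ + 0 ∷ -[1+ 4384613474999 ] ∷ + 1594404900000 ∷ -[1+ 56528900999 ] ∷ + 0 ∷ -[1+ 1507437359999 ] ∷ + 0 ∷ + 12755239200000 ∷ + 0 ∷ + 0 ∷ [])
    ∷ (+ 10075753187500 ∷ -[1+ 1831955124999 ] ∷ -[1+ 36639102499 ] ∷ + 45094280000000 ∷ -[1+ 10009319649999 ] ∷ + 2391607350000 ∷ + 49603708000000 ∷ + 0 ∷ -[1+ 1159567199999 ] ∷ + 0 ∷ + 7247295000000 ∷ + 0 ∷ [])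
    ∷ (+ 0 ∷ + 0 ∷ + 0 ∷ + 0 ∷ + 0 ∷ + 0 ∷ + 1594404900000 ∷ -[1+ 144945899999 ] ∷ + 0 ∷ + 1159567200000 ∷ + 0 ∷ + 0 ∷ [])
    ∷ (-[1+ 121794818749 ] ∷ + 22144512500 ∷ + 442890250 ∷ + 6200463500000 ∷ -[1+ 1346386359999 ] ∷ + 0 ∷ + 11205123325000 ∷ + 2391607350000 ∷ + 253655325000 ∷ + 0 ∷ -[1+ 1884296699999 ] ∷ + 0 ∷ [])
    ∷ (-[1+ 968822421874 ] ∷ + 176149531250 ∷ + 3522990625 ∷ + 10629366000000 ∷ -[1+ 1368933499999 ] ∷ -[1+ 320491489999 ] ∷ + 57978360000000 ∷ -[1+ 7714342899999 ] ∷ + 3188809800000 ∷ + 65608151125000 ∷ + 0 ∷ -[1+ 36236474999 ] ∷ [])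
    ∷ (-[1+ 16608384374 ] ∷ + 3019706250 ∷ + 60394125 ∷ + 845517750000 ∷ -[1+ 183598139999 ] ∷ + 0 ∷ + 2125873200000 ∷ + 0 ∷ + 52180524000 ∷ + 2391607350000 ∷ -[1+ 347870159999 ] ∷ + 0 ∷ [])
    ∷ (-[1+ 49825153124 ] ∷ + 9059118750 ∷ + 181182375 ∷ -[1+ 1018647574999 ] ∷ + 214197830000 ∷ -[1+ 10790416999 ] ∷ + 2721761900000 ∷ -[1+ 1114472919999 ] ∷ + 0 ∷ + 7472766400000 ∷ + 3188809800000 ∷ -[1+ 14494589999 ] ∷ [])
    ∷ (-[1+ 581293453124 ] ∷ + 105689718750 ∷ + 2113794375 ∷ + 27378670000000 ∷ -[1+ 6023307399999 ] ∷ + 8052550000 ∷ + 80606025500000 ∷ + 161051000000 ∷ + 1159567200000 ∷ + 51536320000000 ∷ -[1+ 8696753999999 ] ∷ + 3986012250000 ∷ [])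
    ∷ []

  opaque
    traceMatrix-correct : constantTerms (systemMatrix connection (diagonal 55 E₂) (const (+ 121) *ˢ q∞) (const (+ 1331) *ˢ r∞)) ≡ traceMatrix
    traceMatrix-correct = refl

    traceMatrix-eigenvalues : annihilates traceMatrix (eigenvalues (+ 30 ℤ.* scale) traceExponents) ≡ true
    traceMatrix-eigenvalues = refl

  trace-identity : ∀ i → const (+ 11) *ˢ U (b∞ i) +ˢ E ^ˢ weight i *ˢ b₀ i ≈ˢ τˢ i
  trace-identity i = -ˢ≈0⇒≈ (SR.trans
    (byPoly (const (+ 11) *ˢ U (b∞ i) +ˢ E ^ˢ weight i *ˢ b₀ i ∷ τˢ i ∷ []) (var (# 0) :- var (# 1)) (var (# 0) :+ con -1ℤ :* var (# 1)) refl)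
    (Sol-unique 0 330 {table = connection} {diagonal 55 E₂} {const (+ 121) *ˢ q∞} {const (+ 1331) *ˢ r∞} {v = trace-defect} (eigenvalues (+ 30 ℤ.* scale) traceExponents) trace-rule (λ { j zero z≤n → trace-initial j }) traceMatrix-correct traceMatrix-eigenvalues
      (not-eigenvalue (+ 30 ℤ.* scale) (+ 330 ℤ.* scale) 0 traceExponents (λ ()) refl refl) i))

  nth : List ℤ → ℕ → ℤ
  nth []      n       = 0ℤ
  nth (c ∷ l) zero    = c
  nth (c ∷ l) (suc n) = nth l n

  series-nth : ∀ l n → series l n ≡ nth l n
  series-nth []      n       = refl
  series-nth (c ∷ l) zero    = ℤₚ.+-identityʳ c
  series-nth (c ∷ l) (suc n) = trans (ℤₚ.+-identityˡ _) (trans (X*ˢ (series l) (suc n)) (series-nth l n))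

  by-nth : ∀ N {a} l → (∀ n → n ≤ N → a n ≡ nth l n) → a ≈ˢ[ N ] series l
  by-nth N l p n n≤N = trans (p n n≤N) (sym (series-nth l n))

  literal : ∀ {a} l → coefficients 15 a ≡ l → a ≈ˢ[ 15 ] series l
  literal {a} l refl = coefficients-series 15 a

  lX lφ lVφ lψ lVψ lG ls lz : List ℤ
  lX  = + 0 ∷ + 1 ∷ + 0 ∷ + 0 ∷ + 0 ∷ + 0 ∷ + 0 ∷ + 0 ∷ + 0 ∷ + 0 ∷ + 0 ∷ + 0 ∷ + 0 ∷ + 0 ∷ + 0 ∷ + 0 ∷ []
  lφ  = + 1 ∷ -[1+ 0 ] ∷ -[1+ 0 ] ∷ + 0 ∷ + 0 ∷ + 1 ∷ + 0 ∷ + 1 ∷ + 0 ∷ + 0 ∷ + 0 ∷ + 0 ∷ -[1+ 0 ] ∷ + 0 ∷ + 0 ∷ -[1+ 0 ] ∷ []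
  lVφ = + 1 ∷ + 0 ∷ + 0 ∷ + 0 ∷ + 0 ∷ + 0 ∷ + 0 ∷ + 0 ∷ + 0 ∷ + 0 ∷ + 0 ∷ -[1+ 0 ] ∷ + 0 ∷ + 0 ∷ + 0 ∷ + 0 ∷ []
  lψ  = + 1 ∷ + 1 ∷ + 2 ∷ + 3 ∷ + 5 ∷ + 7 ∷ + 11 ∷ + 15 ∷ + 22 ∷ + 30 ∷ + 42 ∷ + 56 ∷ + 77 ∷ + 101 ∷ + 135 ∷ + 176 ∷ []
  lVψ = 1ℤ ∷ 0ℤ ∷ 0ℤ ∷ 0ℤ ∷ 0ℤ ∷ 0ℤ ∷ 0ℤ ∷ 0ℤ ∷ 0ℤ ∷ 0ℤ ∷ 0ℤ ∷ 1ℤ ∷ []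
  lG  = + 5 ∷ + 12 ∷ + 36 ∷ + 48 ∷ + 84 ∷ + 72 ∷ + 144 ∷ + 96 ∷ + 180 ∷ + 156 ∷ + 216 ∷ + 12 ∷ + 336 ∷ + 168 ∷ + 288 ∷ + 288 ∷ []
  ls  = + 1 ∷ -[1+ 1 ] ∷ -[1+ 5 ] ∷ -[1+ 7 ] ∷ -[1+ 13 ] ∷ -[1+ 11 ] ∷ -[1+ 23 ] ∷ -[1+ 15 ] ∷ -[1+ 29 ] ∷ -[1+ 25 ] ∷ -[1+ 35 ] ∷ -[1+ 45 ] ∷ -[1+ 55 ] ∷ -[1+ 27 ] ∷ -[1+ 47 ] ∷ -[1+ 47 ] ∷ []
  lz  = -[1+ 24 ] ∷ + 50 ∷ + 450 ∷ + 1400 ∷ + 3650 ∷ + 6300 ∷ + 12600 ∷ + 17200 ∷ + 29250 ∷ + 37850 ∷ + 56700 ∷ + 60550 ∷ + 102200 ∷ + 109900 ∷ + 154800 ∷ + 176400 ∷ []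

  -- The defining recursion of `ψ` branches at every level. Instead, φ times the list of partition
  -- numbers is compared with 1, and φ is cancelled by its inverse `ψ`.
  ψ-literal : ψ ≈ˢ[ 15 ] series lψ
  ψ-literal n n≤15 = trans (sym (SR.*-identityʳ ψ n)) (trans (*ˢ-cong-[] 15 {ψ} {ψ} {1ˢ} {φ *ˢ series lψ} (λ _ _ → refl) (≈[]-sym 15 inverse) n n≤15)
    (byHyps {ρ = ψ ∷ φ ∷ series lψ ∷ []} (+ 1) ((var (# 2) · var (# 1) :* var (# 0) ≈ k 1 by φψ≈1) ∷ []) (var (# 0) :* (var (# 1) :* var (# 2))) (var (# 2)) (λ ()) refl n))
    where
    module T₁₅ = Truncated 15
    inverse : φ *ˢ series lψ ≈ˢ[ 15 ] 1ˢ
    inverse = T₁₅.byTruncation {ss = φ ∷ series lψ ∷ []} {ls = lφ ∷ lψ ∷ []} (literal lφ refl T₁₅.∷ (λ _ _ → refl) T₁₅.∷ T₁₅.[]) (var (# 0) :* var (# 1)) (k 1) refl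

  spread : List ℤ → List ℤ
  spread l = nth l 0 ∷ 0ℤ ∷ 0ℤ ∷ 0ℤ ∷ 0ℤ ∷ 0ℤ ∷ 0ℤ ∷ 0ℤ ∷ 0ℤ ∷ 0ℤ ∷ 0ℤ ∷ nth l 1 ∷ []

  V-truncated : ∀ {a} l → a ≈ˢ[ 1 ] series l → V a ≈ˢ[ 15 ] series (spread l)
  V-truncated {a} l p = by-nth 15 (spread l) go
    where
    go : ∀ n → n ≤ 15 → V a n ≡ nth (spread l) n
    go 0 _ = trans (p 0 z≤n) (series-nth l 0)
    go 11 _ = trans (p 1 ℕₚ.≤-refl) (series-nth l 1)
    go 1 _ = refl
    go 2 _ = refl
    go 3 _ = refl
    go 4 _ = refl
    go 5 _ = refl
    go 6 _ = refl
    go 7 _ = refl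
    go 8 _ = refl
    go 9 _ = refl
    go 10 _ = refl
    go 12 _ = refl
    go 13 _ = refl
    go 14 _ = refl
    go 15 _ = refl
    go (suc (suc (suc (suc (suc (suc (suc (suc (suc (suc (suc (suc (suc (suc (suc (suc n)))))))))))))))) n≤15 = ⊥-elim (ℕₚ.<⇒≱ (ℕₚ.m≤m+n 16 n) n≤15)

  twistL : ℕ → List ℤ → List ℤ
  twistL m []      = []
  twistL m (c ∷ l) = χ m ℤ.* c ∷ twistL (suc m) l

  twistL-nth : ∀ m l n → nth (twistL m l) n ≡ χ (m ℕ.+ n) ℤ.* nth l n
  twistL-nth m []      n       = sym (ℤₚ.*-zeroʳ (χ (m ℕ.+ n)))
  twistL-nth m (c ∷ l) zero    = cong (λ j → χ j ℤ.* c) (sym (ℕₚ.+-identityʳ m))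
  twistL-nth m (c ∷ l) (suc n) = trans (twistL-nth (suc m) l n) (cong (λ j → χ j ℤ.* nth l n) (sym (ℕₚ.+-suc m n)))

  χ⊗-truncated : ∀ N {a} l → a ≈ˢ[ N ] series l → χ⊗ a ≈ˢ[ N ] series (twistL 0 l)
  χ⊗-truncated N l p = by-nth N (twistL 0 l) λ n n≤N → trans (cong (χ n ℤ.*_) (trans (p n n≤N) (series-nth l n))) (sym (twistL-nth 0 l n))

  shiftedList : ℕ → List ℤ → List ℤ
  shiftedList zero    l = l
  shiftedList (suc m) l = 0ℤ ∷ shiftedList m l

  -- Multiplication by q^m raises the known precision by m, which a plain truncated product would
  -- not notice.
  X^-truncated : ∀ m N {a} l → a ≈ˢ[ N ] series l → X ^ˢ m *ˢ a ≈ˢ[ m ℕ.+ N ] series (shiftedList m l)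
  X^-truncated zero    N {a} l p = ≈[]-trans N (≈⇒≈[] N (SR.*-identityˡ a)) p
  X^-truncated (suc m) N {a} l p = ≈[]-trans (suc m ℕ.+ N) (≈⇒≈[] (suc m ℕ.+ N) (SR.*-assoc X (X ^ˢ m) a))
    (≈[]-trans (suc m ℕ.+ N) (X*ˢ-cong-[] (m ℕ.+ N) (X^-truncated m N l p))
      (≈⇒≈[] (suc m ℕ.+ N) (SR.trans (SR.sym (SR.+-identityˡ _)) (SR.+-congʳ {X *ˢ series (shiftedList m l)} 0ˢ≈const))))

  base : Series → Vec Series 9
  base w = w ∷ X ∷ φ ∷ V φ ∷ ψ ∷ V ψ ∷ G ∷ s ∷ z ∷ []

  -- Order 15 is needed at the cusp 0, where exponents reach 165 = 11 · 15. Of 15 orders U leaves 1,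
  -- and the factor q⁵ of `δ∞` raises this to the 6 needed at ∞.
  module T₁  = Truncated 1
  module T₆  = Truncated 6
  module T₁₅ = Truncated 15

  module _ (N : ℕ) (N≤15 : N ≤ 15) where
    open Truncated N

    below : ∀ {a} → T₁₅.Approx a → Approx a
    below (T₁₅.approx l q) = approx l (λ n n≤N → q n (ℕₚ.≤-trans n≤N N≤15))

    approx-base : ∀ {w} → Approx w → Approxes (base w)
    approx-base A = A ∷ᴬ below (T₁₅.approx lX (literal lX refl)) ∷ᴬ below (T₁₅.approx lφ (literal lφ refl)) ∷ᴬ below (T₁₅.approx lVφ (literal lVφ refl))
      ∷ᴬ below (T₁₅.approx lψ ψ-literal)
      ∷ᴬ below (T₁₅.approx lVψ (V-truncated lψ (λ n n≤1 → ψ-literal n (ℕₚ.≤-trans n≤1 (s≤s z≤n)))))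
      ∷ᴬ below (T₁₅.approx lG (literal lG refl)) ∷ᴬ below (T₁₅.approx ls (literal ls refl)) ∷ᴬ below (T₁₅.approx lz (literal lz refl)) ∷ᴬ []ᴬ

  approx-U : ∀ {a} → T₁₅.Approx a → T₁.Approx (U a)
  approx-U {a} (T₁₅.approx l p) = T₁.approx (nth l 0 ∷ nth l 11 ∷ []) (by-nth 1 (nth l 0 ∷ nth l 11 ∷ []) λ
    { 0 _ → trans (p 0 z≤n) (series-nth l 0)
    ; 1 _ → trans (p 11 (ℕₚ.m≤m+n 11 4)) (series-nth l 11)
    ; (suc (suc n)) (s≤s ()) })

  approx-V : ∀ {a} → T₁.Approx a → T₁₅.Approx (V a)
  approx-V (T₁.approx l p) = T₁₅.approx (spread l) (V-truncated l p)

  approx-χ⊗ : ∀ {a} → T₁₅.Approx a → T₁₅.Approx (χ⊗ a)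
  approx-χ⊗ (T₁₅.approx l p) = T₁₅.approx (twistL 0 l) (χ⊗-truncated 15 l p)

  approx-X⁵ : ∀ {a} → T₁.Approx a → T₆.Approx (X ^ˢ 5 *ˢ a)
  approx-X⁵ (T₁.approx l p) = T₆.approx (shiftedList 5 l) (X^-truncated 5 1 l p)

open Trace

-- The image of the basis under b ↦ δ U(δ b) at both cusps.

module HeckeImage where

  open import Relation.Binary.Reasoning.Setoid SR.setoid

  private
    k n : ∀ {m} → ℕ → Expr m
    k i = con (+ i)
    n i = con (ℤ.- (+ i))
    𝐱 = ring-𝐱 ; 𝐟 = ring-𝐟 ; 𝐬 = ring-𝐬 ; 𝐳 = ring-𝐳 ; 𝐆 = ring-𝐆
    module ∞ = Cusp cusp∞
    module 𝟘 = Cusp cusp₀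

  -- The operator b ↦ δ U(δ b) and its expansion at the other cusp

  Sol-δ : ∀ {d} {table : Vec (Vec Entry d) d} {diag q r F} {v} δ → const (+ 2) *ˢ θ δ ≈ˢ F *ˢ δ → Sol 660 table diag q r v →
    Sol 660 table (λ i → diag i +ˢ const (+ 330 ℤ.* scale) *ˢ F) q r (λ i → δ *ˢ v i)
  Sol-δ {table = table} {diag} {q} {r} {F} {v} δ p sol i = SR.trans
    (byHyps {ρ = θ (δ *ˢ v i) ∷ θ δ ∷ θ (v i) ∷ δ ∷ v i ∷ F ∷ diag i ∷ D ∷ []} (+ 1)
      ( (k 660 :* con scale · var (# 0) ≈ var (# 1) :* var (# 4) :+ var (# 3) :* var (# 2) by θ-* δ (v i))
      ∷ (k 330 :* con scale :* var (# 4) · k 2 :* var (# 1) ≈ var (# 5) :* var (# 3) by p)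
      ∷ (var (# 3) · k 660 :* (con scale :* var (# 2)) ≈ var (# 6) :* var (# 4) :+ var (# 7) by sol i)
      ∷ []) (k 660 :* (con scale :* var (# 0))) ((var (# 6) :+ con (+ 330 ℤ.* scale) :* var (# 5)) :* (var (# 3) :* var (# 4)) :+ var (# 3) :* var (# 7)) (λ ()) refl)
    (SR.+-congˡ {(diag i +ˢ const (+ 330 ℤ.* scale) *ˢ F) *ˢ (δ *ˢ v i)} (SR.sym (dotˢ-* δ (rowˢ (lookup table i) q r) v)))
    where D = dotˢ (rowˢ (lookup table i) q r) v

  F∞ F₀ : Series
  F∞ = ⟦ k 5 :* 𝐬 :+ 𝐆 ⟧ ∞.ρ
  F₀ = ⟦ k 5 :* 𝐬 :+ 𝐆 ⟧ 𝟘.ρ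

  diag∞ diag₀ : Fin 12 → Series
  diag∞ i = diagonalδ 55 E₂ i +ˢ const (+ 330 ℤ.* scale) *ˢ F∞
  diag₀ i = diagonalδ 55 (V (E *ˢ E₂)) i +ˢ const (+ 330 ℤ.* scale) *ˢ F₀

  H-rule : ∀ c → let open Cusp c in
    Sol 660 connectionδ (λ i → diagonalδ 55 (⟦ k 6 :* 𝐬 :- 𝐆 ⟧ ρ) i +ˢ const (+ 330 ℤ.* scale) *ˢ ⟦ k 5 :* 𝐬 :+ 𝐆 ⟧ ρ)
      (const (+ 121) *ˢ ⟦ 𝐪 ⟧ ρ) (const (+ 1331) *ˢ ⟦ 𝐫 ⟧ ρ) (λ i → ⟦ H i ⟧ ρ)
  H-rule c i = SR.trans
    (byHyps {ρ = θ h ∷ ⟦ derivation levelRule (H i) ⟧ ρ ∷ ⟦ HRight i ⟧ ρ ∷ []} (+ 60)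
      ( (k 11 :* con scale · k 3600 :* var (# 0) ≈ var (# 1) by θ⟦⟧ (H i))
      ∷ (k 1 · con (+ 11 ℤ.* scale) :* var (# 1) ≈ k 60 :* var (# 2) by byRelation (con-scale 11 :* derivation levelRule (H i)) (k 60 :* HRight i) (H-check i))
      ∷ []) (k 660 :* (con scale :* var (# 0))) (var (# 2)) (λ ()) refl)
    (SR.+-congˡ {(diagonalδ 55 (⟦ k 6 :* 𝐬 :- 𝐆 ⟧ ρ) i +ˢ const (+ 330 ℤ.* scale) *ˢ ⟦ k 5 :* 𝐬 :+ 𝐆 ⟧ ρ) *ˢ h}
      (≡⇒≈ (rowₑ-⟦⟧ (lookup connectionδ i) (k 121 :* 𝐪) (k 1331 :* 𝐫) H ρ)))
    where
    open Cusp c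
    h = ⟦ H i ⟧ ρ

  -- `twisted` is the expansion of U(δ b) at 0, up to a scalar. U averages over the translates by
  -- j/11: j = 0 leads to V of the expansion of δ b at 0, and the translates with j ≠ 0 combine to a
  -- Gauss sum, that is to the twist by χ of the expansion at ∞.
  H∞ H₀ h∞ h₀ twisted : Fin 12 → Series
  H∞ i = ⟦ H i ⟧ ∞.ρ
  H₀ i = ⟦ H i ⟧ 𝟘.ρ
  h∞ i = δ∞ *ˢ U (δ∞b i)
  twisted i = const (+ 11) *ˢ χ⊗ (δ∞b i) +ˢ E ^ˢ weight i *ˢ V (δ₀b i)
  h₀ i = δ₀ *ˢ (E ^ˢ weight i *ˢ twisted i)

  weightδ : Fin 12 → ℕ
  weightδ i = 2 ℕ.* weight i ℕ.+ 5

  H∞-rule : Sol 660 connectionδ diag∞ (const (+ 121) *ˢ q∞) (const (+ 1331) *ˢ r∞) H∞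
  H∞-rule = Sol-coefficients {table = connectionδ} {v = H∞} (λ i → SR.+-congʳ {const (+ 330 ℤ.* scale) *ˢ F∞} (diagonalδ-cong 55 𝐆∞-E₂ i))
    (SR.*-congˡ {const (+ 121)} (SR.sym q∞≈)) (SR.*-congˡ {const (+ 1331)} (SR.sym r∞≈)) (H-rule cusp∞)

  h∞-rule : Sol 660 connectionδ diag∞ (const (+ 121) *ˢ q∞) (const (+ 1331) *ˢ r∞) h∞
  h∞-rule = Sol-δ {table = connectionδ} {v = λ i → U (δ∞b i)} δ∞ ∞.δ-rule
    (Sol-coefficients {table = connectionδ} {v = λ i → U (δ∞b i)} (diagonal-11 weightδ 5 E₂) SR.refl SR.refl (U-Sol connectionδ weightδ 60 5 {v = δ∞b} basisδ∞-rule))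

  𝐆₀-6s+G : ⟦ k 6 :* 𝐬 :- 𝐆 ⟧ 𝟘.ρ ≈ˢ V (E *ˢ E₂)
  𝐆₀-6s+G = SR.trans (byPoly (s ∷ G ∷ f ∷ []) (k 6 :* var (# 0) :- (con -1ℤ :* (var (# 1) :+ k 8 :* var (# 2)) :- k 8 :* (con -1ℤ :* var (# 2)))) (k 6 :* var (# 0) :+ var (# 1)) refl)
    (SR.sym 11VE₂≈)

  H₀-rule : Sol 660 connectionδ diag₀ (const (+ 121) *ˢ V (const (+ 121) *ˢ q∞)) (const (+ 1331) *ˢ V (const (+ 1331) *ˢ r∞)) H₀
  H₀-rule = Sol-coefficients {table = connectionδ} {v = H₀} (λ i → SR.+-congʳ {const (+ 330 ℤ.* scale) *ˢ F₀} (diagonalδ-cong 55 𝐆₀-6s+G i))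
    (SR.*-congˡ {const (+ 121)} (SR.trans (SR.sym q₀≈₀) q₀≈V)) (SR.*-congˡ {const (+ 1331)} (SR.trans (SR.sym r₀≈₀) r₀≈V)) (H-rule cusp₀)

  twisted-rule : Sol 60 connectionδ (diagonalδ 5 (V (E *ˢ E₂))) (V (const (+ 121) *ˢ q∞)) (V (const (+ 1331) *ˢ r∞)) twisted
  twisted-rule = Sol-+ {table = connectionδ} {v = λ i → const (+ 11) *ˢ χ⊗ (δ∞b i)} {w = λ i → E ^ˢ weight i *ˢ V (δ₀b i)}
    (Sol-* {table = connectionδ} (+ 11) {v = λ i → χ⊗ (δ∞b i)} (χ⊗-Sol connectionδ weightδ 60 5 {v = δ∞b} basisδ∞-rule))
    (Sol-coefficients {table = connectionδ} {v = λ i → E ^ˢ weight i *ˢ V (δ₀b i)}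
      (λ i → SR.trans (SR.sym (diagonal-11 weightδ 5 (V E₂) i)) (diagonalδ-cong 5 (SR.sym (V-const* (+ 11) E₂)) i))
      (SR.sym (V-const* (+ 121) q∞)) (SR.sym (V-const* (+ 1331) r∞))
      (V-Sol connectionδ weight connectionδ-homogeneous weightδ 60 5 {v = δ₀b} basisδ₀-rule))

  h₀-rule : Sol 660 connectionδ diag₀ (const (+ 121) *ˢ V (const (+ 121) *ˢ q∞)) (const (+ 1331) *ˢ V (const (+ 1331) *ˢ r∞)) h₀
  h₀-rule = Sol-δ {table = connectionδ} {v = λ i → E ^ˢ weight i *ˢ twisted i} δ₀ 𝟘.δ-rule
    (scaled-Sol connectionδ weight connectionδ-homogeneous weightδ 60 5 {v = twisted} twisted-rule)

  fₑ xₑ εₑ δ₀ₑ δ∞ₑ : Expr 9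
  fₑ = var (# 1) :* (var (# 2) :* var (# 2) :* (var (# 3) :* var (# 3)))
  xₑ = var (# 6) :+ k 8 :* fₑ
  εₑ = var (# 3) :^ 11 :* var (# 4)
  δ∞ₑ = var (# 1) :^ 5 :* εₑ
  δ₀ₑ = var (# 2) :^ 11 :* var (# 5)
  σ∞ σ₀ : Vec (Expr 9) 4
  σ∞ = xₑ ∷ fₑ ∷ var (# 7) ∷ var (# 8) ∷ []
  σ₀ = (con -1ℤ :* xₑ) ∷ (con -1ℤ :* fₑ) ∷ var (# 7) ∷ (con -1ℤ :* var (# 8)) ∷ []

  open Level11 using (substitute) public

  substitute-⟦⟧ : ∀ {m m′} (σ : Vec (Expr m′) m) e ρ → ⟦ substitute σ e ⟧ ρ ≡ ⟦ e ⟧ (Vec.map (λ e → ⟦ e ⟧ ρ) σ)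
  substitute-⟦⟧ σ (con c)   ρ = refl
  substitute-⟦⟧ σ (var i)   ρ = sym (Vecₚ.lookup-map i (λ e → ⟦ e ⟧ ρ) σ)
  substitute-⟦⟧ σ (e :+ e′) ρ = cong₂ _+ˢ_ (substitute-⟦⟧ σ e ρ) (substitute-⟦⟧ σ e′ ρ)
  substitute-⟦⟧ σ (e :- e′) ρ = cong₂ _-ˢ_ (substitute-⟦⟧ σ e ρ) (substitute-⟦⟧ σ e′ ρ)
  substitute-⟦⟧ σ (e :* e′) ρ = cong₂ _*ˢ_ (substitute-⟦⟧ σ e ρ) (substitute-⟦⟧ σ e′ ρ)
  substitute-⟦⟧ σ (e :^ j)  ρ = cong (_^ˢ j) (substitute-⟦⟧ σ e ρ)

  -- Dummy for the first variable of `base` in expressions that do not contain it.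
  approx-0 : ∀ {N} → Truncated.Approx N 0ˢ
  approx-0 {N} = Truncated.approx [] (λ _ _ → refl)

  approx-δ∞b : ∀ i → T₁₅.Approx (δ∞b i)
  approx-δ∞b i = T₁₅.approx-resp (SR.*-congˡ {δ∞} (≡⇒≈ (sym (substitute-⟦⟧ σ∞ (basis i) (base 0ˢ)))))
    (T₁₅.approximate (δ∞ₑ :* substitute σ∞ (basis i)) (approx-base 15 ℕₚ.≤-refl approx-0))

  approx-δ₀b : ∀ i → T₁.Approx (δ₀b i)
  approx-δ₀b i = T₁.approx-resp (SR.*-congˡ {δ₀} (≡⇒≈ (sym (substitute-⟦⟧ σ₀ (basis i) (base 0ˢ)))))
    (T₁.approximate (δ₀ₑ :* substitute σ₀ (basis i)) (approx-base 1 (s≤s z≤n) approx-0))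

  approx-h∞ : ∀ i → T₆.Approx (h∞ i)
  approx-h∞ i = T₆.approx-resp (SR.*-assoc (X ^ˢ 5) (V φ ^ˢ 11 *ˢ ψ) (U (δ∞b i)))
    (approx-X⁵ (T₁.approx-* (T₁.approximate εₑ (approx-base 1 (s≤s z≤n) approx-0)) (approx-U (approx-δ∞b i))))

  approx-twisted : ∀ i → T₁₅.Approx (twisted i)
  approx-twisted i = T₁₅.approximate (k 11 :* var (# 0) :+ k 11 :^ weight i :* var (# 1))
    (approx-χ⊗ (approx-δ∞b i) T₁₅.∷ᴬ approx-V (approx-δ₀b i) T₁₅.∷ᴬ T₁₅.[]ᴬ)

  private
    check∞ check₀ : Fin 12 → Expr 9
    check∞ i = con Hscale :* var (# 0) :+ con -1ℤ :* substitute σ∞ (H i)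
    check₀ i = con Hscale :* (δ₀ₑ :* (k 11 :^ weight i :* var (# 0))) :+ k 121 :* substitute σ₀ (H i)

  approx-check∞ : ∀ i → T₆.Approx (⟦ check∞ i ⟧ (base (h∞ i)))
  approx-check∞ i = T₆.approximate (check∞ i) (approx-base 6 (ℕₚ.m≤m+n 6 9) (approx-h∞ i))

  approx-check₀ : ∀ i → T₁₅.Approx (⟦ check₀ i ⟧ (base (twisted i)))
  approx-check₀ i = T₁₅.approximate (check₀ i) (approx-base 15 ℕₚ.≤-refl (approx-twisted i))

  opaque
    check∞-vanishes : ∀ i → T₆.vanishes (T₆.Approx.list (approx-check∞ i)) ≡ true
    check∞-vanishes = every-sound (λ i → T₆.vanishes (T₆.Approx.list (approx-check∞ i))) refl

    check₀-vanishes : ∀ i → T₁₅.vanishes (T₁₅.Approx.list (approx-check₀ i)) ≡ true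
    check₀-vanishes = every-sound (λ i → T₁₅.vanishes (T₁₅.Approx.list (approx-check₀ i))) refl

  -- The pair of expansions is (121 h∞, -h₀): both are 121/Hscale times the expansions of `H`. This
  -- is the origin of the factor 121 and of the sign in the operator on pairs.
  defect∞ defect₀ : Fin 12 → Series
  defect∞ i = const Hscale *ˢ h∞ i +ˢ const -1ℤ *ˢ H∞ i
  defect₀ i = const Hscale *ˢ h₀ i +ˢ const (+ 121) *ˢ H₀ i

  defect∞-initial : ∀ i → defect∞ i ≈ˢ[ 6 ] 0ˢ
  defect∞-initial i = ≈[]-trans 6 (≈⇒≈[] 6 (SR.+-congˡ {const Hscale *ˢ h∞ i} (SR.*-congˡ {const -1ℤ} (≡⇒≈ (sym (substitute-⟦⟧ σ∞ (H i) (base (h∞ i))))))))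
    (T₆.approx-vanishes (approx-check∞ i) (check∞-vanishes i))

  defect₀-initial : ∀ i → defect₀ i ≈ˢ[ 15 ] 0ˢ
  defect₀-initial i = ≈[]-trans 15 (≈⇒≈[] 15 (SR.+-congˡ {const Hscale *ˢ h₀ i} (SR.*-congˡ {const (+ 121)} (≡⇒≈ (sym (substitute-⟦⟧ σ₀ (H i) (base (twisted i))))))))
    (T₁₅.approx-vanishes (approx-check₀ i) (check₀-vanishes i))

  -- All lie below 77 = 11 · 7 at ∞ and below 176 = 11 · 16 at 0, hence the orders 6 and 15 of the
  -- comparison.
  exponents∞ exponents₀ : List ℕ
  exponents∞ = 55 ∷ 60 ∷ 61 ∷ 62 ∷ 63 ∷ 64 ∷ 65 ∷ 66 ∷ 67 ∷ 68 ∷ 69 ∷ 70 ∷ []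
  exponents₀ = 0 ∷ 55 ∷ 66 ∷ 77 ∷ 88 ∷ 99 ∷ 110 ∷ 121 ∷ 132 ∷ 143 ∷ 154 ∷ 165 ∷ []

  matrix∞ matrix₀ : Vec (Vec ℤ 12) 12
  matrix∞
    = (+ 51818159250000 ∷ + 72472950000 ∷ + 0 ∷ -[1+ 579783599999 ] ∷ + 0 ∷ + 0 ∷ + 0 ∷ + 0 ∷ + 0 ∷ + 0 ∷ + 0 ∷ + 0 ∷ [])
    ∷ (-[1+ 8769226949999 ] ∷ + 53412564150000 ∷ + 104361048000 ∷ + 0 ∷ -[1+ 4754225519999 ] ∷ + 0 ∷ + 25510478400000 ∷ + 0 ∷ + 0 ∷ + 0 ∷ + 0 ∷ + 0 ∷ [])
    ∷ (-[1+ 1873425757499999 ] ∷ + 360552926250000 ∷ + 55006969050000 ∷ -[1+ 4496221817999999 ] ∷ + 0 ∷ -[1+ 123377950079999 ] ∷ + 0 ∷ + 378018907200000 ∷ + 0 ∷ + 3542477796000000 ∷ + 0 ∷ + 0 ∷ [])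
    ∷ (+ 0 ∷ + 0 ∷ + 0 ∷ + 53412564150000 ∷ -[1+ 72472949999 ] ∷ + 0 ∷ + 579783600000 ∷ + 0 ∷ + 0 ∷ + 0 ∷ + 0 ∷ + 0 ∷ [])
    ∷ (+ 0 ∷ + 0 ∷ + 0 ∷ -[1+ 8769226949999 ] ∷ + 55006969050000 ∷ -[1+ 40584851999 ] ∷ + 0 ∷ -[1+ 3594658319999 ] ∷ + 0 ∷ + 25510478400000 ∷ + 0 ∷ + 0 ∷ [])
    ∷ (+ 2159089968750 ∷ -[1+ 392561812499 ] ∷ -[1+ 7851236249 ] ∷ + 9663060000000 ∷ -[1+ 17804188049999 ] ∷ + 56601373950000 ∷ + 10629366000000 ∷ + 0 ∷ -[1+ 7247294999999 ] ∷ + 0 ∷ + 47107417500000 ∷ + 0 ∷ [])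
    ∷ (+ 0 ∷ + 0 ∷ + 0 ∷ + 0 ∷ + 0 ∷ + 0 ∷ + 55006969050000 ∷ -[1+ 217418849999 ] ∷ + 0 ∷ + 1739350800000 ∷ + 0 ∷ + 0 ∷ [])
    ∷ (-[1+ 243589637499 ] ∷ + 44289025000 ∷ + 885780500 ∷ + 12400927000000 ∷ -[1+ 2692772719999 ] ∷ + 0 ∷ + 22410246650000 ∷ + 56601373950000 ∷ + 579783600000 ∷ + 0 ∷ -[1+ 4348376999999 ] ∷ + 0 ∷ [])
    ∷ (-[1+ 692016015624 ] ∷ + 125821093750 ∷ + 2516421875 ∷ + 25687634500000 ∷ -[1+ 4267851499999 ] ∷ -[1+ 294723329999 ] ∷ + 122398760000000 ∷ -[1+ 19012070549999 ] ∷ + 58195778850000 ∷ + 135947175375000 ∷ + 0 ∷ -[1+ 108709424999 ] ∷ [])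
    ∷ (-[1+ 27680640624 ] ∷ + 5032843750 ∷ + 100656875 ∷ + 1409196250000 ∷ -[1+ 305996899999 ] ∷ + 0 ∷ + 3543122000000 ∷ + 0 ∷ + 86967540000 ∷ + 56601373950000 ∷ -[1+ 579783599999 ] ∷ + 0 ∷ [])
    ∷ (-[1+ 121794818749 ] ∷ + 22144512500 ∷ + 442890250 ∷ -[1+ 2435896374999 ] ∷ + 513752690000 ∷ -[1+ 26573414999 ] ∷ + 3897434200000 ∷ -[1+ 2125873199999 ] ∷ + 0 ∷ + 13286707500000 ∷ + 58195778850000 ∷ -[1+ 43483769999 ] ∷ [])
    ∷ (-[1+ 1300990109374 ] ∷ + 236543656250 ∷ + 4730873125 ∷ + 58984928750000 ∷ -[1+ 12932395299999 ] ∷ + 0 ∷ + 174498758500000 ∷ -[1+ 1449458999999 ] ∷ + 2898918000000 ∷ + 112333072500000 ∷ -[1+ 21741884999999 ] ∷ + 59790183750000 ∷ [])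
    ∷ []
  matrix₀
    = (+ 43846134750000 ∷ + 72472950000 ∷ + 0 ∷ -[1+ 579783599999 ] ∷ + 0 ∷ + 0 ∷ + 0 ∷ + 0 ∷ + 0 ∷ + 0 ∷ + 0 ∷ + 0 ∷ [])
    ∷ (-[1+ 1061076460949999 ] ∷ + 61384588650000 ∷ + 104361048000 ∷ + 0 ∷ -[1+ 4754225519999 ] ∷ + 0 ∷ + 25510478400000 ∷ + 0 ∷ + 0 ∷ + 0 ∷ + 0 ∷ + 0 ∷ [])
    ∷ (-[1+ 2493529683232499999 ] ∷ + 43626904076250000 ∷ + 78923042550000 ∷ -[1+ 544042839977999999 ] ∷ + 0 ∷ -[1+ 123377950079999 ] ∷ + 0 ∷ + 378018907200000 ∷ + 0 ∷ + 3542477796000000 ∷ + 0 ∷ + 0 ∷ [])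
    ∷ (+ 0 ∷ + 0 ∷ + 0 ∷ + 61384588650000 ∷ -[1+ 72472949999 ] ∷ + 0 ∷ + 579783600000 ∷ + 0 ∷ + 0 ∷ + 0 ∷ + 0 ∷ + 0 ∷ [])
    ∷ (+ 0 ∷ + 0 ∷ + 0 ∷ -[1+ 1061076460949999 ] ∷ + 78923042550000 ∷ -[1+ 40584851999 ] ∷ + 0 ∷ -[1+ 3594658319999 ] ∷ + 0 ∷ + 25510478400000 ∷ + 0 ∷ + 0 ∷ [])
    ∷ (+ 31611236232468750 ∷ -[1+ 522499772437499 ] ∷ -[1+ 949999586249 ] ∷ + 12861532860000000 ∷ -[1+ 2154306754049999 ] ∷ + 96461496450000 ∷ + 1286153286000000 ∷ + 0 ∷ -[1+ 7247294999999 ] ∷ + 0 ∷ + 47107417500000 ∷ + 0 ∷ [])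
    ∷ (+ 0 ∷ + 0 ∷ + 0 ∷ + 0 ∷ + 0 ∷ + 0 ∷ + 78923042550000 ∷ -[1+ 217418849999 ] ∷ + 0 ∷ + 1739350800000 ∷ + 0 ∷ + 0 ∷ [])
    ∷ (-[1+ 3566395882637499 ] ∷ + 58948692275000 ∷ + 107179440500 ∷ + 16505633837000000 ∷ -[1+ 325825499119999 ] ∷ + 0 ∷ + 2711639844650000 ∷ + 96461496450000 ∷ + 579783600000 ∷ + 0 ∷ -[1+ 4348376999999 ] ∷ + 0 ∷ [])
    ∷ (-[1+ 111449871332421874 ] ∷ + 1842146633593750 ∷ + 3349357515625 ∷ + 376092656714500000 ∷ -[1+ 5680510346499999 ] ∷ -[1+ 35661522929999 ] ∷ + 162912749560000000 ∷ -[1+ 2300460536549999 ] ∷ + 113999950350000 ∷ + 16449608220375000 ∷ + 0 ∷ -[1+ 108709424999 ] ∷ [])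
    ∷ (-[1+ 405272259390624 ] ∷ + 6698715031250 ∷ + 12179481875 ∷ + 1875640208750000 ∷ -[1+ 37025624899999 ] ∷ + 0 ∷ + 428717762000000 ∷ + 0 ∷ + 86967540000 ∷ + 96461496450000 ∷ -[1+ 579783599999 ] ∷ + 0 ∷ [])
    ∷ (-[1+ 19615177354506249 ] ∷ + 324217807512500 ∷ + 589486922750 ∷ -[1+ 35663958826374999 ] ∷ + 683804830390000 ∷ -[1+ 3215383214999 ] ∷ + 5187484920200000 ∷ -[1+ 257230657199999 ] ∷ + 0 ∷ + 1607691607500000 ∷ + 113999950350000 ∷ -[1+ 43483769999 ] ∷ [])
    ∷ (-[1+ 2304783339154484374 ] ∷ + 38095592382718750 ∷ + 69264713423125 ∷ + 9499581760116250000 ∷ -[1+ 189343199587299999 ] ∷ + 0 ∷ + 2554836323198500000 ∷ -[1+ 1929229928999999 ] ∷ + 350769078000000 ∷ + 149515319497500000 ∷ -[1+ 2630768084999999 ] ∷ + 131538404250000 ∷ [])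
    ∷ []

  opaque
    matrix∞-correct : constantTerms (systemMatrix connectionδ diag∞ (const (+ 121) *ˢ q∞) (const (+ 1331) *ˢ r∞)) ≡ matrix∞
    matrix∞-correct = refl

    matrix∞-eigenvalues : annihilates matrix∞ (eigenvalues (+ 60 ℤ.* scale) exponents∞) ≡ true
    matrix∞-eigenvalues = refl

    matrix₀-correct : constantTerms (systemMatrix connectionδ diag₀ (const (+ 121) *ˢ V (const (+ 121) *ˢ q∞)) (const (+ 1331) *ˢ V (const (+ 1331) *ˢ r∞))) ≡ matrix₀
    matrix₀-correct = refl

    matrix₀-eigenvalues : annihilates matrix₀ (eigenvalues (+ 60 ℤ.* scale) exponents₀) ≡ true
    matrix₀-eigenvalues = refl

  defect∞≈0 : ∀ i → defect∞ i ≈ˢ 0ˢ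
  defect∞≈0 = Sol-unique 6 660 {table = connectionδ} {diag∞} {const (+ 121) *ˢ q∞} {const (+ 1331) *ˢ r∞} {v = defect∞} (eigenvalues (+ 60 ℤ.* scale) exponents∞)
    (Sol-+ {table = connectionδ} {v = λ i → const Hscale *ˢ h∞ i} {w = λ i → const -1ℤ *ˢ H∞ i}
      (Sol-* {table = connectionδ} Hscale {v = h∞} h∞-rule) (Sol-* {table = connectionδ} -1ℤ {v = H∞} H∞-rule))
    defect∞-initial matrix∞-correct matrix∞-eigenvalues (not-eigenvalue (+ 60 ℤ.* scale) (+ 660 ℤ.* scale) 6 exponents∞ (λ ()) refl refl)

  defect₀≈0 : ∀ i → defect₀ i ≈ˢ 0ˢ
  defect₀≈0 = Sol-unique 15 660 {table = connectionδ} {diag₀} {const (+ 121) *ˢ V (const (+ 121) *ˢ q∞)} {const (+ 1331) *ˢ V (const (+ 1331) *ˢ r∞)} {v = defect₀} (eigenvalues (+ 60 ℤ.* scale) exponents₀)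
    (Sol-+ {table = connectionδ} {v = λ i → const Hscale *ˢ h₀ i} {w = λ i → const (+ 121) *ˢ H₀ i}
      (Sol-* {table = connectionδ} Hscale {v = h₀} h₀-rule) (Sol-* {table = connectionδ} (+ 121) {v = H₀} H₀-rule))
    defect₀-initial matrix₀-correct matrix₀-eigenvalues (not-eigenvalue (+ 60 ℤ.* scale) (+ 660 ℤ.* scale) 15 exponents₀ (λ ()) refl refl)

open HeckeImage

-- Pairs of expansions, and multiplication by forms of level 11.

module FormPairs where

  open import Relation.Binary.Reasoning.Setoid SR.setoid

  private
    k n : ∀ {m} → ℕ → Expr m
    k i = con (+ i)
    n i = con (ℤ.- (+ i))
    𝐱 = ring-𝐱 ; 𝐟 = ring-𝐟 ; 𝐬 = ring-𝐬 ; 𝐳 = ring-𝐳 ; 𝐆 = ring-𝐆 ; 𝐚 = ring-𝐚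
    module ∞ = Cusp cusp∞
    module 𝟘 = Cusp cusp₀

  -- Pairs of expansions of a level 11 form of weight 2 κ at the two cusps

  data Span : ℕ → Series → Series → Set where
    zero-span  : ∀ {κ} → Span κ (const 0ℤ) (const 0ℤ)
    basis-span : ∀ i → Span (weight i) (b∞ i) (b₀ i)
    add-span   : ∀ {κ a a′ b b′} → Span κ a a′ → Span κ b b′ → Span κ (a +ˢ b) (a′ +ˢ b′)
    scale-span : ∀ {κ a a′} c → Span κ a a′ → Span κ (const c *ˢ a) (const c *ˢ a′)
    -- The tables have denominators; this constructor gives rational coefficients while all series
    -- stay integral.
    divide-span : ∀ {κ a a′} c → c ≢ 0ℤ → Span κ (const c *ˢ a) (const c *ˢ a′) → Span κ a a′
    -- The scalars are level 1 forms in q^11 at ∞, and therefore level 1 forms in q at 0.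
    q-span     : ∀ {κ a a′} → Span κ a a′ → Span (2 ℕ.+ κ) (q₀ *ˢ a) (q∞ *ˢ a′)
    r-span     : ∀ {κ a a′} → Span κ a a′ → Span (3 ℕ.+ κ) (r₀ *ˢ a) (r∞ *ˢ a′)
    resp-span  : ∀ {κ a a′ b b′} → a ≈ˢ b → a′ ≈ˢ b′ → Span κ a a′ → Span κ b b′

  weight-resp : ∀ {κ κ′ a a′} → κ ≡ κ′ → Span κ a a′ → Span κ′ a a′
  weight-resp refl p = p

  mulXscale mulFscale : ℤ
  mulXscale = + 130451310000
  mulFscale = + 5218052400000

  -- Multiplication by x and f in terms of the basis
  mulX mulF : Vec Row 12
  mulX
    = ([] ∷ ((+ 130451310000 , 0 , 0) ∷ []) ∷ [] ∷ [] ∷ [] ∷ [] ∷ [] ∷ [] ∷ [] ∷ [] ∷ [] ∷ [] ∷ [])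
    ∷ ([] ∷ [] ∷ ((+ 130451310000 , 0 , 0) ∷ []) ∷ [] ∷ [] ∷ [] ∷ [] ∷ [] ∷ [] ∷ [] ∷ [] ∷ [] ∷ [])
    ∷ (((-[1+ 10781099999 ] , 0 , 1) ∷ []) ∷ ((+ 119670210000 , 1 , 0) ∷ []) ∷ [] ∷ ((-[1+ 1423105199999 ] , 1 , 0) ∷ []) ∷ [] ∷ ((-[1+ 109579100399999 ] , 0 , 0) ∷ []) ∷ [] ∷ ((+ 313083144000000 , 0 , 0) ∷ []) ∷ [] ∷ ((+ 3391734060000000 , 0 , 0) ∷ []) ∷ [] ∷ [] ∷ [])
    ∷ ([] ∷ [] ∷ [] ∷ [] ∷ ((+ 130451310000 , 0 , 0) ∷ []) ∷ [] ∷ [] ∷ [] ∷ [] ∷ [] ∷ [] ∷ [] ∷ [])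
    ∷ ([] ∷ [] ∷ [] ∷ [] ∷ [] ∷ ((+ 130451310000 , 0 , 0) ∷ []) ∷ [] ∷ [] ∷ [] ∷ [] ∷ [] ∷ [] ∷ [])
    ∷ (((-[1+ 3539249 ] , 2 , 0) ∷ []) ∷ ((+ 35392500 , 0 , 1) ∷ []) ∷ ((+ 38931750 , 1 , 0) ∷ []) ∷ ((-[1+ 871199999 ] , 0 , 1) ∷ []) ∷ ((+ 1317690000 , 1 , 0) ∷ []) ∷ [] ∷ ((-[1+ 52707599999 ] , 1 , 0) ∷ []) ∷ [] ∷ ((-[1+ 7827078599999 ] , 0 , 0) ∷ []) ∷ [] ∷ ((+ 58703089500000 , 0 , 0) ∷ []) ∷ [] ∷ [])
    ∷ ([] ∷ [] ∷ [] ∷ [] ∷ [] ∷ [] ∷ [] ∷ ((+ 130451310000 , 0 , 0) ∷ []) ∷ [] ∷ [] ∷ [] ∷ [] ∷ [])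
    ∷ ([] ∷ [] ∷ [] ∷ [] ∷ [] ∷ [] ∷ [] ∷ [] ∷ ((+ 130451310000 , 0 , 0) ∷ []) ∷ [] ∷ [] ∷ [] ∷ [])
    ∷ (((+ 4455 , 1 , 1) ∷ []) ∷ ((-[1+ 44549 ] , 2 , 0) ∷ []) ∷ ((-[1+ 49004 ] , 0 , 1) ∷ []) ∷ ((+ 871200 , 2 , 0) ∷ []) ∷ ((-[1+ 16552799 ] , 0 , 1) ∷ []) ∷ ((+ 206038800 , 1 , 0) ∷ []) ∷ ((+ 69696000 , 0 , 1) ∷ []) ∷ ((-[1+ 2132261999 ] , 1 , 0) ∷ []) ∷ [] ∷ ((+ 2815065000 , 1 , 0) ∷ []) ∷ [] ∷ ((+ 978384825000 , 0 , 0) ∷ []) ∷ [])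
    ∷ ([] ∷ [] ∷ [] ∷ [] ∷ [] ∷ [] ∷ [] ∷ [] ∷ [] ∷ [] ∷ ((+ 130451310000 , 0 , 0) ∷ []) ∷ [] ∷ [])
    ∷ ([] ∷ [] ∷ [] ∷ [] ∷ [] ∷ [] ∷ [] ∷ [] ∷ [] ∷ [] ∷ [] ∷ ((+ 130451310000 , 0 , 0) ∷ []) ∷ [])
    ∷ (((-[1+ 539 ] , 0 , 2) ∷ (+ 628 , 3 , 0) ∷ []) ∷ ((-[1+ 879 ] , 1 , 1) ∷ []) ∷ ((-[1+ 967 ] , 2 , 0) ∷ []) ∷ ((-[1+ 23919 ] , 1 , 1) ∷ []) ∷ ((+ 329120 , 2 , 0) ∷ []) ∷ ((+ 1829520 , 0 , 1) ∷ []) ∷ ((-[1+ 7066399 ] , 2 , 0) ∷ []) ∷ ((+ 22651200 , 0 , 1) ∷ []) ∷ ((-[1+ 527075999 ] , 1 , 0) ∷ []) ∷ ((-[1+ 387683999 ] , 0 , 1) ∷ []) ∷ ((+ 1317690000 , 1 , 0) ∷ []) ∷ [] ∷ [])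
    ∷ []
  mulF
    = ([] ∷ [] ∷ [] ∷ ((+ 5218052400000 , 0 , 0) ∷ []) ∷ [] ∷ [] ∷ [] ∷ [] ∷ [] ∷ [] ∷ [] ∷ [] ∷ [])
    ∷ ([] ∷ [] ∷ [] ∷ [] ∷ ((+ 5218052400000 , 0 , 0) ∷ []) ∷ [] ∷ [] ∷ [] ∷ [] ∷ [] ∷ [] ∷ [] ∷ [])
    ∷ ([] ∷ [] ∷ [] ∷ [] ∷ [] ∷ ((+ 5218052400000 , 0 , 0) ∷ []) ∷ [] ∷ [] ∷ [] ∷ [] ∷ [] ∷ [] ∷ [])
    ∷ ([] ∷ [] ∷ [] ∷ [] ∷ [] ∷ [] ∷ ((+ 5218052400000 , 0 , 0) ∷ []) ∷ [] ∷ [] ∷ [] ∷ [] ∷ [] ∷ [])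
    ∷ ([] ∷ [] ∷ [] ∷ [] ∷ [] ∷ [] ∷ [] ∷ ((+ 5218052400000 , 0 , 0) ∷ []) ∷ [] ∷ [] ∷ [] ∷ [] ∷ [])
    ∷ ([] ∷ [] ∷ [] ∷ [] ∷ [] ∷ [] ∷ [] ∷ [] ∷ ((+ 5218052400000 , 0 , 0) ∷ []) ∷ [] ∷ [] ∷ [] ∷ [])
    ∷ ([] ∷ [] ∷ [] ∷ [] ∷ [] ∷ [] ∷ [] ∷ [] ∷ [] ∷ ((+ 5218052400000 , 0 , 0) ∷ []) ∷ [] ∷ [] ∷ [])
    ∷ ([] ∷ [] ∷ [] ∷ [] ∷ [] ∷ [] ∷ [] ∷ [] ∷ [] ∷ [] ∷ ((+ 5218052400000 , 0 , 0) ∷ []) ∷ [] ∷ [])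
    ∷ ([] ∷ [] ∷ [] ∷ [] ∷ [] ∷ [] ∷ [] ∷ [] ∷ [] ∷ [] ∷ [] ∷ ((+ 5218052400000 , 0 , 0) ∷ []) ∷ [])
    ∷ (((-[1+ 5444 ] , 2 , 0) ∷ []) ∷ ((+ 54450 , 0 , 1) ∷ []) ∷ ((+ 59895 , 1 , 0) ∷ []) ∷ ((+ 15246000 , 0 , 1) ∷ []) ∷ ((-[1+ 182080799 ] , 1 , 0) ∷ []) ∷ [] ∷ ((+ 2108304000 , 1 , 0) ∷ []) ∷ [] ∷ ((+ 156541572000 , 0 , 0) ∷ []) ∷ [] ∷ ((-[1+ 391353929999 ] , 0 , 0) ∷ []) ∷ [] ∷ [])
    ∷ (((+ 396 , 1 , 1) ∷ []) ∷ ((-[1+ 3959 ] , 2 , 0) ∷ []) ∷ ((-[1+ 4355 ] , 0 , 1) ∷ []) ∷ ((+ 392040 , 2 , 0) ∷ []) ∷ ((-[1+ 4617359 ] , 0 , 1) ∷ []) ∷ ((+ 14853960 , 1 , 0) ∷ []) ∷ ((+ 83635200 , 0 , 1) ∷ []) ∷ ((-[1+ 306662399 ] , 1 , 0) ∷ []) ∷ [] ∷ ((+ 4935348000 , 1 , 0) ∷ []) ∷ [] ∷ ((+ 782707860000 , 0 , 0) ∷ []) ∷ [])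
    ∷ (((-[1+ 2879 ] , 0 , 2) ∷ (+ 3365 , 3 , 0) ∷ []) ∷ ((-[1+ 4849 ] , 1 , 1) ∷ []) ∷ ((-[1+ 5334 ] , 2 , 0) ∷ []) ∷ ((-[1+ 195199 ] , 1 , 1) ∷ []) ∷ ((+ 2516800 , 2 , 0) ∷ []) ∷ ((+ 10018800 , 0 , 1) ∷ []) ∷ ((-[1+ 48399999 ] , 2 , 0) ∷ []) ∷ ((+ 209088000 , 0 , 1) ∷ []) ∷ ((-[1+ 4360355999 ] , 1 , 0) ∷ []) ∷ ((-[1+ 2439359999 ] , 0 , 1) ∷ []) ∷ ((+ 19525770000 , 1 , 0) ∷ []) ∷ [] ∷ [])
    ∷ []

  opaque
    mulX-check : ∀ i → isZeroQ (nfQ (con mulXscale :* (𝐱 :* basis i) :- rowₑ (lookup mulX i) 𝐪′ 𝐫′ basis)) ≡ true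
    mulX-check = every-sound (λ i → isZeroQ (nfQ (con mulXscale :* (𝐱 :* basis i) :- rowₑ (lookup mulX i) 𝐪′ 𝐫′ basis))) refl

    mulF-check : ∀ i → isZeroQ (nfQ (con mulFscale :* (𝐟 :* basis i) :- rowₑ (lookup mulF i) 𝐪′ 𝐫′ basis)) ≡ true
    mulF-check = every-sound (λ i → isZeroQ (nfQ (con mulFscale :* (𝐟 :* basis i) :- rowₑ (lookup mulF i) 𝐪′ 𝐫′ basis))) refl

    mulX-homogeneous : ∀ i → homogeneousRow (weight i) weight (lookup mulX i) ≡ true
    mulX-homogeneous = every-sound (λ i → homogeneousRow (weight i) weight (lookup mulX i)) refl

    mulF-homogeneous : ∀ i → homogeneousRow (weight i) weight (lookup mulF i) ≡ true
    mulF-homogeneous = every-sound (λ i → homogeneousRow (weight i) weight (lookup mulF i)) refl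

  entry-span : ∀ {w w′ a a′} l → Span w′ a a′ → homogeneousEntry w w′ l ≡ true → Span (suc w) (terms₂ l q₀ r₀ *ˢ a) (terms₂ l q∞ r∞ *ˢ a′)
  entry-span {a = a} {a′} [] p eq = resp-span (SR.sym (zero-*ˢ a)) (SR.sym (zero-*ˢ a′)) zero-span
    where
    zero-*ˢ : ∀ a → const 0ℤ *ˢ a ≈ˢ const 0ℤ
    zero-*ˢ a = byPoly (a ∷ []) (k 0 :* var (# 0)) (k 0) refl
  entry-span {w} {w′} {a} {a′} ((c , i , j) ∷ l) p eq = resp-span (SR.sym (SR.distribʳ a _ _)) (SR.sym (SR.distribʳ a′ _ _))
    (add-span (weight-resp (ℕₚ.≡ᵇ⇒≡ (2 ℕ.* i ℕ.+ (3 ℕ.* j ℕ.+ w′)) (suc w) (subst T (sym (proj₁ (∧-true {2 ℕ.* i ℕ.+ (3 ℕ.* j ℕ.+ w′) ℕ.≡ᵇ suc w} eq))) _))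
        (resp-span (assoc₄ (const c) (q₀ ^ˢ i) (r₀ ^ˢ j) a) (assoc₄ (const c) (q∞ ^ˢ i) (r∞ ^ˢ j) a′) (scale-span c (q-power i (r-power j p)))))
      (entry-span l p (proj₂ (∧-true {2 ℕ.* i ℕ.+ (3 ℕ.* j ℕ.+ w′) ℕ.≡ᵇ suc w} eq))))
    where
    assoc₄ : ∀ a b c d → a *ˢ (b *ˢ (c *ˢ d)) ≈ˢ a *ˢ (b *ˢ c) *ˢ d
    assoc₄ a b c d = byPoly (a ∷ b ∷ c ∷ d ∷ []) (var (# 0) :* (var (# 1) :* (var (# 2) :* var (# 3)))) (var (# 0) :* (var (# 1) :* var (# 2)) :* var (# 3)) refl
    r-power : ∀ {κ a a′} j → Span κ a a′ → Span (3 ℕ.* j ℕ.+ κ) (r₀ ^ˢ j *ˢ a) (r∞ ^ˢ j *ˢ a′)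
    r-power {a = a} {a′} zero    p = resp-span (SR.sym (SR.*-identityˡ a)) (SR.sym (SR.*-identityˡ a′)) p
    r-power {κ} {a} {a′} (suc j) p = weight-resp (trans (sym (ℕₚ.+-assoc 3 (3 ℕ.* j) κ)) (cong (ℕ._+ κ) (sym (ℕₚ.*-suc 3 j))))
      (resp-span (SR.sym (SR.*-assoc r₀ (r₀ ^ˢ j) a)) (SR.sym (SR.*-assoc r∞ (r∞ ^ˢ j) a′)) (r-span (r-power j p)))
    q-power : ∀ {κ a a′} i → Span κ a a′ → Span (2 ℕ.* i ℕ.+ κ) (q₀ ^ˢ i *ˢ a) (q∞ ^ˢ i *ˢ a′)
    q-power {a = a} {a′} zero    p = resp-span (SR.sym (SR.*-identityˡ a)) (SR.sym (SR.*-identityˡ a′)) p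
    q-power {κ} {a} {a′} (suc i) p = weight-resp (trans (sym (ℕₚ.+-assoc 2 (2 ℕ.* i) κ)) (cong (ℕ._+ κ) (sym (ℕₚ.*-suc 2 i))))
      (resp-span (SR.sym (SR.*-assoc q₀ (q₀ ^ˢ i) a)) (SR.sym (SR.*-assoc q∞ (q∞ ^ˢ i) a′)) (q-span (q-power i p)))

  row-span : ∀ {d} w (w′ : Fin d → ℕ) {a a′ : Fin d → Series} (ls : Vec Entry d) → (∀ i → Span (w′ i) (a i) (a′ i)) → homogeneousRow w w′ ls ≡ true →
    Span (suc w) (dotˢ (rowˢ ls q₀ r₀) a) (dotˢ (rowˢ ls q∞ r∞) a′)
  row-span w w′ [] p eq = zero-span
  row-span w w′ (l ∷ ls) p eq = add-span (entry-span l (p zero) (proj₁ (∧-true eq)))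
    (row-span w (λ i → w′ (suc i)) ls (λ i → p (suc i)) (proj₂ (∧-true {homogeneousEntry w (w′ zero) l} eq)))

  -- One identity in the coordinate ring, evaluated at the two cusps, proves both halves of the
  -- pair.
  table-span : ∀ (table : Vec Row 12) c (e : Expr 4) → c ≢ 0ℤ → (∀ i → homogeneousRow (weight i) weight (lookup table i) ≡ true) →
    (∀ i → isZeroQ (nfQ (con c :* (e :* basis i) :- rowₑ (lookup table i) 𝐪′ 𝐫′ basis)) ≡ true) →
    ∀ i → Span (suc (weight i)) (⟦ e ⟧ ∞.ρ *ˢ b∞ i) (⟦ e ⟧ 𝟘.ρ *ˢ b₀ i)
  table-span table c e c≢0 hom check i = divide-span c c≢0 (resp-span
    (SR.sym (SR.trans (∞.byRelation (con c :* (e :* basis i)) (rowₑ (lookup table i) 𝐪′ 𝐫′ basis) (check i))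
      (SR.trans (≡⇒≈ (rowₑ-⟦⟧ (lookup table i) 𝐪′ 𝐫′ basis ∞.ρ)) (rowˢ-cong (lookup table i) b∞ (SR.sym q₀≈) (SR.sym r₀≈)))))
    (SR.sym (SR.trans (𝟘.byRelation (con c :* (e :* basis i)) (rowₑ (lookup table i) 𝐪′ 𝐫′ basis) (check i))
      (SR.trans (≡⇒≈ (rowₑ-⟦⟧ (lookup table i) 𝐪′ 𝐫′ basis 𝟘.ρ)) (rowˢ-cong (lookup table i) b₀ (SR.sym q∞≈₀) (SR.sym r∞≈₀)))))
    (row-span (weight i) weight (lookup table i) basis-span (hom i)))

  -- `Span` is only a module. Products of forms are obtained by letting a pair act on it, so that
  -- multiplication becomes composition.
  Mul : ℕ → Series → Series → Set
  Mul m u u′ = ∀ {κ a a′} → Span κ a a′ → Span (m ℕ.+ κ) (u *ˢ a) (u′ *ˢ a′)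

  -- Multiplication by u commutes with the other constructors of `Span`, so products with the basis
  -- determine everything.
  mul-from-basis : ∀ {u u′} → (∀ i → Span (suc (weight i)) (u *ˢ b∞ i) (u′ *ˢ b₀ i)) → Mul 1 u u′
  mul-from-basis {u} {u′} p zero-span = resp-span (byPoly (u ∷ []) (k 0) (var (# 0) :* k 0) refl) (byPoly (u′ ∷ []) (k 0) (var (# 0) :* k 0) refl) zero-span
  mul-from-basis p (basis-span i) = p i
  mul-from-basis {u} {u′} p (add-span {a = a} {a′} {b} {b′} s t) =
    resp-span (SR.sym (SR.distribˡ u a b)) (SR.sym (SR.distribˡ u′ a′ b′)) (add-span (mul-from-basis p s) (mul-from-basis p t))
  mul-from-basis {u} {u′} p (scale-span {a = a} {a′} c s) = resp-span (swapˢ (const c) u a) (swapˢ (const c) u′ a′) (scale-span c (mul-from-basis p s))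
  mul-from-basis {u} {u′} p (divide-span {a = a} {a′} c c≢0 s) = divide-span c c≢0 (resp-span (swapˢ u (const c) a) (swapˢ u′ (const c) a′) (mul-from-basis p s))
  mul-from-basis {u} {u′} p (q-span {κ} {a} {a′} s) = resp-span (swapˢ q₀ u a) (swapˢ q∞ u′ a′) (q-span (mul-from-basis p s))
  mul-from-basis {u} {u′} p (r-span {κ} {a} {a′} s) = resp-span (swapˢ r₀ u a) (swapˢ r∞ u′ a′) (r-span (mul-from-basis p s))
  mul-from-basis {u} {u′} p (resp-span e e′ s) = resp-span (SR.*-congˡ {u} e) (SR.*-congˡ {u′} e′) (mul-from-basis p s)

  mul-x : Mul 1 x (Cusp.xᶜ cusp₀)
  mul-x = mul-from-basis (table-span mulX mulXscale 𝐱 (λ ()) mulX-homogeneous mulX-check)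

  mul-f : Mul 1 f (Cusp.fᶜ cusp₀)
  mul-f = mul-from-basis (table-span mulF mulFscale 𝐟 (λ ()) mulF-homogeneous mulF-check)

  mul-resp : ∀ {m u u′ v v′} → u ≈ˢ v → u′ ≈ˢ v′ → Mul m u u′ → Mul m v v′
  mul-resp e e′ p {a = a} {a′} s = resp-span (SR.*-congʳ {a} e) (SR.*-congʳ {a′} e′) (p s)

  mul-weight : ∀ {m m′ u u′} → m ≡ m′ → Mul m u u′ → Mul m′ u u′
  mul-weight refl p = p

  mul-zero : ∀ {m} → Mul m (const 0ℤ) (const 0ℤ)
  mul-zero {a = a} {a′} s = resp-span (byPoly (a ∷ []) (k 0) (k 0 :* var (# 0)) refl) (byPoly (a′ ∷ []) (k 0) (k 0 :* var (# 0)) refl) zero-span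

  mul-one : Mul 0 1ˢ 1ˢ
  mul-one {a = a} {a′} s = resp-span (SR.sym (SR.*-identityˡ a)) (SR.sym (SR.*-identityˡ a′)) s

  mul-const : ∀ c → Mul 0 (const c) (const c)
  mul-const c = scale-span c

  mul-+ : ∀ {m u u′ v v′} → Mul m u u′ → Mul m v v′ → Mul m (u +ˢ v) (u′ +ˢ v′)
  mul-+ {u = u} {u′} {v} {v′} p p′ {a = a} {a′} s = resp-span (SR.sym (SR.distribʳ a u v)) (SR.sym (SR.distribʳ a′ u′ v′)) (add-span (p s) (p′ s))

  mul-* : ∀ {m m′ u u′ v v′} → Mul m u u′ → Mul m′ v v′ → Mul (m ℕ.+ m′) (u *ˢ v) (u′ *ˢ v′)
  mul-* {m} {m′} {u} {u′} {v} {v′} p p′ {κ} {a} {a′} s = weight-resp (sym (ℕₚ.+-assoc m m′ κ))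
    (resp-span (SR.sym (SR.*-assoc u v a)) (SR.sym (SR.*-assoc u′ v′ a′)) (p (p′ s)))

  mul-^ : ∀ {m u u′} i → Mul m u u′ → Mul (i ℕ.* m) (u ^ˢ i) (u′ ^ˢ i)
  mul-^ zero    p = mul-one
  mul-^ (suc i) p = mul-* p (mul-^ i p)

  mul-divide : ∀ {m u u′} c → c ≢ 0ℤ → Mul m (const c *ˢ u) (const c *ˢ u′) → Mul m u u′
  mul-divide {u = u} {u′} c c≢0 p {a = a} {a′} s = divide-span c c≢0 (resp-span (SR.*-assoc (const c) u a) (SR.*-assoc (const c) u′ a′) (p s))

  mul-q₀ : Mul 2 q₀ q∞
  mul-q₀ = q-span

  MulE : ℕ → Expr 4 → Set
  MulE m e = Mul m (⟦ e ⟧ ∞.ρ) (⟦ e ⟧ 𝟘.ρ)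

  mul-a : MulE 2 𝐚
  mul-a = mul-resp {u = ⟦ e ⟧ ∞.ρ} {⟦ e ⟧ 𝟘.ρ} (byPoly ∞.ρ e 𝐚 refl) (byPoly 𝟘.ρ e 𝐚 refl)
    (mul-+ (mul-+ (mul-* (mul-const (+ 61)) (mul-* mul-x mul-x)) (mul-* (mul-const (ℤ.- (+ 1840))) (mul-* mul-x mul-f)))
      (mul-* (mul-const (+ 8800)) (mul-* mul-f mul-f)))
    where
    e : Expr 4
    e = k 61 :* (𝐱 :* 𝐱) :+ n 1840 :* (𝐱 :* 𝐟) :+ k 8800 :* (𝐟 :* 𝐟)

  -- No table for z is needed: 60 z = 𝐚 - 𝐪′, and 𝐪′ is the scalar `q₀` of the module.
  mul-z : MulE 2 𝐳
  mul-z = mul-divide (+ 60) (λ ()) (mul-resp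
    (byHyps {ρ = x ∷ f ∷ s ∷ z ∷ q₀ ∷ []} (+ 1) ((n 1 · var (# 4) ≈ lift+ 𝐪′ by q₀≈) ∷ []) (lift+ 𝐚 :+ n 1 :* var (# 4)) (k 60 :* var (# 3)) (λ ()) refl)
    (byHyps {ρ = Cusp.xᶜ cusp₀ ∷ Cusp.fᶜ cusp₀ ∷ s ∷ Cusp.zᶜ cusp₀ ∷ q∞ ∷ []} (+ 1) ((n 1 · var (# 4) ≈ lift+ 𝐪′ by q∞≈₀) ∷ []) (lift+ 𝐚 :+ n 1 :* var (# 4)) (k 60 :* var (# 3)) (λ ()) refl)
    (mul-+ mul-a (mul-* (mul-const (ℤ.- (+ 1))) mul-q₀)))

  homogeneous : ℕ → List (ℤ × ℕ × ℕ × ℕ) → Bool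
  homogeneous m [] = true
  homogeneous m ((c , a , b , e) ∷ l) = (a ℕ.+ (b ℕ.+ e ℕ.* 2) ℕ.≡ᵇ m) ∧ homogeneous m l

  mul-monomials : ∀ m l → homogeneous m l ≡ true → MulE m (monomialsₑ l)
  mul-monomials m [] eq = mul-zero
  mul-monomials m ((c , a , b , e) ∷ l) eq = mul-+
    (mul-weight (trans (cong₂ (λ u v → u ℕ.+ (v ℕ.+ e ℕ.* 2)) (ℕₚ.*-identityʳ a) (ℕₚ.*-identityʳ b))
        (ℕₚ.≡ᵇ⇒≡ (a ℕ.+ (b ℕ.+ e ℕ.* 2)) m (subst T (sym (proj₁ (∧-true {a ℕ.+ (b ℕ.+ e ℕ.* 2) ℕ.≡ᵇ m} eq))) _)))
      (mul-* (mul-const c) (mul-* (mul-^ a mul-x) (mul-* (mul-^ b mul-f) (mul-^ e mul-z)))))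
    (mul-monomials m l (proj₂ (∧-true {a ℕ.+ (b ℕ.+ e ℕ.* 2) ℕ.≡ᵇ m} eq)))

  mul-H : ∀ i → MulE (5 ℕ.+ weight i) (H i)
  mul-H i = mul-monomials (5 ℕ.+ weight i) (lookup Hterms i) (every-sound (λ i → homogeneous (5 ℕ.+ weight i) (lookup Hterms i)) refl i)

  Qterms Rterms : List (ℤ × ℕ × ℕ × ℕ)
  Qterms = (+ 61 , 2 , 0 , 0) ∷ (-[1+ 1839 ] , 1 , 1 , 0) ∷ (+ 8800 , 0 , 2 , 0) ∷ (+ 60 , 0 , 0 , 1) ∷ []
  Rterms = (+ 38640 , 2 , 1 , 0) ∷ (-[1+ 664 ] , 3 , 0 , 0) ∷ (-[1+ 369599 ] , 1 , 2 , 0) ∷ (+ 847000 , 0 , 3 , 0) ∷ (+ 7920 , 0 , 1 , 1) ∷ (-[1+ 665 ] , 1 , 0 , 1) ∷ []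

  mul-q∞ : Mul 2 q∞ q₀
  mul-q∞ = mul-resp (SR.trans (byPoly ∞.ρ (monomialsₑ Qterms) 𝐪 refl) (SR.sym q∞≈)) (SR.trans (byPoly 𝟘.ρ (monomialsₑ Qterms) 𝐪 refl) (SR.sym q₀≈₀)) (mul-monomials 2 Qterms refl)

  mul-r∞ : Mul 3 r∞ r₀
  mul-r∞ = mul-resp (SR.trans (byPoly ∞.ρ (monomialsₑ Rterms) 𝐫 refl) (SR.sym r∞≈)) (SR.trans (byPoly 𝟘.ρ (monomialsₑ Rterms) 𝐫 refl) (SR.sym r₀≈₀)) (mul-monomials 3 Rterms refl)

  one-span : Span 0 1ˢ 1ˢ
  one-span = resp-span (byPoly ∞.ρ (basis (# 0)) (k 1) refl) (byPoly 𝟘.ρ (basis (# 0)) (k 1) refl) (basis-span (# 0))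

  mul-span : ∀ {m u u′} → Mul m u u′ → Span m u u′
  mul-span {m} {u} {u′} p = weight-resp (ℕₚ.+-identityʳ m) (resp-span (SR.*-identityʳ u) (SR.*-identityʳ u′) (p one-span))

  -- The squares of the eta quotients δ

  δ²terms : List (ℤ × ℕ × ℕ × ℕ)
  δ²terms = (-[1+ 241999 ] , 0 , 3 , 1) ∷ (-[1+ 16637499 ] , 0 , 5 , 0) ∷ (+ 15950 , 1 , 2 , 1) ∷ (+ 9680000 , 1 , 4 , 0) ∷ (-[1+ 319 ] , 2 , 1 , 1) ∷ (-[1+ 923999 ] , 2 , 3 , 0) ∷ (+ 2 , 3 , 0 , 1) ∷ (+ 30850 , 3 , 2 , 0) ∷ (-[1+ 419 ] , 4 , 1 , 0) ∷ (+ 2 , 5 , 0 , 0) ∷ []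

  δ²ₑ : Expr 4
  δ²ₑ = monomialsₑ δ²terms

  opaque
    δ²-check : isZeroQ (nfQ (derivation levelRule δ²ₑ :- k 3600 :* ((k 5 :* 𝐬 :+ 𝐆) :* δ²ₑ))) ≡ true
    δ²-check = refl

  module _ (c : Cusp) where
    open Cusp c

    -- θ v = (5 s + G) v is a system of size one. Its only exponent is the constant term of 5 s + G,
    -- namely 10 at ∞ and 0 at the other cusp.
    δ²-unique : ∀ K → let v = const K *ˢ (δ *ˢ δ) -ˢ ⟦ δ²ₑ ⟧ ρ in v ≈ˢ[ 15 ] 0ˢ →
      ∀ e → ⟦ k 5 :* 𝐬 :+ 𝐆 ⟧ ρ 0 ≡ e → (∀ n → 15 < n → 1ℤ ℤ.* + n ≢ e) → v ≈ˢ 0ˢ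
    δ²-unique K initial e refl ≢ = system-unique {1} 15 1ℤ ((F ∷ []) ∷ []) (λ _ → v) (F 0 ∷ [])
      (λ { zero → byHyps {ρ = θ v ∷ θ δ ∷ θ p ∷ δ ∷ p ∷ F ∷ const K ∷ ⟦ derivation levelRule δ²ₑ ⟧ ρ ∷ []} (+ 3600)
        ( (k 3600 · var (# 0) ≈ var (# 6) :* (var (# 1) :* var (# 3) :+ var (# 3) :* var (# 1)) :- var (# 2) by
            SR.trans (θ-- (const K *ˢ (δ *ˢ δ)) p) (-ˢ-cong (SR.trans (θ-const* K (δ *ˢ δ)) (SR.*-congˡ {const K} (θ-* δ δ))) SR.refl))
        ∷ (k 3600 :* (var (# 6) :* var (# 3)) · k 2 :* var (# 1) ≈ var (# 5) :* var (# 3) by δ-rule)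
        ∷ (n 1 · k 3600 :* var (# 2) ≈ var (# 7) by θ⟦⟧ δ²ₑ)
        ∷ (n 1 · var (# 7) ≈ k 3600 :* (var (# 5) :* var (# 4)) by byRelation (derivation levelRule δ²ₑ) (k 3600 :* ((k 5 :* 𝐬 :+ 𝐆) :* δ²ₑ)) δ²-check)
        ∷ []) (k 1 :* var (# 0)) (var (# 5) :* (var (# 6) :* (var (# 3) :* var (# 3)) :- var (# 4)) :+ k 0) (λ ()) refl })
      (λ { zero → initial }) (annihilates₁ (F 0)) (λ { n 15<n _ (here refl) → ≢ n 15<n }) zero
      where
      F = ⟦ k 5 :* 𝐬 :+ 𝐆 ⟧ ρ
      p = ⟦ δ²ₑ ⟧ ρ
      v = const K *ˢ (δ *ˢ δ) -ˢ p
      isZeroℤ-complete : ∀ {i} → i ≡ 0ℤ → isZeroℤ i ≡ true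
      isZeroℤ-complete refl = refl
      annihilates₁ : ∀ i → annihilates {1} ((i ∷ []) ∷ []) (i ∷ []) ≡ true
      annihilates₁ i = cong (λ b → (b ∧ true) ∧ true) (isZeroℤ-complete (eq i))
        where
        eq : ∀ i → (1ℤ ℤ.* i ℤ.+ 0ℤ) ℤ.- i ℤ.* 1ℤ ≡ 0ℤ
        eq = solve-∀

  -- 22144512500 = 12500 · 11⁶, so the normalised pair is (11⁶ δ∞², -δ₀²).
  δ∞²-scale δ₀²-scale : ℤ
  δ∞²-scale = + 22144512500
  δ₀²-scale = -[1+ 12499 ]

  approx-δ∞² : T₁₅.Approx (⟦ con δ∞²-scale :* (δ∞ₑ :* δ∞ₑ) :- substitute σ∞ δ²ₑ ⟧ (base 0ˢ))
  approx-δ∞² = T₁₅.approximate (con δ∞²-scale :* (δ∞ₑ :* δ∞ₑ) :- substitute σ∞ δ²ₑ) (approx-base 15 ℕₚ.≤-refl approx-0)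

  approx-δ₀² : T₁₅.Approx (⟦ con δ₀²-scale :* (δ₀ₑ :* δ₀ₑ) :- substitute σ₀ δ²ₑ ⟧ (base 0ˢ))
  approx-δ₀² = T₁₅.approximate (con δ₀²-scale :* (δ₀ₑ :* δ₀ₑ) :- substitute σ₀ δ²ₑ) (approx-base 15 ℕₚ.≤-refl approx-0)

  opaque
    δ∞²≈ : const δ∞²-scale *ˢ (δ∞ *ˢ δ∞) ≈ˢ ⟦ δ²ₑ ⟧ ∞.ρ
    δ∞²≈ = -ˢ≈0⇒≈ (δ²-unique cusp∞ δ∞²-scale (T₁₅.approx-vanishes approx-δ∞² refl) (+ 10) refl λ { n 15<n eq → ℕₚ.<⇒≱ 15<n (ℕₚ.≤-trans (ℕₚ.≤-reflexive (ℤₚ.+-injective (trans (sym (ℤₚ.*-identityˡ (+ n))) eq))) (ℕₚ.m≤m+n 10 5)) })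

    δ₀²≈ : const δ₀²-scale *ˢ (δ₀ *ˢ δ₀) ≈ˢ ⟦ δ²ₑ ⟧ 𝟘.ρ
    δ₀²≈ = -ˢ≈0⇒≈ (δ²-unique cusp₀ δ₀²-scale (T₁₅.approx-vanishes approx-δ₀² refl) (+ 0) refl λ { n 15<n eq → ℕₚ.<⇒≱ 15<n (ℕₚ.≤-trans (ℕₚ.≤-reflexive (ℤₚ.+-injective (trans (sym (ℤₚ.*-identityˡ (+ n))) eq))) z≤n) })

  mul-δ² : Mul 5 (E ^ˢ 6 *ˢ (δ∞ *ˢ δ∞)) (const -1ℤ *ˢ (δ₀ *ˢ δ₀))
  mul-δ² = mul-divide (+ 12500) (λ ()) (mul-resp
    (SR.trans (SR.sym δ∞²≈) (byPoly (δ∞ ∷ []) (con δ∞²-scale :* (var (# 0) :* var (# 0))) (k 12500 :* ((k 11) :^ 6 :* (var (# 0) :* var (# 0)))) refl))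
    (SR.trans (SR.sym δ₀²≈) (byPoly (δ₀ ∷ []) (con δ₀²-scale :* (var (# 0) :* var (# 0))) (k 12500 :* (con -1ℤ :* (var (# 0) :* var (# 0)))) refl))
    (mul-monomials 5 δ²terms refl))

open FormPairs

-- Traces as level 1 forms, the operator on pairs, and forms of weight 12 m.

module Level1Forms where

  open import Relation.Binary.Reasoning.Setoid SR.setoid

  private
    k n : ∀ {m} → ℕ → Expr m
    k i = con (+ i)
    n i = con (ℤ.- (+ i))
    v₀ : ∀ {m} → Expr (1 ℕ.+ m)
    v₀ = var zero
    v₁ : ∀ {m} → Expr (2 ℕ.+ m)
    v₁ = var (suc zero)
    v₂ : ∀ {m} → Expr (3 ℕ.+ m)
    v₂ = var (suc (suc zero))
    v₃ : ∀ {m} → Expr (4 ℕ.+ m)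
    v₃ = var (suc (suc (suc zero)))
    v₄ : ∀ {m} → Expr (5 ℕ.+ m)
    v₄ = var (suc (suc (suc (suc zero))))
    module ∞ = Cusp cusp∞
    module 𝟘 = Cusp cusp₀

  data Lev : ℕ → Series → Set where
    zero-lev     : ∀ {κ} → Lev κ (const 0ℤ)
    monomial-lev : ∀ i j → Lev (2 ℕ.* i ℕ.+ 3 ℕ.* j) (q∞ ^ˢ i *ˢ r∞ ^ˢ j)
    add-lev      : ∀ {κ a b} → Lev κ a → Lev κ b → Lev κ (a +ˢ b)
    scale-lev    : ∀ {κ a} c → Lev κ a → Lev κ (const c *ˢ a)
    divide-lev   : ∀ {κ a} c → c ≢ 0ℤ → Lev κ (const c *ˢ a) → Lev κ a
    resp-lev     : ∀ {κ a b} → a ≈ˢ b → Lev κ a → Lev κ b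

  *-zero : ∀ a → a *ˢ const 0ℤ ≈ˢ const 0ℤ
  *-zero a = byPoly (a ∷ []) (v₀ :* k 0) (k 0) refl

  q-lev : ∀ {κ a} → Lev κ a → Lev (2 ℕ.+ κ) (q∞ *ˢ a)
  q-lev zero-lev = resp-lev (SR.sym (*-zero q∞)) zero-lev
  q-lev (monomial-lev i j) = subst (λ κ → Lev κ (q∞ *ˢ (q∞ ^ˢ i *ˢ r∞ ^ˢ j))) (weight-eq i j) (resp-lev (SR.*-assoc q∞ (q∞ ^ˢ i) (r∞ ^ˢ j)) (monomial-lev (suc i) j))
    where
    weight-eq : ∀ i j → 2 ℕ.* suc i ℕ.+ 3 ℕ.* j ≡ 2 ℕ.+ (2 ℕ.* i ℕ.+ 3 ℕ.* j)
    weight-eq = solve-∀ℕ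
  q-lev (add-lev {a = a} {b} s t) = resp-lev (SR.sym (SR.distribˡ q∞ a b)) (add-lev (q-lev s) (q-lev t))
  q-lev (scale-lev {a = a} c s) = resp-lev (swapˢ (const c) q∞ a) (scale-lev c (q-lev s))
  q-lev (divide-lev {a = a} c c≢0 s) = divide-lev c c≢0 (resp-lev (swapˢ q∞ (const c) a) (q-lev s))
  q-lev (resp-lev e s) = resp-lev (SR.*-congˡ {q∞} e) (q-lev s)

  r-lev : ∀ {κ a} → Lev κ a → Lev (3 ℕ.+ κ) (r∞ *ˢ a)
  r-lev zero-lev = resp-lev (SR.sym (*-zero r∞)) zero-lev
  r-lev (monomial-lev i j) = subst (λ κ → Lev κ (r∞ *ˢ (q∞ ^ˢ i *ˢ r∞ ^ˢ j))) (weight-eq i j) (resp-lev (swapˢ (q∞ ^ˢ i) r∞ (r∞ ^ˢ j)) (monomial-lev i (suc j)))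
    where
    weight-eq : ∀ i j → 2 ℕ.* i ℕ.+ 3 ℕ.* suc j ≡ 3 ℕ.+ (2 ℕ.* i ℕ.+ 3 ℕ.* j)
    weight-eq = solve-∀ℕ
  r-lev (add-lev {a = a} {b} s t) = resp-lev (SR.sym (SR.distribˡ r∞ a b)) (add-lev (r-lev s) (r-lev t))
  r-lev (scale-lev {a = a} c s) = resp-lev (swapˢ (const c) r∞ a) (scale-lev c (r-lev s))
  r-lev (divide-lev {a = a} c c≢0 s) = divide-lev c c≢0 (resp-lev (swapˢ r∞ (const c) a) (r-lev s))
  r-lev (resp-lev e s) = resp-lev (SR.*-congˡ {r∞} e) (r-lev s)

  τ-lev : ∀ i → Lev (weight i) (τˢ i)
  τ-lev zero                = resp-lev (byPoly [] (k 12 :* (k 1 :* k 1)) (k 12) refl) (scale-lev (+ 12) (monomial-lev 0 0))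
  τ-lev (suc zero)          = zero-lev
  τ-lev (suc (suc zero))    = resp-lev (SR.trans (byPoly (q∞ ∷ []) (k 132 :* (v₀ :* k 1 :* k 1)) (k 132 :* v₀) refl) (SR.*-congˡ {const (+ 132)} q∞≈))
    (scale-lev (+ 132) (monomial-lev 1 0))
  τ-lev (suc (suc (suc i))) = zero-lev

  E²≈ : E ^ˢ 2 ≈ˢ const (+ 121)
  E²≈ = byPoly [] (k 11 :^ 2) (k 121) refl

  E³≈ : E ^ˢ 3 ≈ˢ const (+ 1331)
  E³≈ = byPoly [] (k 11 :^ 3) (k 1331) refl

  E^-shift : ∀ w {K} κ → E ^ˢ w ≈ˢ const K → E ^ˢ (w ℕ.+ κ) ≈ˢ const K *ˢ E ^ˢ κ
  E^-shift w κ p = SR.trans (^-homo-* E w κ) (SR.*-congʳ {E ^ˢ κ} p)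

  -- U turns u₀ = V (K u∞) into K u∞, and 11^(w+κ) = K 11^κ puts the same factor K u∞ on the second
  -- summand. Thus the trace is linear over level 1.
  trace-multiple : ∀ w K u∞ u₀ κ a a′ → E ^ˢ w ≈ˢ const K → u₀ ≈ˢ V (const K *ˢ u∞) →
    const K *ˢ (u∞ *ˢ (const (+ 11) *ˢ U a +ˢ E ^ˢ κ *ˢ a′)) ≈ˢ const (+ 11) *ˢ U (u₀ *ˢ a) +ˢ E ^ˢ (w ℕ.+ κ) *ˢ (u∞ *ˢ a′)
  trace-multiple w K u∞ u₀ κ a a′ E≈ u₀≈ = SR.trans
    (byPoly (const K ∷ u∞ ∷ U a ∷ E ^ˢ κ ∷ a′ ∷ []) (v₀ :* (v₁ :* (k 11 :* v₂ :+ v₃ :* v₄))) (k 11 :* ((v₀ :* v₁) :* v₂) :+ (v₀ :* v₃) :* (v₁ :* v₄)) refl)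
    (SR.+-cong (SR.*-congˡ {const (+ 11)} (SR.sym (SR.trans (U-cong (SR.*-congʳ {a} u₀≈)) (U-V* (const K *ˢ u∞) a))))
      (SR.*-congʳ {u∞ *ˢ a′} (SR.sym (E^-shift w κ E≈))))

  trace : ∀ {κ a a′} → Span κ a a′ → Lev κ (const (+ 11) *ˢ U a +ˢ E ^ˢ κ *ˢ a′)
  trace {κ} zero-span = resp-lev (SR.sym (SR.trans (SR.+-congʳ (SR.*-congˡ {const (+ 11)} {U (const 0ℤ)} {const 0ℤ} λ { zero → refl ; (suc _) → refl }))
    (byPoly (E ^ˢ κ ∷ []) (k 11 :* k 0 :+ v₀ :* k 0) (k 0) refl))) zero-lev
  trace (basis-span i) = resp-lev (SR.sym (trace-identity i)) (τ-lev i)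
  trace {κ} (add-span {a = a} {a′} {b} {b′} s t) = resp-lev
    (byPoly (U a ∷ U b ∷ E ^ˢ κ ∷ a′ ∷ b′ ∷ []) ((k 11 :* v₀ :+ v₂ :* v₃) :+ (k 11 :* v₁ :+ v₂ :* v₄)) (k 11 :* (v₀ :+ v₁) :+ v₂ :* (v₃ :+ v₄)) refl)
    (add-lev (trace s) (trace t))
  trace {κ} (scale-span {a = a} {a′} c s) = resp-lev (scaled c κ a a′) (scale-lev c (trace s))
    where
    scaled : ∀ c κ a a′ → const c *ˢ (const (+ 11) *ˢ U a +ˢ E ^ˢ κ *ˢ a′) ≈ˢ const (+ 11) *ˢ U (const c *ˢ a) +ˢ E ^ˢ κ *ˢ (const c *ˢ a′)
    scaled c κ a a′ = SR.trans (byPoly (const c ∷ U a ∷ E ^ˢ κ ∷ a′ ∷ []) (v₀ :* (k 11 :* v₁ :+ v₂ :* v₃)) (k 11 :* (v₀ :* v₁) :+ v₂ :* (v₀ :* v₃)) refl)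
      (SR.+-congʳ (SR.*-congˡ {const (+ 11)} (SR.sym (U-const* c a))))
  trace {κ} (divide-span {a = a} {a′} c c≢0 s) = divide-lev c c≢0 (resp-lev
    (SR.trans (SR.+-congʳ (SR.*-congˡ {const (+ 11)} (U-const* c a)))
      (byPoly (const c ∷ U a ∷ E ^ˢ κ ∷ a′ ∷ []) (k 11 :* (v₀ :* v₁) :+ v₂ :* (v₀ :* v₃)) (v₀ :* (k 11 :* v₁ :+ v₂ :* v₃)) refl)) (trace s))
  trace (q-span {κ} {a} {a′} s) = resp-lev (trace-multiple 2 (+ 121) q∞ q₀ κ a a′ E²≈ q₀≈V) (scale-lev (+ 121) (q-lev (trace s)))
  trace (r-span {κ} {a} {a′} s) = resp-lev (trace-multiple 3 (+ 1331) r∞ r₀ κ a a′ E³≈ r₀≈V) (scale-lev (+ 1331) (r-lev (trace s)))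
  trace {κ} (resp-span e e′ s) = resp-lev (SR.+-cong (SR.*-congˡ {const (+ 11)} (U-cong e)) (SR.*-congˡ {E ^ˢ κ} e′)) (trace s)

  -- The operator b ↦ 121 δ U(δ b) on pairs of expansions

  twist : ℕ → Series → Series → Series
  twist κ a a′ = const (+ 11) *ˢ χ⊗ (δ∞ *ˢ a) +ˢ E ^ˢ κ *ˢ V (δ₀ *ˢ a′)

  hecke∞ : Series → Series
  hecke∞ a = const (+ 121) *ˢ (δ∞ *ˢ U (δ∞ *ˢ a))

  hecke₀ : ℕ → Series → Series → Series
  hecke₀ κ a a′ = const -1ℤ *ˢ (δ₀ *ˢ (E ^ˢ κ *ˢ twist κ a a′))

  twist-cong : ∀ κ {a a′ b b′} → a ≈ˢ b → a′ ≈ˢ b′ → twist κ a a′ ≈ˢ twist κ b b′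
  twist-cong κ e e′ = SR.+-cong (SR.*-congˡ {const (+ 11)} (χ⊗-cong (SR.*-congˡ {δ∞} e))) (SR.*-congˡ {E ^ˢ κ} (V-cong (SR.*-congˡ {δ₀} e′)))

  twist-const* : ∀ c κ a a′ → twist κ (const c *ˢ a) (const c *ˢ a′) ≈ˢ const c *ˢ twist κ a a′
  twist-const* c κ a a′ = SR.trans
    (SR.+-cong (SR.*-congˡ {const (+ 11)} (SR.trans (χ⊗-cong (swapˢ δ∞ (const c) a)) (χ⊗-const* c (δ∞ *ˢ a))))
      (SR.*-congˡ {E ^ˢ κ} (SR.trans (V-cong (swapˢ δ₀ (const c) a′)) (V-const* c (δ₀ *ˢ a′)))))
    (byPoly (const c ∷ χ⊗ (δ∞ *ˢ a) ∷ E ^ˢ κ ∷ V (δ₀ *ˢ a′) ∷ []) (k 11 :* (v₀ :* v₁) :+ v₂ :* (v₀ :* v₃)) (v₀ :* (k 11 :* v₁ :+ v₂ :* v₃)) refl)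

  twist-+ : ∀ κ a a′ b b′ → twist κ (a +ˢ b) (a′ +ˢ b′) ≈ˢ twist κ a a′ +ˢ twist κ b b′
  twist-+ κ a a′ b b′ = SR.trans
    (SR.+-cong (SR.*-congˡ {const (+ 11)} (SR.trans (χ⊗-cong (SR.distribˡ δ∞ a b)) (χ⊗-+ (δ∞ *ˢ a) (δ∞ *ˢ b))))
      (SR.*-congˡ {E ^ˢ κ} (SR.trans (V-cong (SR.distribˡ δ₀ a′ b′)) (V-+ (δ₀ *ˢ a′) (δ₀ *ˢ b′)))))
    (byPoly (χ⊗ (δ∞ *ˢ a) ∷ χ⊗ (δ∞ *ˢ b) ∷ E ^ˢ κ ∷ V (δ₀ *ˢ a′) ∷ V (δ₀ *ˢ b′) ∷ [])
      (k 11 :* (v₀ :+ v₁) :+ v₂ :* (v₃ :+ v₄)) ((k 11 :* v₀ :+ v₂ :* v₃) :+ (k 11 :* v₁ :+ v₂ :* v₄)) refl)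

  hecke∞-const* : ∀ c a → hecke∞ (const c *ˢ a) ≈ˢ const c *ˢ hecke∞ a
  hecke∞-const* c a = SR.trans (SR.*-congˡ {const (+ 121)} (SR.*-congˡ {δ∞} (SR.trans (U-cong (swapˢ δ∞ (const c) a)) (U-const* c (δ∞ *ˢ a)))))
    (byPoly (const c ∷ δ∞ ∷ U (δ∞ *ˢ a) ∷ []) (k 121 :* (v₁ :* (v₀ :* v₂))) (v₀ :* (k 121 :* (v₁ :* v₂))) refl)

  hecke₀-const* : ∀ c κ a a′ → hecke₀ κ (const c *ˢ a) (const c *ˢ a′) ≈ˢ const c *ˢ hecke₀ κ a a′
  hecke₀-const* c κ a a′ = SR.trans (SR.*-congˡ {const -1ℤ} (SR.*-congˡ {δ₀} (SR.*-congˡ {E ^ˢ κ} (twist-const* c κ a a′))))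
    (byPoly (const c ∷ δ₀ ∷ E ^ˢ κ ∷ twist κ a a′ ∷ []) (con -1ℤ :* (v₁ :* (v₂ :* (v₀ :* v₃)))) (v₀ :* (con -1ℤ :* (v₁ :* (v₂ :* v₃)))) refl)

  -- The scalar (u₀, u∞) comes out as K (u∞, u₀): at ∞ the operator U replaces q^11 by q, and at 0
  -- the operator V does the reverse. The extension to `q-span` and `r-span` therefore needs
  -- multiplication by `q∞` and `r∞` on pairs.
  hecke-multiple : ∀ w K u∞ u₀ κ a a′ → E ^ˢ w ≈ˢ const K → u₀ ≈ˢ V (const K *ˢ u∞) →
    const K *ˢ (u∞ *ˢ hecke∞ a) ≈ˢ hecke∞ (u₀ *ˢ a) × const K *ˢ (u₀ *ˢ hecke₀ κ a a′) ≈ˢ hecke₀ (w ℕ.+ κ) (u₀ *ˢ a) (u∞ *ˢ a′)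
  hecke-multiple w K u∞ u₀ κ a a′ E≈ u₀≈ =
    SR.trans (byPoly (const K ∷ u∞ ∷ δ∞ ∷ U (δ∞ *ˢ a) ∷ []) (v₀ :* (v₁ :* (k 121 :* (v₂ :* v₃)))) (k 121 :* (v₂ :* ((v₀ :* v₁) :* v₃))) refl)
      (SR.*-congˡ {const (+ 121)} (SR.*-congˡ {δ∞} (SR.sym (SR.trans (U-cong (SR.trans (swapˢ δ∞ u₀ a) (SR.*-congʳ {δ∞ *ˢ a} u₀≈))) (U-V* (const K *ˢ u∞) (δ∞ *ˢ a))))))
    , SR.trans (byPoly (const K ∷ u₀ ∷ δ₀ ∷ E ^ˢ κ ∷ twist κ a a′ ∷ []) (v₀ :* (v₁ :* (con -1ℤ :* (v₂ :* (v₃ :* v₄))))) (con -1ℤ :* (v₂ :* ((v₀ :* v₃) :* (v₁ :* v₄)))) refl)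
      (SR.*-congˡ {const -1ℤ} (SR.*-congˡ {δ₀} (SR.*-cong (SR.sym (E^-shift w κ E≈)) (SR.sym twist-multiple))))
    where
    twist-multiple : twist (w ℕ.+ κ) (u₀ *ˢ a) (u∞ *ˢ a′) ≈ˢ u₀ *ˢ twist κ a a′
    twist-multiple = SR.trans
      (SR.+-cong (SR.*-congˡ {const (+ 11)} (SR.trans (χ⊗-cong (SR.trans (swapˢ δ∞ u₀ a) (SR.*-congʳ {δ∞ *ˢ a} u₀≈)))
          (SR.trans (χ⊗-V* (const K *ˢ u∞) (δ∞ *ˢ a)) (SR.*-congʳ {χ⊗ (δ∞ *ˢ a)} (SR.sym u₀≈)))))
        (SR.trans (SR.*-cong (E^-shift w κ E≈) (SR.trans (V-cong (swapˢ δ₀ u∞ a′)) (V-* u∞ (δ₀ *ˢ a′))))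
          (SR.trans (byPoly (const K ∷ E ^ˢ κ ∷ V u∞ ∷ V (δ₀ *ˢ a′) ∷ []) ((v₀ :* v₁) :* (v₂ :* v₃)) ((v₀ :* v₂) :* (v₁ :* v₃)) refl)
            (SR.*-congʳ {E ^ˢ κ *ˢ V (δ₀ *ˢ a′)} (SR.sym (SR.trans u₀≈ (V-const* K u∞)))))))
      (byPoly (u₀ ∷ χ⊗ (δ∞ *ˢ a) ∷ E ^ˢ κ *ˢ V (δ₀ *ˢ a′) ∷ []) (k 11 :* (v₀ :* v₁) :+ v₀ :* v₂) (v₀ :* (k 11 :* v₁ :+ v₂)) refl)

  hecke : ∀ {κ a a′} → Span κ a a′ → Span (5 ℕ.+ κ) (hecke∞ a) (hecke₀ κ a a′)
  hecke {κ} zero-span = resp-span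
    (SR.sym (SR.trans (SR.*-congˡ {const (+ 121)} (SR.*-congˡ {δ∞} {U (δ∞ *ˢ const 0ℤ)} {const 0ℤ}
      (SR.trans (U-cong (*-zero δ∞)) λ { zero → refl ; (suc _) → refl }))) (byPoly (δ∞ ∷ []) (k 121 :* (v₀ :* k 0)) (k 0) refl)))
    (SR.sym (SR.trans (SR.*-congˡ {const -1ℤ} (SR.*-congˡ {δ₀} (SR.*-congˡ {E ^ˢ κ} (SR.trans
        (twist-cong κ (byPoly [] (k 0) (k 0 :* k 0) refl) (byPoly [] (k 0) (k 0 :* k 0) refl)) (twist-const* 0ℤ κ (const 0ℤ) (const 0ℤ))))))
      (byPoly (δ₀ ∷ E ^ˢ κ ∷ twist κ (const 0ℤ) (const 0ℤ) ∷ []) (con -1ℤ :* (v₀ :* (v₁ :* (k 0 :* v₂)))) (k 0) refl))) zero-span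
  hecke (basis-span i) = divide-span Hscale (λ ()) (resp-span
    (SR.sym (SR.trans (byPoly (const Hscale ∷ h∞ i ∷ []) (v₀ :* (k 121 :* v₁)) (k 121 :* (v₀ :* v₁)) refl) (SR.*-congˡ {const (+ 121)} (-ˢ≈0⇒≈
      (SR.trans (byPoly (const Hscale *ˢ h∞ i ∷ H∞ i ∷ []) (v₀ :- v₁) (v₀ :+ con -1ℤ :* v₁) refl) (defect∞≈0 i))))))
    (SR.sym (-ˢ≈0⇒≈ (SR.trans (byPoly (const Hscale ∷ h₀ i ∷ H₀ i ∷ []) (v₀ :* (con -1ℤ :* v₁) :- k 121 :* v₂) (con -1ℤ :* (v₀ :* v₁ :+ k 121 :* v₂)) refl)
      (SR.trans (SR.*-congˡ {const -1ℤ} (defect₀≈0 i)) (SR.zeroʳ (const -1ℤ))))))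
    (scale-span (+ 121) (mul-span (mul-H i))))
  hecke {κ} (add-span {a = a} {a′} {b} {b′} s t) = resp-span
    (SR.sym (SR.trans (SR.*-congˡ {const (+ 121)} (SR.*-congˡ {δ∞} (U-cong (SR.distribˡ δ∞ a b))))
      (byPoly (δ∞ ∷ U (δ∞ *ˢ a) ∷ U (δ∞ *ˢ b) ∷ []) (k 121 :* (v₀ :* (v₁ :+ v₂))) (k 121 :* (v₀ :* v₁) :+ k 121 :* (v₀ :* v₂)) refl)))
    (SR.sym (SR.trans (SR.*-congˡ {const -1ℤ} (SR.*-congˡ {δ₀} (SR.*-congˡ {E ^ˢ κ} (twist-+ κ a a′ b b′))))
      (byPoly (δ₀ ∷ E ^ˢ κ ∷ twist κ a a′ ∷ twist κ b b′ ∷ []) (con -1ℤ :* (v₀ :* (v₁ :* (v₂ :+ v₃)))) (con -1ℤ :* (v₀ :* (v₁ :* v₂)) :+ con -1ℤ :* (v₀ :* (v₁ :* v₃))) refl)))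
    (add-span (hecke s) (hecke t))
  hecke {κ} (scale-span {a = a} {a′} c s) = resp-span (SR.sym (hecke∞-const* c a)) (SR.sym (hecke₀-const* c κ a a′)) (scale-span c (hecke s))
  hecke {κ} (divide-span {a = a} {a′} c c≢0 s) = divide-span c c≢0 (resp-span (hecke∞-const* c a) (hecke₀-const* c κ a a′) (hecke s))
  hecke (q-span {κ} {a} {a′} s) = let e , e′ = hecke-multiple 2 (+ 121) q∞ q₀ κ a a′ E²≈ q₀≈V in
    weight-resp (ℕ-swap 2 5 κ) (resp-span e e′ (scale-span (+ 121) (mul-q∞ (hecke s))))
    where
    ℕ-swap : ∀ i j l → i ℕ.+ (j ℕ.+ l) ≡ j ℕ.+ (i ℕ.+ l)
    ℕ-swap = solve-∀ℕ
  hecke (r-span {κ} {a} {a′} s) = let e , e′ = hecke-multiple 3 (+ 1331) r∞ r₀ κ a a′ E³≈ r₀≈V in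
    weight-resp (ℕ-swap 3 5 κ) (resp-span e e′ (scale-span (+ 1331) (mul-r∞ (hecke s))))
    where
    ℕ-swap : ∀ i j l → i ℕ.+ (j ℕ.+ l) ≡ j ℕ.+ (i ℕ.+ l)
    ℕ-swap = solve-∀ℕ
  hecke {κ} (resp-span {a = a} {a′} {b} {b′} e e′ s) = resp-span
    (SR.*-congˡ {const (+ 121)} (SR.*-congˡ {δ∞} (U-cong (SR.*-congˡ {δ∞} e))))
    (SR.*-congˡ {const -1ℤ} (SR.*-congˡ {δ₀} (SR.*-congˡ {E ^ˢ κ} (twist-cong κ e e′)))) (hecke s)

  -- Level 1 forms of weight 12 m as polynomials in q³ and D = q³ - r²

  Q³ D : Series
  Q³ = q∞ ^ˢ 3
  -- By 25³ = 125² the constant term is 0; D is 15625 · 1728 = 27000000 times the discriminant form.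
  D = Q³ -ˢ r∞ ^ˢ 2

  data Form : ℕ → Series → Set where
    const-form : ∀ c → Form 0 (const c)
    step-form  : ∀ {m G} c → Form m G → Form (suc m) (const c *ˢ Q³ ^ˢ suc m +ˢ D *ˢ G)
    resp-form  : ∀ {m G G′} → G ≈ˢ G′ → Form m G → Form m G′

  zero-form : ∀ m → Form m (const 0ℤ)
  zero-form zero    = const-form 0ℤ
  zero-form (suc m) = resp-form (byPoly (Q³ ^ˢ suc m ∷ D ∷ []) (k 0 :* v₀ :+ v₁ :* k 0) (k 0) refl) (step-form 0ℤ (zero-form m))

  form-view : ∀ {m G} → Form (suc m) G → Σ ℤ λ c → Σ Series λ G′ → Form m G′ × G ≈ˢ const c *ˢ Q³ ^ˢ suc m +ˢ D *ˢ G′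
  form-view (step-form {G = G} c F) = c , G , F , SR.refl
  form-view (resp-form e F) = let c , G′ , F′ , p = form-view F in c , G′ , F′ , SR.trans (SR.sym e) p

  form-view₀ : ∀ {G} → Form 0 G → Σ ℤ λ c → G ≈ˢ const c
  form-view₀ (const-form c) = c , SR.refl
  form-view₀ (resp-form e F) = let c , p = form-view₀ F in c , SR.trans (SR.sym e) p

  add-form : ∀ m {G G′} → Form m G → Form m G′ → Form m (G +ˢ G′)
  add-form zero F F′ = let c , p = form-view₀ F ; c′ , p′ = form-view₀ F′ in resp-form (SR.trans (const-+ c c′) (SR.sym (SR.+-cong p p′))) (const-form (c ℤ.+ c′))
  add-form (suc m) F F′ = let c , G , F₁ , p = form-view F ; c′ , G′ , F₁′ , p′ = form-view F′ in
    resp-form (SR.sym (SR.trans (SR.+-cong p p′) (SR.trans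
        (byPoly (const c ∷ const c′ ∷ Q³ ^ˢ suc m ∷ D *ˢ G ∷ D *ˢ G′ ∷ []) ((v₀ :* v₂ :+ v₃) :+ (v₁ :* v₂ :+ v₄)) ((v₀ :+ v₁) :* v₂ :+ (v₃ :+ v₄)) refl)
        (SR.+-cong (SR.*-congʳ {Q³ ^ˢ suc m} (SR.sym (const-+ c c′))) (SR.sym (SR.distribˡ D G G′))))))
      (step-form (c ℤ.+ c′) (add-form m F₁ F₁′))

  scale-form : ∀ m {G} a → Form m G → Form m (const a *ˢ G)
  scale-form zero a F = let c , p = form-view₀ F in resp-form (SR.trans (const-* a c) (SR.*-congˡ {const a} (SR.sym p))) (const-form (a ℤ.* c))
  scale-form (suc m) a F = let c , G , F₁ , p = form-view F in
    resp-form (SR.sym (SR.trans (SR.*-congˡ {const a} p) (SR.trans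
        (byPoly (const a ∷ const c ∷ Q³ ^ˢ suc m ∷ D ∷ G ∷ []) (v₀ :* (v₁ :* v₂ :+ v₃ :* v₄)) ((v₀ :* v₁) :* v₂ :+ v₃ :* (v₀ :* v₄)) refl)
        (SR.+-congʳ (SR.*-congʳ {Q³ ^ˢ suc m} (SR.sym (const-* a c)))))))
      (step-form (a ℤ.* c) (scale-form m a F₁))

  D-form : ∀ m {G} → Form m G → Form (suc m) (D *ˢ G)
  D-form m {G} F = resp-form (byPoly (Q³ ^ˢ suc m ∷ D ∷ G ∷ []) (k 0 :* v₀ :+ v₁ :* v₂) (v₁ :* v₂) refl) (step-form 0ℤ F)

  Q³-form : ∀ m {G} → Form m G → Form (suc m) (Q³ *ˢ G)
  Q³-form zero F = let c , p = form-view₀ F in resp-form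
    (SR.trans (byPoly (const c ∷ Q³ ∷ D ∷ []) (v₀ :* (v₁ :* k 1) :+ v₂ :* k 0) (v₁ :* v₀) refl) (SR.*-congˡ {Q³} (SR.sym p)))
    (step-form c (zero-form 0))
  Q³-form (suc m) F = let c , G , F₁ , p = form-view F in resp-form
    (SR.trans (byPoly (const c ∷ Q³ ∷ Q³ ^ˢ suc m ∷ D ∷ G ∷ []) (v₀ :* (v₁ :* v₂) :+ v₃ :* (v₁ :* v₄)) (v₁ :* (v₀ :* v₂ :+ v₃ :* v₄)) refl) (SR.*-congˡ {Q³} (SR.sym p)))
    (step-form c (Q³-form m F₁))

  r²-form : ∀ m {G} → Form m G → Form (suc m) (r∞ ^ˢ 2 *ˢ G)
  r²-form m {G} F = resp-form (byPoly (Q³ ∷ r∞ ^ˢ 2 ∷ G ∷ []) (v₀ :* v₂ :+ con -1ℤ :* ((v₀ :- v₁) :* v₂)) (v₁ :* v₂) refl)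
    (add-form (suc m) (Q³-form m F) (scale-form (suc m) -1ℤ (D-form m F)))

  monomial-form : ∀ i j → Form (i ℕ.+ j) (Q³ ^ˢ i *ˢ (r∞ ^ˢ 2) ^ˢ j)
  monomial-form zero    zero    = resp-form (byPoly [] (k 1) (k 1 :* k 1) refl) (const-form 1ℤ)
  monomial-form zero    (suc j) = resp-form (swapˢ (r∞ ^ˢ 2) 1ˢ ((r∞ ^ˢ 2) ^ˢ j)) (r²-form j (monomial-form zero j))
  monomial-form (suc i) j       = resp-form (SR.sym (SR.*-assoc Q³ (Q³ ^ˢ i) ((r∞ ^ˢ 2) ^ˢ j))) (Q³-form (i ℕ.+ j) (monomial-form i j))

  -- Modulo 2 the equation makes j odd, and modulo 3 it makes i a multiple of 3. In terms of
  -- remainders, five of the six residue classes contradict the equation modulo 6.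
  weight-split : ∀ i j m → 2 ℕ.* i ℕ.+ 3 ℕ.* j ≡ 3 ℕ.+ 6 ℕ.* m →
    Σ ℕ λ i′ → Σ ℕ λ j′ → i ≡ 3 ℕ.* i′ × j ≡ suc (2 ℕ.* j′) × i′ ℕ.+ j′ ≡ m
  weight-split i j m eq = go (i % 3) (j % 2) (m%n<n i 3) (m%n<n j 2) (m≡m%n+[m/n]*n i 3) (m≡m%n+[m/n]*n j 2)
    where
    a = i / 3
    b = j / 2
    shape : ∀ i₀ j₀ a b → 2 ℕ.* (i₀ ℕ.+ a ℕ.* 3) ℕ.+ 3 ℕ.* (j₀ ℕ.+ b ℕ.* 2) ≡ (2 ℕ.* i₀ ℕ.+ 3 ℕ.* j₀) ℕ.+ (a ℕ.+ b) ℕ.* 6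
    shape = solve-∀ℕ
    combined : ∀ i₀ j₀ → i ≡ i₀ ℕ.+ a ℕ.* 3 → j ≡ j₀ ℕ.+ b ℕ.* 2 → (2 ℕ.* i₀ ℕ.+ 3 ℕ.* j₀) ℕ.+ (a ℕ.+ b) ℕ.* 6 ≡ 3 ℕ.+ m ℕ.* 6
    combined i₀ j₀ p p′ = trans (sym (shape i₀ j₀ a b)) (trans (sym (cong₂ (λ u v → 2 ℕ.* u ℕ.+ 3 ℕ.* v) p p′)) (trans eq (cong (3 ℕ.+_) (ℕₚ.*-comm 6 m))))
    residue : ∀ i₀ j₀ → i ≡ i₀ ℕ.+ a ℕ.* 3 → j ≡ j₀ ℕ.+ b ℕ.* 2 → (2 ℕ.* i₀ ℕ.+ 3 ℕ.* j₀) % 6 ≡ 3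
    residue i₀ j₀ p p′ = trans (sym ([m+kn]%n≡m%n (2 ℕ.* i₀ ℕ.+ 3 ℕ.* j₀) (a ℕ.+ b) 6)) (trans (cong (_% 6) (combined i₀ j₀ p p′)) ([m+kn]%n≡m%n 3 m 6))
    go : ∀ i₀ j₀ → i₀ < 3 → j₀ < 2 → i ≡ i₀ ℕ.+ a ℕ.* 3 → j ≡ j₀ ℕ.+ b ℕ.* 2 →
      Σ ℕ λ i′ → Σ ℕ λ j′ → i ≡ 3 ℕ.* i′ × j ≡ suc (2 ℕ.* j′) × i′ ℕ.+ j′ ≡ m
    go 0 1 _ _ p p′ = a , b , trans p (ℕₚ.*-comm a 3) , trans p′ (cong suc (ℕₚ.*-comm b 2)) ,
      ℕₚ.*-cancelʳ-≡ (a ℕ.+ b) m 6 (ℕₚ.+-cancelˡ-≡ 3 _ _ (combined 0 1 p p′))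
    go 0 0 _ _ p p′ with residue 0 0 p p′
    ... | ()
    go 1 0 _ _ p p′ with residue 1 0 p p′
    ... | ()
    go 1 1 _ _ p p′ with residue 1 1 p p′
    ... | ()
    go 2 0 _ _ p p′ with residue 2 0 p p′
    ... | ()
    go 2 1 _ _ p p′ with residue 2 1 p p′
    ... | ()
    go (suc (suc (suc _))) _ (s≤s (s≤s (s≤s ()))) _ _ _
    go 0 (suc (suc _)) _ (s≤s (s≤s ())) _ _
    go 1 (suc (suc _)) _ (s≤s (s≤s ())) _ _
    go 2 (suc (suc _)) _ (s≤s (s≤s ())) _ _

  *-≢0 : ∀ i j → i ≢ 0ℤ → j ≢ 0ℤ → i ℤ.* j ≢ 0ℤ
  *-≢0 i j i≢0 j≢0 eq = Sum.[ i≢0 , j≢0 ]′ (ℤₚ.i*j≡0⇒i≡0∨j≡0 i eq)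

  -- In weight 6 + 12 m every monomial is r times a monomial in q³ and r². The integer c collects
  -- the denominators introduced by `divide-lev`.
  lev-form : ∀ {κ a} m → κ ≡ 3 ℕ.+ 6 ℕ.* m → Lev κ a → Σ ℤ λ c → c ≢ 0ℤ × Σ Series λ G → Form m G × const c *ˢ a ≈ˢ r∞ *ˢ G
  lev-form m eq zero-lev = 1ℤ , (λ ()) , const 0ℤ , zero-form m , byPoly (r∞ ∷ []) (k 1 :* k 0) (v₀ :* k 0) refl
  lev-form m eq (monomial-lev i j) = go (weight-split i j m eq)
    where
    go : (Σ ℕ λ i′ → Σ ℕ λ j′ → i ≡ 3 ℕ.* i′ × j ≡ suc (2 ℕ.* j′) × i′ ℕ.+ j′ ≡ m) →
      Σ ℤ λ c → c ≢ 0ℤ × Σ Series λ G → Form m G × const c *ˢ (q∞ ^ˢ i *ˢ r∞ ^ˢ j) ≈ˢ r∞ *ˢ G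
    go (i′ , j′ , refl , refl , refl) = 1ℤ , (λ ()) , Q³ ^ˢ i′ *ˢ (r∞ ^ˢ 2) ^ˢ j′ , monomial-form i′ j′ ,
      SR.trans (SR.*-identityˡ _) (SR.trans (SR.*-cong (SR.sym (^-assocʳ q∞ 3 i′)) (SR.*-congˡ {r∞} (SR.sym (^-assocʳ r∞ 2 j′))))
        (swapˢ (Q³ ^ˢ i′) r∞ ((r∞ ^ˢ 2) ^ˢ j′)))
  lev-form m eq (add-lev {a = a} {b} s t) =
    let c , c≢0 , G , F , p = lev-form m eq s ; c′ , c′≢0 , G′ , F′ , p′ = lev-form m eq t in
    c ℤ.* c′ , *-≢0 c c′ c≢0 c′≢0 , const c′ *ˢ G +ˢ const c *ˢ G′ , add-form m (scale-form m c′ F) (scale-form m c F′) ,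
    SR.trans (SR.*-congʳ {a +ˢ b} (const-* c c′)) (SR.trans
      (byPoly (const c ∷ const c′ ∷ a ∷ b ∷ []) ((v₀ :* v₁) :* (v₂ :+ v₃)) (v₁ :* (v₀ :* v₂) :+ v₀ :* (v₁ :* v₃)) refl)
      (SR.trans (SR.+-cong (SR.*-congˡ {const c′} p) (SR.*-congˡ {const c} p′))
        (byPoly (const c ∷ const c′ ∷ r∞ ∷ G ∷ G′ ∷ []) (v₁ :* (v₂ :* v₃) :+ v₀ :* (v₂ :* v₄)) (v₂ :* (v₁ :* v₃ :+ v₀ :* v₄)) refl)))
  lev-form m eq (scale-lev {a = a} d s) = let c , c≢0 , G , F , p = lev-form m eq s in
    c , c≢0 , const d *ˢ G , scale-form m d F , SR.trans (swapˢ (const c) (const d) a) (SR.trans (SR.*-congˡ {const d} p) (swapˢ (const d) r∞ G))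
  lev-form m eq (divide-lev {a = a} d d≢0 s) = let c , c≢0 , G , F , p = lev-form m eq s in
    c ℤ.* d , *-≢0 c d c≢0 d≢0 , G , F ,
    SR.trans (SR.*-congʳ {a} (const-* c d)) (SR.trans (SR.*-assoc (const c) (const d) a) p)
  lev-form m eq (resp-lev e s) = let c , c≢0 , G , F , p = lev-form m eq s in c , c≢0 , G , F , SR.trans (SR.*-congˡ {const c} (SR.sym e)) p

open Level1Forms

-- The operator T on quotients E₆ G / φ^(24 m + 1).

module CongruenceChain where

  open import Relation.Binary.Reasoning.Setoid SR.setoid
  private
    k n : ∀ {m} → ℕ → Expr m
    k i = con (+ i)
    n i = con (ℤ.- (+ i))
    v₀ : ∀ {m} → Expr (1 ℕ.+ m)
    v₀ = var zero
    v₁ : ∀ {m} → Expr (2 ℕ.+ m)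
    v₁ = var (suc zero)
    v₂ : ∀ {m} → Expr (3 ℕ.+ m)
    v₂ = var (suc (suc zero))
    v₃ : ∀ {m} → Expr (4 ℕ.+ m)
    v₃ = var (suc (suc (suc zero)))
    v₄ : ∀ {m} → Expr (5 ℕ.+ m)
    v₄ = var (suc (suc (suc (suc zero))))
    v₅ : ∀ {m} → Expr (6 ℕ.+ m)
    v₅ = var (suc (suc (suc (suc (suc zero)))))

  -- The Fricke involution sends a level 1 form u of weight 2 w to 11^w u(q^11).
  LMul : ℕ → Series → Set
  LMul w u = Mul w u (E ^ˢ w *ˢ V u)

  LMul-resp : ∀ {w u v} → u ≈ˢ v → LMul w u → LMul w v
  LMul-resp {w} e p = mul-resp e (SR.*-congˡ {E ^ˢ w} (V-cong e)) p

  LMul-const : ∀ c → LMul 0 (const c)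
  LMul-const c = mul-resp SR.refl (SR.sym (SR.trans (SR.*-identityˡ (V (const c))) (V-const c))) (mul-const c)

  LMul-+ : ∀ {w u v} → LMul w u → LMul w v → LMul w (u +ˢ v)
  LMul-+ {w} {u} {v} p p′ = mul-resp SR.refl
    (SR.trans (SR.sym (SR.distribˡ (E ^ˢ w) (V u) (V v))) (SR.*-congˡ {E ^ˢ w} (SR.sym (V-+ u v)))) (mul-+ p p′)

  LMul-* : ∀ {w w′ u v} → LMul w u → LMul w′ v → LMul (w ℕ.+ w′) (u *ˢ v)
  LMul-* {w} {w′} {u} {v} p p′ = mul-resp SR.refl (SR.trans
    (byPoly (E ^ˢ w ∷ V u ∷ E ^ˢ w′ ∷ V v ∷ []) ((v₀ :* v₁) :* (v₂ :* v₃)) ((v₀ :* v₂) :* (v₁ :* v₃)) refl)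
    (SR.*-cong (SR.sym (^-homo-* E w w′)) (SR.sym (V-* u v)))) (mul-* p p′)

  LMul-^ : ∀ {w u} i → LMul w u → LMul (i ℕ.* w) (u ^ˢ i)
  LMul-^ zero    p = LMul-const 1ℤ
  LMul-^ (suc i) p = LMul-* p (LMul-^ i p)

  LMul-q∞ : LMul 2 q∞
  LMul-q∞ = mul-resp SR.refl (SR.trans q₀≈V (SR.trans (V-const* (+ 121) q∞) (SR.*-congʳ {V q∞} (SR.sym E²≈)))) mul-q∞

  LMul-r∞ : LMul 3 r∞
  LMul-r∞ = mul-resp SR.refl (SR.trans r₀≈V (SR.trans (V-const* (+ 1331) r∞) (SR.*-congʳ {V r∞} (SR.sym E³≈)))) mul-r∞

  LMul-D : LMul 6 D
  LMul-D = LMul-resp (byPoly (Q³ ∷ r∞ ^ˢ 2 ∷ []) (v₀ :+ con -1ℤ :* v₁) (v₀ :- v₁) refl)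
    (LMul-+ (LMul-^ 3 LMul-q∞) (LMul-* (LMul-const -1ℤ) (LMul-^ 2 LMul-r∞)))

  LMul-form : ∀ {m G} → Form m G → LMul (m ℕ.* 6) G
  LMul-form (const-form c) = LMul-const c
  LMul-form (step-form {m} c F) = LMul-+ (LMul-* (LMul-const c) (LMul-^ (suc m) (LMul-^ 3 LMul-q∞))) (LMul-* LMul-D (LMul-form F))
  LMul-form (resp-form e F) = LMul-resp e (LMul-form F)

  -- The chain of forms attached to A = E₆ G / φ^(24 m + 1)

  transfer : ℕ → Series → Series
  -- The powers of q are the leading terms of δ∞^d and δ∞^(11 d), by which the denominators φ^d and
  -- φ^(11 d) are cleared before each U. The constants are 11⁴ and 11⁹.
  transfer d A = (U (X ^ˢ (5 ℕ.* (11 ℕ.* d)) *ˢ U (X ^ˢ (5 ℕ.* d) *ˢ A)) +ˢ const (+ 14641) *ˢ χ⊗ (X ^ˢ (5 ℕ.* d) *ˢ A)) +ˢ const (+ 2357947691) *ˢ V (V A)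

  -- A = E₆ G / φ^(24 m + 1) up to a rational factor: the scalar gathers the denominators of `Span`
  -- and `Lev` as well as powers of 11.
  record Good (m : ℕ) (A : Series) : Set where
    constructor good
    field
      {scalar}   : ℤ
      scalar≢0   : scalar ≢ 0ℤ
      {form}     : Series
      isForm     : Form m form
      expansion  : const scalar *ˢ (φ ^ˢ suc (24 ℕ.* m) *ˢ A) ≈ˢ E₆ *ˢ form

  odd-power : ∀ u n → (u *ˢ u) ^ˢ n *ˢ u ≈ˢ u ^ˢ suc (2 ℕ.* n)
  odd-power u n = SR.trans (SR.*-comm ((u *ˢ u) ^ˢ n) u) (SR.*-congˡ {u} (SR.trans (^-congˡ n (byPoly (u ∷ []) (v₀ :* v₀) (v₀ :^ 2) refl)) (^-assocʳ u 2 n)))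

  scaled-odd-power : ∀ c u n → (c *ˢ (u *ˢ u)) ^ˢ n *ˢ u ≈ˢ c ^ˢ n *ˢ u ^ˢ suc (2 ℕ.* n)
  scaled-odd-power c u n = SR.trans (SR.*-congʳ {u} (^-distrib-* c (u *ˢ u) n))
    (SR.trans (SR.*-assoc (c ^ˢ n) ((u *ˢ u) ^ˢ n) u) (SR.*-congˡ {c ^ˢ n} (odd-power u n)))

  1^ : ∀ n → 1ˢ ^ˢ n ≈ˢ 1ˢ
  1^ zero    = SR.refl
  1^ (suc n) = SR.trans (SR.*-identityˡ (1ˢ ^ˢ n)) (1^ n)

  -1^even : ∀ n → const -1ℤ ^ˢ (2 ℕ.* n) ≈ˢ 1ˢ
  -1^even n = SR.trans (SR.sym (^-assocʳ (const -1ℤ) 2 n)) (SR.trans (^-congˡ n (byPoly [] (con -1ℤ :^ 2) (k 1) refl)) (1^ n))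

  opaque
    -- Only the existence of a nonzero constant matters; opacity keeps the power of 11 symbolic.
    E^≈const : ∀ n → Σ ℤ λ c → c ≢ 0ℤ × E ^ˢ n ≈ˢ const c
    E^≈const zero    = 1ℤ , (λ ()) , SR.refl
    E^≈const (suc n) = let c , c≢0 , p = E^≈const n in + 11 ℤ.* c ,
      *-≢0 (+ 11) c (λ ()) c≢0 ,
      SR.trans (SR.*-congˡ {E} p) (SR.sym (const-* (+ 11) c))

  -- The purpose of δ: its powers replace φ^(-d) by a power of q times a series in q^11, and the
  -- latter passes through U and the twist.
  δ∞φ^ : ∀ d → δ∞ ^ˢ d *ˢ φ ^ˢ d ≈ˢ X ^ˢ (5 ℕ.* d) *ˢ V ((φ ^ˢ 11) ^ˢ d)
  δ∞φ^ d = SR.trans (SR.sym (^-distrib-* δ∞ φ d)) (SR.trans (^-congˡ d δ∞φ) (SR.trans (^-distrib-* (X ^ˢ 5) (V φ ^ˢ 11) d)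
    (SR.*-cong (^-assocʳ X 5 d) (SR.sym (SR.trans (V-^ (φ ^ˢ 11) d) (^-congˡ d (V-^ φ 11)))))))

  δ₀Vφ^ : ∀ d → δ₀ ^ˢ d *ˢ V φ ^ˢ d ≈ˢ (φ ^ˢ 11) ^ˢ d
  δ₀Vφ^ d = SR.trans (SR.sym (^-distrib-* δ₀ (V φ) d)) (^-congˡ d δ₀Vφ)

  chain-exponent : ∀ m → (1 ℕ.+ 2 ℕ.* (2 ℕ.* (6 ℕ.* m))) ≡ (1 ℕ.+ 24 ℕ.* m)
  chain-exponent = solve-∀ℕ

  chain-exponent′ : ∀ m → 11 ℕ.* (1 ℕ.+ 2 ℕ.* (2 ℕ.* (6 ℕ.* m))) ≡ (1 ℕ.+ 2 ℕ.* (1 ℕ.+ 2 ℕ.* (66 ℕ.* m ℕ.+ 2)))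
  chain-exponent′ = solve-∀ℕ

  chain-exponent″ : ∀ m → 11 ℕ.* (11 ℕ.* (1 ℕ.+ 2 ℕ.* (2 ℕ.* (6 ℕ.* m)))) ≡ (1 ℕ.+ 24 ℕ.* (121 ℕ.* m ℕ.+ 5))
  chain-exponent″ = solve-∀ℕ

  -- The sign of `hecke₀` cancels against the N′ factors -δ₀², since N′ is odd.
  chain-sign : ∀ m → (1 ℕ.+ (1 ℕ.+ 2 ℕ.* (66 ℕ.* m ℕ.+ 2))) ≡ 2 ℕ.* (66 ℕ.* m ℕ.+ 3)
  chain-sign = solve-∀ℕ

  -- With this total exponent the powers of 11 at the cusp 0 combine to 11⁶ F^N for F = 11⁶, so they
  -- share the factor F^N with the expansion at ∞.
  chain-weight : ∀ m → ((3 ℕ.+ m ℕ.* 6) ℕ.+ 2 ℕ.* (6 ℕ.* m) ℕ.* 5) ℕ.+ (3 ℕ.+ m ℕ.* 6) ≡ 6 ℕ.+ 6 ℕ.* (2 ℕ.* (6 ℕ.* m))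
  chain-weight = solve-∀ℕ

  chain-weight′ : ∀ m → 
    ((1 ℕ.+ 2 ℕ.* (66 ℕ.* m ℕ.+ 2)) ℕ.* 5 ℕ.+ (5 ℕ.+ ((3 ℕ.+ m ℕ.* 6) ℕ.+ 2 ℕ.* (6 ℕ.* m) ℕ.* 5))) ℕ.+ ((3 ℕ.+ m ℕ.* 6) ℕ.+ 2 ℕ.* (6 ℕ.* m) ℕ.* 5) ≡ 6 ℕ.+ 6 ℕ.* (1 ℕ.+ 2 ℕ.* (66 ℕ.* m ℕ.+ 2))
  chain-weight′ = solve-∀ℕ

  chain-weight″ : ∀ m → (1 ℕ.+ 2 ℕ.* (66 ℕ.* m ℕ.+ 2)) ℕ.* 5 ℕ.+ (5 ℕ.+ ((3 ℕ.+ m ℕ.* 6) ℕ.+ 2 ℕ.* (6 ℕ.* m) ℕ.* 5)) ≡ 3 ℕ.+ 6 ℕ.* (121 ℕ.* m ℕ.+ 5)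
  chain-weight″ = solve-∀ℕ

  -- Only even powers of δ are multipliers of `Span`, while odd powers are needed: d = 2 N + 1
  -- before the inner U, and 11 d = 2 N′ + 1 before the outer one. The two odd factors are those of
  -- δ U(δ b). So p is r∞ G times δ^(2 N), the operator is applied to p, the result γ is multiplied
  -- by δ^(2 N′), and the outer U is part of the trace of γ.
  module Chain (m : ℕ) (c : ℤ) (A G : Series) (isForm : Form m G)
    (expansion : const c *ˢ (φ ^ˢ suc (24 ℕ.* m) *ˢ A) ≈ˢ E₆ *ˢ G) where

    N N′ d κ κ′ : ℕ
    N  = 2 ℕ.* (6 ℕ.* m)
    N′ = suc (2 ℕ.* (66 ℕ.* m ℕ.+ 2))
    d  = suc (2 ℕ.* N)
    κ  = (3 ℕ.+ m ℕ.* 6) ℕ.+ N ℕ.* 5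
    κ′ = N′ ℕ.* 5 ℕ.+ (5 ℕ.+ κ)

    F C Y Φ Ψ tail-form : Series
    F = E ^ˢ 6
    C = const (+ 125) *ˢ const c
    Y = X ^ˢ (5 ℕ.* d) *ˢ A
    Φ = (φ ^ˢ 11) ^ˢ d
    Ψ = (φ ^ˢ 11) ^ˢ (11 ℕ.* d)
    tail-form = const (+ 11) *ˢ χ⊗ Y +ˢ F *ˢ V (V A)

    p∞ p₀ γ∞ γ₀ : Series
    p∞ = (r∞ *ˢ G) *ˢ (F *ˢ (δ∞ *ˢ δ∞)) ^ˢ N
    p₀ = (E ^ˢ (3 ℕ.+ m ℕ.* 6) *ˢ V (r∞ *ˢ G)) *ˢ (const -1ℤ *ˢ (δ₀ *ˢ δ₀)) ^ˢ N
    γ∞ = (F *ˢ (δ∞ *ˢ δ∞)) ^ˢ N′ *ˢ hecke∞ p∞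
    γ₀ = (const -1ℤ *ˢ (δ₀ *ˢ δ₀)) ^ˢ N′ *ˢ hecke₀ κ p∞ p₀

    p-span : Span κ p∞ p₀
    p-span = mul-span (mul-* (LMul-* LMul-r∞ (LMul-form isForm)) (mul-^ N mul-δ²))

    γ-span : Span κ′ γ∞ γ₀
    γ-span = mul-^ N′ mul-δ² (hecke p-span)

    r∞G : r∞ *ˢ G ≈ˢ C *ˢ (φ ^ˢ d *ˢ A)
    r∞G = SR.trans (SR.*-assoc (const (+ 125)) E₆ G) (SR.trans (SR.*-congˡ {const (+ 125)} (SR.sym (SR.trans (SR.*-congˡ {const c} (SR.*-congʳ {A} (^-congʳ φ (chain-exponent m)))) expansion)))
      (SR.sym (SR.*-assoc (const (+ 125)) (const c) (φ ^ˢ d *ˢ A))))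

    V-r∞G : V (r∞ *ˢ G) ≈ˢ C *ˢ (V φ ^ˢ d *ˢ V A)
    V-r∞G = SR.trans (V-cong r∞G) (SR.trans (V-* C (φ ^ˢ d *ˢ A)) (SR.*-cong
      (SR.trans (V-* (const (+ 125)) (const c)) (SR.*-cong (V-const (+ 125)) (V-const c)))
      (SR.trans (V-* (φ ^ˢ d) A) (SR.*-congʳ {V A} (V-^ φ d)))))

    δ∞p∞ : δ∞ *ˢ p∞ ≈ˢ (C *ˢ F ^ˢ N) *ˢ (V Φ *ˢ Y)
    δ∞p∞ = SR.trans (byPoly (δ∞ ∷ r∞ *ˢ G ∷ (F *ˢ (δ∞ *ˢ δ∞)) ^ˢ N ∷ []) (v₀ :* (v₁ :* v₂)) (v₁ :* (v₂ :* v₀)) refl)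
      (SR.trans (SR.*-cong r∞G (scaled-odd-power F δ∞ N)) (SR.trans
        (byPoly (C ∷ φ ^ˢ d ∷ A ∷ F ^ˢ N ∷ δ∞ ^ˢ d ∷ []) ((v₀ :* (v₁ :* v₂)) :* (v₃ :* v₄)) ((v₀ :* v₃) :* ((v₄ :* v₁) :* v₂)) refl)
        (SR.*-congˡ {C *ˢ F ^ˢ N} (SR.trans (SR.*-congʳ {A} (δ∞φ^ d))
          (byPoly (X ^ˢ (5 ℕ.* d) ∷ V Φ ∷ A ∷ []) ((v₀ :* v₁) :* v₂) (v₁ :* (v₀ :* v₂)) refl)))))

    δ₀p₀ : δ₀ *ˢ p₀ ≈ˢ (E ^ˢ (3 ℕ.+ m ℕ.* 6) *ˢ C) *ˢ (Φ *ˢ V A)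
    δ₀p₀ = SR.trans (byPoly (δ₀ ∷ E ^ˢ (3 ℕ.+ m ℕ.* 6) *ˢ V (r∞ *ˢ G) ∷ (const -1ℤ *ˢ (δ₀ *ˢ δ₀)) ^ˢ N ∷ []) (v₀ :* (v₁ :* v₂)) (v₁ :* (v₂ :* v₀)) refl)
      (SR.trans (SR.*-cong (SR.*-congˡ {E ^ˢ (3 ℕ.+ m ℕ.* 6)} V-r∞G)
          (SR.trans (scaled-odd-power (const -1ℤ) δ₀ N) (SR.trans (SR.*-congʳ {δ₀ ^ˢ d} (-1^even (6 ℕ.* m))) (SR.*-identityˡ (δ₀ ^ˢ d)))))
        (SR.trans (byPoly (E ^ˢ (3 ℕ.+ m ℕ.* 6) ∷ C ∷ V φ ^ˢ d ∷ V A ∷ δ₀ ^ˢ d ∷ []) ((v₀ :* (v₁ :* (v₂ :* v₃))) :* v₄) ((v₀ :* v₁) :* ((v₄ :* v₂) :* v₃)) refl)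
          (SR.*-congˡ {E ^ˢ (3 ℕ.+ m ℕ.* 6) *ˢ C} (SR.*-congʳ {V A} (δ₀Vφ^ d)))))

    E-weights : ∀ n → E ^ˢ (6 ℕ.+ 6 ℕ.* n) ≈ˢ F *ˢ F ^ˢ n
    E-weights n = SR.trans (^-homo-* E 6 (6 ℕ.* n)) (SR.*-congˡ {F} (SR.sym (^-assocʳ E 6 n)))

    constant : Σ ℤ λ K → C *ˢ F ^ˢ N ≈ˢ const K
    constant = let K , _ , p = E^≈const (6 ℕ.* N) in (+ 125 ℤ.* c) ℤ.* K ,
      SR.trans (SR.*-cong (SR.sym (const-* (+ 125) c)) (SR.trans (^-assocʳ E 6 N) p)) (SR.sym (const-* (+ 125 ℤ.* c) K))

    twist-p : twist κ p∞ p₀ ≈ˢ (C *ˢ F ^ˢ N) *ˢ (V Φ *ˢ tail-form)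
    twist-p = SR.trans (SR.+-cong
        (SR.*-congˡ {const (+ 11)} (SR.trans (χ⊗-cong (SR.trans δ∞p∞ (SR.trans
            (byPoly (C ∷ F ^ˢ N ∷ V Φ ∷ Y ∷ []) ((v₀ :* v₁) :* (v₂ :* v₃)) (v₂ :* (v₀ :* v₁ :* v₃)) refl)
            SR.refl)))
          (SR.trans (χ⊗-V* Φ (C *ˢ F ^ˢ N *ˢ Y)) (SR.*-congˡ {V Φ} χ⊗-C))))
        (SR.trans (SR.*-congˡ {E ^ˢ κ} (SR.trans (V-cong δ₀p₀) V-δ₀p₀))
          (SR.trans (byPoly (E ^ˢ κ ∷ E ^ˢ (3 ℕ.+ m ℕ.* 6) ∷ C ∷ V Φ ∷ V (V A) ∷ []) (v₀ :* ((v₁ :* v₂) :* (v₃ :* v₄))) ((v₀ :* v₁) :* (v₂ :* (v₃ :* v₄))) refl)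
            (SR.*-congʳ {C *ˢ (V Φ *ˢ V (V A))} (SR.trans (SR.sym (^-homo-* E κ (3 ℕ.+ m ℕ.* 6))) (SR.trans (^-congʳ E (chain-weight m)) (E-weights N)))))))
      (byPoly (C ∷ F ^ˢ N ∷ V Φ ∷ χ⊗ Y ∷ F ∷ V (V A) ∷ [])
        (k 11 :* (v₂ :* (v₀ :* v₁ :* v₃)) :+ (v₄ :* v₁) :* (v₀ :* (v₂ :* v₅))) ((v₀ :* v₁) :* (v₂ :* (k 11 :* v₃ :+ v₄ :* v₅))) refl)
      where
      χ⊗-C : χ⊗ (C *ˢ F ^ˢ N *ˢ Y) ≈ˢ C *ˢ F ^ˢ N *ˢ χ⊗ Y
      χ⊗-C = let K , p = constant in SR.trans (χ⊗-cong (SR.*-congʳ {Y} p)) (SR.trans (χ⊗-const* K Y) (SR.*-congʳ {χ⊗ Y} (SR.sym p)))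
      V-δ₀p₀ : V ((E ^ˢ (3 ℕ.+ m ℕ.* 6) *ˢ C) *ˢ (Φ *ˢ V A)) ≈ˢ (E ^ˢ (3 ℕ.+ m ℕ.* 6) *ˢ C) *ˢ (V Φ *ˢ V (V A))
      V-δ₀p₀ = SR.trans (V-* (E ^ˢ (3 ℕ.+ m ℕ.* 6) *ˢ C) (Φ *ˢ V A)) (SR.*-cong
        (SR.trans (V-* (E ^ˢ (3 ℕ.+ m ℕ.* 6)) C) (SR.*-cong (SR.trans (V-^ E (3 ℕ.+ m ℕ.* 6)) (^-congˡ (3 ℕ.+ m ℕ.* 6) (V-const (+ 11))))
          (SR.trans (V-* (const (+ 125)) (const c)) (SR.*-cong (V-const (+ 125)) (V-const c)))))
        (V-* Φ (V A)))

    hecke∞-p : hecke∞ p∞ ≈ˢ const (+ 121) *ˢ (δ∞ *ˢ (C *ˢ F ^ˢ N *ˢ (Φ *ˢ U Y)))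
    hecke∞-p = SR.*-congˡ {const (+ 121)} (SR.*-congˡ {δ∞} (SR.trans (U-cong (SR.trans δ∞p∞
        (byPoly (C ∷ F ^ˢ N ∷ V Φ ∷ Y ∷ []) ((v₀ :* v₁) :* (v₂ :* v₃)) (v₂ :* (v₀ :* v₁ :* v₃)) refl)))
      (SR.trans (U-V* Φ (C *ˢ F ^ˢ N *ˢ Y)) (SR.trans
        (SR.*-congˡ {Φ} (let K , p = constant in SR.trans (U-cong (SR.*-congʳ {Y} p)) (SR.trans (U-const* K Y) (SR.*-congʳ {U Y} (SR.sym p)))))
        (swapˢ Φ (C *ˢ F ^ˢ N) (U Y))))))

    Uγ∞ : U γ∞ ≈ˢ const (+ 121) *ˢ (F ^ˢ N′ *ˢ (C *ˢ F ^ˢ N)) *ˢ (Ψ *ˢ U (X ^ˢ (5 ℕ.* (11 ℕ.* d)) *ˢ U Y))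
    Uγ∞ = SR.trans (U-cong γ∞≈) (SR.trans (U-V* Ψ (M *ˢ Z))
      (SR.trans (SR.*-congˡ {Ψ} (SR.trans (U-cong (SR.*-congʳ {Z} K≈)) (SR.trans (U-const* K Z) (SR.*-congʳ {U Z} (SR.sym K≈)))))
        (swapˢ Ψ M (U Z))))
      where
      M Z : Series
      M = const (+ 121) *ˢ (F ^ˢ N′ *ˢ (C *ˢ F ^ˢ N))
      Z = X ^ˢ (5 ℕ.* (11 ℕ.* d)) *ˢ U Y
      K : ℤ
      K = + 121 ℤ.* (proj₁ (E^≈const (6 ℕ.* N′)) ℤ.* proj₁ constant)
      K≈ : M ≈ˢ const K
      K≈ = SR.trans (SR.*-congˡ {const (+ 121)} (SR.trans (SR.*-cong (SR.trans (^-assocʳ E 6 N′) (proj₂ (proj₂ (E^≈const (6 ℕ.* N′))))) (proj₂ constant))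
        (SR.sym (const-* (proj₁ (E^≈const (6 ℕ.* N′))) (proj₁ constant))))) (SR.sym (const-* (+ 121) (proj₁ (E^≈const (6 ℕ.* N′)) ℤ.* proj₁ constant)))
      γ∞≈ : γ∞ ≈ˢ V Ψ *ˢ (M *ˢ Z)
      γ∞≈ = SR.trans (SR.*-congˡ {(F *ˢ (δ∞ *ˢ δ∞)) ^ˢ N′} hecke∞-p) (SR.trans
        (byPoly ((F *ˢ (δ∞ *ˢ δ∞)) ^ˢ N′ ∷ δ∞ ∷ C *ˢ F ^ˢ N ∷ Φ ∷ U Y ∷ []) (v₀ :* (k 121 :* (v₁ :* (v₂ :* (v₃ :* v₄))))) ((v₀ :* v₁) :* (k 121 :* v₂ :* (v₃ :* v₄))) refl)
        (SR.trans (SR.*-cong (SR.trans (scaled-odd-power F δ∞ N′) (SR.*-congˡ {F ^ˢ N′} (^-congʳ δ∞ (sym (chain-exponent′ m)))))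
            (SR.*-congˡ {const (+ 121) *ˢ (C *ˢ F ^ˢ N)} (SR.*-congʳ {U Y} (^-assocʳ φ 11 d))))
          (SR.trans (byPoly (F ^ˢ N′ ∷ δ∞ ^ˢ (11 ℕ.* d) ∷ C *ˢ F ^ˢ N ∷ φ ^ˢ (11 ℕ.* d) ∷ U Y ∷ [])
              ((v₀ :* v₁) :* (k 121 :* v₂ :* (v₃ :* v₄))) ((v₁ :* v₃) :* (k 121 :* (v₀ :* v₂) :* v₄)) refl)
            (SR.trans (SR.*-congʳ {M *ˢ U Y} (δ∞φ^ (11 ℕ.* d)))
              (byPoly (X ^ˢ (5 ℕ.* (11 ℕ.* d)) ∷ V Ψ ∷ M ∷ U Y ∷ []) ((v₀ :* v₁) :* (v₂ :* v₃)) (v₁ :* (v₂ :* (v₀ :* v₃))) refl)))))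

    γ₀≈ : γ₀ ≈ˢ E ^ˢ κ *ˢ (C *ˢ F ^ˢ N) *ˢ (Ψ *ˢ tail-form)
    γ₀≈ = SR.trans (byPoly ((const -1ℤ *ˢ (δ₀ *ˢ δ₀)) ^ˢ N′ ∷ δ₀ ∷ E ^ˢ κ ∷ twist κ p∞ p₀ ∷ [])
        (v₀ :* (con -1ℤ :* (v₁ :* (v₂ :* v₃)))) (con -1ℤ :* (v₀ :* v₁) :* (v₂ :* v₃)) refl)
      (SR.trans (SR.*-cong signs (SR.*-congˡ {E ^ˢ κ} (SR.trans twist-p (SR.*-congˡ {C *ˢ F ^ˢ N} (SR.*-congʳ {tail-form} VΦ)))))
        (SR.trans (byPoly (δ₀ ^ˢ (11 ℕ.* d) ∷ E ^ˢ κ ∷ C *ˢ F ^ˢ N ∷ V φ ^ˢ (11 ℕ.* d) ∷ tail-form ∷ [])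
            (v₀ :* (v₁ :* (v₂ :* (v₃ :* v₄)))) (v₁ :* v₂ :* ((v₀ :* v₃) :* v₄)) refl)
          (SR.*-congˡ {E ^ˢ κ *ˢ (C *ˢ F ^ˢ N)} (SR.*-congʳ {tail-form} (δ₀Vφ^ (11 ℕ.* d))))))
      where
      VΦ : V Φ ≈ˢ V φ ^ˢ (11 ℕ.* d)
      VΦ = SR.trans (V-cong (^-assocʳ φ 11 d)) (V-^ φ (11 ℕ.* d))
      signs : const -1ℤ *ˢ ((const -1ℤ *ˢ (δ₀ *ˢ δ₀)) ^ˢ N′ *ˢ δ₀) ≈ˢ δ₀ ^ˢ (11 ℕ.* d)
      signs = SR.trans (SR.*-congˡ {const -1ℤ} (scaled-odd-power (const -1ℤ) δ₀ N′))
        (SR.trans (SR.sym (SR.*-assoc (const -1ℤ) (const -1ℤ ^ˢ N′) (δ₀ ^ˢ suc (2 ℕ.* N′))))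
          (SR.trans (SR.*-cong (SR.trans (^-congʳ (const -1ℤ) (chain-sign m)) (-1^even (66 ℕ.* m ℕ.+ 3))) (^-congʳ δ₀ (sym (chain-exponent′ m))))
            (SR.*-identityˡ (δ₀ ^ˢ (11 ℕ.* d)))))

    -- Bookkeeping of powers of 11, beyond those in F^N and F^N′: the three terms carry 11 · 121 =
    -- 11³, then 11⁶ · 11 = 11³ · 11⁴, then 11⁶ · 11⁶ = 11³ · 11⁹. After removal of 11³ these are
    -- the constants of `transfer`.
    γ-trace : const (+ 11) *ˢ U γ∞ +ˢ E ^ˢ κ′ *ˢ γ₀ ≈ˢ (const (+ 1331) *ˢ (F ^ˢ N′ *ˢ (C *ˢ F ^ˢ N))) *ˢ (Ψ *ˢ transfer d A)
    γ-trace = SR.trans (SR.+-cong (SR.*-congˡ {const (+ 11)} Uγ∞) (SR.trans (SR.*-congˡ {E ^ˢ κ′} γ₀≈) (SR.trans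
        (byPoly (E ^ˢ κ′ ∷ E ^ˢ κ ∷ C *ˢ F ^ˢ N ∷ Ψ *ˢ tail-form ∷ []) (v₀ :* (v₁ :* v₂ :* v₃)) ((v₀ :* v₁) :* (v₂ :* v₃)) refl)
        (SR.*-congʳ {C *ˢ F ^ˢ N *ˢ (Ψ *ˢ tail-form)} (SR.trans (SR.sym (^-homo-* E κ′ κ)) (SR.trans (^-congʳ E (chain-weight′ m)) (E-weights N′)))))))
      (byPoly (F ^ˢ N′ ∷ C *ˢ F ^ˢ N ∷ Ψ ∷ U (X ^ˢ (5 ℕ.* (11 ℕ.* d)) *ˢ U Y) ∷ χ⊗ Y ∷ V (V A) ∷ [])
        (k 11 :* (k 121 :* (v₀ :* v₁) :* (v₂ :* v₃)) :+ (k 11 :^ 6 :* v₀) :* (v₁ :* (v₂ :* (k 11 :* v₄ :+ k 11 :^ 6 :* v₅))))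
        ((k 1331 :* (v₀ :* v₁)) :* (v₂ :* ((v₃ :+ k 14641 :* v₄) :+ k 2357947691 :* v₅))) refl)

  transfer-good : ∀ m A → Good m A → Good (121 ℕ.* m ℕ.+ 5) (transfer (suc (24 ℕ.* m)) A)
  transfer-good m A (good {c} c≢0 {G} isForm expansion) = subst (λ d → Good (121 ℕ.* m ℕ.+ 5) (transfer d A)) (chain-exponent m) (conclude (lev-form m′ (chain-weight″ m) (trace γ-span)))
    where
    open Chain m c A G isForm expansion
    m′ = 121 ℕ.* m ℕ.+ 5
    conclude : (Σ ℤ λ c′ → c′ ≢ 0ℤ × Σ Series λ G′ → Form m′ G′ × const c′ *ˢ (const (+ 11) *ˢ U γ∞ +ˢ E ^ˢ κ′ *ˢ γ₀) ≈ˢ r∞ *ˢ G′) → Good m′ (transfer d A)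
    conclude (c′ , c′≢0 , G′ , isForm′ , p) = good {scalar = c′ ℤ.* (+ 1331 ℤ.* (K ℤ.* ((+ 125 ℤ.* c) ℤ.* K₁)))}
      (*-≢0 c′ _ c′≢0 (*-≢0 (+ 1331) (K ℤ.* ((+ 125 ℤ.* c) ℤ.* K₁)) (λ ()) (*-≢0 K _ K≢0 (*-≢0 (+ 125 ℤ.* c) K₁ (*-≢0 (+ 125) c (λ ()) c≢0) K₁≢0)))) (scale-form m′ (+ 125) isForm′)
      (SR.trans (SR.*-cong scalar≈ (SR.*-congʳ {transfer d A} (SR.sym (SR.trans (^-assocʳ φ 11 (11 ℕ.* d)) (^-congʳ φ (chain-exponent″ m))))))
        (SR.trans (SR.*-assoc (const c′) (const (+ 1331) *ˢ (F ^ˢ N′ *ˢ (C *ˢ F ^ˢ N))) (Ψ *ˢ transfer d A))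
          (SR.trans (SR.*-congˡ {const c′} (SR.sym γ-trace)) (SR.trans p
            (byPoly (E₆ ∷ G′ ∷ []) ((k 125 :* v₀) :* v₁) (v₀ :* (k 125 :* v₁)) refl)))))
      where
      K K₁ : ℤ
      K = proj₁ (E^≈const (6 ℕ.* N′))
      K₁ = proj₁ (E^≈const (6 ℕ.* N))
      K≢0 : K ≢ 0ℤ
      K≢0 = proj₁ (proj₂ (E^≈const (6 ℕ.* N′)))
      K₁≢0 : K₁ ≢ 0ℤ
      K₁≢0 = proj₁ (proj₂ (E^≈const (6 ℕ.* N)))
      scalar≈ : const (c′ ℤ.* (+ 1331 ℤ.* (K ℤ.* ((+ 125 ℤ.* c) ℤ.* K₁)))) ≈ˢ const c′ *ˢ (const (+ 1331) *ˢ (F ^ˢ N′ *ˢ (C *ˢ F ^ˢ N)))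
      scalar≈ = SR.trans (const-* c′ (+ 1331 ℤ.* (K ℤ.* ((+ 125 ℤ.* c) ℤ.* K₁)))) (SR.*-congˡ {const c′} (SR.trans (const-* (+ 1331) (K ℤ.* ((+ 125 ℤ.* c) ℤ.* K₁))) (SR.*-congˡ {const (+ 1331)} (SR.trans (const-* K ((+ 125 ℤ.* c) ℤ.* K₁))
        (SR.*-cong (SR.sym (SR.trans (^-assocʳ E 6 N′) (proj₂ (proj₂ (E^≈const (6 ℕ.* N′)))))) (SR.sym (proj₂ constant)))))))

  e₆-good : Good 0 e₆
  e₆-good = good {scalar = 1ℤ} (λ ()) (const-form 1ℤ) (SR.trans
    (byPoly (φ ∷ e₆ ∷ []) (k 1 :* (v₀ :* k 1 :* v₁)) (v₀ :* v₁) refl) (SR.trans (SR.*-congˡ {φ} e₆≈E₆ψ) (SR.trans (swapˢ φ E₆ ψ) (SR.*-congˡ {E₆} φψ≈1))))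

open CongruenceChain

-- Divisibility by powers of 11 from finitely many coefficients.

module PrincipalParts where

  private
    k n : ∀ {m} → ℕ → Expr m
    k i = con (+ i)
    n i = con (ℤ.- (+ i))
    v₀ : ∀ {m} → Expr (1 ℕ.+ m)
    v₀ = var zero
    v₁ : ∀ {m} → Expr (2 ℕ.+ m)
    v₁ = var (suc zero)
    v₂ : ∀ {m} → Expr (3 ℕ.+ m)
    v₂ = var (suc (suc zero))
    v₃ : ∀ {m} → Expr (4 ℕ.+ m)
    v₃ = var (suc (suc (suc zero)))
    v₄ : ∀ {m} → Expr (5 ℕ.+ m)
    v₄ = var (suc (suc (suc (suc zero))))
    v₅ : ∀ {m} → Expr (6 ℕ.+ m)
    v₅ = var (suc (suc (suc (suc (suc zero)))))

  opaque
    pow : ℕ → ℤ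
    pow n = + (11 ℕ.^ n)

    pow≡ : ∀ n → pow n ≡ + (11 ℕ.^ n)
    pow≡ n = refl

    pow-+ : ∀ m n → pow (m ℕ.+ n) ≡ pow m ℤ.* pow n
    pow-+ m n = trans (cong +_ (ℕₚ.^-distribˡ-+-* 11 m n)) (ℤₚ.pos-* (11 ℕ.^ m) (11 ℕ.^ n))

    pow-suc : ∀ n → pow (suc n) ≡ + 11 ℤ.* pow n
    pow-suc n = ℤₚ.pos-* 11 (11 ℕ.^ n)

    pow≢0 : ∀ n → pow n ≢ 0ℤ
    pow≢0 n eq = ℕ.≢-nonZero⁻¹ (11 ℕ.^ n) {{ℕₚ.m^n≢0 11 n}} (ℤₚ.+-injective eq)

  pow-zero : ∀ i → pow 0 ∣ᶻ i
  pow-zero i = divides i (sym (trans (cong (i ℤ.*_) (pow≡ 0)) (ℤₚ.*-identityʳ i)))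

  pow-weaken : ∀ {i j} x → i ≤ j → pow j ∣ᶻ x → pow i ∣ᶻ x
  pow-weaken {i} {j} x i≤j p = Div.∣-trans (divides (pow (j ℕ.∸ i)) (trans (cong pow (sym (ℕₚ.m∸n+n≡m i≤j))) (pow-+ (j ℕ.∸ i) i))) p

  pow-* : ∀ i j {x y} → pow i ∣ᶻ x → pow j ∣ᶻ y → pow (i ℕ.+ j) ∣ᶻ x ℤ.* y
  pow-* i j (divides a refl) (divides b refl) = divides (a ℤ.* b) (trans (eq a b (pow i) (pow j)) (cong (a ℤ.* b ℤ.*_) (sym (pow-+ i j))))
    where
    eq : ∀ a b p q → (a ℤ.* p) ℤ.* (b ℤ.* q) ≡ (a ℤ.* b) ℤ.* (p ℤ.* q)
    eq = solve-∀

  ∣0 : ∀ {x} → x ∣ᶻ 0ℤ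
  ∣0 {x} = divides 0ℤ (sym (ℤₚ.*-zeroˡ x))

  -- Being prime to 11, encoded as the cancellation property in which it is used; it is visibly
  -- closed under products.
  record Unit₁₁ (u : ℤ) : Set where
    constructor unit
    field cancel : ∀ N i → pow N ∣ᶻ u ℤ.* i → pow N ∣ᶻ i
  open Unit₁₁

  unit-* : ∀ {u v} → Unit₁₁ u → Unit₁₁ v → Unit₁₁ (u ℤ.* v)
  unit-* {u} {v} p p′ = unit λ N i d → cancel p′ N i (cancel p N (v ℤ.* i) (subst (pow N ∣ᶻ_) (ℤₚ.*-assoc u v i) d))

  -- One power of 11 at a time: if i = t 11^N, the hypothesis for N + 1 gives 11 ∣ u t, and the
  -- Bézout relation gives 11 ∣ t.
  unit-bezout : ∀ u a b → a ℤ.* u ℤ.+ b ℤ.* + 11 ≡ 1ℤ → Unit₁₁ u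
  unit-bezout u a b bezout = unit go
    where
    bezout-at : ∀ t → a ℤ.* (u ℤ.* t) ℤ.+ (b ℤ.* t) ℤ.* + 11 ≡ t
    bezout-at t = trans (eq a b u t) (trans (cong (ℤ._* t) bezout) (ℤₚ.*-identityˡ t))
      where
      eq : ∀ a b u t → a ℤ.* (u ℤ.* t) ℤ.+ (b ℤ.* t) ℤ.* + 11 ≡ (a ℤ.* u ℤ.+ b ℤ.* + 11) ℤ.* t
      eq = solve-∀
    go : ∀ N i → pow N ∣ᶻ u ℤ.* i → pow N ∣ᶻ i
    go zero    i p = pow-zero i
    go (suc N) i p with go N i (pow-weaken (u ℤ.* i) (ℕₚ.n≤1+n N) p)
    ... | divides t refl = subst (_∣ᶻ t ℤ.* pow N) (sym (pow-suc N)) (Div.*-monoˡ-∣ (pow N) (subst (+ 11 ∣ᶻ_) (bezout-at t)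
      (Div.∣m∣n⇒∣m+n (Div.∣n⇒∣m*n a 11∣ut) (divides (b ℤ.* t) refl))))
      where
      11∣ut : + 11 ∣ᶻ u ℤ.* t
      11∣ut = Div.*-cancelʳ-∣ (pow N) {{ℤ.≢-nonZero (pow≢0 N)}} (subst₂ _∣ᶻ_ (pow-suc N) (sym (ℤₚ.*-assoc u t (pow N))) p)

  infix 4 _∣ˢ_ _∣ˢ[_]_
  _∣ˢ_ : ℤ → Series → Set
  K ∣ˢ a = ∀ n → K ∣ᶻ a n

  _∣ˢ[_]_ : ℤ → ℕ → Series → Set
  K ∣ˢ[ m ] a = ∀ n → n ≤ m → K ∣ᶻ a n

  ∣ˢ[]-* : ∀ {K m b} a → K ∣ˢ[ m ] b → K ∣ˢ[ m ] a *ˢ b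
  ∣ˢ[]-* a p zero    0≤m = Div.∣n⇒∣m*n (a 0) (p 0 0≤m)
  ∣ˢ[]-* {K} {m} {b} a p (suc n) n<m = Div.∣m∣n⇒∣m+n (Div.∣n⇒∣m*n (a 0) (p (suc n) n<m)) (∣ˢ[]-* {b = b} (tail a) (λ i i≤n → p i (ℕₚ.≤-trans i≤n (ℕₚ.<⇒≤ n<m))) n ℕₚ.≤-refl)

  ∣ˢ-* : ∀ {K b} a → K ∣ˢ b → K ∣ˢ a *ˢ b
  ∣ˢ-* {b = b} a p n = ∣ˢ[]-* {b = b} a (λ i _ → p i) n ℕₚ.≤-refl

  ∣ˢ-resp : ∀ {K a b} → a ≈ˢ b → K ∣ˢ a → K ∣ˢ b
  ∣ˢ-resp {K} e p n = subst (K ∣ᶻ_) (e n) (p n)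

  ∣ˢ[]-resp : ∀ {K m a b} → a ≈ˢ b → K ∣ˢ[ m ] a → K ∣ˢ[ m ] b
  ∣ˢ[]-resp {K} e p n n≤m = subst (K ∣ᶻ_) (e n) (p n n≤m)

  ∣ˢ-const : ∀ {K u} → K ∣ᶻ u → K ∣ˢ const u
  ∣ˢ-const p zero    = p
  ∣ˢ-const p (suc n) = ∣0

  ∣ˢ-+ : ∀ {K a b} → K ∣ˢ a → K ∣ˢ b → K ∣ˢ a +ˢ b
  ∣ˢ-+ p p′ n = Div.∣m∣n⇒∣m+n (p n) (p′ n)

  ^-0 : ∀ a n → (a ^ˢ n) 0 ≡ a 0 ℤ.^ n
  ^-0 a zero    = refl
  ^-0 a (suc n) = cong (a 0 ℤ.*_) (^-0 a n)

  unit-^ : ∀ {u} n → Unit₁₁ u → Unit₁₁ (u ℤ.^ n)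
  unit-^ {u} zero    p = unit λ N i → subst (pow N ∣ᶻ_) (ℤₚ.*-identityˡ i)
  unit-^ {u} (suc n) p = unit-* p (unit-^ n p)

  D≈X* : D ≈ˢ X *ˢ tail D
  D≈X* n = trans (shifted n) (sym (X*ˢ (tail D) n))
    where
    shifted : D ≈ˢ shift (tail D)
    shifted zero    = refl
    shifted (suc n) = refl

  -- The constant term of `Q³` is 25³ = 15625, and 9 · 15625 - 12784 · 11 = 1.
  Q³-unit : ∀ n → Unit₁₁ ((Q³ ^ˢ n) 0)
  Q³-unit n = subst Unit₁₁ (sym (^-0 Q³ n)) (unit-^ n (unit-bezout (+ 15625) (+ 9) (-[1+ 12783 ]) refl))

  tail-D-unit : Unit₁₁ (tail D 0)
  tail-D-unit = unit-bezout (+ 27000000) (+ 9) (-[1+ 22090908 ]) refl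

  -- The polynomial in q³ and D is triangular, so a product W G is controlled by its coefficients up to the degree of G.
  module Triangular (K g : ℤ) (m : ℕ) (W G G′ P D D′ : Series) (G≈ : G ≈ˢ const g *ˢ P +ˢ D *ˢ G′) (D≈X*D′ : D ≈ˢ X *ˢ D′)
    (p : K ∣ˢ[ suc m ] W *ˢ G) where

    Π₁ : ℤ
    Π₁ = W 0 ℤ.* P 0

    W′ B : Series
    W′ = const Π₁ *ˢ (W *ˢ D′)
    B  = const Π₁ *ˢ (W *ˢ (const g *ˢ P))

    X*W′ : X *ˢ W′ ≈ˢ const Π₁ *ˢ (W *ˢ D)
    X*W′ = SR.trans (byPoly (X ∷ const Π₁ ∷ W ∷ D′ ∷ []) (v₀ :* (v₁ :* (v₂ :* v₃))) (v₁ :* (v₂ :* (v₀ :* v₃))) refl)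
      (SR.*-congˡ {const Π₁} (SR.*-congˡ {W} (SR.sym D≈X*D′)))

    -- D has no constant term, so Π₁ g is the constant term of W G.
    K∣Π₁g : K ∣ᶻ Π₁ ℤ.* g
    K∣Π₁g = subst (K ∣ᶻ_) (trans (cong (W 0 ℤ.*_) (trans (G≈ 0) (cong (λ i → g ℤ.* P 0 ℤ.+ i ℤ.* G′ 0) (D≈X*D′ 0)))) (eq (W 0) g (P 0) (D′ 0) (G′ 0))) (p 0 z≤n)
      where
      eq : ∀ w g l d z → w ℤ.* (g ℤ.* l ℤ.+ (0ℤ ℤ.* d) ℤ.* z) ≡ (w ℤ.* l) ℤ.* g
      eq = solve-∀

    K∣B : K ∣ˢ B
    K∣B = ∣ˢ-resp {a = (W *ˢ P) *ˢ const (Π₁ ℤ.* g)}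
      (SR.trans (SR.*-congˡ {W *ˢ P} (const-* Π₁ g))
        (byPoly (W ∷ P ∷ const Π₁ ∷ const g ∷ []) ((v₀ :* v₁) :* (v₂ :* v₃)) (v₂ :* (v₀ :* (v₃ :* v₁))) refl))
      (∣ˢ-* (W *ˢ P) (∣ˢ-const K∣Π₁g))

    -- Removing Π₁ W g P from Π₁ W G leaves Π₁ W D G′ = q W′ G′. Division by q costs one
    -- coefficient, and the degree drops by one at the same time.
    remainder : K ∣ˢ[ m ] W′ *ˢ G′
    remainder n n≤m = subst (K ∣ᶻ_) (trans (difference (suc n)) (X*ˢ (W′ *ˢ G′) (suc n)))
      (Div.∣m∣n⇒∣m+n (∣ˢ[]-* {b = W *ˢ G} (const Π₁) p (suc n) (s≤s n≤m)) (∣ˢ-* {b = B} (const -1ℤ) K∣B (suc n)))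
      where
      difference : const Π₁ *ˢ (W *ˢ G) +ˢ const -1ℤ *ˢ B ≈ˢ X *ˢ (W′ *ˢ G′)
      difference = SR.trans (SR.+-congʳ {const -1ℤ *ˢ B} (SR.*-congˡ {const Π₁} (SR.*-congˡ {W} G≈)))
        (SR.trans (byPoly (const Π₁ ∷ W ∷ const g *ˢ P ∷ D ∷ G′ ∷ []) (v₀ :* (v₁ :* (v₂ :+ v₃ :* v₄)) :+ con -1ℤ :* (v₀ :* (v₁ :* v₂))) ((v₀ :* (v₁ :* v₃)) :* v₄) refl)
          (SR.trans (SR.*-congʳ {G′} (SR.sym X*W′)) (SR.*-assoc X W′ G′)))

    extend : ∀ Π → K ∣ˢ const Π *ˢ (W′ *ˢ G′) → K ∣ˢ const (Π ℤ.* Π₁) *ˢ (W *ˢ G)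
    extend Π d = ∣ˢ-resp {a = const Π *ˢ B +ˢ X *ˢ (const Π *ˢ (W′ *ˢ G′))}
      (SR.trans (SR.+-congˡ {const Π *ˢ B} (SR.trans (byPoly (X ∷ const Π ∷ W′ ∷ G′ ∷ []) (v₀ :* (v₁ :* (v₂ :* v₃))) (v₁ :* ((v₀ :* v₂) :* v₃)) refl)
          (SR.*-congˡ {const Π} (SR.*-congʳ {G′} X*W′))))
        (SR.trans (byPoly (const Π ∷ const Π₁ ∷ W ∷ const g *ˢ P ∷ D ∷ G′ ∷ [])
            (v₀ :* (v₁ :* (v₂ :* v₃)) :+ v₀ :* ((v₁ :* (v₂ :* v₄)) :* v₅)) ((v₀ :* v₁) :* (v₂ :* (v₃ :+ v₄ :* v₅))) refl)
          (SR.*-cong (SR.sym (const-* Π Π₁)) (SR.*-congˡ {W} (SR.sym G≈)))))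
      (∣ˢ-+ {a = const Π *ˢ B} (∣ˢ-* {b = B} (const Π) K∣B) (∣ˢ-* X d))

  -- Each step replaces W by W′, whose constant term is again prime to 11, and multiplies by Π₁; the
  -- product of these units is Π. The modulus K is arbitrary, because the scalar of a good series
  -- may itself be divisible by 11.
  principal-part : ∀ m {G} → Form m G → ∀ W → Unit₁₁ (W 0) → ∀ K → K ∣ˢ[ m ] W *ˢ G → Σ ℤ λ Π → Unit₁₁ Π × K ∣ˢ const Π *ˢ (W *ˢ G)
  principal-part zero {G} isForm W W-unit K p with form-view₀ isForm
  ... | g , G≈ = W 0 , W-unit , ∣ˢ-resp {a = W *ˢ const (W 0 ℤ.* g)}
    (SR.trans (SR.*-congˡ {W} (const-* (W 0) g)) (SR.trans (swapˢ W (const (W 0)) (const g)) (SR.*-congˡ {const (W 0)} (SR.*-congˡ {W} (SR.sym G≈)))))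
    (∣ˢ-* W (∣ˢ-const (subst (K ∣ᶻ_) (cong (W 0 ℤ.*_) (G≈ 0)) (p 0 z≤n))))
  principal-part (suc m) {G} isForm W W-unit K p = go (form-view isForm)
    where
    go : (Σ ℤ λ g → Σ Series λ G′ → Form m G′ × G ≈ˢ const g *ˢ Q³ ^ˢ suc m +ˢ D *ˢ G′) → Σ ℤ λ Π → Unit₁₁ Π × K ∣ˢ const Π *ˢ (W *ˢ G)
    go (g , G′ , isForm′ , G≈) = conclude (principal-part m isForm′ W′ (unit-* Π₁-unit (unit-* W-unit tail-D-unit)) K remainder)
      where
      open Triangular K g m W G G′ (Q³ ^ˢ suc m) D (tail D) G≈ D≈X* p
      Π₁-unit : Unit₁₁ Π₁
      Π₁-unit = unit-* W-unit (Q³-unit (suc m))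
      conclude : (Σ ℤ λ Π → Unit₁₁ Π × K ∣ˢ const Π *ˢ (W′ *ˢ G′)) → Σ ℤ λ Π → Unit₁₁ Π × K ∣ˢ const Π *ˢ (W *ˢ G)
      conclude (Π , Π-unit , d) = Π ℤ.* Π₁ , unit-* Π-unit Π₁-unit , extend Π d

  -- The criterion is applied to E₆ G = c φ^(24 m + 1) A modulo c 11^N. Afterwards c is cancelled
  -- exactly and Π as a unit, and the power of φ is removed by multiplying with the same power of ψ.
  good-divisible : ∀ {m A} → Good m A → ∀ N → pow N ∣ˢ[ m ] A → pow N ∣ˢ A
  good-divisible {m} {A} (good {c} c≢0 {G} isForm expansion) N p = ∣ˢ-resp {a = ψ ^ˢ e *ˢ (φ ^ˢ e *ˢ A)}
      (SR.trans (SR.sym (SR.*-assoc (ψ ^ˢ e) (φ ^ˢ e) A)) (SR.trans (SR.*-congʳ {A} (SR.trans (SR.sym (^-distrib-* ψ φ e))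
        (SR.trans (^-congˡ e (SR.trans (SR.*-comm ψ φ) φψ≈1)) (1^ e)))) (SR.*-identityˡ A)))
      (∣ˢ-* (ψ ^ˢ e) φA)
    where
    e : ℕ
    e = suc (24 ℕ.* m)
    low : c ℤ.* pow N ∣ˢ[ m ] E₆ *ˢ G
    low = ∣ˢ[]-resp expansion λ n n≤m → subst (c ℤ.* pow N ∣ᶻ_) (sym (const*ˢ c (φ ^ˢ e *ˢ A) n)) (Div.*-monoʳ-∣ c (∣ˢ[]-* {b = A} (φ ^ˢ e) p n n≤m))
    all : Σ ℤ λ Π → Unit₁₁ Π × c ℤ.* pow N ∣ˢ const Π *ˢ (E₆ *ˢ G)
    all = principal-part m isForm E₆ (unit-bezout 1ℤ 1ℤ 0ℤ refl) (c ℤ.* pow N) low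
    φA : pow N ∣ˢ φ ^ˢ e *ˢ A
    φA n = let Π , Π-unit , d = all in cancel Π-unit N ((φ ^ˢ e *ˢ A) n) (Div.*-cancelˡ-∣ c {{ℤ.≢-nonZero c≢0}}
      (subst (c ℤ.* pow N ∣ᶻ_) (trans (const*ˢ Π (E₆ *ˢ G) n) (trans (cong (Π ℤ.*_) (trans (sym (expansion n)) (const*ˢ c (φ ^ˢ e *ˢ A) n)))
        (eq Π c ((φ ^ˢ e *ˢ A) n)))) (d n)))
      where
      eq : ∀ p c a → p ℤ.* (c ℤ.* a) ≡ c ℤ.* (p ℤ.* a)
      eq = solve-∀

open PrincipalParts

-- Coefficients along the orbits of s, and the congruence.

module Orbits where

  private
    k n : ∀ {m} → ℕ → Expr m
    k i = con (+ i)
    n i = con (ℤ.- (+ i))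
    v₀ : ∀ {m} → Expr (1 ℕ.+ m)
    v₀ = var zero
    v₁ : ∀ {m} → Expr (2 ℕ.+ m)
    v₁ = var (suc zero)
    v₂ : ∀ {m} → Expr (3 ℕ.+ m)
    v₂ = var (suc (suc zero))
    v₃ : ∀ {m} → Expr (4 ℕ.+ m)
    v₃ = var (suc (suc (suc zero)))
    v₄ : ∀ {m} → Expr (5 ℕ.+ m)
    v₄ = var (suc (suc (suc (suc zero))))
    v₅ : ∀ {m} → Expr (6 ℕ.+ m)
    v₅ = var (suc (suc (suc (suc (suc zero)))))

  -- Extension by 0 to negative exponents, so that shifts of exponents become identities in ℤ.
  coef : Series → ℤ → ℤ
  coef a (+ n)    = a n
  coef a -[1+ n ] = 0ℤ

  coef-neg : ∀ a {z} → z ℤ.< 0ℤ → coef a z ≡ 0ℤ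
  coef-neg a {+ n}      (ℤ.+<+ ())
  coef-neg a { -[1+ n ]} _ = refl

  coef-+ : ∀ a b z → coef (a +ˢ b) z ≡ coef a z ℤ.+ coef b z
  coef-+ a b (+ n)    = refl
  coef-+ a b -[1+ n ] = refl

  coef-const* : ∀ c a z → coef (const c *ˢ a) z ≡ c ℤ.* coef a z
  coef-const* c a (+ n)    = const*ˢ c a n
  coef-const* c a -[1+ n ] = sym (ℤₚ.*-zeroʳ c)

  coef-X^* : ∀ d a z → coef (X ^ˢ d *ˢ a) z ≡ coef a (z ℤ.- + d)
  coef-X^* d a -[1+ n ] = sym (coef-neg a (ℤₚ.≤-<-trans (ℤₚ.≤-trans (ℤₚ.+-monoʳ-≤ -[1+ n ] (ℤₚ.neg-mono-≤ {0ℤ} {+ d} (ℤ.+≤+ z≤n))) (ℤₚ.≤-reflexive (ℤₚ.+-identityʳ -[1+ n ]))) ℤ.-<+))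
  coef-X^* d a (+ n) with ℕₚ.<-≤-connex n d
  ... | inj₁ n<d = trans (X^*-< d a n n<d) (sym (coef-neg a (ℤₚ.<-≤-trans (ℤₚ.+-monoˡ-< (ℤ.- + d) (ℤ.+<+ n<d)) (ℤₚ.≤-reflexive (ℤₚ.+-inverseʳ (+ d))))))
  ... | inj₂ d≤n = trans (cong (X ^ˢ d *ˢ a) (sym d+k≡n)) (trans (X^*-≥ d a (n ℕ.∸ d)) (cong (coef a)
      (trans (eq (+ d) (+ (n ℕ.∸ d))) (cong (λ i → i ℤ.- + d) (trans (sym (ℤₚ.pos-+ d (n ℕ.∸ d))) (cong +_ d+k≡n))))))
    where
    d+k≡n : d ℕ.+ (n ℕ.∸ d) ≡ n
    d+k≡n = ℕₚ.m+[n∸m]≡n d≤n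
    eq : ∀ i j → j ≡ (i ℤ.+ j) ℤ.- i
    eq = solve-∀

  coef-U : ∀ a z → coef (U a) z ≡ coef a (+ 11 ℤ.* z)
  coef-U a (+ n)    = cong (coef a) (trans (ℤₚ.pos-* n 11) (ℤₚ.*-comm (+ n) (+ 11)))
  coef-U a -[1+ n ] = refl

  coef-χ⊗ : ∀ a z → Σ ℤ λ ε → coef (χ⊗ a) z ≡ ε ℤ.* coef a z
  coef-χ⊗ a (+ n)    = χ n , refl
  coef-χ⊗ a -[1+ n ] = 0ℤ , refl

  Lift : ℤ → (ℤ → ℤ) → ℤ → ℤ → Set
  Lift N a z y = (Σ ℤ λ t → N ℤ.* t ≡ z × y ≡ a t) ⊎ y ≡ 0ℤ

  V-value : ∀ n a → Lift (+ 11) (coef a) (+ n) (V a n)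
  V-value = steps-of-11 (λ n → ∀ a → Lift (+ 11) (coef a) (+ n) (V a n)) low high
    where
    low : ∀ n → n ≤ 10 → ∀ a → Lift (+ 11) (coef a) (+ n) (V a n)
    low zero    _    a = inj₁ (0ℤ , refl , refl)
    low (suc n) n≤10 a = inj₂ (V≈[10]const a (suc n) n≤10)
    high : ∀ n → (∀ a → Lift (+ 11) (coef a) (+ n) (V a n)) → ∀ a → Lift (+ 11) (coef a) (+ (11 ℕ.+ n)) (V a (11 ℕ.+ n))
    high n ih a with ih (tail a)
    ... | inj₂ p                    = inj₂ p
    ... | inj₁ (+ t , q , p)        = inj₁ (+ suc t , trans (ℤₚ.*-suc (+ 11) (+ t)) (cong (λ i → + 11 ℤ.+ i) q) , p)
    ... | inj₁ (-[1+ t ] , q , p)   = inj₂ p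

  coef-V : ∀ a z → Lift (+ 11) (coef a) z (coef (V a) z)
  coef-V a (+ n)    = V-value n a
  coef-V a -[1+ n ] = inj₂ refl

  coef-VV : ∀ a z → Lift (+ 121) (coef a) z (coef (V (V a)) z)
  coef-VV a z with coef-V (V a) z
  ... | inj₂ p = inj₂ p
  ... | inj₁ (t , q , p) with coef-V a t
  ...   | inj₂ p′ = inj₂ (trans p p′)
  ...   | inj₁ (t′ , q′ , p′) = inj₁ (t′ , trans (ℤₚ.*-assoc (+ 11) (+ 11) t′) (trans (cong (+ 11 ℤ.*_) q′) q) , trans p p′)

  s₁₂₁ : ℤ → ℤ
  s₁₂₁ r = + 121 ℤ.* r ℤ.- + 5

  -- The coefficient of a series attached to m at r is that of q^(r + m).
  at : ℕ → Series → ℤ → ℤ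
  at m A r = coef A (r ℤ.+ + m)

  -- Opaque, since comparing products with these literals would otherwise unfold them in unary.
  opaque
    unfolding pow

    11⁴ 11⁹ : ℤ
    11⁴ = + 14641
    11⁹ = + 2357947691

    11⁴-divisible : pow 4 ∣ᶻ 11⁴
    11⁴-divisible = divides 1ℤ refl

    11⁹-divisible : pow 9 ∣ᶻ 11⁹
    11⁹-divisible = divides 1ℤ refl

    coef-11⁴* : ∀ a z → coef (const (+ 14641) *ˢ a) z ≡ 11⁴ ℤ.* coef a z
    coef-11⁴* = coef-const* 11⁴

    coef-11⁹* : ∀ a z → coef (const (+ 2357947691) *ˢ a) z ≡ 11⁹ ℤ.* coef a z
    coef-11⁹* = coef-const* 11⁹

  -- The relation b = T a at r. The value of χ is kept only as some integer ε, and v is a at the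
  -- preimage of r under s or 0: this is all that divisibility arguments use.
  record Linked (c c′ : ℤ) (a b : ℤ → ℤ) (r : ℤ) : Set where
    constructor recurrence
    field
      ε v    : ℤ
      value  : b r ≡ (a (s₁₂₁ r) ℤ.+ c ℤ.* (ε ℤ.* a r)) ℤ.+ c′ ℤ.* v
      source : (Σ ℤ λ t → s₁₂₁ t ≡ r × v ≡ a t) ⊎ v ≡ 0ℤ

  Recurrence : (a b : ℤ → ℤ) → ℤ → Set
  Recurrence = Linked 11⁴ 11⁹

  -- The shifts fit because 121 (r + 121 m + 5) - 610 (24 m + 1) = (121 r - 5) + m, where 610 = 11 ·
  -- 55 + 5. Likewise (r + 121 m + 5) - 5 (24 m + 1) = r + m, and 121 (t + m) = r + 121 m + 5 means
  -- s t = r.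
  transfer-recurrence : ∀ m A r → Recurrence (at m A) (at (121 ℕ.* m ℕ.+ 5) (transfer (suc (24 ℕ.* m)) A)) r
  transfer-recurrence m A r = recurrence (proj₁ twisted-value) (coef (V (V A)) y)
      (trans (coef-+ (U W +ˢ const (+ 14641) *ˢ χ⊗ Y) (const (+ 2357947691) *ˢ V (V A)) y)
        (cong₂ ℤ._+_ (trans (coef-+ (U W) (const (+ 14641) *ˢ χ⊗ Y) y) (cong₂ ℤ._+_ first second)) (coef-11⁹* (V (V A)) y)))
      (third (coef-VV A y))
    where
    d : ℕ
    d = suc (24 ℕ.* m)
    Y W : Series
    Y = X ^ˢ (5 ℕ.* d) *ˢ A
    W = X ^ˢ (5 ℕ.* (11 ℕ.* d)) *ˢ U Y
    y : ℤ
    y = r ℤ.+ + (121 ℕ.* m ℕ.+ 5)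
    d≡ : + d ≡ 1ℤ ℤ.+ + 24 ℤ.* + m
    d≡ = cong (λ i → 1ℤ ℤ.+ i) (ℤₚ.pos-* 24 m)
    5d≡ : + (5 ℕ.* d) ≡ + 5 ℤ.* (1ℤ ℤ.+ + 24 ℤ.* + m)
    5d≡ = trans (ℤₚ.pos-* 5 d) (cong (+ 5 ℤ.*_) d≡)
    55d≡ : + (5 ℕ.* (11 ℕ.* d)) ≡ + 5 ℤ.* (+ 11 ℤ.* (1ℤ ℤ.+ + 24 ℤ.* + m))
    55d≡ = trans (ℤₚ.pos-* 5 (11 ℕ.* d)) (cong (+ 5 ℤ.*_) (trans (ℤₚ.pos-* 11 d) (cong (+ 11 ℤ.*_) d≡)))
    y≡ : y ≡ r ℤ.+ (+ 121 ℤ.* + m ℤ.+ + 5)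
    y≡ = cong (λ i → r ℤ.+ (i ℤ.+ + 5)) (ℤₚ.pos-* 121 m)
    first : coef (U W) y ≡ at m A (s₁₂₁ r)
    first = trans (coef-U W y) (trans (coef-X^* (5 ℕ.* (11 ℕ.* d)) (U Y) (+ 11 ℤ.* y))
      (trans (coef-U Y (+ 11 ℤ.* y ℤ.- + (5 ℕ.* (11 ℕ.* d)))) (trans (coef-X^* (5 ℕ.* d) A (+ 11 ℤ.* (+ 11 ℤ.* y ℤ.- + (5 ℕ.* (11 ℕ.* d)))))
        (cong (coef A) (trans (cong₂ (λ u w → + 11 ℤ.* u ℤ.- w) (cong₂ (λ u w → + 11 ℤ.* u ℤ.- w) y≡ 55d≡) 5d≡) (exponent₁ (+ m) r))))))
      where
      exponent₁ : ∀ m r → + 11 ℤ.* (+ 11 ℤ.* (r ℤ.+ (+ 121 ℤ.* m ℤ.+ + 5)) ℤ.- + 5 ℤ.* (+ 11 ℤ.* (1ℤ ℤ.+ + 24 ℤ.* m))) ℤ.- + 5 ℤ.* (1ℤ ℤ.+ + 24 ℤ.* m)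
        ≡ (+ 121 ℤ.* r ℤ.- + 5) ℤ.+ m
      exponent₁ = solve-∀
    twisted-value : Σ ℤ λ ε → coef (χ⊗ Y) y ≡ ε ℤ.* at m A r
    twisted-value = let ε , p = coef-χ⊗ Y y in ε , trans p (cong (ε ℤ.*_) (trans (coef-X^* (5 ℕ.* d) A y)
      (cong (coef A) (trans (cong₂ ℤ._-_ y≡ 5d≡) (exponent₂ (+ m) r)))))
      where
      exponent₂ : ∀ m r → (r ℤ.+ (+ 121 ℤ.* m ℤ.+ + 5)) ℤ.- + 5 ℤ.* (1ℤ ℤ.+ + 24 ℤ.* m) ≡ r ℤ.+ m
      exponent₂ = solve-∀
    second : coef (const (+ 14641) *ˢ χ⊗ Y) y ≡ 11⁴ ℤ.* (proj₁ twisted-value ℤ.* at m A r)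
    second = trans (coef-11⁴* (χ⊗ Y) y) (cong (11⁴ ℤ.*_) (proj₂ twisted-value))
    third : Lift (+ 121) (coef A) y (coef (V (V A)) y) → (Σ ℤ λ t → s₁₂₁ t ≡ r × coef (V (V A)) y ≡ at m A t) ⊎ coef (V (V A)) y ≡ 0ℤ
    third (inj₂ p) = inj₂ p
    third (inj₁ (t , q , p)) = inj₁ (t ℤ.- + m , trans (exponent₃ (+ m) t) (trans (cong (λ i → i ℤ.- (+ 121 ℤ.* + m ℤ.+ + 5)) (trans q y≡)) (exponent₄ (+ m) r)) ,
        trans p (cong (coef A) (exponent₅ (+ m) t)))
      where
      exponent₃ : ∀ m t → + 121 ℤ.* (t ℤ.- m) ℤ.- + 5 ≡ + 121 ℤ.* t ℤ.- (+ 121 ℤ.* m ℤ.+ + 5)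
      exponent₃ = solve-∀
      exponent₄ : ∀ m r → (r ℤ.+ (+ 121 ℤ.* m ℤ.+ + 5)) ℤ.- (+ 121 ℤ.* m ℤ.+ + 5) ≡ r
      exponent₄ = solve-∀
      exponent₅ : ∀ m t → t ≡ (t ℤ.- m) ℤ.+ m
      exponent₅ = solve-∀

  -- (121^k - 1)/24. It is the degree m after k steps, and its negative represents the residue class
  -- 1/24 modulo 121^k.
  offset : ℕ → ℕ
  offset zero    = 0
  offset (suc k) = 121 ℕ.* offset k ℕ.+ 5

  iterate : ℕ → Series
  iterate zero    = e₆
  iterate (suc k) = transfer (suc (24 ℕ.* offset k)) (iterate k)

  iterate-good : ∀ k → Good (offset k) (iterate k)
  iterate-good zero    = e₆-good
  iterate-good (suc k) = transfer-good (offset k) (iterate k) (iterate-good k)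

  a₁₂₁ : ℕ → ℤ → ℤ
  a₁₂₁ k = at (offset k) (iterate k)

  a-recurrence : ∀ k r → Recurrence (a₁₂₁ k) (a₁₂₁ (suc k)) r
  a-recurrence k = transfer-recurrence (offset k) (iterate k)

  s^ : ℕ → ℤ → ℤ
  s^ zero    r = r
  s^ (suc k) r = s₁₂₁ (s^ k r)

  s-injective : ∀ t r → s₁₂₁ t ≡ s₁₂₁ r → t ≡ r
  s-injective t r eq = ℤₚ.*-cancelˡ-≡ (+ 121) t r (trans (cancelled t) (trans (cong (λ i → i ℤ.+ + 5) eq) (sym (cancelled r))))
    where
    cancelled : ∀ t → + 121 ℤ.* t ≡ (+ 121 ℤ.* t ℤ.- + 5) ℤ.+ + 5
    cancelled = solve-∀

  s-nonpositive : ∀ t → s₁₂₁ t ℤ.≤ 0ℤ → t ℤ.≤ 0ℤ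
  s-nonpositive (+ zero)  _ = ℤₚ.≤-refl
  s-nonpositive (+ suc t) p = ⊥-elim (ℤₚ.<⇒≱ (ℤₚ.<-≤-trans (ℤ.+<+ (s≤s z≤n))
    (ℤₚ.≤-trans (ℤ.+≤+ (ℕₚ.m≤m+n 116 (121 ℕ.* t))) (ℤₚ.≤-reflexive (sym positive)))) p)
    where
    positive : s₁₂₁ (+ suc t) ≡ + (116 ℕ.+ 121 ℕ.* t)
    positive = trans (cong (λ i → + 121 ℤ.* i ℤ.- + 5) (ℤₚ.pos-+ 1 t)) (trans (eq (+ t)) (cong (λ i → + 116 ℤ.+ i) (sym (ℤₚ.pos-* 121 t))))
      where
      eq : ∀ t → + 121 ℤ.* (1ℤ ℤ.+ t) ℤ.- + 5 ≡ + 116 ℤ.+ + 121 ℤ.* t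
      eq = solve-∀
  s-nonpositive -[1+ t ]  _ = ℤ.-≤+

  s^-negative : ∀ j r → r ℤ.≤ 0ℤ → s^ (suc j) r ℤ.< 0ℤ
  s^-negative j r r≤0 = ℤₚ.<-≤-trans {j = + 121 ℤ.* s^ j r ℤ.+ 0ℤ} (ℤₚ.+-monoʳ-< (+ 121 ℤ.* s^ j r) ℤ.-<+) (ℤₚ.≤-trans (ℤₚ.≤-reflexive (ℤₚ.+-identityʳ (+ 121 ℤ.* s^ j r)))
    (ℤₚ.≤-trans (ℤₚ.*-monoˡ-≤-nonNeg (+ 121) (nonpositive j)) ℤₚ.≤-refl))
    where
    nonpositive : ∀ j → s^ j r ℤ.≤ 0ℤ
    nonpositive zero    = r≤0
    nonpositive (suc j) = ℤₚ.<⇒≤ (s^-negative j r r≤0)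

  source-divisible : ∀ {a b r} N → (rec : Recurrence a b r) → (∀ t → s₁₂₁ t ≡ r → pow N ∣ᶻ a t) → pow (9 ℕ.+ N) ∣ᶻ 11⁹ ℤ.* Linked.v rec
  source-divisible N (recurrence ε v value (inj₁ (t , q , p))) d = pow-* 9 N 11⁹-divisible (subst (pow N ∣ᶻ_) (sym p) (d t q))
  source-divisible N (recurrence ε v value (inj₂ p)) d = subst (λ v → pow (9 ℕ.+ N) ∣ᶻ 11⁹ ℤ.* v) (sym p) (subst (pow (9 ℕ.+ N) ∣ᶻ_) (sym (ℤₚ.*-zeroʳ 11⁹)) ∣0)

  twisted-divisible : ∀ {a b r} N → (rec : Recurrence a b r) → pow N ∣ᶻ a r → pow (4 ℕ.+ N) ∣ᶻ 11⁴ ℤ.* (Linked.ε rec ℤ.* a r)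
  twisted-divisible N rec d = pow-* 4 N 11⁴-divisible (Div.∣n⇒∣m*n (Linked.ε rec) d)

  4+4* : ∀ k → 4 ℕ.* suc k ≡ 4 ℕ.+ 4 ℕ.* k
  4+4* = ℕₚ.*-suc 4

  -- The extra 5 j makes the induction on k close. For a_(k+1) at s^j r the first term is a_k at
  -- s^(j+1) r, with exponent 4 k + 5 (j + 1), one more than required. The middle term has 4 + 4 k +
  -- 5 j, exactly enough. The last term is a_k at s^(j-1) r, with 9 + 4 k + 5 (j - 1), again exact;
  -- for j = 0 its argument is still nonpositive and 9 exceeds 4. For k = 0 the coefficient at s^j r
  -- is 0 when j > 0, because that argument is negative, and nothing is claimed when j = 0.
  polar-divisible : ∀ k j r → r ℤ.≤ 0ℤ → pow (4 ℕ.* k ℕ.+ 5 ℕ.* j) ∣ᶻ a₁₂₁ k (s^ j r)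
  polar-divisible zero    zero    r r≤0 = pow-zero (a₁₂₁ 0 r)
  polar-divisible zero    (suc j) r r≤0 = subst (pow (5 ℕ.* suc j) ∣ᶻ_) (sym (coef-neg e₆ (ℤₚ.≤-<-trans (ℤₚ.≤-reflexive (ℤₚ.+-identityʳ (s^ (suc j) r))) (s^-negative j r r≤0)))) ∣0
  polar-divisible (suc k) j       r r≤0 = subst (pow (4 ℕ.* suc k ℕ.+ 5 ℕ.* j) ∣ᶻ_) (sym (Linked.value rec))
      (Div.∣m∣n⇒∣m+n (Div.∣m∣n⇒∣m+n
        (pow-weaken (a₁₂₁ k (s^ (suc j) r)) (ℕₚ.≤-trans (ℕₚ.n≤1+n (4 ℕ.* suc k ℕ.+ 5 ℕ.* j)) (ℕₚ.≤-reflexive (exponent k j))) (polar-divisible k (suc j) r r≤0))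
        (subst (λ N → pow N ∣ᶻ 11⁴ ℤ.* (Linked.ε rec ℤ.* a₁₂₁ k (s^ j r))) (sym exponent″) (twisted-divisible (4 ℕ.* k ℕ.+ 5 ℕ.* j) rec (polar-divisible k j r r≤0))))
        (source-part j refl))
    where
    rec : Recurrence (a₁₂₁ k) (a₁₂₁ (suc k)) (s^ j r)
    rec = a-recurrence k (s^ j r)
    exponent : ∀ k j → 1 ℕ.+ (4 ℕ.* (1 ℕ.+ k) ℕ.+ 5 ℕ.* j) ≡ 4 ℕ.* k ℕ.+ 5 ℕ.* (1 ℕ.+ j)
    exponent = solve-∀ℕ
    exponent′ : ∀ k j → 9 ℕ.+ (4 ℕ.* k ℕ.+ 5 ℕ.* j) ≡ 4 ℕ.* (1 ℕ.+ k) ℕ.+ 5 ℕ.* (1 ℕ.+ j)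
    exponent′ = solve-∀ℕ
    exponent″ : 4 ℕ.* suc k ℕ.+ 5 ℕ.* j ≡ 4 ℕ.+ (4 ℕ.* k ℕ.+ 5 ℕ.* j)
    exponent″ = cong (ℕ._+ 5 ℕ.* j) (4+4* k)
    source-part : ∀ j′ → j′ ≡ j → pow (4 ℕ.* suc k ℕ.+ 5 ℕ.* j) ∣ᶻ 11⁹ ℤ.* Linked.v rec
    source-part zero    refl = pow-weaken (11⁹ ℤ.* Linked.v rec) (ℕₚ.≤-trans (ℕₚ.m≤n+m (4 ℕ.* suc k ℕ.+ 0) 5) (ℕₚ.≤-reflexive (cong (5 ℕ.+_) exponent″)))
      (source-divisible (4 ℕ.* k ℕ.+ 5 ℕ.* 0) rec λ t st≡r → polar-divisible k 0 t (s-nonpositive t (ℤₚ.≤-trans (ℤₚ.≤-reflexive st≡r) r≤0)))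
    source-part (suc j) refl = subst (λ N → pow N ∣ᶻ 11⁹ ℤ.* Linked.v rec) (exponent′ k j)
      (source-divisible (4 ℕ.* k ℕ.+ 5 ℕ.* j) rec λ t st≡ → subst (λ t → pow (4 ℕ.* k ℕ.+ 5 ℕ.* j) ∣ᶻ a₁₂₁ k t) (sym (s-injective t (s^ j r) st≡)) (polar-divisible k j r r≤0))

  -- The coefficients through q^(offset k) are those at r ≤ 0, exactly the ones that
  -- `good-divisible` asks for.
  iterate-divisible : ∀ k → pow (4 ℕ.* k) ∣ˢ iterate k
  iterate-divisible k = good-divisible (iterate-good k) (4 ℕ.* k) λ n n≤m →
    subst₂ (λ N i → pow N ∣ᶻ coef (iterate k) i) (ℕₚ.+-identityʳ (4 ℕ.* k)) (shifted n (offset k))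
      (polar-divisible k 0 (+ n ℤ.- + offset k) (ℤₚ.≤-trans (ℤₚ.+-monoˡ-≤ (ℤ.- + offset k) (ℤ.+≤+ n≤m)) (ℤₚ.≤-reflexive (ℤₚ.+-inverseʳ (+ offset k)))))
    where
    shifted : ∀ n m → (+ n ℤ.- + m) ℤ.+ + m ≡ + n
    shifted n m = eq (+ n) (+ m)
      where
      eq : ∀ n m → (n ℤ.- m) ℤ.+ m ≡ n
      eq = solve-∀

  a-divisible : ∀ i r → pow (4 ℕ.* i) ∣ᶻ a₁₂₁ i r
  a-divisible i r = coef-divisible (r ℤ.+ + offset i)
    where
    coef-divisible : ∀ z → pow (4 ℕ.* i) ∣ᶻ coef (iterate i) z
    coef-divisible (+ n)    = iterate-divisible i n
    coef-divisible -[1+ n ] = ∣0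

  ∣-isolate : ∀ {P x y z w} → w ≡ (x ℤ.+ y) ℤ.+ z → P ∣ᶻ w → P ∣ᶻ y → P ∣ᶻ z → P ∣ᶻ x
  ∣-isolate {x = x} {y} {z} refl p q r = Div.∣m+n∣n⇒∣m {m = x} (Div.∣m+n∣n⇒∣m {m = x ℤ.+ y} p r) q

  -- Induction on k for all iterates i at once: the recurrence solved for a_i at s^(k+1) r refers to
  -- a_(i+1) at s^k r, which has the same value of k + i + 1. The term with 11⁴ is sharp. In the
  -- term with 11⁹ the argument steps back to s^(k-1) r, losing 8 in the exponent, which 9 covers.
  orbit-divisible : ∀ k i r → pow (4 ℕ.* (k ℕ.+ i)) ∣ᶻ a₁₂₁ i (s^ k r)
  orbit-divisible zero    i r = a-divisible i r
  orbit-divisible (suc k) i r = ∣-isolate (Linked.value rec)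
      (subst (λ l → pow (4 ℕ.* l) ∣ᶻ a₁₂₁ (suc i) (s^ k r)) (ℕₚ.+-suc k i) (orbit-divisible k (suc i) r))
      (subst (λ N → pow N ∣ᶻ 11⁴ ℤ.* (Linked.ε rec ℤ.* a₁₂₁ i (s^ k r))) (sym (4+4* (k ℕ.+ i))) (twisted-divisible (4 ℕ.* (k ℕ.+ i)) rec (orbit-divisible k i r)))
      (source-part k refl)
    where
    rec : Recurrence (a₁₂₁ i) (a₁₂₁ (suc i)) (s^ k r)
    rec = a-recurrence i (s^ k r)
    source-part : ∀ k′ → k′ ≡ k → pow (4 ℕ.* suc (k ℕ.+ i)) ∣ᶻ 11⁹ ℤ.* Linked.v rec
    source-part zero    refl = pow-weaken (11⁹ ℤ.* Linked.v rec) (ℕₚ.≤-trans (ℕₚ.≤-reflexive (4+4* i)) (ℕₚ.+-monoˡ-≤ (4 ℕ.* i) (ℕₚ.m≤m+n 4 5)))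
      (source-divisible (4 ℕ.* i) rec λ t _ → a-divisible i t)
    source-part (suc k) refl = pow-weaken (11⁹ ℤ.* Linked.v rec)
      (ℕₚ.≤-trans (ℕₚ.≤-reflexive (trans (4+4* (suc (k ℕ.+ i))) (cong (4 ℕ.+_) (4+4* (k ℕ.+ i))))) (ℕₚ.n≤1+n (8 ℕ.+ 4 ℕ.* (k ℕ.+ i))))
      (source-divisible (4 ℕ.* (k ℕ.+ i)) rec λ t st≡ → subst (λ t → pow (4 ℕ.* (k ℕ.+ i)) ∣ᶻ a₁₂₁ i t) (sym (s-injective t (s^ k r) st≡)) (orbit-divisible k i r))

  pow-2suc : ∀ k → pow (2 ℕ.* suc k) ≡ + 121 ℤ.* pow (2 ℕ.* k)
  pow-2suc k = trans (cong pow (ℕₚ.*-suc 2 k)) (trans (pow-+ 2 (2 ℕ.* k)) (cong (ℤ._* pow (2 ℕ.* k)) (pow≡ 2)))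

  s^-value : ∀ k r → s^ k r ≡ pow (2 ℕ.* k) ℤ.* r ℤ.- + offset k
  s^-value zero    r = trans (eq r) (cong (λ p → p ℤ.* r ℤ.- 0ℤ) (sym (pow≡ 0)))
    where
    eq : ∀ r → r ≡ 1ℤ ℤ.* r ℤ.- 0ℤ
    eq = solve-∀
  s^-value (suc k) r = trans (cong s₁₂₁ (s^-value k r)) (trans (eq (pow (2 ℕ.* k)) r (+ offset k))
    (sym (cong₂ (λ p o → p ℤ.* r ℤ.- o) (pow-2suc k) (cong (λ i → i ℤ.+ + 5) (ℤₚ.pos-* 121 (offset k))))))
    where
    eq : ∀ p r o → + 121 ℤ.* (p ℤ.* r ℤ.- o) ℤ.- + 5 ≡ (+ 121 ℤ.* p) ℤ.* r ℤ.- (+ 121 ℤ.* o ℤ.+ + 5)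
    eq = solve-∀

  offset-value : ∀ k → + 24 ℤ.* + offset k ℤ.+ 1ℤ ≡ pow (2 ℕ.* k)
  offset-value zero    = sym (pow≡ 0)
  offset-value (suc k) = trans (cong (λ o → + 24 ℤ.* (o ℤ.+ + 5) ℤ.+ 1ℤ) (ℤₚ.pos-* 121 (offset k)))
    (trans (eq (+ offset k)) (trans (cong (+ 121 ℤ.*_) (offset-value k)) (sym (pow-2suc k))))
    where
    eq : ∀ o → + 24 ℤ.* (+ 121 ℤ.* o ℤ.+ + 5) ℤ.+ 1ℤ ≡ + 121 ℤ.* (+ 24 ℤ.* o ℤ.+ 1ℤ)
    eq = solve-∀

  -- With u = (δ + offset k)/121^k the index 121^k n + δ equals s^k (n + u). The orbit yields 11^(4
  -- k), of which 11^(2 k) is kept.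
  e₆-divisible : ∀ k n δ → pow (2 ℕ.* k) ∣ᶻ + (24 ℕ.* δ) ℤ.- + 1 → pow (2 ℕ.* k) ∣ᶻ e₆ (11 ℕ.^ (2 ℕ.* k) ℕ.* n ℕ.+ δ)
  e₆-divisible k n δ p = pow-weaken (e₆ N) (ℕₚ.*-monoˡ-≤ k {2} {4} (s≤s (s≤s z≤n))) (subst₂ (λ l z → pow (4 ℕ.* l) ∣ᶻ coef e₆ z) (ℕₚ.+-identityʳ k) (exponent d) (orbit-divisible k 0 (+ n ℤ.+ Div.quotient d)))
    where
    P : ℤ
    P = pow (2 ℕ.* k)
    N : ℕ
    N = 11 ℕ.^ (2 ℕ.* k) ℕ.* n ℕ.+ δ
    -- (24 δ - 1) + (24 offset k + 1) = 24 (δ + offset k), and 24 is cancelled by 6 · 24 - 13 · 11 =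
    -- 1.
    d : P ∣ᶻ + δ ℤ.+ + offset k
    d = Unit₁₁.cancel (unit-bezout (+ 24) (+ 6) -[1+ 12 ] refl) (2 ℕ.* k) (+ δ ℤ.+ + offset k)
      (subst (P ∣ᶻ_) (trans (cong (λ i → (i ℤ.- + 1) ℤ.+ (+ 24 ℤ.* + offset k ℤ.+ 1ℤ)) (ℤₚ.pos-* 24 δ)) (eq (+ δ) (+ offset k)))
        (Div.∣m∣n⇒∣m+n p (Div.∣-reflexive (sym (offset-value k)))))
      where
      eq : ∀ x o → (+ 24 ℤ.* x ℤ.- + 1) ℤ.+ (+ 24 ℤ.* o ℤ.+ 1ℤ) ≡ + 24 ℤ.* (x ℤ.+ o)
      eq = solve-∀
    exponent : (d : P ∣ᶻ + δ ℤ.+ + offset k) → s^ k (+ n ℤ.+ Div.quotient d) ℤ.+ + 0 ≡ + N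
    exponent (divides u q) = trans (ℤₚ.+-identityʳ _) (trans (s^-value k (+ n ℤ.+ u)) (trans (eq P (+ n) u (+ offset k))
      (trans (cong (λ i → (P ℤ.* + n ℤ.+ i) ℤ.- + offset k) (sym q)) (trans (eq′ (P ℤ.* + n) (+ δ) (+ offset k)) (cong (λ i → i ℤ.+ + δ) (trans (cong (ℤ._* + n) (pow≡ (2 ℕ.* k))) (sym (ℤₚ.pos-* (11 ℕ.^ (2 ℕ.* k)) n))))))))
      where
      eq : ∀ p n u o → p ℤ.* (n ℤ.+ u) ℤ.- o ≡ (p ℤ.* n ℤ.+ u ℤ.* p) ℤ.- o
      eq = solve-∀
      eq′ : ∀ x y o → (x ℤ.+ (y ℤ.+ o)) ℤ.- o ≡ x ℤ.+ y
      eq′ = solve-∀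

open Orbits

open import Data.Nat using (_+_; _*_; _^_)

theorem7p10 : (k n δ : ℕ) → 1 ≤ k →
    0 < δ → δ < 11 ^ (2 * k) →
    (+ (11 ^ (2 * k))) ℤd.∣ (+ (24 * δ) ℤ.- + 1) →
    (+ (11 ^ (2 * k))) ℤd.∣ e₆ (11 ^ (2 * k) * n + δ)
theorem7p10 k n δ _ _ _ p = Div.∣⇒∣ᵤ (subst (_∣ᶻ e₆ (11 ^ (2 * k) * n + δ)) (pow≡ (2 * k))
  (e₆-divisible k n δ (subst (_∣ᶻ + (24 * δ) ℤ.- + 1) (sym (pow≡ (2 * k))) (Div.∣ᵤ⇒∣ p))))
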